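{- Let $\mathsf{D}=(D_n)_{n\ge1}$ be a minimal regular elliptic divisibility sequence associated to the elliptic curve $E/\mathbb{Q}$ and point $P\in E(\mathbb{Q})$. \begin{itemize} \item[(a)] Let $n\ge1$ and let $p$ be a prime. If $n\in\mathcal{S}(\mathsf{D})$ and either $p\mid D_n$ or $E$ has additive reduction at $p$, then $(n\to np)\in\operatorname{Arr}(\mathsf{D})$. \item[(b)] Let $n\ge1$, $d\ge1$. If $n\in\mathcal{S}(\mathsf{D})$ and $d\in\mathcal{A}_{\mathrm{gen}}(\mathsf{D})$, then $nd\in\mathcal{S}(\mathsf{D})$ and $\gcd(d,n)\in\{1,d\}$. Furthermore, if $n\in\mathcal{S}(\mathsf{D})$, $d\in\mathcal{A}_{\mathrm{gen}}(\mathsf{D})$ and $\gcd(d,n)=1$, then $(n\to nd)\in\operatorname{Arr}(\mathsf{D})$. \item[(c)] Let $n\ge1$ and let $p$ be a prime with $n\in\mathcal{S}(\mathsf{D})$, $p\nmid D_n$ and $(n\to np)\in\operatorname{Arr}(\mathsf{D})$. (1) If $E$ has good reduction at $p$ and $\#E(\mathbb{F}_p)\ne 2p$, then $p\in\mathcal{A}(\mathsf{D})$ (and if $p\ge7$ one always has $\#E(\mathbb{F}_p)\ne2p$). (2) If $E$ has bad reduction at $p$, then $E$ has additive reduction at $p$. \item[(d)] Let $n\ge1$ and $d\ge1$ with $d$ composite. Let $t$ be the number of primes $p\mid d$ such that $r_p$ is composite, and let $p_0$ be the smallest prime divisor of $nd$. Suppose $(n\to nd)\in\operatorname{Arr}(\mathsf{D})$.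 Then one of the following holds: (i) $t=0$ and $d\in\mathcal{A}_{\mathrm{gen}}(\mathsf{D})$; (ii) $t\ge1$ and $$\prod_{p\mid d}\Bigl(1+\frac{1}{\sqrt p}\Bigr)^2\ \ge\ \prod_{p\mid d}\frac{\#E_{\mathrm{ns}}(\mathbb{F}_p)}{p}\ \ge\ p_0^{\,t},$$ where the products run over the distinct primes dividing $d$. \end{itemize}
   Context: Let $E/\mathbb{Q}$ be an elliptic curve given by a Weierstrass equation with integer coefficients and let $P\in E(\mathbb{Q})$ be a point of infinite order. The elliptic divisibility sequence (EDS) $\mathsf{D}=(D_n)_{n\ge1}$ associated to $(E,P)$ is the sequence of positive integers obtained by writing $x([n]P)=A_n/D_n^2$ in lowest terms. It is minimal if the Weierstrass equation is a global minimal Weierstrass equation; $\operatorname{Disc}(E)$ denotes the minimal discriminant. For a prime $p$, $E_{\mathrm{ns}}(\mathbb{F}_p)$ denotes the group of nonsingular points of the reduction of $E$ modulo $p$ (equal to $E(\mathbb{F}_p)$ when $E$ has good reduction at $p$), and "$P\in E_{\mathrm{ns}}(\mathbb{F}_p)$" means $P$ reduces to a nonsingular point mod $p$. For $n\ge1$ the rank of apparition is $r_n=\min\{r\ge1:n\mid D_r\}$. Regularity: $\mathsf{D}$ is $2$-irregular if all hold: (I1) $E$ has good reduction at $2$; (I2) $\#E(\mathbb{F}_2)=4$; (I3) $r_2=4$; (I4) $D_2$ is odd; (I5) $\operatorname{ord}_2(D_4)=1$; otherwise it is $2$-regular. $\mathsf{D}$ is regular if it is $2$-regular and $P\in E_{\mathrm{ns}}(\mathbb{F}_p)$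 for every prime $p\mid\operatorname{Disc}(E)$. $\mathcal{S}(\mathsf{D})=\{n\ge1:n\mid D_n\}$; $\operatorname{Arr}(\mathsf{D})$ is the set of $(n\to m)$ with $n,m\in\mathcal{S}(\mathsf{D})$, $n\mid m$, $n\ne m$, and no $k\in\mathcal{S}(\mathsf{D})$ with $n\mid k\mid m$ other than $k\in\{n,m\}$. A generalized aliquot cycle for $\mathsf{D}$ is a tuple $(p_1,\dots,p_\ell)$, $\ell\ge1$, of distinct primes with $r_{p_i}=p_{i+1}$ for $1\le i\le\ell$ ($p_{\ell+1}=p_1$); it is an aliquot cycle if moreover every $p_i$ is a prime of good reduction for $E$. $\mathcal{A}(\mathsf{D})$ (resp. $\mathcal{A}_{\mathrm{gen}}(\mathsf{D})$) is the set of products $p_1\cdots p_\ell$ over all aliquot cycles (resp. generalized aliquot cycles). -}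

module Defs where

open import Data.Nat as ℕ using (ℕ; zero; suc; _≤_; _<_)
open import Data.Nat.Divisibility using (_∣_; _∣?_)
open import Data.Nat.Primality using (Prime; prime?; Composite)
open import Data.Integer as ℤ using (ℤ; +_)
open import Data.Rational as ℚ using (ℚ; 0ℚ; 1ℚ; _+_; _*_; _-_; -_; _÷_; ↥_; ↧ₙ_; ≢-nonZero)
open import Data.Rational.Properties using (_≟_)
open import Data.List using (List; []; _∷_; _++_; length; filter; upTo; cartesianProduct; map)
open import Data.List.Relation.Unary.All using (All)
open import Data.List.Relation.Unary.Unique.Propositional using (Unique)
open import Data.List.Relation.Unary.Linked using (Linked)
open import Data.List.Membership.Propositional using (_∈_)
open import Data.Product using (Σ; _×_; _,_)
open import Data.Sum using (_⊎_)
open import Data.Empty using (⊥)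
open import Data.Unit using (⊤)
open import Relation.Nullary using (¬_; Dec; yes; no)
open import Relation.Nullary.Decidable using (_×-dec_; ¬?)
open import Relation.Binary.PropositionalEquality using (_≡_; _≢_)

ℕtoℚ : ℕ → ℚ
ℕtoℚ n = ℚ._/_ (+ n) 1

ℤtoℚ : ℤ → ℚ
ℤtoℚ z = ℚ._/_ z 1

-- division, with the (never used) convention q / 0 = 0
divQ : ℚ → ℚ → ℚ
divQ p q with q ≟ 0ℚ
... | yes _ = 0ℚ
... | no q≢0 = _÷_ p q {{≢-nonZero q≢0}}

-- a / b for naturals (b = 0 gives 0, never used)
divℕ : ℕ → ℕ → ℚ
divℕ a zero = 0ℚ
divℕ a (suc k) = ℚ._/_ (+ a) (suc k)

prodℕ : List ℕ → ℕ
prodℕ [] = 1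
prodℕ (x ∷ xs) = x ℕ.* prodℕ xs

prodℚ : List ℚ → ℚ
prodℚ [] = 1ℚ
prodℚ (x ∷ xs) = x * prodℚ xs

PInt : ℕ → ℚ → Set
PInt p q = ¬ (p ∣ ↧ₙ q)

-- p divides the numerator of q; for p-integral q this says q ≡ 0 mod p
PDiv : ℕ → ℚ → Set
PDiv p q = p ∣ ℤ.∣ ↥ q ∣

PDiv? : (p : ℕ) (q : ℚ) → Dec (PDiv p q)
PDiv? p q = p ∣? ℤ.∣ ↥ q ∣

-- Weierstrass equations
-- y² + a1 x y + a3 y = x³ + a2 x² + a4 x + a6

record Curve : Set where
  constructor curve
  field
    a1 a2 a3 a4 a6 : ℤ

record WEq : Set where
  constructor weq
  field
    c1 c2 c3 c4' c6 : ℚ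

toW : Curve → WEq
toW (curve a1 a2 a3 a4 a6) = weq (ℤtoℚ a1) (ℤtoℚ a2) (ℤtoℚ a3) (ℤtoℚ a4) (ℤtoℚ a6)

module _ (W : WEq) where
  open WEq W renaming (c1 to a1; c2 to a2; c3 to a3; c4' to a4; c6 to a6)

  b2 b4 b6 b8 : ℚ
  b2 = a1 * a1 + ℕtoℚ 4 * a2
  b4 = ℕtoℚ 2 * a4 + a1 * a3
  b6 = a3 * a3 + ℕtoℚ 4 * a6
  b8 = a1 * a1 * a6 + ℕtoℚ 4 * a2 * a6 - a1 * a3 * a4 + a2 * a3 * a3 - a4 * a4

  c₄ : ℚ
  c₄ = b2 * b2 - ℕtoℚ 24 * b4

  Δ : ℚ
  Δ = - (b2 * b2 * b8) - ℕtoℚ 8 * b4 * b4 * b4 - ℕtoℚ 27 * b6 * b6 + ℕtoℚ 9 * b2 * b4 * b6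

  F Fx Fy : ℚ → ℚ → ℚ
  F x y = y * y + a1 * x * y + a3 * y - x * x * x - a2 * x * x - a4 * x - a6
  Fx x y = a1 * y - ℕtoℚ 3 * x * x - ℕtoℚ 2 * a2 * x - a4
  Fy x y = ℕtoℚ 2 * y + a1 * x + a3

-- change of variables x = u²x' + r, y = u³y' + u²sx' + t (Silverman, Table 3.1)
transform : WEq → ℚ → ℚ → ℚ → ℚ → WEq
transform (weq a1 a2 a3 a4 a6) u r s t =
  weq (divQ (a1 + ℕtoℚ 2 * s) u)
      (divQ (a2 - s * a1 + ℕtoℚ 3 * r - s * s) (u * u))
      (divQ (a3 + r * a1 + ℕtoℚ 2 * t) (u * u * u))
      (divQ (a4 - s * a3 + ℕtoℚ 2 * r * a2 - (t + r * s) * a1 + ℕtoℚ 3 * r * r - ℕtoℚ 2 * s * t) (u * u * u * u))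
      (divQ (a6 + r * a4 + r * r * a2 + r * r * r - t * a3 - t * t - r * t * a1) (u * u * u * u * u * u))

AllPInt : ℕ → WEq → Set
AllPInt p (weq a1 a2 a3 a4 a6) = PInt p a1 × PInt p a2 × PInt p a3 × PInt p a4 × PInt p a6

-- the (integral) equation is minimal at p: ord_p Δ ≤ ord_p Δ' for every
-- rational change of variables giving a p-integral equation
-- (ord_p Δ ≤ ord_p Δ' expressed as: Δ'/Δ is p-integral)
MinimalAt : ℕ → Curve → Set
MinimalAt p E = ∀ (u r s t : ℚ) → u ≢ 0ℚ → AllPInt p (transform (toW E) u r s t)
  → PInt p (divQ (Δ (transform (toW E) u r s t)) (Δ (toW E)))

GlobalMinimal : Curve → Set
GlobalMinimal E = ∀ p → Prime p → MinimalAt p E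

-- Reduction types (for a minimal equation)

GoodRed BadRed AdditiveRed : Curve → ℕ → Set
GoodRed E p = ¬ PDiv p (Δ (toW E))
BadRed E p = PDiv p (Δ (toW E))
AdditiveRed E p = PDiv p (Δ (toW E)) × PDiv p (c₄ (toW E))

-- #E_ns(F_p): the point at infinity plus the affine points (x,y) ∈ F_p²
-- on the reduced curve that are nonsingular (not both partials ≡ 0 mod p)
NsCount : Curve → ℕ → ℕ
NsCount E p = suc (length (filter ok? (cartesianProduct (upTo p) (upTo p))))
  where
  W = toW E
  ok? : (xy : ℕ × ℕ) → Dec _
  ok? (x , y) = PDiv? p (F W (ℕtoℚ x) (ℕtoℚ y))
           ×-dec ¬? (PDiv? p (Fx W (ℕtoℚ x) (ℕtoℚ y)) ×-dec PDiv? p (Fy W (ℕtoℚ x) (ℕtoℚ y)))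

data Pt : Set where
  O   : Pt
  aff : ℚ → ℚ → Pt

NsRed : Curve → ℕ → Pt → Set
NsRed E p O = ⊤
NsRed E p (aff x y) = ¬ (PInt p x × PInt p y × PDiv p (Fx (toW E) x y) × PDiv p (Fy (toW E) x y))

-- addition (Silverman, III.2.3)
add : WEq → Pt → Pt → Pt
add W O Q = Q
add W (aff x y) O = aff x y
add W (aff x1 y1) (aff x2 y2) with x1 ≟ x2
... | no _ = third (divQ (y2 - y1) (x2 - x1)) (divQ (y1 * x2 - y2 * x1) (x2 - x1))
  where
  open WEq W renaming (c1 to a1; c2 to a2; c3 to a3; c4' to a4; c6 to a6)
  third : ℚ → ℚ → Pt
  third l v = aff x3 (- ((l + a1) * x3) - v - a3)
    where x3 = l * l + a1 * l - a2 - x1 - x2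
... | yes _ with (y1 + y2 + WEq.c1 W * x2 + WEq.c3 W) ≟ 0ℚ
...   | yes _ = O
...   | no _ = third (divQ (ℕtoℚ 3 * x1 * x1 + ℕtoℚ 2 * a2 * x1 + a4 - a1 * y1) den)
                     (divQ (- (x1 * x1 * x1) + a4 * x1 + ℕtoℚ 2 * a6 - a3 * y1) den)
  where
  open WEq W renaming (c1 to a1; c2 to a2; c3 to a3; c4' to a4; c6 to a6)
  den = ℕtoℚ 2 * y1 + a1 * x1 + a3
  third : ℚ → ℚ → Pt
  third l v = aff x3 (- ((l + a1) * x3) - v - a3)
    where x3 = l * l + a1 * l - a2 - x1 - x2

mul : WEq → Pt → ℕ → Pt
mul W P zero = O
mul W P (suc n) = add W P (mul W P n)

module EDS (E : Curve) (P : Pt) where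
  W = toW E

  -- D_n = d : x([n]P) = A_n / d² in lowest terms (d ≥ 1)
  Dterm : ℕ → ℕ → Set
  Dterm n d = Σ ℚ λ x → Σ ℚ λ y → mul W P n ≡ aff x y × ↧ₙ x ≡ d ℕ.* d

  DivD : ℕ → ℕ → Set
  DivD m n = Σ ℕ λ d → Dterm n d × m ∣ d

  InS : ℕ → Set
  InS n = 1 ≤ n × DivD n n

  IsRank : ℕ → ℕ → Set
  IsRank m r = 1 ≤ r × DivD m r × (∀ k → 1 ≤ k → k < r → ¬ DivD m k)

  Arrow : ℕ → ℕ → Set
  Arrow n m = InS n × InS m × n ∣ m × n ≢ m
    × (∀ k → InS k → n ∣ k → k ∣ m → k ≡ n ⊎ k ≡ m)

  GenCycle : List ℕ → Set
  GenCycle [] = ⊥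
  GenCycle (p ∷ ps) = All Prime (p ∷ ps) × Unique (p ∷ ps)
    × Linked IsRank (p ∷ ps ++ p ∷ [])

  AliqCycle : List ℕ → Set
  AliqCycle cs = GenCycle cs × All (GoodRed E) cs

  InAgen InA : ℕ → Set
  InAgen d = Σ (List ℕ) λ cs → GenCycle cs × prodℕ cs ≡ d
  InA d = Σ (List ℕ) λ cs → AliqCycle cs × prodℕ cs ≡ d

  TwoIrregular : Set
  TwoIrregular = GoodRed E 2 × NsCount E 2 ≡ 4 × IsRank 2 4
    × (Σ ℕ λ d → Dterm 2 d × ¬ (2 ∣ d))
    × (Σ ℕ λ d → Dterm 4 d × 2 ∣ d × ¬ (4 ∣ d))

  Regular : Set
  Regular = ¬ TwoIrregular × (∀ p → Prime p → PDiv p (Δ W) → NsRed E p P)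

  CompRankCount : ℕ → ℕ → Set
  CompRankCount d t = Σ (List ℕ) λ L → Unique L
    × (∀ q → (q ∈ L → Prime q × q ∣ d × Σ ℕ λ r → IsRank q r × Composite r)
           × (Prime q × q ∣ d × (Σ ℕ λ r → IsRank q r × Composite r) → q ∈ L))
    × length L ≡ t

primeDivs : ℕ → List ℕ
primeDivs d = filter (λ q → prime? q ×-dec q ∣? d) (upTo (suc d))

LeastPrimeDiv : ℕ → ℕ → Set
LeastPrimeDiv m q = Prime q × q ∣ m × (∀ q' → Prime q' → q' ∣ m → q ≤ q')

module Submission where

-- With x([n]P) = A_n / D_n² and B_n = D_n², the numbers x([a]P) and x([b]P) determine the sum and the product of x([a±b]P);
-- over ℤ this says that three forms in (A_a , B_a , A_b , B_b) are c times (B₊B₋ , A₊B₋ + A₋B₊ , A₊A₋), and p ∤ c exactly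
-- because P is nonsingular modulo p. From this relation alone one reads off that {n : pᵏ ∣ D_n} is a group of indices, that
-- pᵏ ∣ D_a implies pᵏ⁺¹ ∣ D_{pa}, that p ∣ D_p at a cusp, and that p ∣ D_{pk} implies p ∣ D_k at a node (where the traces
-- 2 + τ B_n / (A_n - s B_n) satisfy T_p ≡ T_1). Listing the reductions of ±[k]P gives r_p ≤ #E_ns(F_p) ≤ 2p + 1, so p² ∣ r_p
-- only for p = 2, r_p = 4, which regularity handles; hence n ∈ S iff every prime q ∣ n divides D_n, i.e. r_q ∣ n.
-- Everything about arrows is then combinatorics of the map p ↦ r_p. In (d), an arrow n → nd forces every prime q ∣ d to
-- divide some r_p with p ∣ d, so ∏ r_p ≥ p₀ᵗ ∏ p. The upper bound for #E_ns(F_p) is Hasse's inequality, proved as Manin did: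
-- the heights d_n of a sequence of points over F_p(t), with x-coordinates starting from tᵖ, satisfy d_{n+1} + d_{n-1} ≤ 2 d_n + 2.

-- No reduction homomorphism, formal group or group law over F_p or F_p(t) is constructed; the group
-- law over ℚ is needed only along the multiples of P. The multiplier c replaces them: the three
-- forms are polynomials with integer coefficients, so they can be read modulo p and modulo p^e, and
-- c is all that is lost on passing to lowest terms. Where c is a unit, the indices a and b control
-- a + b and a - b just as a reduction map would. Abscissas see points only up to sign; ordinates
-- return when reductions are counted.
--
-- The exceptional case at 2 arises because each factor q in an index beyond r_q raises ord_q(D) by
-- at least one. So q-divisibility can fail only if ord_q(r_q) > ord_q(D at r_q), which needs q² ∣
-- r_q; the bound 2q + 1 leaves q = 2, r = 4 and ord_2(D_4) = 1.
--
-- In Manin's argument d_0 = p, and each affine point over F_p costs one degree in the second term.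
-- With p + a affine points this yields 0 ≤ d_n ≤ n² - na + p, and n near a/2 gives a² ≤ 4p. An
-- upper bound on heights is enough since only an upper bound on the number of points is wanted.

open import Algebra.Bundles using (CommutativeRing)
open import Data.Empty using (⊥; ⊥-elim)
open import Data.Integer as ℤ using (0ℤ; 1ℤ; ℤ; ∣_∣)
open import Data.List.Membership.Propositional using (_∈_)
open import Data.List.Relation.Unary.Unique.Propositional using (Unique)
open import Data.Nat as ℕ using (suc; s≤s; zero; z≤n; ℕ)
open import Data.Nat.Primality using (Composite; Prime; euclidsLemma; prime[2]; prime⇒irreducible; prime⇒nonTrivial; prime⇒nonZero; ¬prime[1])
open import Data.Product using (_,_; _×_; proj₁; proj₂; Σ; ∃; ∃₂)
open import Data.Sum using ([_,_]′; _⊎_; inj₁; inj₂)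
open import Data.Vec.N-ary using (N-ary; _$ⁿ_)
open import Relation.Nullary using (Dec; no; yes; ¬_)
import Algebra.Properties.CommutativeSemiring.Exp as CExp
import Data.Nat.Coprimality as Cop
import Data.Fin.Properties as FinP
import Data.Nat.GCD as GCD
import Data.List.Properties as ListP
import Data.List.Membership.Propositional.Properties as MemP
import Data.List.Relation.Binary.Permutation.Propositional.Properties as PermP
import Algebra.Properties.Semiring.Exp as SExp
import Data.List.Relation.Unary.Unique.Propositional.Properties as UniqueP
import Data.Nat.Divisibility as ℕD
import Data.Nat.DivMod as ℕDM
import Data.Nat.Properties as ℕP
import Data.Rational.Properties as ℚP
import Data.Rational.Unnormalised as ℚᵘ
import Data.Rational.Unnormalised.Properties as ℚᵘP
import Data.Integer.Divisibility.Signed as ℤD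
import Data.Integer.DivMod as ℤM
import Data.Integer.Properties as ℤP
import Relation.Binary.PropositionalEquality as ≡
open import Level using (Level)

-- Polynomial identities in commutative rings

module Solver {a ℓ : Level} (R : CommutativeRing a ℓ) where
  open import Data.Bool using (true; false; if_then_else_; T)
  open import Data.Integer using (+_; -[1+_])
  open import Data.Fin using (Fin; zero; suc)
  open import Data.List using (List; []; _∷_)
  open import Data.Vec as Vec using (Vec; []; _∷_; lookup; zipWith; replicate)
  open import Data.Unit using (tt)
  open ≡ using (_≡_)
  open CommutativeRing R
  open import Algebra.Properties.Ring ring using (-‿distribˡ-*; -‿distribʳ-*; -0#≈0#; -‿involutive; -‿+-comm)
  open import Algebra.Properties.Semiring.Mult.TCOptimised semiring using (1+×; ×-homo-+; ×1-homo-*) renaming (_×_ to _×ₙ_)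
  open import Algebra.Properties.Semiring.Exp semiring using (_^_; ^-homo-*) public
  open import Algebra.Properties.CommutativeSemigroup *-commutativeSemigroup using () renaming (interchange to *-interchange)
  open import Algebra.Properties.CommutativeSemigroup +-commutativeSemigroup using () renaming (interchange to +-interchange)
  open import Relation.Binary.Reasoning.Setoid setoid

  -- The optimised multiple makes `fromℤ (+ 1)` compute to `1#`, so a numeral in a solver expression
  -- evaluates to the term written in the statement without any conversion.
  fromℤ : ℤ → Carrier
  fromℤ (+ n) = n ×ₙ 1#
  fromℤ -[1+ n ] = - (suc n ×ₙ 1#)

  fromℤ-⊖ : ∀ m n → fromℤ (m ℤ.⊖ n) ≈ m ×ₙ 1# - n ×ₙ 1#
  fromℤ-⊖ m zero = sym (trans (+-congˡ -0#≈0#) (+-identityʳ _))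
  fromℤ-⊖ zero (suc n) = sym (+-identityˡ _)
  fromℤ-⊖ (suc m) (suc n) = begin
    fromℤ (suc m ℤ.⊖ suc n)          ≡⟨ ≡.cong fromℤ (ℤP.[1+m]⊖[1+n]≡m⊖n m n) ⟩
    fromℤ (m ℤ.⊖ n)                  ≈⟨ fromℤ-⊖ m n ⟩
    x - y                            ≈⟨ +-identityˡ _ ⟨
    0# + (x - y)                     ≈⟨ +-congʳ (-‿inverseʳ 1#) ⟨
    (1# - 1#) + (x - y)              ≈⟨ +-interchange 1# (- 1#) x (- y) ⟩
    (1# + x) + (- 1# - y)            ≈⟨ +-congˡ (-‿+-comm 1# y) ⟩
    (1# + x) - (1# + y)              ≈⟨ +-cong (1+× m 1#) (-‿cong (1+× n 1#)) ⟨
    suc m ×ₙ 1# - suc n ×ₙ 1#        ∎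
    where x = m ×ₙ 1#
          y = n ×ₙ 1#

  fromℤ-neg : ∀ z → fromℤ (ℤ.- z) ≈ - fromℤ z
  fromℤ-neg (+ zero) = sym -0#≈0#
  fromℤ-neg (+ suc n) = refl
  fromℤ-neg -[1+ n ] = sym (-‿involutive _)

  fromℤ-+ : ∀ x y → fromℤ (x ℤ.+ y) ≈ fromℤ x + fromℤ y
  fromℤ-+ (+ m) (+ n) = ×-homo-+ 1# m n
  fromℤ-+ (+ m) -[1+ n ] = fromℤ-⊖ m (suc n)
  fromℤ-+ -[1+ m ] (+ n) = trans (fromℤ-⊖ n (suc m)) (+-comm _ _)
  fromℤ-+ -[1+ m ] -[1+ n ] = begin
    - (suc (suc (m ℕ.+ n)) ×ₙ 1#) ≡⟨ ≡.cong (λ k → - (suc k ×ₙ 1#)) (ℕP.+-suc m n) ⟨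
    - ((suc m ℕ.+ suc n) ×ₙ 1#)   ≈⟨ -‿cong (×-homo-+ 1# (suc m) (suc n)) ⟩
    - (suc m ×ₙ 1# + suc n ×ₙ 1#) ≈⟨ -‿+-comm _ _ ⟨
    _                             ∎

  fromℤ-+*+ : ∀ m n → fromℤ ((+ m) ℤ.* (+ n)) ≈ (m ×ₙ 1#) * (n ×ₙ 1#)
  fromℤ-+*+ m n = trans (reflexive (≡.cong fromℤ (≡.sym (ℤP.pos-* m n)))) (×1-homo-* m n)

  fromℤ-* : ∀ x y → fromℤ (x ℤ.* y) ≈ fromℤ x * fromℤ y
  fromℤ-* (+ m) (+ n) = fromℤ-+*+ m n
  fromℤ-* (+ m) -[1+ n ] = begin
    fromℤ ((+ m) ℤ.* (ℤ.- (+ suc n)))   ≡⟨ ≡.cong fromℤ (ℤP.neg-distribʳ-* (+ m) (+ suc n)) ⟨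
    fromℤ (ℤ.- ((+ m) ℤ.* (+ suc n)))   ≈⟨ fromℤ-neg ((+ m) ℤ.* (+ suc n)) ⟩
    - fromℤ ((+ m) ℤ.* (+ suc n))       ≈⟨ -‿cong (fromℤ-+*+ m (suc n)) ⟩
    - ((m ×ₙ 1#) * (suc n ×ₙ 1#))       ≈⟨ -‿distribʳ-* _ _ ⟩
    _                                   ∎
  fromℤ-* -[1+ m ] (+ n) = begin
    fromℤ ((ℤ.- (+ suc m)) ℤ.* (+ n))   ≡⟨ ≡.cong fromℤ (ℤP.neg-distribˡ-* (+ suc m) (+ n)) ⟨
    fromℤ (ℤ.- ((+ suc m) ℤ.* (+ n)))   ≈⟨ fromℤ-neg ((+ suc m) ℤ.* (+ n)) ⟩
    - fromℤ ((+ suc m) ℤ.* (+ n))       ≈⟨ -‿cong (fromℤ-+*+ (suc m) n) ⟩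
    - ((suc m ×ₙ 1#) * (n ×ₙ 1#))       ≈⟨ -‿distribˡ-* _ _ ⟩
    _                                   ∎
  fromℤ-* -[1+ m ] -[1+ n ] = begin
    (suc m ℕ.* suc n) ×ₙ 1#                 ≈⟨ ×1-homo-* (suc m) (suc n) ⟩
    (suc m ×ₙ 1#) * (suc n ×ₙ 1#)           ≈⟨ -‿involutive _ ⟨
    - - ((suc m ×ₙ 1#) * (suc n ×ₙ 1#))     ≈⟨ -‿cong (-‿distribˡ-* _ _) ⟩
    - (- (suc m ×ₙ 1#) * (suc n ×ₙ 1#))     ≈⟨ -‿distribʳ-* _ _ ⟩
    _                                       ∎

  infix 4 _:=_
  infixl 6 _:+_ _:-_
  infixl 7 _:*_
  infix 8 :-_
  infixr 9 _:^_

  data Expr (n : ℕ) : Set where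
    var : Fin n → Expr n
    con : ℤ → Expr n
    _:+_ _:*_ _:-_ : Expr n → Expr n → Expr n
    :-_ : Expr n → Expr n
    _:^_ : Expr n → ℕ → Expr n

  _:=_ : ∀ {n} → Expr n → Expr n → Expr n × Expr n
  _:=_ = _,_

  module _ {n : ℕ} where

    ⟦_⟧ : Expr n → Vec Carrier n → Carrier
    ⟦ var i ⟧ ρ = lookup ρ i
    ⟦ con k ⟧ ρ = fromℤ k
    ⟦ e :+ f ⟧ ρ = ⟦ e ⟧ ρ + ⟦ f ⟧ ρ
    ⟦ e :* f ⟧ ρ = ⟦ e ⟧ ρ * ⟦ f ⟧ ρ
    ⟦ e :- f ⟧ ρ = ⟦ e ⟧ ρ - ⟦ f ⟧ ρ
    ⟦ :- e ⟧ ρ = - ⟦ e ⟧ ρ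
    ⟦ e :^ k ⟧ ρ = ⟦ e ⟧ ρ ^ k

  Mono : ℕ → Set
  Mono = Vec ℕ

  Poly : ℕ → Set
  Poly n = List (Mono n × ℤ)

  data Cmp : Set where
    lt eq gt : Cmp

  cmp : ∀ {n} → Mono n → Mono n → Cmp
  cmp [] [] = eq
  cmp (x ∷ m) (y ∷ m′) = if x ℕ.≡ᵇ y then cmp m m′ else if x ℕ.<ᵇ y then lt else gt

  -- The property of `cmp` on which soundness rests: `lt` and `gt` only decide which head `addP`
  -- emits first, whereas `eq` merges two coefficients under one monomial.
  cmp-eq : ∀ {n} (m m′ : Mono n) → cmp m m′ ≡ eq → m ≡ m′
  cmp-eq [] [] _ = ≡.refl
  cmp-eq (x ∷ m) (y ∷ m′) h with x ℕ.≡ᵇ y in e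
  ... | true = ≡.cong₂ _∷_ (ℕP.≡ᵇ⇒≡ x y (≡.subst T (≡.sym e) tt)) (cmp-eq m m′ h)
  ... | false with x ℕ.<ᵇ y
  cmp-eq (x ∷ m) (y ∷ m′) () | false | true
  cmp-eq (x ∷ m) (y ∷ m′) () | false | false

  -- Zero coefficients are dropped at once, so that a vanishing polynomial normalises to `[]`, the
  -- form for which `solve` asks.
  cons : ∀ {n} → Mono n → ℤ → Poly n → Poly n
  cons m (+ zero) p = p
  cons m c p = (m , c) ∷ p

  pick : ∀ {b} {B : Set b} → Cmp → B → B → B → B
  pick lt x y z = x
  pick eq x y z = y
  pick gt x y z = z

  addP : ∀ {n} → Poly n → Poly n → Poly n
  addP [] q = q
  addP (t ∷ p) [] = t ∷ p
  addP (t ∷ p) (u ∷ q) = pick (cmp (proj₁ t) (proj₁ u))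
    (u ∷ addP (t ∷ p) q)
    (cons (proj₁ t) (proj₂ t ℤ.+ proj₂ u) (addP p q))
    (t ∷ addP p (u ∷ q))

  negP : ∀ {n} → Poly n → Poly n
  negP [] = []
  negP ((m , c) ∷ p) = (m , ℤ.- c) ∷ negP p

  scale : ∀ {n} → Mono n → ℤ → Poly n → Poly n
  scale m c [] = []
  scale m c ((m′ , c′) ∷ p) = (zipWith ℕ._+_ m m′ , c ℤ.* c′) ∷ scale m c p

  mulP : ∀ {n} → Poly n → Poly n → Poly n
  mulP [] q = []
  mulP ((m , c) ∷ p) q = addP (scale m c q) (mulP p q)

  powP : ∀ {n} → Poly n → ℕ → Poly n
  powP p zero = (replicate _ 0 , + 1) ∷ []
  powP p (suc k) = mulP p (powP p k)

  unit : ∀ {n} → Fin n → Mono n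
  unit zero = 1 ∷ replicate _ 0
  unit (suc i) = 0 ∷ unit i

  norm : ∀ {n} → Expr n → Poly n
  norm (var i) = (unit i , + 1) ∷ []
  norm (con k) = cons (replicate _ 0) k []
  norm (e :+ f) = addP (norm e) (norm f)
  norm (e :* f) = mulP (norm e) (norm f)
  norm (e :- f) = addP (norm e) (negP (norm f))
  norm (:- e) = negP (norm e)
  norm (e :^ k) = powP (norm e) k

  ⟦_⟧M : ∀ {n} → Mono n → Vec Carrier n → Carrier
  ⟦ [] ⟧M [] = 1#
  ⟦ k ∷ m ⟧M (x ∷ ρ) = x ^ k * ⟦ m ⟧M ρ

  ⟦_⟧P : ∀ {n} → Poly n → Vec Carrier n → Carrier
  ⟦ [] ⟧P ρ = 0#
  ⟦ (m , c) ∷ p ⟧P ρ = fromℤ c * ⟦ m ⟧M ρ + ⟦ p ⟧P ρ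

  one-M : ∀ {n} (ρ : Vec Carrier n) → ⟦ replicate _ 0 ⟧M ρ ≈ 1#
  one-M [] = refl
  one-M (x ∷ ρ) = trans (*-identityˡ _) (one-M ρ)

  unit-M : ∀ {n} (i : Fin n) ρ → ⟦ unit i ⟧M ρ ≈ lookup ρ i
  unit-M zero (x ∷ ρ) = trans (*-cong (*-identityʳ x) (one-M ρ)) (*-identityʳ x)
  unit-M (suc i) (x ∷ ρ) = trans (*-identityˡ _) (unit-M i ρ)

  mul-M : ∀ {n} (m m′ : Mono n) ρ → ⟦ zipWith ℕ._+_ m m′ ⟧M ρ ≈ ⟦ m ⟧M ρ * ⟦ m′ ⟧M ρ
  mul-M [] [] [] = sym (*-identityˡ 1#)
  mul-M (j ∷ m) (k ∷ m′) (x ∷ ρ) =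
    trans (*-cong (^-homo-* x j k) (mul-M m m′ ρ)) (*-interchange _ _ _ _)

  cons-P : ∀ {n} (m : Mono n) c p ρ → ⟦ cons m c p ⟧P ρ ≈ fromℤ c * ⟦ m ⟧M ρ + ⟦ p ⟧P ρ
  cons-P m (+ zero) p ρ = sym (trans (+-congʳ (zeroˡ _)) (+-identityˡ _))
  cons-P m (+ suc _) p ρ = refl
  cons-P m -[1+ _ ] p ρ = refl

  add-step : ∀ {n} (t u : Mono n × ℤ) p q ρ k → cmp (proj₁ t) (proj₁ u) ≡ k →
    ⟦ addP (t ∷ p) q ⟧P ρ ≈ ⟦ t ∷ p ⟧P ρ + ⟦ q ⟧P ρ → ⟦ addP p q ⟧P ρ ≈ ⟦ p ⟧P ρ + ⟦ q ⟧P ρ →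
    ⟦ addP p (u ∷ q) ⟧P ρ ≈ ⟦ p ⟧P ρ + ⟦ u ∷ q ⟧P ρ →
    ⟦ pick k (u ∷ addP (t ∷ p) q) (cons (proj₁ t) (proj₂ t ℤ.+ proj₂ u) (addP p q)) (t ∷ addP p (u ∷ q)) ⟧P ρ
      ≈ ⟦ t ∷ p ⟧P ρ + ⟦ u ∷ q ⟧P ρ
  add-step t u p q ρ lt e h₁ h₂ h₃ = begin
    x′ + ⟦ addP (t ∷ p) q ⟧P ρ        ≈⟨ +-congˡ h₁ ⟩
    x′ + (⟦ t ∷ p ⟧P ρ + ⟦ q ⟧P ρ)    ≈⟨ +-assoc _ _ _ ⟨
    x′ + ⟦ t ∷ p ⟧P ρ + ⟦ q ⟧P ρ      ≈⟨ +-congʳ (+-comm _ _) ⟩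
    ⟦ t ∷ p ⟧P ρ + x′ + ⟦ q ⟧P ρ      ≈⟨ +-assoc _ _ _ ⟩
    _                                 ∎
    where x′ = fromℤ (proj₂ u) * ⟦ proj₁ u ⟧M ρ
  add-step t u p q ρ gt e h₁ h₂ h₃ = trans (+-congˡ h₃) (sym (+-assoc _ _ _))
  add-step t u p q ρ eq e h₁ h₂ h₃ = begin
    ⟦ cons (proj₁ t) (c ℤ.+ c′) (addP p q) ⟧P ρ            ≈⟨ cons-P (proj₁ t) (c ℤ.+ c′) (addP p q) ρ ⟩
    fromℤ (c ℤ.+ c′) * y + ⟦ addP p q ⟧P ρ                 ≈⟨ +-cong (trans (*-congʳ (fromℤ-+ c c′)) (distribʳ _ _ _)) h₂ ⟩
    (fromℤ c * y + fromℤ c′ * y) + (⟦ p ⟧P ρ + ⟦ q ⟧P ρ)   ≈⟨ +-interchange _ _ _ _ ⟩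
    (fromℤ c * y + ⟦ p ⟧P ρ) + (fromℤ c′ * y + ⟦ q ⟧P ρ)   ≡⟨ ≡.cong (λ m → (fromℤ c * y + ⟦ p ⟧P ρ) + (fromℤ c′ * ⟦ m ⟧M ρ + ⟦ q ⟧P ρ)) (cmp-eq (proj₁ t) (proj₁ u) e) ⟩
    _                                                      ∎
    where y = ⟦ proj₁ t ⟧M ρ
          c = proj₂ t
          c′ = proj₂ u

  add-P : ∀ {n} (p q : Poly n) ρ → ⟦ addP p q ⟧P ρ ≈ ⟦ p ⟧P ρ + ⟦ q ⟧P ρ
  add-P [] q ρ = sym (+-identityˡ _)
  add-P (t ∷ p) [] ρ = sym (+-identityʳ _)
  add-P (t ∷ p) (u ∷ q) ρ = add-step t u p q ρ (cmp (proj₁ t) (proj₁ u)) ≡.refl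
    (add-P (t ∷ p) q ρ) (add-P p q ρ) (add-P p (u ∷ q) ρ)

  neg-P : ∀ {n} (p : Poly n) ρ → ⟦ negP p ⟧P ρ ≈ - ⟦ p ⟧P ρ
  neg-P [] ρ = sym -0#≈0#
  neg-P ((m , c) ∷ p) ρ =
    trans (+-cong (trans (*-congʳ (fromℤ-neg c)) (sym (-‿distribˡ-* _ _))) (neg-P p ρ)) (-‿+-comm _ _)

  scale-P : ∀ {n} (m : Mono n) c p ρ → ⟦ scale m c p ⟧P ρ ≈ fromℤ c * ⟦ m ⟧M ρ * ⟦ p ⟧P ρ
  scale-P m c [] ρ = sym (zeroʳ _)
  scale-P m c ((m′ , c′) ∷ p) ρ =
    trans (+-cong (trans (*-cong (fromℤ-* c c′) (mul-M m m′ ρ)) (*-interchange _ _ _ _)) (scale-P m c p ρ))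
          (sym (distribˡ _ _ _))

  mul-P : ∀ {n} (p q : Poly n) ρ → ⟦ mulP p q ⟧P ρ ≈ ⟦ p ⟧P ρ * ⟦ q ⟧P ρ
  mul-P [] q ρ = sym (zeroˡ _)
  mul-P ((m , c) ∷ p) q ρ =
    trans (add-P (scale m c q) (mulP p q) ρ)
    (trans (+-cong (scale-P m c q ρ) (mul-P p q ρ)) (sym (distribʳ _ _ _)))

  one-P : ∀ {n} c (ρ : Vec Carrier n) → ⟦ cons (replicate _ 0) c [] ⟧P ρ ≈ fromℤ c
  one-P c ρ = trans (cons-P (replicate _ 0) c [] ρ)
    (trans (+-identityʳ _) (trans (*-congˡ (one-M ρ)) (*-identityʳ _)))

  norm-sound : ∀ {n} (e : Expr n) ρ → ⟦ norm e ⟧P ρ ≈ ⟦ e ⟧ ρ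
  pow-P : ∀ {n} (e : Expr n) k ρ → ⟦ powP (norm e) k ⟧P ρ ≈ ⟦ e ⟧ ρ ^ k
  norm-sound (var i) ρ = trans (+-identityʳ _) (trans (*-identityˡ _) (unit-M i ρ))
  norm-sound (con k) ρ = one-P k ρ
  norm-sound (e :+ f) ρ = trans (add-P (norm e) (norm f) ρ) (+-cong (norm-sound e ρ) (norm-sound f ρ))
  norm-sound (e :* f) ρ = trans (mul-P (norm e) (norm f) ρ) (*-cong (norm-sound e ρ) (norm-sound f ρ))
  norm-sound (e :- f) ρ = trans (add-P (norm e) (negP (norm f)) ρ)
    (+-cong (norm-sound e ρ) (trans (neg-P (norm f) ρ) (-‿cong (norm-sound f ρ))))
  norm-sound (:- e) ρ = trans (neg-P (norm e) ρ) (-‿cong (norm-sound e ρ))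
  norm-sound (e :^ k) ρ = pow-P e k ρ
  pow-P e zero ρ = one-P (+ 1) ρ
  pow-P e (suc k) ρ = trans (mul-P (norm e) (powP (norm e) k) ρ) (*-cong (norm-sound e ρ) (pow-P e k ρ))

  x-y≈0⇒x≈y : ∀ {x y} → x - y ≈ 0# → x ≈ y
  x-y≈0⇒x≈y {x} {y} h = begin
    x             ≈⟨ +-identityʳ x ⟨
    x + 0#        ≈⟨ +-congˡ (-‿inverseˡ y) ⟨
    x + (- y + y) ≈⟨ +-assoc _ _ _ ⟨
    x - y + y     ≈⟨ +-congʳ h ⟩
    0# + y        ≈⟨ +-identityˡ y ⟩
    y             ∎

  x≈y⇒x-y≈0 : ∀ {x y} → x ≈ y → x - y ≈ 0#
  x≈y⇒x-y≈0 {x} {y} h = trans (+-congʳ h) (-‿inverseʳ y)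

  vars : ∀ {n} → Vec (Expr n) n
  vars = Vec.tabulate var

  -- The hypothesis on normal forms is closed by computation at each use. The entries of `ρ` are
  -- atoms, so whole subterms can be passed as variables to keep the polynomials small.
  solve : ∀ {n} (ρ : Vec Carrier n) (f : N-ary n (Expr n) (Expr n × Expr n)) →
          let e = f $ⁿ vars in norm (proj₁ e :- proj₂ e) ≡ [] →
          ⟦ proj₁ e ⟧ ρ ≈ ⟦ proj₂ e ⟧ ρ
  solve {n} ρ f h = x-y≈0⇒x≈y (trans (sym (norm-sound (l :- r) ρ)) (reflexive (≡.cong (λ p → ⟦ p ⟧P ρ) h)))
    where l = proj₁ (f $ⁿ vars {n})
          r = proj₂ (f $ⁿ vars {n})

  NoZeroDivisors : Set _
  NoZeroDivisors = ∀ x y → x * y ≈ 0# → x ≈ 0# ⊎ y ≈ 0#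

  infixl 6 _⊕_
  infix 7 _·_

  _·_ : ∀ c {l r} → l ≈ r → c * (l - r) ≈ 0#
  c · h = trans (*-congˡ (x≈y⇒x-y≈0 h)) (zeroʳ c)

  _⊕_ : ∀ {x y} → x ≈ 0# → y ≈ 0# → x + y ≈ 0#
  h ⊕ k = trans (+-cong h k) (+-identityˡ 0#)

  -- The pattern of nearly all the algebra below: an unconditional identity exhibits l - r as an
  -- explicit combination of the differences of known equations, and `_·_` and `_⊕_` show that the
  -- combination vanishes. The coefficients are certificates of ideal membership.
  comb : ∀ {l r z} → l - r ≈ z → z ≈ 0# → l ≈ r
  comb h k = x-y≈0⇒x≈y (trans h k)

-- Ring homomorphisms acting on polynomial expressions

module Hom {a ℓ b m : Level} (R : CommutativeRing a ℓ) (R′ : CommutativeRing b m) where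
  open import Data.Integer using (+_; -[1+_])
  open import Data.Fin using (zero; suc)
  open import Data.Vec as Vec using (Vec; _∷_)
  module R = CommutativeRing R
  module R′ = CommutativeRing R′
  module S = Solver R
  module S′ = Solver R′

  record IsHom (ι : R.Carrier → R′.Carrier) : Set (a Agda.Primitive.⊔ m) where
    field
      hom-1 : ι R.1# R′.≈ R′.1#
      hom-0 : ι R.0# R′.≈ R′.0#
      hom-+ : ∀ x y → ι (x R.+ y) R′.≈ ι x R′.+ ι y
      hom-* : ∀ x y → ι (x R.* y) R′.≈ ι x R′.* ι y
      hom-neg : ∀ x → ι (R.- x) R′.≈ R′.- ι x

    hom-fromℕ : ∀ n → ι (S.fromℤ (+ n)) R′.≈ S′.fromℤ (+ n)
    hom-fromℕ zero = hom-0
    hom-fromℕ (suc zero) = hom-1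
    hom-fromℕ (suc (suc n)) = R′.trans (hom-+ _ _) (R′.+-cong (hom-fromℕ (suc n)) hom-1)

    convert : ∀ {n} → S.Expr n → S′.Expr n
    convert (S.var i) = S′.var i
    convert (S.con k) = S′.con k
    convert (e S.:+ f) = convert e S′.:+ convert f
    convert (e S.:* f) = convert e S′.:* convert f
    convert (e S.:- f) = convert e S′.:- convert f
    convert (S.:- e) = S′.:- convert e
    convert (e S.:^ k) = convert e S′.:^ k

    hom-eval : ∀ {n} (e : S.Expr n) ρ → ι (S.⟦ e ⟧ ρ) R′.≈ S′.⟦ convert e ⟧ (Vec.map ι ρ)
    hom-pow : ∀ {n} (e : S.Expr n) k ρ → ι (S.⟦ e ⟧ ρ S.^ k) R′.≈ S′.⟦ convert e ⟧ (Vec.map ι ρ) S′.^ k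
    hom-eval (S.var zero) (x ∷ ρ) = R′.refl
    hom-eval (S.var (suc i)) (x ∷ ρ) = hom-eval (S.var i) ρ
    hom-eval (S.con (+ n)) ρ = hom-fromℕ n
    hom-eval (S.con -[1+ n ]) ρ = R′.trans (hom-neg _) (R′.-‿cong (hom-fromℕ (suc n)))
    hom-eval (e S.:+ f) ρ = R′.trans (hom-+ _ _) (R′.+-cong (hom-eval e ρ) (hom-eval f ρ))
    hom-eval (e S.:* f) ρ = R′.trans (hom-* _ _) (R′.*-cong (hom-eval e ρ) (hom-eval f ρ))
    hom-eval (e S.:- f) ρ = R′.trans (hom-+ _ _) (R′.+-cong (hom-eval e ρ) (R′.trans (hom-neg _) (R′.-‿cong (hom-eval f ρ))))
    hom-eval (S.:- e) ρ = R′.trans (hom-neg _) (R′.-‿cong (hom-eval e ρ))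
    hom-eval (e S.:^ k) ρ = hom-pow e k ρ
    hom-pow e zero ρ = hom-1
    hom-pow e (suc k) ρ = R′.trans (hom-* _ _) (R′.*-cong (hom-eval e ρ) (hom-pow e k ρ))

-- Lines meeting a Weierstrass cubic over an integral domain

module Lines {c ℓ : Level} (R : CommutativeRing c ℓ) (dom : Solver.NoZeroDivisors R)
  (a1 a2 a3 a4 a6 : CommutativeRing.Carrier R) where
  open import Data.Vec using ([]; _∷_)
  open import Data.Integer using (+_)
  open CommutativeRing R
  open Solver R

  2# 3# 4# : Carrier
  2# = fromℤ (+ 2)
  3# = fromℤ (+ 3)
  4# = fromℤ (+ 4)

  cancel : ∀ {x y z} → ¬ (x ≈ y) → (x - y) * z ≈ 0# → z ≈ 0#
  cancel {x} {y} {z} x≉y h = [ (λ e → ⊥-elim (x≉y (x-y≈0⇒x≈y e))) , (λ e → e) ]′ (dom (x - y) z h)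

  -- Minus the Weierstrass polynomial, signed so that its restriction to a line y = l x + v is the
  -- monic cubic whose roots are the abscissas of the intersection.
  g : Carrier → Carrier → Carrier
  g x y = x * x * x + a2 * x * x + a4 * x + a6 - y * y - (a1 * x + a3) * y

  g-cong : ∀ {x x′ y y′} → x ≈ x′ → y ≈ y′ → g x y ≈ g x′ y′
  g-cong p q = +-cong (+-cong (+-congʳ (+-cong (+-cong (*-cong (*-cong p p) p) (*-cong (*-congˡ p) p)) (*-congˡ p)))
    (-‿cong (*-cong q q))) (-‿cong (*-cong (+-congʳ (*-congˡ p)) q))

  -- Vieta's relations for the cubic cut out by y = l x + v, with multiplicity. A tangent is the
  -- case x₁ = x₂, so chords and tangents share one notion that is invariant under permuting the
  -- abscissas.
  record Line (l v x₁ x₂ x₃ : Carrier) : Set ℓ where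
    constructor line
    field
      e₁ : x₁ + x₂ + x₃ ≈ l * l + a1 * l - a2
      e₂ : x₁ * x₂ + x₁ * x₃ + x₂ * x₃ ≈ a4 - 2# * l * v - a1 * v - a3 * l
      e₃ : x₁ * x₂ * x₃ ≈ v * v + a3 * v - a6

  private
    line-e₃ : ∀ l v x₁ x₂ x₃ → g x₁ (l * x₁ + v) ≈ 0# →
      x₁ + x₂ + x₃ ≈ l * l + a1 * l - a2 →
      x₁ * x₂ + x₁ * x₃ + x₂ * x₃ ≈ a4 - 2# * l * v - a1 * v - a3 * l →
      x₁ * x₂ * x₃ ≈ v * v + a3 * v - a6
    line-e₃ l v x₁ x₂ x₃ h e₁ e₂ = comb
      (solve (l ∷ v ∷ x₁ ∷ x₂ ∷ x₃ ∷ a1 ∷ a2 ∷ a3 ∷ a4 ∷ a6 ∷ [])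
        (λ l v x₁ x₂ x₃ a1 a2 a3 a4 a6 →
          x₁ :* x₂ :* x₃ :- (v :* v :+ a3 :* v :- a6) :=
          con (+ 1) :* ((x₁ :* x₁ :* x₁ :+ a2 :* x₁ :* x₁ :+ a4 :* x₁ :+ a6 :- (l :* x₁ :+ v) :* (l :* x₁ :+ v) :- (a1 :* x₁ :+ a3) :* (l :* x₁ :+ v)) :- con (+ 0))
          :+ (:- (x₁ :* x₁)) :* ((x₁ :+ x₂ :+ x₃) :- (l :* l :+ a1 :* l :- a2))
          :+ x₁ :* ((x₁ :* x₂ :+ x₁ :* x₃ :+ x₂ :* x₃) :- (a4 :- con (+ 2) :* l :* v :- a1 :* v :- a3 :* l)))
        ≡.refl)
      (_ · h ⊕ _ · e₁ ⊕ _ · e₂)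

  -- The difference of the curve equations at the two abscissas contains the factor x₁ - x₂;
  -- cancelling it leaves the second Vieta relation.
  chord-line : ∀ {l v x₁ x₂ x₃} → ¬ (x₁ ≈ x₂) → g x₁ (l * x₁ + v) ≈ 0# → g x₂ (l * x₂ + v) ≈ 0# →
    x₁ + x₂ + x₃ ≈ l * l + a1 * l - a2 → Line l v x₁ x₂ x₃
  chord-line {l} {v} {x₁} {x₂} {x₃} x₁≉x₂ h₁ h₂ e₁ = line e₁ e₂ (line-e₃ l v x₁ x₂ x₃ h₁ e₁ e₂)
    where
    e₂ : x₁ * x₂ + x₁ * x₃ + x₂ * x₃ ≈ a4 - 2# * l * v - a1 * v - a3 * l
    e₂ = x-y≈0⇒x≈y (cancel x₁≉x₂ (comb
      (solve (l ∷ v ∷ x₁ ∷ x₂ ∷ x₃ ∷ a1 ∷ a2 ∷ a3 ∷ a4 ∷ a6 ∷ [])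
        (λ l v x₁ x₂ x₃ a1 a2 a3 a4 a6 →
          let gg = λ x y → x :* x :* x :+ a2 :* x :* x :+ a4 :* x :+ a6 :- y :* y :- (a1 :* x :+ a3) :* y in
          (x₁ :- x₂) :* ((x₁ :* x₂ :+ x₁ :* x₃ :+ x₂ :* x₃) :- (a4 :- con (+ 2) :* l :* v :- a1 :* v :- a3 :* l)) :- con (+ 0) :=
          con (+ 1) :* (gg x₂ (l :* x₂ :+ v) :- con (+ 0)) :+ (:- con (+ 1)) :* (gg x₁ (l :* x₁ :+ v) :- con (+ 0))
          :+ ((x₁ :- x₂) :* (x₁ :+ x₂)) :* ((x₁ :+ x₂ :+ x₃) :- (l :* l :+ a1 :* l :- a2)))
        ≡.refl)
      (_ · h₂ ⊕ _ · h₁ ⊕ _ · e₁)))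

  tangent-line : ∀ {l v x x₃} → g x (l * x + v) ≈ 0# →
    l * (2# * (l * x + v) + a1 * x + a3) ≈ 3# * x * x + 2# * a2 * x + a4 - a1 * (l * x + v) →
    x + x + x₃ ≈ l * l + a1 * l - a2 → Line l v x x x₃
  tangent-line {l} {v} {x} {x₃} h t e₁ = line e₁ e₂ (line-e₃ l v x x x₃ h e₁ e₂)
    where
    e₂ = comb
      (solve (l ∷ v ∷ x ∷ x₃ ∷ a1 ∷ a2 ∷ a3 ∷ a4 ∷ [])
        (λ l v x x₃ a1 a2 a3 a4 →
          x :* x :+ x :* x₃ :+ x :* x₃ :- (a4 :- con (+ 2) :* l :* v :- a1 :* v :- a3 :* l) :=
          con (+ 1) :* (l :* (con (+ 2) :* (l :* x :+ v) :+ a1 :* x :+ a3) :- (con (+ 3) :* x :* x :+ con (+ 2) :* a2 :* x :+ a4 :- a1 :* (l :* x :+ v)))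
          :+ (con (+ 2) :* x) :* ((x :+ x :+ x₃) :- (l :* l :+ a1 :* l :- a2)))
        ≡.refl)
      (_ · t ⊕ _ · e₁)

  line-tangent : ∀ {l v x x₃} → Line l v x x x₃ →
    l * (2# * (l * x + v) + a1 * x + a3) ≈ 3# * x * x + 2# * a2 * x + a4 - a1 * (l * x + v)
  line-tangent {l} {v} {x} {x₃} (line e₁ e₂ _) = comb
      (solve (l ∷ v ∷ x ∷ x₃ ∷ a1 ∷ a2 ∷ a3 ∷ a4 ∷ [])
        (λ l v x x₃ a1 a2 a3 a4 →
          l :* (con (+ 2) :* (l :* x :+ v) :+ a1 :* x :+ a3) :- (con (+ 3) :* x :* x :+ con (+ 2) :* a2 :* x :+ a4 :- a1 :* (l :* x :+ v)) :=
          con (+ 1) :* (x :* x :+ x :* x₃ :+ x :* x₃ :- (a4 :- con (+ 2) :* l :* v :- a1 :* v :- a3 :* l))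
          :+ (:- (con (+ 2) :* x)) :* ((x :+ x :+ x₃) :- (l :* l :+ a1 :* l :- a2)))
        ≡.refl)
      (_ · e₂ ⊕ _ · e₁)

  line-swap : ∀ {l v x₁ x₂ x₃} → Line l v x₁ x₂ x₃ → Line l v x₂ x₁ x₃
  line-swap {l} {v} {x₁} {x₂} {x₃} (line e₁ e₂ e₃) = line
    (trans (solve (x₁ ∷ x₂ ∷ x₃ ∷ []) (λ x₁ x₂ x₃ → x₂ :+ x₁ :+ x₃ := x₁ :+ x₂ :+ x₃) ≡.refl) e₁)
    (trans (solve (x₁ ∷ x₂ ∷ x₃ ∷ []) (λ x₁ x₂ x₃ → x₂ :* x₁ :+ x₂ :* x₃ :+ x₁ :* x₃ := x₁ :* x₂ :+ x₁ :* x₃ :+ x₂ :* x₃) ≡.refl) e₂)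
    (trans (solve (x₁ ∷ x₂ ∷ x₃ ∷ []) (λ x₁ x₂ x₃ → x₂ :* x₁ :* x₃ := x₁ :* x₂ :* x₃) ≡.refl) e₃)

  line-rotate : ∀ {l v x₁ x₂ x₃} → Line l v x₁ x₂ x₃ → Line l v x₂ x₃ x₁
  line-rotate {l} {v} {x₁} {x₂} {x₃} (line e₁ e₂ e₃) = line
    (trans (solve (x₁ ∷ x₂ ∷ x₃ ∷ []) (λ x₁ x₂ x₃ → x₂ :+ x₃ :+ x₁ := x₁ :+ x₂ :+ x₃) ≡.refl) e₁)
    (trans (solve (x₁ ∷ x₂ ∷ x₃ ∷ []) (λ x₁ x₂ x₃ → x₂ :* x₃ :+ x₂ :* x₁ :+ x₃ :* x₁ := x₁ :* x₂ :+ x₁ :* x₃ :+ x₂ :* x₃) ≡.refl) e₂)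
    (trans (solve (x₁ ∷ x₂ ∷ x₃ ∷ []) (λ x₁ x₂ x₃ → x₂ :* x₃ :* x₁ := x₁ :* x₂ :* x₃) ≡.refl) e₃)

  line-neg : ∀ {l v x₁ x₂ x₃} → Line l v x₁ x₂ x₃ → Line (- l - a1) (- v - a3) x₁ x₂ x₃
  line-neg {l} {v} {x₁} {x₂} {x₃} (line e₁ e₂ e₃) = line
    (trans e₁ (solve (l ∷ a1 ∷ a2 ∷ []) (λ l a1 a2 → l :* l :+ a1 :* l :- a2 := (:- l :- a1) :* (:- l :- a1) :+ a1 :* (:- l :- a1) :- a2) ≡.refl))
    (trans e₂ (solve (l ∷ v ∷ a1 ∷ a3 ∷ a4 ∷ []) (λ l v a1 a3 a4 → a4 :- con (+ 2) :* l :* v :- a1 :* v :- a3 :* l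
       := a4 :- con (+ 2) :* (:- l :- a1) :* (:- v :- a3) :- a1 :* (:- v :- a3) :- a3 :* (:- l :- a1)) ≡.refl))
    (trans e₃ (solve (v ∷ a3 ∷ a6 ∷ []) (λ v a3 a6 → v :* v :+ a3 :* v :- a6 := (:- v :- a3) :* (:- v :- a3) :+ a3 :* (:- v :- a3) :- a6) ≡.refl))

  line-g : ∀ {l v x₁ x₂ x₃} → Line l v x₁ x₂ x₃ → ∀ x → g x (l * x + v) ≈ (x - x₁) * ((x - x₂) * (x - x₃))
  line-g {l} {v} {x₁} {x₂} {x₃} (line e₁ e₂ e₃) x = comb
    (solve (l ∷ v ∷ x ∷ x₁ ∷ x₂ ∷ x₃ ∷ a1 ∷ a2 ∷ a3 ∷ a4 ∷ a6 ∷ [])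
        (λ l v x x₁ x₂ x₃ a1 a2 a3 a4 a6 →
          let gg = λ x y → x :* x :* x :+ a2 :* x :* x :+ a4 :* x :+ a6 :- y :* y :- (a1 :* x :+ a3) :* y in
          gg x (l :* x :+ v) :- (x :- x₁) :* ((x :- x₂) :* (x :- x₃)) :=
          (x :* x) :* ((x₁ :+ x₂ :+ x₃) :- (l :* l :+ a1 :* l :- a2))
          :+ (:- x) :* ((x₁ :* x₂ :+ x₁ :* x₃ :+ x₂ :* x₃) :- (a4 :- con (+ 2) :* l :* v :- a1 :* v :- a3 :* l))
          :+ con (+ 1) :* (x₁ :* x₂ :* x₃ :- (v :* v :+ a3 :* v :- a6)))
        ≡.refl)
    (_ · e₁ ⊕ _ · e₂ ⊕ _ · e₃)

  line-on : ∀ {l v x₁ x₂ x₃} → Line l v x₁ x₂ x₃ → g x₁ (l * x₁ + v) ≈ 0#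
  line-on {l} {v} {x₁} {x₂} {x₃} L = trans (line-g L x₁) (trans (*-congʳ (-‿inverseʳ x₁)) (zeroˡ _))

  private
    slope-chord : ∀ {l v l′ v′ x₁ x₂} → l * x₁ + v ≈ l′ * x₁ + v′ → l * x₂ + v ≈ l′ * x₂ + v′ → ¬ (x₁ ≈ x₂) → l ≈ l′
    slope-chord {l} {v} {l′} {v′} {x₁} {x₂} h₁ h₂ ne = x-y≈0⇒x≈y (cancel ne (comb
      (solve (l ∷ v ∷ l′ ∷ v′ ∷ x₁ ∷ x₂ ∷ []) (λ l v l′ v′ x₁ x₂ →
         (x₁ :- x₂) :* (l :- l′) :- con (+ 0) := con (+ 1) :* ((l :* x₁ :+ v) :- (l′ :* x₁ :+ v′)) :+ (:- con (+ 1)) :* ((l :* x₂ :+ v) :- (l′ :* x₂ :+ v′))) ≡.refl)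
      (_ · h₁ ⊕ _ · h₂)))

    slope-tangent : ∀ {l v l′ v′ x x₃ x₃′} → Line l v x x x₃ → Line l′ v′ x x x₃′ → l * x + v ≈ l′ * x + v′ →
      ¬ ((l * x + v) + (l * x + v) + a1 * x + a3 ≈ 0#) → l ≈ l′
    slope-tangent {l} {v} {l′} {v′} {x} L L′ h nopp = [ (λ e → ⊥-elim (nopp e)) , x-y≈0⇒x≈y ]′ (dom ((l * x + v) + (l * x + v) + a1 * x + a3) (l - l′)
          (comb (solve (l ∷ v ∷ l′ ∷ v′ ∷ x ∷ a1 ∷ a2 ∷ a3 ∷ a4 ∷ []) (λ l v l′ v′ x a1 a2 a3 a4 →
             let r = λ l v → con (+ 3) :* x :* x :+ con (+ 2) :* a2 :* x :+ a4 :- a1 :* (l :* x :+ v) in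
             ((l :* x :+ v) :+ (l :* x :+ v) :+ a1 :* x :+ a3) :* (l :- l′) :- con (+ 0) :=
               con (+ 1) :* (l :* (con (+ 2) :* (l :* x :+ v) :+ a1 :* x :+ a3) :- r l v)
               :+ (:- con (+ 1)) :* (l′ :* (con (+ 2) :* (l′ :* x :+ v′) :+ a1 :* x :+ a3) :- r l′ v′)
               :+ (:- (con (+ 2) :* l′ :+ a1)) :* ((l :* x :+ v) :- (l′ :* x :+ v′))) ≡.refl)
            (_ · line-tangent L ⊕ _ · line-tangent L′ ⊕ _ · h)))

    slope-unique : ∀ {l v l′ v′ x₁ x₂ x₃ x₃′} → Line l v x₁ x₂ x₃ → Line l′ v′ x₁ x₂ x₃′ →
      l * x₁ + v ≈ l′ * x₁ + v′ → l * x₂ + v ≈ l′ * x₂ + v′ →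
      ¬ (x₁ ≈ x₂ × (l * x₁ + v) + (l * x₂ + v) + a1 * x₂ + a3 ≈ 0#) →
      (¬ (x₁ ≈ x₂) ⊎ (x₁ ≡.≡ x₂)) → l ≈ l′
    slope-unique L L′ h₁ h₂ nopp (inj₁ ne) = slope-chord h₁ h₂ ne
    slope-unique L L′ h₁ h₂ nopp (inj₂ ≡.refl) = slope-tangent L L′ h₁ (λ e → nopp (refl , e))

  -- the points (x₁ , l x₁ + v) and (x₂ , l x₂ + v) determine the line unless they are opposite
  line-unique : ∀ {l v l′ v′ x₁ x₂ x₃ x₃′} → Line l v x₁ x₂ x₃ → Line l′ v′ x₁ x₂ x₃′ →
    l * x₁ + v ≈ l′ * x₁ + v′ → l * x₂ + v ≈ l′ * x₂ + v′ →
    ¬ (x₁ ≈ x₂ × (l * x₁ + v) + (l * x₂ + v) + a1 * x₂ + a3 ≈ 0#) →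
    (¬ (x₁ ≈ x₂) ⊎ (x₁ ≡.≡ x₂)) →
    l ≈ l′ × v ≈ v′ × x₃ ≈ x₃′
  line-unique {l} {v} {l′} {v′} {x₁} {x₂} {x₃} {x₃′} L L′ h₁ h₂ nopp dec = l≈ , v≈ , x≈
    where
    l≈ : l ≈ l′
    l≈ = slope-unique L L′ h₁ h₂ nopp dec
    v≈ : v ≈ v′
    v≈ = comb (solve (l ∷ v ∷ l′ ∷ v′ ∷ x₁ ∷ []) (λ l v l′ v′ x → v :- v′ := con (+ 1) :* ((l :* x :+ v) :- (l′ :* x :+ v′)) :+ (:- x) :* (l :- l′)) ≡.refl)
      (_ · h₁ ⊕ _ · l≈)
    x≈ : x₃ ≈ x₃′
    x≈ = comb (solve (l ∷ l′ ∷ x₁ ∷ x₂ ∷ x₃ ∷ x₃′ ∷ a1 ∷ a2 ∷ []) (λ l l′ x₁ x₂ x₃ x₃′ a1 a2 →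
            x₃ :- x₃′ := con (+ 1) :* ((x₁ :+ x₂ :+ x₃) :- (l :* l :+ a1 :* l :- a2)) :+ (:- con (+ 1)) :* ((x₁ :+ x₂ :+ x₃′) :- (l′ :* l′ :+ a1 :* l′ :- a2))
              :+ (l :+ l′ :+ a1) :* (l :- l′)) ≡.refl)
      (_ · Line.e₁ L ⊕ _ · Line.e₁ L′ ⊕ _ · l≈)

  -- Two lines through T and -T multiply, on the curve, to (x - x_T) f with f = x² + α x + β - κ y.
  private
    κ : Carrier → Carrier → Carrier
    κ l l′ = a1 + l + l′
    α : Carrier → Carrier → Carrier → Carrier
    α l l′ t = a2 + l * l′ + t
    β : Carrier → Carrier → Carrier → Carrier → Carrier → Carrier
    β l v l′ v′ t = a4 + l * v′ + l′ * v + t * α l l′ t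

    f-on-line : ∀ {l v l′ v′ x₁ x₂ t} → Line l v x₁ x₂ t → κ l l′ * t + (a3 + v + v′) ≈ 0# → ∀ x →
      x * x + α l l′ t * x + β l v l′ v′ t - κ l l′ * (l * x + v) ≈ (x - x₁) * (x - x₂)
    f-on-line {l} {v} {l′} {v′} {x₁} {x₂} {t} (line e₁ e₂ _) h x = comb
      (solve (l ∷ v ∷ l′ ∷ v′ ∷ x₁ ∷ x₂ ∷ t ∷ x ∷ a1 ∷ a2 ∷ a3 ∷ a4 ∷ [])
        (λ l v l′ v′ x₁ x₂ t x a1 a2 a3 a4 →
          let K = a1 :+ l :+ l′
              A = a2 :+ l :* l′ :+ t
              B = a4 :+ l :* v′ :+ l′ :* v :+ t :* A in
          x :* x :+ A :* x :+ B :- K :* (l :* x :+ v) :- (x :- x₁) :* (x :- x₂) :=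
          (x :+ t) :* ((x₁ :+ x₂ :+ t) :- (l :* l :+ a1 :* l :- a2))
          :+ (:- con (+ 1)) :* ((x₁ :* x₂ :+ x₁ :* t :+ x₂ :* t) :- (a4 :- con (+ 2) :* l :* v :- a1 :* v :- a3 :* l))
          :+ l :* ((K :* t :+ (a3 :+ v :+ v′)) :- con (+ 0)))
        ≡.refl)
      (_ · e₁ ⊕ _ · e₂ ⊕ _ · h)

    -- two functions of the shape of f agreeing at three non-collinear points coincide
    f-unique : ∀ {κ α β κ′ α′ β′ xA yA xB yB xC yC} →
      xA * xA + α * xA + β ≈ κ * yA → xA * xA + α′ * xA + β′ ≈ κ′ * yA →
      xB * xB + α * xB + β ≈ κ * yB → xB * xB + α′ * xB + β′ ≈ κ′ * yB →
      xC * xC + α * xC + β ≈ κ * yC → xC * xC + α′ * xC + β′ ≈ κ′ * yC →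
      ¬ (xA ≈ xB) → ¬ ((yB - yA) * (xC - xA) - (yC - yA) * (xB - xA) ≈ 0#) →
      κ ≈ κ′ × α ≈ α′ × β ≈ β′
    f-unique {κ} {α} {β} {κ′} {α′} {β′} {xA} {yA} {xB} {yB} {xC} {yC} A A′ B B′ C C′ ne nc = κ≈ , α≈ , β≈
      where
      κ≈ : κ ≈ κ′
      κ≈ = [ x-y≈0⇒x≈y , (λ e → ⊥-elim (nc e)) ]′ (dom (κ - κ′) ((yB - yA) * (xC - xA) - (yC - yA) * (xB - xA)) (comb
           (solve (κ ∷ α ∷ β ∷ κ′ ∷ α′ ∷ β′ ∷ xA ∷ yA ∷ xB ∷ yB ∷ xC ∷ yC ∷ [])
             (λ κ α β κ′ α′ β′ xA yA xB yB xC yC →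
               (κ :- κ′) :* ((yB :- yA) :* (xC :- xA) :- (yC :- yA) :* (xB :- xA)) :- con (+ 0) :=
               (xC :- xB) :* ((xA :* xA :+ α :* xA :+ β) :- κ :* yA) :+ (xB :- xC) :* ((xA :* xA :+ α′ :* xA :+ β′) :- κ′ :* yA)
               :+ (xA :- xC) :* ((xB :* xB :+ α :* xB :+ β) :- κ :* yB) :+ (xC :- xA) :* ((xB :* xB :+ α′ :* xB :+ β′) :- κ′ :* yB)
               :+ (xB :- xA) :* ((xC :* xC :+ α :* xC :+ β) :- κ :* yC) :+ (xA :- xB) :* ((xC :* xC :+ α′ :* xC :+ β′) :- κ′ :* yC))
             ≡.refl)
           (_ · A ⊕ _ · A′ ⊕ _ · B ⊕ _ · B′ ⊕ _ · C ⊕ _ · C′)))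
      α≈ : α ≈ α′
      α≈ = x-y≈0⇒x≈y (cancel ne (comb
         (solve (κ ∷ α ∷ β ∷ κ′ ∷ α′ ∷ β′ ∷ xA ∷ yA ∷ xB ∷ yB ∷ [])
             (λ κ α β κ′ α′ β′ xA yA xB yB →
               (xA :- xB) :* (α :- α′) :- con (+ 0) :=
               con (+ 1) :* ((xA :* xA :+ α :* xA :+ β) :- κ :* yA) :+ (:- con (+ 1)) :* ((xA :* xA :+ α′ :* xA :+ β′) :- κ′ :* yA)
               :+ (:- con (+ 1)) :* ((xB :* xB :+ α :* xB :+ β) :- κ :* yB) :+ con (+ 1) :* ((xB :* xB :+ α′ :* xB :+ β′) :- κ′ :* yB)
               :+ (yA :- yB) :* (κ :- κ′))
             ≡.refl)
         (_ · A ⊕ _ · A′ ⊕ _ · B ⊕ _ · B′ ⊕ _ · κ≈)))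
      β≈ : β ≈ β′
      β≈ = comb (solve (κ ∷ α ∷ β ∷ κ′ ∷ α′ ∷ β′ ∷ xA ∷ yA ∷ [])
             (λ κ α β κ′ α′ β′ xA yA → β :- β′ :=
               con (+ 1) :* ((xA :* xA :+ α :* xA :+ β) :- κ :* yA) :+ (:- con (+ 1)) :* ((xA :* xA :+ α′ :* xA :+ β′) :- κ′ :* yA)
               :+ yA :* (κ :- κ′) :+ (:- xA) :* (α :- α′)) ≡.refl)
         (_ · A ⊕ _ · A′ ⊕ _ · κ≈ ⊕ _ · α≈)

    root : ∀ {κ α β x y x₁ x₂} → x * x + α * x + β - κ * y ≈ (x - x₁) * (x - x₂) → (x - x₁) * (x - x₂) ≈ 0# →
      x * x + α * x + β ≈ κ * y
    root h k = x-y≈0⇒x≈y (trans h k)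

    zero₁ : ∀ x z → (x - x) * z ≈ 0#
    zero₁ x z = trans (*-congʳ (-‿inverseʳ x)) (zeroˡ z)

    zero₂ : ∀ x z → z * (x - x) ≈ 0#
    zero₂ x z = trans (*-congˡ (-‿inverseʳ x)) (zeroʳ z)

  module _ {l₁ v₁ l₂ v₂ m₁ w₁ m₂ w₂ xA xB xC xT xS xT′ xS′ : Carrier}
    (L₁ : Line l₁ v₁ xA xB xT) (L₂ : Line l₂ v₂ xT xC xS)
    (M₁ : Line m₁ w₁ xB xC xT′) (M₂ : Line m₂ w₂ xA xT′ xS′)
    (hT : (a1 + l₁ + l₂) * xT + (a3 + v₁ + v₂) ≈ 0#)
    (hT′ : (a1 + m₁ + m₂) * xT′ + (a3 + w₁ + w₂) ≈ 0#)
    (hA : l₁ * xA + v₁ ≈ m₂ * xA + w₂)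
    (hB : l₁ * xB + v₁ ≈ m₁ * xB + w₁)
    (hC : l₂ * xC + v₂ ≈ m₁ * xC + w₁)
    (A≉B : ¬ (xA ≈ xB)) (A≉C : ¬ (xA ≈ xC)) (B≉C : ¬ (xB ≈ xC))
    (C≉-T : ¬ (xC ≈ xT × l₂ * xC + v₂ ≈ l₁ * xC + v₁))
    where

    private
      yA yB yC κ₁ κ₂ α₁ α₂ β₁ β₂ : Carrier
      yA = l₁ * xA + v₁
      yB = l₁ * xB + v₁
      yC = l₂ * xC + v₂
      κ₁ = κ l₁ l₂
      α₁ = α l₁ l₂ xT
      β₁ = β l₁ v₁ l₂ v₂ xT
      κ₂ = κ m₂ m₁
      α₂ = α m₂ m₁ xT′
      β₂ = β m₂ w₂ m₁ w₁ xT′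
      hT₂ : κ l₂ l₁ * xT + (a3 + v₂ + v₁) ≈ 0#
      hT₂ = trans (solve (a1 ∷ l₁ ∷ l₂ ∷ xT ∷ a3 ∷ v₁ ∷ v₂ ∷ []) (λ a1 l₁ l₂ xT a3 v₁ v₂ → (a1 :+ l₂ :+ l₁) :* xT :+ (a3 :+ v₂ :+ v₁) := (a1 :+ l₁ :+ l₂) :* xT :+ (a3 :+ v₁ :+ v₂)) ≡.refl) hT
      hT′₂ : κ m₂ m₁ * xT′ + (a3 + w₂ + w₁) ≈ 0#
      hT′₂ = trans (solve (a1 ∷ m₁ ∷ m₂ ∷ xT′ ∷ a3 ∷ w₁ ∷ w₂ ∷ []) (λ a1 l₁ l₂ xT a3 v₁ v₂ → (a1 :+ l₂ :+ l₁) :* xT :+ (a3 :+ v₂ :+ v₁) := (a1 :+ l₁ :+ l₂) :* xT :+ (a3 :+ v₁ :+ v₂)) ≡.refl) hT′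
      flip : ∀ {l v l′ v′ t x z} →
        x * x + α l l′ t * x + β l v l′ v′ t - κ l l′ * (l * x + v) ≈ z →
        x * x + α l′ l t * x + β l′ v′ l v t - κ l′ l * (l * x + v) ≈ z
      flip {l} {v} {l′} {v′} {t} {x} h = trans (solve (l ∷ v ∷ l′ ∷ v′ ∷ t ∷ x ∷ a1 ∷ a2 ∷ a4 ∷ [])
        (λ l v l′ v′ t x a1 a2 a4 →
           x :* x :+ (a2 :+ l′ :* l :+ t) :* x :+ (a4 :+ l′ :* v :+ l :* v′ :+ t :* (a2 :+ l′ :* l :+ t)) :- (a1 :+ l′ :+ l) :* (l :* x :+ v) :=
           x :* x :+ (a2 :+ l :* l′ :+ t) :* x :+ (a4 :+ l :* v′ :+ l′ :* v :+ t :* (a2 :+ l :* l′ :+ t)) :- (a1 :+ l :+ l′) :* (l :* x :+ v)) ≡.refl) h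

      L₂′ : Line l₂ v₂ xC xS xT
      L₂′ = line-rotate L₂
      M₂′ : Line m₂ w₂ xA xS′ xT′
      M₂′ = line-swap (line-rotate (line-rotate M₂))

      A₁ : xA * xA + α₁ * xA + β₁ ≈ κ₁ * yA
      A₁ = root (f-on-line L₁ hT xA) (zero₁ xA _)
      B₁ : xB * xB + α₁ * xB + β₁ ≈ κ₁ * yB
      B₁ = root (f-on-line L₁ hT xB) (zero₂ xB _)
      C₁ : xC * xC + α₁ * xC + β₁ ≈ κ₁ * yC
      C₁ = root (flip (f-on-line L₂′ hT₂ xC)) (zero₁ xC _)
      S₁ : xS * xS + α₁ * xS + β₁ ≈ κ₁ * (l₂ * xS + v₂)
      S₁ = root (flip (f-on-line L₂′ hT₂ xS)) (zero₂ xS _)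
      A₂ : xA * xA + α₂ * xA + β₂ ≈ κ₂ * yA
      A₂ = trans (root (f-on-line M₂′ hT′₂ xA) (zero₁ xA _)) (*-congˡ (sym hA))
      S₂ : xS′ * xS′ + α₂ * xS′ + β₂ ≈ κ₂ * (m₂ * xS′ + w₂)
      S₂ = root (f-on-line M₂′ hT′₂ xS′) (zero₂ xS′ _)
      B₂ : xB * xB + α₂ * xB + β₂ ≈ κ₂ * yB
      B₂ = trans (root (flip (f-on-line M₁ hT′ xB)) (zero₁ xB _)) (*-congˡ (sym hB))
      C₂ : xC * xC + α₂ * xC + β₂ ≈ κ₂ * yC
      C₂ = trans (root (flip (f-on-line M₁ hT′ xC)) (zero₂ xC _)) (*-congˡ (sym hC))

      -- If C lay on the line AB, it would be one of the three points of the curve on that line;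
      -- being over neither A nor B it would be -T, which is excluded.
      noncollinear : ¬ ((yB - yA) * (xC - xA) - (yC - yA) * (xB - xA) ≈ 0#)
      noncollinear h = C≉-T (x-y≈0⇒x≈y xC-xT , yC≈)
        where
        yC≈ : yC ≈ l₁ * xC + v₁
        yC≈ = sym (x-y≈0⇒x≈y (cancel (λ e → A≉B (sym e)) (trans
          (solve (l₁ ∷ v₁ ∷ xA ∷ xB ∷ xC ∷ yC ∷ []) (λ l v xA xB xC yC →
             (xB :- xA) :* ((l :* xC :+ v) :- yC) :=
             ((l :* xB :+ v) :- (l :* xA :+ v)) :* (xC :- xA) :- (yC :- (l :* xA :+ v)) :* (xB :- xA)) ≡.refl) h)))
        xC-xT : xC - xT ≈ 0#
        xC-xT = cancel (λ e → B≉C (sym e)) (cancel (λ e → A≉C (sym e))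
          (trans (sym (line-g L₁ xC)) (trans (g-cong refl (sym yC≈)) (line-on L₂′))))

      uniq : κ₁ ≈ κ₂ × α₁ ≈ α₂ × β₁ ≈ β₂
      uniq = f-unique A₁ A₂ B₁ B₂ C₁ C₂ A≉B noncollinear

      κ≈ : κ₁ ≈ κ₂
      κ≈ = proj₁ uniq
      α≈ : α₁ ≈ α₂
      α≈ = proj₁ (proj₂ uniq)

      sumS : ∀ {l v l′ v′ t x₁ x₂ x₃ x₄} → Line l v x₁ x₂ t → Line l′ v′ x₃ x₄ t →
        x₁ + x₂ + x₃ + x₄ ≈ κ l l′ * (κ l l′ - a1) - 2# * α l l′ t
      sumS {l} {v} {l′} {v′} {t} {x₁} {x₂} {x₃} {x₄} L L′ = comb
        (solve (l ∷ l′ ∷ t ∷ x₁ ∷ x₂ ∷ x₃ ∷ x₄ ∷ a1 ∷ a2 ∷ []) (λ l l′ t x₁ x₂ x₃ x₄ a1 a2 →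
           x₁ :+ x₂ :+ x₃ :+ x₄ :- ((a1 :+ l :+ l′) :* ((a1 :+ l :+ l′) :- a1) :- con (+ 2) :* (a2 :+ l :* l′ :+ t)) :=
           con (+ 1) :* (x₁ :+ x₂ :+ t :- (l :* l :+ a1 :* l :- a2)) :+ con (+ 1) :* (x₃ :+ x₄ :+ t :- (l′ :* l′ :+ a1 :* l′ :- a2))) ≡.refl)
        (_ · Line.e₁ L ⊕ _ · Line.e₁ L′)

    -- The four zeros of f on the curve have abscissas with sum κ(κ - a1) - 2α. Both groupings of A
    -- + B + C produce an f that vanishes at A, B and C, hence the same f, and so the same fourth
    -- abscissa.
    assoc-x : xS ≈ xS′
    assoc-x = comb (solve (xA ∷ xB ∷ xC ∷ xS ∷ xS′ ∷ κ₁ ∷ κ₂ ∷ α₁ ∷ α₂ ∷ a1 ∷ [])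
       (λ xA xB xC xS xS′ κ₁ κ₂ α₁ α₂ a1 → xS :- xS′ :=
         con (+ 1) :* (xA :+ xB :+ xC :+ xS :- (κ₁ :* (κ₁ :- a1) :- con (+ 2) :* α₁))
         :+ (:- con (+ 1)) :* (xA :+ xS′ :+ xB :+ xC :- (κ₂ :* (κ₂ :- a1) :- con (+ 2) :* α₂))
         :+ (κ₁ :+ κ₂ :- a1) :* (κ₁ :- κ₂) :+ (:- con (+ 2)) :* (α₁ :- α₂)) ≡.refl)
       (_ · sumS L₁ L₂′ ⊕ _ · sumS M₂′ M₁ ⊕ _ · κ≈ ⊕ _ · α≈)

    -- The equation f = 0 determines the ordinate as long as κ ≠ 0. If κ = 0, then f is a quadratic
    -- in x alone with roots x_A, x_B and also x_A, x_C, which contradicts x_B ≠ x_C.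
    assoc-y : l₂ * xS + v₂ ≈ m₂ * xS′ + w₂
    assoc-y = [ degenerate , x-y≈0⇒x≈y ]′ (dom κ₁ ((l₂ * xS + v₂) - (m₂ * xS′ + w₂)) (comb
      (solve (κ₁ ∷ α₁ ∷ β₁ ∷ κ₂ ∷ α₂ ∷ β₂ ∷ xS ∷ xS′ ∷ (l₂ * xS + v₂) ∷ (m₂ * xS′ + w₂) ∷ [])
        (λ κ₁ α₁ β₁ κ₂ α₂ β₂ xS xS′ yS yS′ → κ₁ :* (yS :- yS′) :- con (+ 0) :=
          (:- con (+ 1)) :* (xS :* xS :+ α₁ :* xS :+ β₁ :- κ₁ :* yS) :+ con (+ 1) :* (xS′ :* xS′ :+ α₂ :* xS′ :+ β₂ :- κ₂ :* yS′)
          :+ (xS :+ xS′ :+ α₁) :* (xS :- xS′) :+ xS′ :* (α₁ :- α₂) :+ con (+ 1) :* (β₁ :- β₂) :+ (:- yS′) :* (κ₁ :- κ₂)) ≡.refl)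
      (_ · S₁ ⊕ _ · S₂ ⊕ _ · assoc-x ⊕ _ · α≈ ⊕ _ · proj₂ (proj₂ uniq) ⊕ _ · κ≈)))
      where
      vieta : κ₁ ≈ 0# → ∀ {x y} → ¬ (xA ≈ x) → x * x + α₁ * x + β₁ ≈ κ₁ * y → xA + x + α₁ ≈ 0#
      vieta κ≈0 {x} {y} ne h = cancel ne (comb
        (solve (xA ∷ x ∷ yA ∷ y ∷ κ₁ ∷ α₁ ∷ β₁ ∷ []) (λ xA x yA y κ α β → (xA :- x) :* (xA :+ x :+ α) :- con (+ 0) :=
          con (+ 1) :* (xA :* xA :+ α :* xA :+ β :- κ :* yA) :+ (:- con (+ 1)) :* (x :* x :+ α :* x :+ β :- κ :* y) :+ (yA :- y) :* (κ :- con (+ 0))) ≡.refl)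
        (_ · A₁ ⊕ _ · h ⊕ _ · κ≈0))
      degenerate : κ₁ ≈ 0# → l₂ * xS + v₂ ≈ m₂ * xS′ + w₂
      degenerate κ≈0 = ⊥-elim (B≉C (x-y≈0⇒x≈y (comb
        (solve (xA ∷ xB ∷ xC ∷ α₁ ∷ []) (λ xA xB xC α → (xB :- xC) :- con (+ 0) := con (+ 1) :* ((xA :+ xB :+ α) :- con (+ 0)) :+ (:- con (+ 1)) :* ((xA :+ xC :+ α) :- con (+ 0))) ≡.refl)
        (_ · vieta κ≈0 A≉B B₁ ⊕ _ · vieta κ≈0 A≉C C₁))))

  chord-y : ∀ {l v x₁ y₁ x₂ y₂} → ¬ (x₁ ≈ x₂) → l * (x₂ - x₁) ≈ y₂ - y₁ → v * (x₂ - x₁) ≈ y₁ * x₂ - y₂ * x₁ →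
    y₁ ≈ l * x₁ + v × y₂ ≈ l * x₂ + v
  chord-y {l} {v} {x₁} {y₁} {x₂} {y₂} ne hl hv =
    x-y≈0⇒x≈y (cancel ne′ (comb (solve (l ∷ v ∷ x₁ ∷ y₁ ∷ x₂ ∷ y₂ ∷ []) (λ l v x₁ y₁ x₂ y₂ →
      (x₂ :- x₁) :* (y₁ :- (l :* x₁ :+ v)) :- con (+ 0) :=
      (:- x₁) :* (l :* (x₂ :- x₁) :- (y₂ :- y₁)) :+ (:- con (+ 1)) :* (v :* (x₂ :- x₁) :- (y₁ :* x₂ :- y₂ :* x₁))) ≡.refl)
      (_ · hl ⊕ _ · hv))) ,
    x-y≈0⇒x≈y (cancel ne′ (comb (solve (l ∷ v ∷ x₁ ∷ y₁ ∷ x₂ ∷ y₂ ∷ []) (λ l v x₁ y₁ x₂ y₂ →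
      (x₂ :- x₁) :* (y₂ :- (l :* x₂ :+ v)) :- con (+ 0) :=
      (:- x₂) :* (l :* (x₂ :- x₁) :- (y₂ :- y₁)) :+ (:- con (+ 1)) :* (v :* (x₂ :- x₁) :- (y₁ :* x₂ :- y₂ :* x₁))) ≡.refl)
      (_ · hl ⊕ _ · hv)))
    where ne′ = λ e → ne (sym e)

  tangent-y : ∀ {l v x y} → g x y ≈ 0# → ¬ (2# * y + a1 * x + a3 ≈ 0#) →
    l * (2# * y + a1 * x + a3) ≈ 3# * x * x + 2# * a2 * x + a4 - a1 * y →
    v * (2# * y + a1 * x + a3) ≈ - (x * x * x) + a4 * x + 2# * a6 - a3 * y → y ≈ l * x + v
  tangent-y {l} {v} {x} {y} on ne hl hv = x-y≈0⇒x≈y ([ (λ e → ⊥-elim (ne e)) , (λ e → e) ]′ (dom _ _ (comb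
    (solve (l ∷ v ∷ x ∷ y ∷ a1 ∷ a2 ∷ a3 ∷ a4 ∷ a6 ∷ []) (λ l v x y a1 a2 a3 a4 a6 →
      let d = con (+ 2) :* y :+ a1 :* x :+ a3 in
      d :* (y :- (l :* x :+ v)) :- con (+ 0) :=
      (:- x) :* (l :* d :- (con (+ 3) :* x :* x :+ con (+ 2) :* a2 :* x :+ a4 :- a1 :* y))
      :+ (:- con (+ 1)) :* (v :* d :- (:- (x :* x :* x) :+ a4 :* x :+ con (+ 2) :* a6 :- a3 :* y))
      :+ (:- con (+ 2)) :* ((x :* x :* x :+ a2 :* x :* x :+ a4 :* x :+ a6 :- y :* y :- (a1 :* x :+ a3) :* y) :- con (+ 0))) ≡.refl)
    (_ · hl ⊕ _ · hv ⊕ _ · on))))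

  same-x : ∀ {x y₁ y₂} → g x y₁ ≈ 0# → g x y₂ ≈ 0# → y₁ ≈ y₂ ⊎ y₁ + y₂ + a1 * x + a3 ≈ 0#
  same-x {x} {y₁} {y₂} h₁ h₂ = [ (λ e → inj₁ (x-y≈0⇒x≈y e)) , inj₂ ]′ (dom (y₁ - y₂) (y₁ + y₂ + a1 * x + a3) (comb
    (solve (x ∷ y₁ ∷ y₂ ∷ a1 ∷ a2 ∷ a3 ∷ a4 ∷ a6 ∷ []) (λ x y₁ y₂ a1 a2 a3 a4 a6 →
      let gg = λ y → x :* x :* x :+ a2 :* x :* x :+ a4 :* x :+ a6 :- y :* y :- (a1 :* x :+ a3) :* y in
      (y₁ :- y₂) :* (y₁ :+ y₂ :+ a1 :* x :+ a3) :- con (+ 0) := con (+ 1) :* (gg y₂ :- con (+ 0)) :+ (:- con (+ 1)) :* (gg y₁ :- con (+ 0))) ≡.refl)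
    (_ · h₂ ⊕ _ · h₁)))

  -- In terms of these, x(A+B) and x(A-B) are the roots of (x_A - x_B)² X² - S X + Π.
  b2 b4 b6 b8 : Carrier
  b2 = a1 * a1 + 4# * a2
  b4 = 2# * a4 + a1 * a3
  b6 = a3 * a3 + 4# * a6
  b8 = a1 * a1 * a6 + 4# * a2 * a6 - a1 * a3 * a4 + a2 * a3 * a3 - a4 * a4

  S Π : Carrier → Carrier → Carrier
  S x z = 2# * x * z * (x + z) + b2 * x * z + b4 * (x + z) + b6
  Π x z = x * x * z * z - b4 * x * z - b6 * (x + z) - b8

  module _ {l v m w x y x′ y′ x₊ x₋ : Carrier} (on : g x y ≈ 0#) (on′ : g x′ y′ ≈ 0#)
    (L : Line l v x x′ x₊) (M : Line m w x x′ x₋)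
    (hl : y ≈ l * x + v) (hl′ : y′ ≈ l * x′ + v)
    (hm : y ≈ m * x + w) (hm′ : - y′ - a1 * x′ - a3 ≈ m * x′ + w) where

    private
      h N₊ N₋ : Carrier
      h = x - x′
      N₊ = (y - y′) * (y - y′) + a1 * h * (y - y′) - h * h * (a2 + x + x′)
      N₋ = (y + y′ + a1 * x′ + a3) * (y + y′ + a1 * x′ + a3) + a1 * h * (y + y′ + a1 * x′ + a3) - h * h * (a2 + x + x′)

      step : ∀ {l v x₊ u} → Line l v x x′ x₊ → y ≈ l * x + v → u ≈ l * x′ + v →
        h * h * x₊ ≈ (y - u) * (y - u) + a1 * h * (y - u) - h * h * (a2 + x + x′)
      step {l} {v} {x₊} {u} L hl hu = comb
        (solve (l ∷ v ∷ x ∷ x′ ∷ x₊ ∷ y ∷ u ∷ a1 ∷ a2 ∷ []) (λ l v x x′ x₊ y u a1 a2 → let h = x :- x′ in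
           h :* h :* x₊ :- ((y :- u) :* (y :- u) :+ a1 :* h :* (y :- u) :- h :* h :* (a2 :+ x :+ x′)) :=
           (h :* h) :* ((x :+ x′ :+ x₊) :- (l :* l :+ a1 :* l :- a2))
           :+ (:- (l :* h :+ (y :- u) :+ a1 :* h)) :* (y :- (l :* x :+ v))
           :+ (l :* h :+ (y :- u) :+ a1 :* h) :* (u :- (l :* x′ :+ v))) ≡.refl)
        (_ · Line.e₁ L ⊕ _ · hl ⊕ _ · hu)

      N₊≈ : h * h * x₊ ≈ N₊
      N₊≈ = step L hl hl′

      N₋≈ : h * h * x₋ ≈ N₋
      N₋≈ = trans (step M hm hm′) (solve (x ∷ x′ ∷ y ∷ y′ ∷ a1 ∷ a2 ∷ a3 ∷ []) (λ x x′ y y′ a1 a2 a3 →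
        let h = x :- x′
            u = :- y′ :- a1 :* x′ :- a3
            u′ = y :+ y′ :+ a1 :* x′ :+ a3 in
        (y :- u) :* (y :- u) :+ a1 :* h :* (y :- u) :- h :* h :* (a2 :+ x :+ x′) :=
        u′ :* u′ :+ a1 :* h :* u′ :- h :* h :* (a2 :+ x :+ x′)) ≡.refl)

    x-sum : h * h * (x₊ + x₋) ≈ S x x′
    x-sum = trans (distribˡ _ _ _) (trans (+-cong N₊≈ N₋≈) (comb
      (solve (x ∷ x′ ∷ y ∷ y′ ∷ a1 ∷ a2 ∷ a3 ∷ a4 ∷ a6 ∷ []) (λ x x′ y y′ a1 a2 a3 a4 a6 →
        let h = x :- x′
            u = y :+ y′ :+ a1 :* x′ :+ a3
            N₊ = (y :- y′) :* (y :- y′) :+ a1 :* h :* (y :- y′) :- h :* h :* (a2 :+ x :+ x′)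
            N₋ = u :* u :+ a1 :* h :* u :- h :* h :* (a2 :+ x :+ x′)
            B2 = a1 :* a1 :+ con (+ 4) :* a2
            B4 = con (+ 2) :* a4 :+ a1 :* a3
            B6 = a3 :* a3 :+ con (+ 4) :* a6
            SS = con (+ 2) :* x :* x′ :* (x :+ x′) :+ B2 :* x :* x′ :+ B4 :* (x :+ x′) :+ B6
            gg = λ x y → x :* x :* x :+ a2 :* x :* x :+ a4 :* x :+ a6 :- y :* y :- (a1 :* x :+ a3) :* y in
        N₊ :+ N₋ :- SS := (:- con (+ 2)) :* (gg x y :- con (+ 0)) :+ (:- con (+ 2)) :* (gg x′ y′ :- con (+ 0))) ≡.refl)
      (_ · on ⊕ _ · on′)))

    -- On the curve the product of the numerators `N₊` and `N₋` is (x - x′)² Π. The identity is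
    -- therefore reached only after multiplication by (x - x′)², which is then cancelled.
    x-prod : ¬ (x ≈ x′) → h * h * (x₊ * x₋) ≈ Π x x′
    x-prod ne = x-y≈0⇒x≈y (cancel ne (cancel ne (comb
      (trans (solve (x ∷ x′ ∷ x₊ ∷ x₋ ∷ Π x x′ ∷ []) (λ x x′ x₊ x₋ p → let h = x :- x′ in
          (h :* (h :* (h :* h :* (x₊ :* x₋) :- p))) :- con (+ 0) := (h :* h :* x₊) :* (h :* h :* x₋) :- h :* h :* p) ≡.refl)
       (trans (+-congʳ (*-cong N₊≈ N₋≈))
      (solve (x ∷ x′ ∷ y ∷ y′ ∷ a1 ∷ a2 ∷ a3 ∷ a4 ∷ a6 ∷ []) (λ x x′ y y′ a1 a2 a3 a4 a6 →
        let h = x :- x′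
            u = y :+ y′ :+ a1 :* x′ :+ a3
            N₊ = (y :- y′) :* (y :- y′) :+ a1 :* h :* (y :- y′) :- h :* h :* (a2 :+ x :+ x′)
            N₋ = u :* u :+ a1 :* h :* u :- h :* h :* (a2 :+ x :+ x′)
            B2 = a1 :* a1 :+ con (+ 4) :* a2
            B4 = con (+ 2) :* a4 :+ a1 :* a3
            B6 = a3 :* a3 :+ con (+ 4) :* a6
            B8 = a1 :* a1 :* a6 :+ con (+ 4) :* a2 :* a6 :- a1 :* a3 :* a4 :+ a2 :* a3 :* a3 :- a4 :* a4
            SS = con (+ 2) :* x :* x′ :* (x :+ x′) :+ B2 :* x :* x′ :+ B4 :* (x :+ x′) :+ B6
            P = x :* x :* x′ :* x′ :- B4 :* x :* x′ :- B6 :* (x :+ x′) :- B8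
            f = λ x → con (+ 4) :* x :* x :* x :+ B2 :* x :* x :+ con (+ 2) :* B4 :* x :+ B6
            gg = λ x y → x :* x :* x :+ a2 :* x :* x :+ a4 :* x :+ a6 :- y :* y :- (a1 :* x :+ a3) :* y in
        N₊ :* N₋ :- h :* h :* P :=
          (:- SS :+ f x′ :+ gg x y :- con (+ 2) :* gg x′ y′) :* (gg x y :- con (+ 0))
          :+ (:- SS :+ f x :+ gg x′ y′) :* (gg x′ y′ :- con (+ 0))) ≡.refl)))
      (_ · on ⊕ _ · on′))))

  -- On the curve `S x x` is the square of 2y + a1 x + a3, the denominator in the slope of the
  -- tangent.
  x-double : ∀ {l v x y x₂} → g x y ≈ 0# → Line l v x x x₂ → y ≈ l * x + v → S x x * x₂ ≈ Π x x
  x-double {l} {v} {x} {y} {x₂} on L hl = comb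
    (solve (l ∷ v ∷ x ∷ y ∷ x₂ ∷ a1 ∷ a2 ∷ a3 ∷ a4 ∷ a6 ∷ []) (λ l v x y x₂ a1 a2 a3 a4 a6 →
        let B2 = a1 :* a1 :+ con (+ 4) :* a2
            B4 = con (+ 2) :* a4 :+ a1 :* a3
            B6 = a3 :* a3 :+ con (+ 4) :* a6
            B8 = a1 :* a1 :* a6 :+ con (+ 4) :* a2 :* a6 :- a1 :* a3 :* a4 :+ a2 :* a3 :* a3 :- a4 :* a4
            SS = con (+ 2) :* x :* x :* (x :+ x) :+ B2 :* x :* x :+ B4 :* (x :+ x) :+ B6
            P = x :* x :* x :* x :- B4 :* x :* x :- B6 :* (x :+ x) :- B8
            gg = x :* x :* x :+ a2 :* x :* x :+ a4 :* x :+ a6 :- y :* y :- (a1 :* x :+ a3) :* y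
            η = con (+ 2) :* y :+ a1 :* x :+ a3
            t = con (+ 3) :* x :* x :+ con (+ 2) :* a2 :* x :+ a4 :- a1 :* y in
        SS :* x₂ :- P := (con (+ 4) :* x₂ :+ (a1 :* a1 :+ con (+ 4) :* a2 :+ con (+ 8) :* x)) :* (gg :- con (+ 0))
          :+ (η :* η) :* ((x :+ x :+ x₂) :- (l :* l :+ a1 :* l :- a2))
          :+ (l :* η :+ t :+ a1 :* η) :* (l :* η :- t)) ≡.refl)
    (_ · on ⊕ _ · Line.e₁ L ⊕ _ · tangent)
    where
    tangent : l * (2# * y + a1 * x + a3) ≈ 3# * x * x + 2# * a2 * x + a4 - a1 * y
    tangent = trans (*-congˡ (+-congʳ (+-congʳ (*-congˡ hl)))) (trans (line-tangent L) (+-congˡ (-‿cong (*-congˡ (sym hl)))))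

  opposite-y : ∀ {x y y′} → y + y′ + a1 * x + a3 ≈ 0# → y′ ≈ - y - a1 * x - a3
  opposite-y {x} {y} {y′} h = comb
    (solve (x ∷ y ∷ y′ ∷ a1 ∷ a3 ∷ []) (λ x y y′ a1 a3 → y′ :- (:- y :- a1 :* x :- a3) := con (+ 1) :* ((y :+ y′ :+ a1 :* x :+ a3) :- con (+ 0))) ≡.refl)
    (_ · h)

  opposite-lines : ∀ {l v m w x y} → - y - a1 * x - a3 ≈ l * x + v → y ≈ m * x + w → (a1 + l + m) * x + (a3 + v + w) ≈ 0#
  opposite-lines {l} {v} {m} {w} {x} {y} h k = comb
    (solve (l ∷ v ∷ m ∷ w ∷ x ∷ y ∷ a1 ∷ a3 ∷ []) (λ l v m w x y a1 a3 →
      (a1 :+ l :+ m) :* x :+ (a3 :+ v :+ w) :- con (+ 0) := (:- con (+ 1)) :* ((:- y :- a1 :* x :- a3) :- (l :* x :+ v)) :+ (:- con (+ 1)) :* (y :- (m :* x :+ w))) ≡.refl)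
    (_ · h ⊕ _ · k)

  weierstrass-g : ∀ {x y} → y * y + a1 * x * y + a3 * y - x * x * x - a2 * x * x - a4 * x - a6 ≈ 0# → g x y ≈ 0#
  weierstrass-g {x} {y} h = comb (solve (x ∷ y ∷ a1 ∷ a2 ∷ a3 ∷ a4 ∷ a6 ∷ []) (λ x y a1 a2 a3 a4 a6 →
     (x :* x :* x :+ a2 :* x :* x :+ a4 :* x :+ a6 :- y :* y :- (a1 :* x :+ a3) :* y) :- con (+ 0) :=
     (:- con (+ 1)) :* ((y :* y :+ a1 :* x :* y :+ a3 :* y :- x :* x :* x :- a2 :* x :* x :- a4 :* x :- a6) :- con (+ 0))) ≡.refl) (_ · h)

-- Multiples of a rational point

module Points where
  open import Defs
  open import Data.Integer using (+_)
  open import Data.Rational as ℚ using (ℚ; 0ℚ; _+_; _*_; _-_; -_; ≢-nonZero)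
  open import Data.Vec using ([]; _∷_)
  open import Relation.Binary.Definitions using (tri<; tri≈; tri>)
  open import Relation.Binary.PropositionalEquality hiding ([_])

  divQ-* : ∀ p {q} → q ≢ 0ℚ → divQ p q * q ≡ p
  divQ-* p {q} q≢0 with q ℚP.≟ 0ℚ
  ... | yes q≡0 = ⊥-elim (q≢0 q≡0)
  ... | no q≢0′ = trans (ℚP.*-assoc p (ℚ.1/_ q {{≢-nonZero q≢0′}}) q)
      (trans (cong (p *_) (ℚP.*-inverseˡ q {{≢-nonZero q≢0′}})) (ℚP.*-identityʳ p))

  noZeroDivisors-ℚ : Solver.NoZeroDivisors ℚP.+-*-commutativeRing
  noZeroDivisors-ℚ x y xy≡0 with x ℚP.≟ 0ℚ
  ... | yes x≡0 = inj₁ x≡0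
  ... | no x≢0 = inj₂ (trans (sym (ℚP.*-identityˡ y)) (trans (cong (_* y) (sym (ℚP.*-inverseˡ x)))
        (trans (ℚP.*-assoc (ℚ.1/ x) x y) (trans (cong (ℚ.1/ x *_) xy≡0) (ℚP.*-zeroʳ (ℚ.1/ x))))))
    where instance _ = ≢-nonZero x≢0

  module Group (W : WEq) where
    open WEq W renaming (c1 to a1; c2 to a2; c3 to a3; c4' to a4; c6 to a6)
    open Lines ℚP.+-*-commutativeRing noZeroDivisors-ℚ a1 a2 a3 a4 a6 public
    open Solver ℚP.+-*-commutativeRing

    On : ℚ × ℚ → Set
    On (x , y) = g x y ≡ 0ℚ

    neg : ℚ × ℚ → ℚ × ℚ
    neg (x , y) = x , - y - a1 * x - a3

    Opposite : ℚ × ℚ → ℚ × ℚ → Set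
    Opposite (x₁ , y₁) (x₂ , y₂) = x₁ ≡ x₂ × y₁ + y₂ + a1 * x₂ + a3 ≡ 0ℚ

    pt : ℚ × ℚ → Pt
    pt (x , y) = aff x y

    -- The group law as a relation: A + B = C is `Collinear A B (neg C)`. The relation is symmetric
    -- in its three points, so commutativity and subtraction are permutations of one record.
    record Collinear (A B C : ℚ × ℚ) : Set where
      constructor coll
      field
        {l v} : ℚ
        through : Line l v (proj₁ A) (proj₁ B) (proj₁ C)
        on₁ : proj₂ A ≡ l * proj₁ A + v
        on₂ : proj₂ B ≡ l * proj₁ B + v
        on₃ : proj₂ C ≡ l * proj₁ C + v

    coll-swap : ∀ {A B C} → Collinear A B C → Collinear B A C
    coll-swap (coll L p q r) = coll (line-swap L) q p r

    coll-rotate : ∀ {A B C} → Collinear A B C → Collinear B C A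
    coll-rotate (coll L p q r) = coll (line-rotate L) q r p

    coll-neg : ∀ {A B C} → Collinear A B C → Collinear (neg A) (neg B) (neg C)
    coll-neg {xA , yA} {xB , yB} {xC , yC} (coll {l} {v} L p q r) = coll (line-neg L) (on p) (on q) (on r)
      where
      on : ∀ {x y} → y ≡ l * x + v → - y - a1 * x - a3 ≡ (- l - a1) * x + (- v - a3)
      on {x} refl = solve (l ∷ v ∷ x ∷ a1 ∷ a3 ∷ []) (λ l v x a1 a3 → :- (l :* x :+ v) :- a1 :* x :- a3 := (:- l :- a1) :* x :+ (:- v :- a3)) refl

    neg-neg : ∀ A → neg (neg A) ≡ A
    neg-neg (x , y) = cong (x ,_) (solve (x ∷ y ∷ a1 ∷ a3 ∷ []) (λ x y a1 a3 → :- (:- y :- a1 :* x :- a3) :- a1 :* x :- a3 := y) refl)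

    g-neg : ∀ x y → g x (- y - a1 * x - a3) ≡ g x y
    g-neg x y = solve (x ∷ y ∷ a1 ∷ a2 ∷ a3 ∷ a4 ∷ a6 ∷ []) (λ x y a1 a2 a3 a4 a6 →
      let gg = λ y → x :* x :* x :+ a2 :* x :* x :+ a4 :* x :+ a6 :- y :* y :- (a1 :* x :+ a3) :* y in
      gg (:- y :- a1 :* x :- a3) := gg y) refl

    on-neg : ∀ A → On A → On (neg A)
    on-neg (x , y) h = trans (g-neg x y) h

    coll-on : ∀ {A B C} → Collinear A B C → On A
    coll-on {xA , yA} (coll L refl _ _) = line-on L

    opposite-neg : ∀ A → Opposite A (neg A)
    opposite-neg (x , y) = refl , solve (x ∷ y ∷ a1 ∷ a3 ∷ []) (λ x y a1 a3 → y :+ (:- y :- a1 :* x :- a3) :+ a1 :* x :+ a3 := con (+ 0)) refl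

    opposite⇒neg : ∀ {A B} → Opposite A B → B ≡ neg A
    opposite⇒neg {x , y} {x′ , y′} (refl , h) = cong (x ,_) (opposite-y {x} {y} {y′} h)

    on-same-x : ∀ {A B} → On A → On B → proj₁ A ≡ proj₁ B → A ≡ B ⊎ Opposite A B
    on-same-x {x , y} {.x , y′} oA oB refl = [ (λ e → inj₁ (cong (x ,_) e)) , (λ e → inj₂ (refl , e)) ]′ (same-x {x} {y} {y′} oA oB)

    coll-unique : ∀ {A B C C′} → Collinear A B C → Collinear A B C′ → ¬ Opposite A B → C ≡ C′
    coll-unique {A} {B} {xC , yC} {xC′ , yC′} (coll {l} {v} L p q r) (coll {l′} {v′} L′ p′ q′ r′) nopp =
      cong₂ _,_ (proj₂ (proj₂ u)) (trans r (trans (cong₂ _+_ (cong₂ _*_ (proj₁ u) (proj₂ (proj₂ u))) (proj₁ (proj₂ u))) (sym r′)))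
      where
      dec : ¬ (proj₁ A ≡ proj₁ B) ⊎ (proj₁ A ≡ proj₁ B)
      dec with proj₁ A ℚP.≟ proj₁ B
      ... | yes e = inj₂ e
      ... | no e = inj₁ e
      u : l ≡ l′ × v ≡ v′ × xC ≡ xC′
      u = line-unique L L′ (trans (sym p) p′) (trans (sym q) q′)
            (λ (e , h) → nopp (e , trans (cong₂ (λ y y′ → y + y′ + a1 * proj₁ B + a3) p q) h)) dec

    -- (A + B) + C = A + (B + C)
    coll-assoc : ∀ {A B C T S T′ S′} → Collinear A B (neg T) → Collinear T C (neg S) →
      Collinear B C (neg T′) → Collinear A T′ (neg S′) →
      proj₁ A ≢ proj₁ B → proj₁ A ≢ proj₁ C → proj₁ B ≢ proj₁ C → C ≢ neg T → neg S ≡ neg S′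
    coll-assoc {A} {B} {C} {T} {S} {T′} {S′} (coll {l₁} {v₁} L₁ A₁ B₁ T₁) (coll {l₂} {v₂} L₂ T₂ C₂ S₂)
      (coll {m₁} {w₁} M₁ B₃ C₃ T₃) (coll {m₂} {w₂} M₂ A₄ T₄ S₄) A≢B A≢C B≢C C≢-T =
      cong₂ _,_ (assoc-x L₁ L₂ M₁ M₂ hT hT′ hA hB hC A≢B A≢C B≢C nT)
        (trans S₂ (trans (assoc-y L₁ L₂ M₁ M₂ hT hT′ hA hB hC A≢B A≢C B≢C nT) (sym S₄)))
      where
      hT = opposite-lines {l₁} {v₁} {l₂} {v₂} {proj₁ T} {proj₂ T} T₁ T₂
      hT′ = opposite-lines {m₁} {w₁} {m₂} {w₂} {proj₁ T′} {proj₂ T′} T₃ T₄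
      hA = trans (sym A₁) A₄
      hB = trans (sym B₁) B₃
      hC = trans (sym C₂) C₃
      nT : ¬ (proj₁ C ≡ proj₁ T × l₂ * proj₁ C + v₂ ≡ l₁ * proj₁ C + v₁)
      nT (e , f) = C≢-T (cong₂ _,_ e (trans C₂ (trans f (trans (cong (λ z → l₁ * z + v₁) e) (sym T₁)))))

    data Sum (A B : ℚ × ℚ) : Pt → Set where
      opposite : Opposite A B → Sum A B O
      collinear : ∀ {D} → Collinear A B (neg D) → Sum A B (pt D)

    private
      third : ∀ {A B l v x₃} → Line l v (proj₁ A) (proj₁ B) x₃ → proj₂ A ≡ l * proj₁ A + v → proj₂ B ≡ l * proj₁ B + v →
        Sum A B (aff x₃ (- ((l + a1) * x₃) - v - a3))
      third {l = l} {v} {x₃} L p q = collinear (coll L p q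
        (solve (l ∷ v ∷ x₃ ∷ a1 ∷ a3 ∷ []) (λ l v x a1 a3 → :- (:- ((l :+ a1) :* x) :- v :- a3) :- a1 :* x :- a3 := l :* x :+ v) refl))

      sum-e₁ : ∀ l x₁ x₂ → x₁ + x₂ + (l * l + a1 * l - a2 - x₁ - x₂) ≡ l * l + a1 * l - a2
      sum-e₁ l x₁ x₂ = solve (l ∷ x₁ ∷ x₂ ∷ a1 ∷ a2 ∷ []) (λ l x₁ x₂ a1 a2 → x₁ :+ x₂ :+ (l :* l :+ a1 :* l :- a2 :- x₁ :- x₂) := l :* l :+ a1 :* l :- a2) refl

      chord : ∀ {x₁ y₁ x₂ y₂} → On (x₁ , y₁) → On (x₂ , y₂) → x₁ ≢ x₂ → ∀ {l v} →
        l * (x₂ - x₁) ≡ y₂ - y₁ → v * (x₂ - x₁) ≡ y₁ * x₂ - y₂ * x₁ →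
        Sum (x₁ , y₁) (x₂ , y₂) (aff (l * l + a1 * l - a2 - x₁ - x₂) (- ((l + a1) * (l * l + a1 * l - a2 - x₁ - x₂)) - v - a3))
      chord {x₁} {y₁} {x₂} {y₂} o₁ o₂ ne {l} {v} hl hv = third {x₁ , y₁} {x₂ , y₂}
        (chord-line {l} {v} {x₁} {x₂} {l * l + a1 * l - a2 - x₁ - x₂} ne (trans (cong (g x₁) (sym (proj₁ ys))) o₁) (trans (cong (g x₂) (sym (proj₂ ys))) o₂) (sum-e₁ l x₁ x₂))
        (proj₁ ys) (proj₂ ys)
        where ys = chord-y {l} {v} {x₁} {y₁} {x₂} {y₂} ne hl hv

      tangent : ∀ {x₁ y₁ x₂ y₂} → On (x₁ , y₁) → On (x₂ , y₂) → x₁ ≡ x₂ → y₁ + y₂ + a1 * x₂ + a3 ≢ 0ℚ → ∀ {l v} →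
        (2# * y₁ + a1 * x₁ + a3 ≢ 0ℚ → l * (2# * y₁ + a1 * x₁ + a3) ≡ 3# * x₁ * x₁ + 2# * a2 * x₁ + a4 - a1 * y₁) →
        (2# * y₁ + a1 * x₁ + a3 ≢ 0ℚ → v * (2# * y₁ + a1 * x₁ + a3) ≡ - (x₁ * x₁ * x₁) + a4 * x₁ + 2# * a6 - a3 * y₁) →
        Sum (x₁ , y₁) (x₂ , y₂) (aff (l * l + a1 * l - a2 - x₁ - x₂) (- ((l + a1) * (l * l + a1 * l - a2 - x₁ - x₂)) - v - a3))
      tangent {x} {y₁} {.x} {y₂} o₁ o₂ refl nopp {l} {v} hl hv = third {x , y₁} {x , y₂}
        (tangent-line {l} {v} {x} {l * l + a1 * l - a2 - x - x} (trans (cong (g x) (sym ey)) o₁)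
          (trans (cong (λ y → l * (2# * y + a1 * x + a3)) (sym ey)) (trans (hl den≢0) (cong (λ y → 3# * x * x + 2# * a2 * x + a4 - a1 * y) ey)))
          (sum-e₁ l x x)) ey (trans (sym y₁≡y₂) ey)
        where
        y₁≡y₂ : y₁ ≡ y₂
        y₁≡y₂ = [ (λ e → e) , (λ e → ⊥-elim (nopp e)) ]′ (same-x {x} {y₁} {y₂} o₁ o₂)
        den≢0 : 2# * y₁ + a1 * x + a3 ≢ 0ℚ
        den≢0 e = nopp (trans (cong (λ y → y₁ + y + a1 * x + a3) (sym y₁≡y₂)) (trans
          (solve (x ∷ y₁ ∷ a1 ∷ a3 ∷ []) (λ x y a1 a3 → y :+ y :+ a1 :* x :+ a3 := con (+ 2) :* y :+ a1 :* x :+ a3) refl) e))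
        ey : y₁ ≡ l * x + v
        ey = tangent-y {l} {v} {x} {y₁} o₁ den≢0 (hl den≢0) (hv den≢0)

    add-sum : ∀ {A B} → On A → On B → Sum A B (add W (pt A) (pt B))
    add-sum {x₁ , y₁} {x₂ , y₂} o₁ o₂ with x₁ ℚP.≟ x₂
    ... | no x₁≢x₂ = chord o₁ o₂ x₁≢x₂ {divQ (y₂ - y₁) (x₂ - x₁)} {divQ (y₁ * x₂ - y₂ * x₁) (x₂ - x₁)} (divQ-* (y₂ - y₁) ne) (divQ-* (y₁ * x₂ - y₂ * x₁) ne)
      where
      ne : x₂ - x₁ ≢ 0ℚ
      ne e = x₁≢x₂ (sym (x-y≈0⇒x≈y e))
    ... | yes x₁≡x₂ with (y₁ + y₂ + a1 * x₂ + a3) ℚP.≟ 0ℚ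
    ...   | yes e = opposite (x₁≡x₂ , e)
    ...   | no e = tangent o₁ o₂ x₁≡x₂ e
      {divQ (ℕtoℚ 3 * x₁ * x₁ + ℕtoℚ 2 * a2 * x₁ + a4 - a1 * y₁) (ℕtoℚ 2 * y₁ + a1 * x₁ + a3)}
      {divQ (- (x₁ * x₁ * x₁) + a4 * x₁ + ℕtoℚ 2 * a6 - a3 * y₁) (ℕtoℚ 2 * y₁ + a1 * x₁ + a3)}
      (divQ-* (3# * x₁ * x₁ + 2# * a2 * x₁ + a4 - a1 * y₁)) (divQ-* (- (x₁ * x₁ * x₁) + a4 * x₁ + 2# * a6 - a3 * y₁))

    add-opposite : ∀ {A B} → Opposite A B → add W (pt A) (pt B) ≡ O
    add-opposite {x₁ , y₁} {x₂ , y₂} (e , h) with x₁ ℚP.≟ x₂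
    ... | no x₁≢x₂ = ⊥-elim (x₁≢x₂ e)
    ... | yes _ with (y₁ + y₂ + a1 * x₂ + a3) ℚP.≟ 0ℚ
    ...   | yes _ = refl
    ...   | no n = ⊥-elim (n h)

  -- `Q k` is [k+1]P, so that [a+1]P + [b+1]P has index `suc (a + b)`. The hypothesis `nopp` is
  -- infinite order: P + [k+1]P is never O.
  module Progression (W : WEq) (Q : ℕ → ℚ × ℚ)
    (on-Q : ∀ k → Group.On W (Q k))
    (succ : ∀ k → Group.Collinear W (Q 0) (Q k) (Group.neg W (Q (suc k))))
    (nopp : ∀ k → ¬ Group.Opposite W (Q 0) (Q k)) where

    open Group W

    pred : ∀ k → Collinear (neg (Q 0)) (Q (suc k)) (neg (Q k))
    pred k = coll-rotate (coll-rotate (coll-swap (coll-rotate (subst (Collinear (neg (Q 0)) (neg (Q k)))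
      (neg-neg (Q (suc k))) (coll-neg (succ k))))))

    -- The line through P and [k+1]P also contains -[k+2]P. Were [k+2]P = P, this line y = l x + v
    -- would contain P and -P, which have one abscissa and therefore would coincide, against P + P ≠
    -- O.
    Q≢Q₀ : ∀ k → Q (suc k) ≢ Q 0
    Q≢Q₀ k e = nopp 0 (subst (Opposite (Q 0)) (on-line (succ k)) (opposite-neg (Q 0)))
      where
      on-line : Collinear (Q 0) (Q k) (neg (Q (suc k))) → neg (Q 0) ≡ Q 0
      on-line (coll {l} {v} L p q r) = trans (cong neg (sym e))
        (cong₂ _,_ (cong proj₁ e) (trans r (trans (cong (λ A → l * proj₁ A + v) e) (sym p))))

    -- Subtracting P on both sides, which `pred` and the uniqueness of the third point allow, lowers
    -- both indices until `Q≢Q₀` applies.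
    Q-injective : ∀ m k → Q m ≢ Q (suc k ℕ.+ m)
    Q-injective zero k e = Q≢Q₀ k (trans (cong Q (cong suc (sym (ℕP.+-identityʳ k)))) (sym e))
    Q-injective (suc m) k e = Q-injective m k (trans (sym (neg-neg (Q m))) (trans (cong neg
      (coll-unique (pred m) (subst (λ A → Collinear (neg (Q 0)) A (neg (Q (suc k ℕ.+ m)))) (sym (trans e (cong Q (cong suc (ℕP.+-suc k m))))) (pred (suc k ℕ.+ m)))
        (λ h → Q≢Q₀ m (trans (opposite⇒neg {neg (Q 0)} {Q (suc m)} h) (neg-neg (Q 0)))))) (neg-neg (Q (suc k ℕ.+ m)))))

    Q≢neg : ∀ n m → Q m ≢ neg (Q n)
    Q≢neg zero m e = nopp m (subst (Opposite (Q 0)) (sym e) (opposite-neg (Q 0)))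
    Q≢neg (suc n) m e = Q≢neg n (suc m) (trans (sym (neg-neg (Q (suc m)))) (cong neg
      (coll-unique (succ m) (subst₂ (λ A B → Collinear A B (Q n)) (neg-neg (Q 0)) (sym e)
          (subst (Collinear (neg (neg (Q 0))) (neg (Q (suc n)))) (neg-neg (Q n)) (coll-neg (pred n))))
        (nopp m))))

    x-injective : ∀ m k → proj₁ (Q m) ≢ proj₁ (Q (suc k ℕ.+ m))
    x-injective m k e = [ Q-injective m k , (λ h → Q≢neg m (suc k ℕ.+ m) (opposite⇒neg {Q m} {Q (suc k ℕ.+ m)} h)) ]′
      (on-same-x (on-Q m) (on-Q (suc k ℕ.+ m)) e)

    x-distinct : ∀ {m n} → m ≢ n → proj₁ (Q m) ≢ proj₁ (Q n)
    x-distinct {m} {n} m≢n e with ℕP.<-cmp m n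
    ... | tri< (ℕ.s≤s {n = n′} m≤n) _ _ = x-injective m (n′ ℕ.∸ m) (trans e (cong (λ k → proj₁ (Q (suc k))) (sym (ℕP.m∸n+n≡m m≤n))))
    ... | tri≈ _ m≡n _ = m≢n m≡n
    ... | tri> _ _ (ℕ.s≤s {n = m′} n≤m) = x-injective n (m′ ℕ.∸ n) (trans (sym e) (cong (λ k → proj₁ (Q (suc k))) (sym (ℕP.m∸n+n≡m n≤m))))

    private
      dichotomy : ∀ {A B D} → Sum A B D → ¬ Opposite A B → ∃ λ C → Collinear A B (neg C)
      dichotomy (opposite h) n = ⊥-elim (n h)
      dichotomy (collinear {D} c) _ = D , c

      ¬opp : ∀ a b → ¬ Opposite (Q a) (Q b)
      ¬opp a b h = Q≢neg a b (opposite⇒neg {Q a} {Q b} h)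

    -- [a+1]P + [b+1]P = [a+b+2]P, via [a+1]P + (-P + [b+2]P) = ([a+1]P - P) + [b+2]P
    sum-Q : ∀ a b → Collinear (Q a) (Q b) (neg (Q (suc (a ℕ.+ b))))
    sum-Q zero b = succ b
    sum-Q (suc a) b with suc a ℕ.≟ suc b
    -- Here [a+2]P would be both the first and the third point of `coll-assoc`, which needs distinct
    -- abscissas; commutativity and the case of the smaller first index give the sum instead.
    ... | yes refl = coll-swap (subst (λ k → Collinear (Q a) (Q (suc a)) (neg (Q (suc k)))) (ℕP.+-suc a a) (sum-Q a (suc a)))
    ... | no a≢b = subst (Collinear (Q (suc a)) (Q b)) (sym (coll-assoc
          {Q (suc a)} {neg (Q 0)} {Q (suc b)} {Q a} {Q (suc (suc a ℕ.+ b))} {Q b} {proj₁ U}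
          (coll-swap (pred a))
          (subst (λ k → Collinear (Q a) (Q (suc b)) (neg (Q (suc k)))) (ℕP.+-suc a b) (sum-Q a (suc b)))
          (pred b) (proj₂ U)
          (x-distinct {suc a} {0} λ ()) (x-distinct a≢b) (x-distinct {0} {suc b} λ ()) (Q≢neg a (suc b)))) (proj₂ U)
      where U = dichotomy (add-sum (on-Q (suc a)) (on-Q b)) (¬opp (suc a) b)

    diff-Q : ∀ b k → Collinear (Q (suc (b ℕ.+ k))) (neg (Q b)) (neg (Q k))
    diff-Q b k = coll-rotate (coll-rotate (subst (Collinear (neg (Q b)) (neg (Q k))) (neg-neg (Q (suc (b ℕ.+ k)))) (coll-neg (sum-Q b k))))

    X : ℕ → ℚ
    X k = proj₁ (Q k)

    X-sum : ∀ b k → let a = suc (b ℕ.+ k) in (X a - X b) * (X a - X b) * (X (suc (a ℕ.+ b)) + X k) ≡ S (X a) (X b)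
    X-sum b k = let a = suc (b ℕ.+ k)
                    c = sum-Q a b
                    d = diff-Q b k in
      x-sum {x₊ = X (suc (a ℕ.+ b))} {x₋ = X k} (on-Q a) (on-Q b) (Collinear.through c) (Collinear.through d)
        (Collinear.on₁ c) (Collinear.on₂ c) (Collinear.on₁ d) (Collinear.on₂ d)

    X-prod : ∀ b k → let a = suc (b ℕ.+ k) in (X a - X b) * (X a - X b) * (X (suc (a ℕ.+ b)) * X k) ≡ Π (X a) (X b)
    X-prod b k = let a = suc (b ℕ.+ k)
                     c = sum-Q a b
                     d = diff-Q b k in
      x-prod {x₊ = X (suc (a ℕ.+ b))} {x₋ = X k} (on-Q a) (on-Q b) (Collinear.through c) (Collinear.through d)
        (Collinear.on₁ c) (Collinear.on₂ c) (Collinear.on₁ d) (Collinear.on₂ d)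
        (x-distinct (λ e → ℕP.<-irrefl (sym e) (ℕ.s≤s (ℕP.m≤m+n b k))))

    X-double : ∀ a → S (X a) (X a) * X (suc (a ℕ.+ a)) ≡ Π (X a) (X a)
    X-double a = x-double {x₂ = X (suc (a ℕ.+ a))} (on-Q a) (Collinear.through c) (Collinear.on₁ c)
      where c = sum-Q a a

  module Multiples (W : WEq) (x₀ y₀ : ℚ) (on₀ : F W x₀ y₀ ≡ 0ℚ)
    (inf : ∀ n → 1 ℕ.≤ n → mul W (aff x₀ y₀) n ≢ O) where

    open Group W

    coords : Pt → ℚ × ℚ
    coords O = 0ℚ , 0ℚ
    coords (aff x y) = x , y

    private
      pt-coords : ∀ Q → Q ≢ O → Q ≡ pt (coords Q)
      pt-coords O n = ⊥-elim (n refl)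
      pt-coords (aff x y) _ = refl

      sum-collinear : ∀ {A B C D} → Sum A B D → D ≡ pt C → Collinear A B (neg C)
      sum-collinear (collinear c) refl = c
      sum-collinear (opposite _) ()

      not-opposite : ∀ {A B C D} → Sum A B D → D ≡ pt C → add W (pt A) (pt B) ≡ D → ¬ Opposite A B
      not-opposite (collinear c) refl e h with trans (sym e) (add-opposite h)
      ... | ()

    -- the multiple [k+1]P
    mP : ℕ → ℚ × ℚ
    mP k = coords (mul W (aff x₀ y₀) (suc k))

    mul-mP : ∀ k → mul W (aff x₀ y₀) (suc k) ≡ pt (mP k)
    mul-mP k = pt-coords (mul W (aff x₀ y₀) (suc k)) (inf (suc k) (ℕ.s≤s ℕ.z≤n))

    private
      add-mP : ∀ k → add W (aff x₀ y₀) (pt (mP k)) ≡ pt (mP (suc k))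
      add-mP k = trans (cong (add W (aff x₀ y₀)) (sym (mul-mP k))) (mul-mP (suc k))

      step : ∀ k → On (mP k) → Collinear (x₀ , y₀) (mP k) (neg (mP (suc k)))
      step k o = sum-collinear (add-sum {x₀ , y₀} {mP k} (weierstrass-g {x₀} {y₀} on₀) o) (add-mP k)

    on-mP : ∀ k → On (mP k)
    on-mP zero = weierstrass-g {x₀} {y₀} on₀
    on-mP (suc k) = subst On (neg-neg (mP (suc k)))
      (on-neg (neg (mP (suc k))) (coll-on (coll-rotate (coll-rotate (step k (on-mP k))))))

    succ-mP : ∀ k → Collinear (mP 0) (mP k) (neg (mP (suc k)))
    succ-mP k = step k (on-mP k)

    ¬opposite-mP : ∀ k → ¬ Opposite (mP 0) (mP k)
    ¬opposite-mP k = not-opposite (add-sum {x₀ , y₀} {mP k} (weierstrass-g {x₀} {y₀} on₀) (on-mP k)) (add-mP k) refl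

    open Progression W mP on-mP succ-mP ¬opposite-mP public

-- Homogeneous forms for the abscissas of a sum and a difference

module Forms {c ℓ : Level} (R : CommutativeRing c ℓ) where
  open import Data.Vec using ([]; _∷_)
  open import Data.Integer using (+_)
  open CommutativeRing R
  open Solver R

  -- Homogeneous versions of (x - x′)², S and Π, with x = a / b and x′ = a′ / b′.
  H : (a b a′ b′ : Carrier) → Carrier
  H a b a′ b′ = a * b′ - a′ * b

  Sₕ : (b2 b4 b6 a b a′ b′ : Carrier) → Carrier
  Sₕ b2 b4 b6 a b a′ b′ = fromℤ (+ 2) * a * a′ * (a * b′ + a′ * b) + b2 * a * a′ * b * b′ + b4 * b * b′ * (a * b′ + a′ * b) + b6 * b * b * b′ * b′

  Πₕ : (b4 b6 b8 a b a′ b′ : Carrier) → Carrier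
  Πₕ b4 b6 b8 a b a′ b′ = a * a * a′ * a′ - b4 * a * a′ * b * b′ - b6 * b * b′ * (a * b′ + a′ * b) - b8 * b * b * b′ * b′

  module Ex {n : ℕ} where
    Sₑ : (b2 b4 b6 a b a′ b′ : Expr n) → Expr n
    Sₑ b2 b4 b6 a b a′ b′ = con (+ 2) :* a :* a′ :* (a :* b′ :+ a′ :* b) :+ b2 :* a :* a′ :* b :* b′ :+ b4 :* b :* b′ :* (a :* b′ :+ a′ :* b) :+ b6 :* b :* b :* b′ :* b′

    Πₑ : (b4 b6 b8 a b a′ b′ : Expr n) → Expr n
    Πₑ b4 b6 b8 a b a′ b′ = a :* a :* a′ :* a′ :- b4 :* a :* a′ :* b :* b′ :- b6 :* b :* b′ :* (a :* b′ :+ a′ :* b) :- b8 :* b :* b :* b′ :* b′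

  open Ex public

  module _ {b2 b4 b6 b8 x b x′ b′ x₊ b₊ x₋ b₋ : Carrier} where
    homogenize-sum : (x - x′) * (x - x′) * (x₊ + x₋) ≈ fromℤ (+ 2) * x * x′ * (x + x′) + b2 * x * x′ + b4 * (x + x′) + b6 →
      H (x * b) b (x′ * b′) b′ * H (x * b) b (x′ * b′) b′ * (x₊ * b₊ * b₋ + x₋ * b₋ * b₊)
        ≈ Sₕ b2 b4 b6 (x * b) b (x′ * b′) b′ * (b₊ * b₋)
    homogenize-sum h = comb
      (solve (b2 ∷ b4 ∷ b6 ∷ x ∷ b ∷ x′ ∷ b′ ∷ x₊ ∷ b₊ ∷ x₋ ∷ b₋ ∷ []) (λ b2 b4 b6 x b x′ b′ x₊ b₊ x₋ b₋ →
        let h = (x :* b) :* b′ :- (x′ :* b′) :* b in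
        h :* h :* (x₊ :* b₊ :* b₋ :+ x₋ :* b₋ :* b₊) :- Sₑ b2 b4 b6 (x :* b) b (x′ :* b′) b′ :* (b₊ :* b₋) :=
        (b :* b :* b′ :* b′ :* b₊ :* b₋) :* ((x :- x′) :* (x :- x′) :* (x₊ :+ x₋) :- (con (+ 2) :* x :* x′ :* (x :+ x′) :+ b2 :* x :* x′ :+ b4 :* (x :+ x′) :+ b6))) ≡.refl)
      (_ · h)

    homogenize-prod : (x - x′) * (x - x′) * (x₊ * x₋) ≈ x * x * x′ * x′ - b4 * x * x′ - b6 * (x + x′) - b8 →
      H (x * b) b (x′ * b′) b′ * H (x * b) b (x′ * b′) b′ * (x₊ * b₊ * (x₋ * b₋))
        ≈ Πₕ b4 b6 b8 (x * b) b (x′ * b′) b′ * (b₊ * b₋)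
    homogenize-prod h = comb
      (solve (b4 ∷ b6 ∷ b8 ∷ x ∷ b ∷ x′ ∷ b′ ∷ x₊ ∷ b₊ ∷ x₋ ∷ b₋ ∷ []) (λ b4 b6 b8 x b x′ b′ x₊ b₊ x₋ b₋ →
        let h = (x :* b) :* b′ :- (x′ :* b′) :* b in
        h :* h :* (x₊ :* b₊ :* (x₋ :* b₋)) :- Πₑ b4 b6 b8 (x :* b) b (x′ :* b′) b′ :* (b₊ :* b₋) :=
        (b :* b :* b′ :* b′ :* b₊ :* b₋) :* ((x :- x′) :* (x :- x′) :* (x₊ :* x₋) :- (x :* x :* x′ :* x′ :- b4 :* x :* x′ :- b6 :* (x :+ x′) :- b8))) ≡.refl)
      (_ · h)

    homogenize-double : (fromℤ (+ 2) * x * x * (x + x) + b2 * x * x + b4 * (x + x) + b6) * x₊ ≈ x * x * x * x - b4 * x * x - b6 * (x + x) - b8 →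
      Sₕ b2 b4 b6 (x * b) b (x * b) b * (x₊ * b₊) ≈ Πₕ b4 b6 b8 (x * b) b (x * b) b * b₊
    homogenize-double h = comb
      (solve (b2 ∷ b4 ∷ b6 ∷ b8 ∷ x ∷ b ∷ x₊ ∷ b₊ ∷ []) (λ b2 b4 b6 b8 x b x₊ b₊ →
        Sₑ b2 b4 b6 (x :* b) b (x :* b) b :* (x₊ :* b₊) :- Πₑ b4 b6 b8 (x :* b) b (x :* b) b :* b₊ :=
        (b :* b :* b :* b :* b₊) :* ((con (+ 2) :* x :* x :* (x :+ x) :+ b2 :* x :* x :+ b4 :* (x :+ x) :+ b6) :* x₊ :- (x :* x :* x :* x :- b4 :* x :* x :- b6 :* (x :+ x) :- b8))) ≡.refl)
      (_ · h)

  -- (b₊b₋ , a₊b₋ + a₋b₊ , a₊a₋) is unimodular when (a₊ , b₊) and (a₋ , b₋) are, so a proportional vector is a multiple of it.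
  module _ {a₊ b₊ a₋ b₋ r₊ s₊ r₋ s₋ : Carrier} (u₊ : r₊ * a₊ + s₊ * b₊ ≈ 1#) (u₋ : r₋ * a₋ + s₋ * b₋ ≈ 1#)
    {v₁ v₂ v₃ : Carrier} where

    private
      w₁ w₂ w₃ e k n₁ n₂ n₃ : Carrier
      w₁ = b₊ * b₋
      w₂ = a₊ * b₋ + a₋ * b₊
      w₃ = a₊ * a₋
      e = r₊ * r₋ * w₃ + s₊ * s₋ * w₁ + s₊ * r₋ * w₂
      k = r₊ * s₋ - s₊ * r₋
      n₁ = (s₊ * s₋) * (e + fromℤ (+ 2) * k * (a₊ * b₋)) - k * k * w₃
      n₂ = s₊ * r₋ * (e + fromℤ (+ 2) * k * (a₊ * b₋)) + k * k * (a₊ * b₋)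
      n₃ = r₊ * r₋ * (e + fromℤ (+ 2) * k * (a₊ * b₋))

      -- With X = a₊b₋ the product of the two Bézout relations is e + kX, which by itself need not
      -- lie in the ideal of w₁, w₂, w₃. Its square does, because X² = w₂ X - w₁ w₃ and e is already
      -- a combination of the w's; the coefficients n₁, n₂, n₃ are read off from e(e + 2kX) + k²X².
      unimodular : n₁ * w₁ + n₂ * w₂ + n₃ * w₃ ≈ 1#
      unimodular = comb (solve (a₊ ∷ b₊ ∷ a₋ ∷ b₋ ∷ r₊ ∷ s₊ ∷ r₋ ∷ s₋ ∷ []) (λ a₊ b₊ a₋ b₋ r₊ s₊ r₋ s₋ →
        let w₁ = b₊ :* b₋
            w₂ = a₊ :* b₋ :+ a₋ :* b₊
            w₃ = a₊ :* a₋
            e = r₊ :* r₋ :* w₃ :+ s₊ :* s₋ :* w₁ :+ s₊ :* r₋ :* w₂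
            k = r₊ :* s₋ :- s₊ :* r₋
            m = e :+ con (+ 2) :* k :* (a₊ :* b₋)
            u = r₊ :* a₊ :+ s₊ :* b₊
            v = r₋ :* a₋ :+ s₋ :* b₋ in
        ((s₊ :* s₋) :* m :- k :* k :* w₃) :* w₁ :+ (s₊ :* r₋ :* m :+ k :* k :* (a₊ :* b₋)) :* w₂ :+ r₊ :* r₋ :* m :* w₃ :- con (+ 1) :=
        ((u :+ con (+ 1)) :* v :* v) :* (u :- con (+ 1)) :+ (v :+ con (+ 1)) :* (v :- con (+ 1))) ≡.refl)
        (_ · u₊ ⊕ _ · u₋)

    multiplier : Carrier
    multiplier = n₁ * v₁ + n₂ * v₂ + n₃ * v₃

    module _ (p₁₂ : v₁ * w₂ ≈ v₂ * w₁) (p₁₃ : v₁ * w₃ ≈ v₃ * w₁) (p₂₃ : v₂ * w₃ ≈ v₃ * w₂) where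

      multiple₁ : v₁ ≈ multiplier * w₁
      multiple₁ = comb (solve (v₁ ∷ v₂ ∷ v₃ ∷ w₁ ∷ w₂ ∷ w₃ ∷ n₁ ∷ n₂ ∷ n₃ ∷ []) (λ v₁ v₂ v₃ w₁ w₂ w₃ n₁ n₂ n₃ →
        v₁ :- (n₁ :* v₁ :+ n₂ :* v₂ :+ n₃ :* v₃) :* w₁ :=
        (:- v₁) :* (n₁ :* w₁ :+ n₂ :* w₂ :+ n₃ :* w₃ :- con (+ 1)) :+ n₂ :* (v₁ :* w₂ :- v₂ :* w₁) :+ n₃ :* (v₁ :* w₃ :- v₃ :* w₁)) ≡.refl)
        (_ · unimodular ⊕ _ · p₁₂ ⊕ _ · p₁₃)

      multiple₂ : v₂ ≈ multiplier * w₂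
      multiple₂ = comb (solve (v₁ ∷ v₂ ∷ v₃ ∷ w₁ ∷ w₂ ∷ w₃ ∷ n₁ ∷ n₂ ∷ n₃ ∷ []) (λ v₁ v₂ v₃ w₁ w₂ w₃ n₁ n₂ n₃ →
        v₂ :- (n₁ :* v₁ :+ n₂ :* v₂ :+ n₃ :* v₃) :* w₂ :=
        (:- v₂) :* (n₁ :* w₁ :+ n₂ :* w₂ :+ n₃ :* w₃ :- con (+ 1)) :+ (:- n₁) :* (v₁ :* w₂ :- v₂ :* w₁) :+ n₃ :* (v₂ :* w₃ :- v₃ :* w₂)) ≡.refl)
        (_ · unimodular ⊕ _ · p₁₂ ⊕ _ · p₂₃)

      multiple₃ : v₃ ≈ multiplier * w₃
      multiple₃ = comb (solve (v₁ ∷ v₂ ∷ v₃ ∷ w₁ ∷ w₂ ∷ w₃ ∷ n₁ ∷ n₂ ∷ n₃ ∷ []) (λ v₁ v₂ v₃ w₁ w₂ w₃ n₁ n₂ n₃ →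
        v₃ :- (n₁ :* v₁ :+ n₂ :* v₂ :+ n₃ :* v₃) :* w₃ :=
        (:- v₃) :* (n₁ :* w₁ :+ n₂ :* w₂ :+ n₃ :* w₃ :- con (+ 1)) :+ (:- n₁) :* (v₁ :* w₃ :- v₃ :* w₁) :+ (:- n₂) :* (v₂ :* w₃ :- v₃ :* w₂)) ≡.refl)
        (_ · unimodular ⊕ _ · p₁₃ ⊕ _ · p₂₃)

  proportional : ∀ {a₊ b₊ a₋ b₋ r₊ s₊ r₋ s₋} → r₊ * a₊ + s₊ * b₊ ≈ 1# → r₋ * a₋ + s₋ * b₋ ≈ 1# → ∀ v₁ v₂ v₃ →
    v₁ * (a₊ * b₋ + a₋ * b₊) ≈ v₂ * (b₊ * b₋) → v₁ * (a₊ * a₋) ≈ v₃ * (b₊ * b₋) → v₂ * (a₊ * a₋) ≈ v₃ * (a₊ * b₋ + a₋ * b₊) →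
    ∃ λ c → v₁ ≈ c * (b₊ * b₋) × v₂ ≈ c * (a₊ * b₋ + a₋ * b₊) × v₃ ≈ c * (a₊ * a₋)
  proportional u₊ u₋ v₁ v₂ v₃ p q r = multiplier u₊ u₋ {v₁} {v₂} {v₃} , multiple₁ u₊ u₋ p q r , multiple₂ u₊ u₋ p q r , multiple₃ u₊ u₋ p q r

-- Integral shape of rational points

module Model where
  open import Defs
  open import Data.Integer using (+_; -[1+_])
  open import Data.Rational as ℚ using (ℚ; 0ℚ; ↥_; ↧_; ↧ₙ_; mkℚ)
  open import Data.Vec as Vec using (Vec; []; _∷_)
  open import Relation.Binary.PropositionalEquality hiding ([_])
  open Points

  ℤring : CommutativeRing _ _
  ℤring = ℤP.+-*-commutativeRing

  ℚring : CommutativeRing _ _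
  ℚring = ℚP.+-*-commutativeRing

  private
    ι : ℤ → ℚ
    ι = ℤtoℚ

  module _ where
    ιᵘ : ∀ i → ℚ.toℚᵘ (ι i) ℚᵘ.≃ ℚᵘ.mkℚᵘ i 0
    ιᵘ i = ℚP.toℚᵘ-fromℚᵘ (ℚᵘ.mkℚᵘ i 0)

    ι-+ : ∀ i j → ι (i ℤ.+ j) ≡ ι i ℚ.+ ι j
    ι-+ i j = ℚP.toℚᵘ-injective (ℚᵘP.≃-trans (ιᵘ (i ℤ.+ j)) (ℚᵘP.≃-trans
      (ℚᵘ.*≡* (cong (ℤ._* 1ℤ) (cong₂ ℤ._+_ (sym (ℤP.*-identityʳ i)) (sym (ℤP.*-identityʳ j)))))
      (ℚᵘP.≃-trans (ℚᵘP.+-cong (ℚᵘP.≃-sym (ιᵘ i)) (ℚᵘP.≃-sym (ιᵘ j))) (ℚᵘP.≃-sym (ℚP.toℚᵘ-homo-+ (ι i) (ι j))))))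

    ι-* : ∀ i j → ι (i ℤ.* j) ≡ ι i ℚ.* ι j
    ι-* i j = ℚP.toℚᵘ-injective (ℚᵘP.≃-trans (ιᵘ (i ℤ.* j)) (ℚᵘP.≃-trans (ℚᵘ.*≡* refl)
      (ℚᵘP.≃-trans (ℚᵘP.*-cong (ℚᵘP.≃-sym (ιᵘ i)) (ℚᵘP.≃-sym (ιᵘ j))) (ℚᵘP.≃-sym (ℚP.toℚᵘ-homo-* (ι i) (ι j))))))

    ι-neg : ∀ i → ι (ℤ.- i) ≡ ℚ.- ι i
    ι-neg i = ℚP.toℚᵘ-injective (ℚᵘP.≃-trans (ιᵘ (ℤ.- i)) (ℚᵘP.≃-trans
      (ℚᵘP.-‿cong (ℚᵘP.≃-sym (ιᵘ i))) (ℚᵘP.≃-sym (ℚP.toℚᵘ-homo‿- (ι i)))))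

    ι-injective : ∀ {i j} → ι i ≡ ι j → i ≡ j
    ι-injective {i} {j} e with ℚᵘP.≃-trans (ℚᵘP.≃-sym (ιᵘ i)) (ℚᵘP.≃-trans (ℚP.toℚᵘ-cong e) (ιᵘ j))
    ... | ℚᵘ.*≡* h = trans (sym (ℤP.*-identityʳ i)) (trans h (ℤP.*-identityʳ j))

  private
    ι-isHom : Hom.IsHom ℤring ℚring ι
    ι-isHom = record { hom-1 = refl ; hom-0 = refl ; hom-+ = ι-+ ; hom-* = ι-* ; hom-neg = ι-neg }

    x*↧x : ∀ x → x ℚ.* ι (↧ x) ≡ ι (↥ x)
    x*↧x x@(mkℚ n d-1 _) = ℚP.toℚᵘ-injective (ℚᵘP.≃-trans (ℚP.toℚᵘ-homo-* x (ι (↧ x)))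
      (ℚᵘP.≃-trans (ℚᵘP.*-cong (ℚᵘP.≃-refl {ℚ.toℚᵘ x}) (ιᵘ (↧ x))) (ℚᵘP.≃-trans
        (ℚᵘ.*≡* (trans (ℤP.*-identityʳ (n ℤ.* + suc d-1)) (cong (n ℤ.*_) (cong (λ k → + suc k) (sym (ℕP.*-identityʳ d-1))))))
        (ℚᵘP.≃-sym (ιᵘ n)))))

  open Hom.IsHom ι-isHom using (hom-eval) public

  private
    module Sℤ = Solver ℤring

  numerator-ℤ : ∀ i → ↥ (ℤtoℚ i) ≡ i
  numerator-ℤ i = ι-injective (trans (sym (x*↧x (ι i))) (trans (cong (λ d → ι i ℚ.* ι d) (den i)) (ℚP.*-identityʳ (ι i))))
    where
    den : ∀ i → ↧ (ι i) ≡ + 1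
    den (+ n) = trans (cong (↧_) (ℚP.normalize-coprime {n} {0} (Cop.sym (Cop.1-coprimeTo n)))) refl
    den -[1+ n ] = trans (cong (λ q → ↧ (ℚ.- q)) (ℚP.normalize-coprime {suc n} {0} (Cop.sym (Cop.1-coprimeTo (suc n))))) refl

  private
    bézout′ : ∀ a b → Cop.Coprime ∣ a ∣ ∣ b ∣ → ∃₂ λ r s → r ℤ.* a ℤ.+ s ℤ.* b ≡ 1ℤ
    bézout′ a b c = sgn a b (abs (Cop.coprime-Bézout c))
      where
      open ≡-Reasoning
      abs : GCD.Bézout.Identity 1 ∣ a ∣ ∣ b ∣ → ∃₂ λ r s → r ℤ.* + ∣ a ∣ ℤ.+ s ℤ.* + ∣ b ∣ ≡ 1ℤ
      abs (GCD.Bézout.+- x y eq) = + x , ℤ.- (+ y) , (begin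
        + x ℤ.* + ∣ a ∣ ℤ.+ ℤ.- (+ y) ℤ.* + ∣ b ∣ ≡⟨ cong₂ ℤ._+_ (sym (ℤP.pos-* x ∣ a ∣)) (trans (sym (ℤP.neg-distribˡ-* (+ y) (+ ∣ b ∣))) (cong ℤ.-_ (sym (ℤP.pos-* y ∣ b ∣)))) ⟩
        + (x ℕ.* ∣ a ∣) ℤ.- + (y ℕ.* ∣ b ∣)       ≡⟨ cong (λ k → + k ℤ.- + (y ℕ.* ∣ b ∣)) (sym eq) ⟩
        1ℤ ℤ.+ + (y ℕ.* ∣ b ∣) ℤ.- + (y ℕ.* ∣ b ∣) ≡⟨ Sℤ.solve (+ (y ℕ.* ∣ b ∣) ∷ []) (λ t → Sℤ.con (+ 1) Sℤ.:+ t Sℤ.:- t Sℤ.:= Sℤ.con (+ 1)) refl ⟩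
        1ℤ ∎)
      abs (GCD.Bézout.-+ x y eq) = ℤ.- (+ x) , + y , (begin
        ℤ.- (+ x) ℤ.* + ∣ a ∣ ℤ.+ + y ℤ.* + ∣ b ∣ ≡⟨ cong₂ ℤ._+_ (trans (sym (ℤP.neg-distribˡ-* (+ x) (+ ∣ a ∣))) (cong ℤ.-_ (sym (ℤP.pos-* x ∣ a ∣)))) (sym (ℤP.pos-* y ∣ b ∣)) ⟩
        ℤ.- + (x ℕ.* ∣ a ∣) ℤ.+ + (y ℕ.* ∣ b ∣)   ≡⟨ cong (λ k → ℤ.- + (x ℕ.* ∣ a ∣) ℤ.+ + k) (sym eq) ⟩
        ℤ.- + (x ℕ.* ∣ a ∣) ℤ.+ (1ℤ ℤ.+ + (x ℕ.* ∣ a ∣)) ≡⟨ Sℤ.solve (+ (x ℕ.* ∣ a ∣) ∷ []) (λ t → Sℤ.:- t Sℤ.:+ (Sℤ.con (+ 1) Sℤ.:+ t) Sℤ.:= Sℤ.con (+ 1)) refl ⟩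
        1ℤ ∎)
      negate : ∀ r i → ℤ.- r ℤ.* i ≡ r ℤ.* ℤ.- i
      negate r i = trans (sym (ℤP.neg-distribˡ-* r i)) (ℤP.neg-distribʳ-* r i)
      one : ∀ a r → ∃ λ r′ → r′ ℤ.* a ≡ r ℤ.* + ∣ a ∣
      one (+ n) r = r , refl
      one -[1+ n ] r = ℤ.- r , negate r -[1+ n ]
      sgn : ∀ a b → ∃₂ (λ r s → r ℤ.* + ∣ a ∣ ℤ.+ s ℤ.* + ∣ b ∣ ≡ 1ℤ) → ∃₂ λ r s → r ℤ.* a ℤ.+ s ℤ.* b ≡ 1ℤ
      sgn a b (r , s , h) = proj₁ (one a r) , proj₁ (one b s) , trans (cong₂ ℤ._+_ (proj₂ (one a r)) (proj₂ (one b s))) h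

  abstract
    bézout : ∀ a b → Cop.Coprime ∣ a ∣ ∣ b ∣ → ∃₂ λ r s → r ℤ.* a ℤ.+ s ℤ.* b ≡ 1ℤ
    bézout = bézout′

  -- identities behind the shape (A/D² , C/D³) of a point on an integral Weierstrass equation
  module Shape {c ℓ} (R : CommutativeRing c ℓ) where
    open CommutativeRing R hiding (refl; sym; trans)
    open Solver R

    monic : ∀ {a1 a2 a3 a4 a6 x y b} → x * x * x + a2 * x * x + a4 * x + a6 - y * y - (a1 * x + a3) * y ≈ 0# →
      (y * (b * b)) * (y * (b * b)) + b * (a1 * (x * b) + a3 * b) * (y * (b * b)) ≈
      b * ((x * b) * (x * b) * (x * b) + b * (a2 * (x * b) * (x * b) + a4 * (x * b) * b + a6 * b * b))
    monic {a1} {a2} {a3} {a4} {a6} {x} {y} {b} h = comb (solve (a1 ∷ a2 ∷ a3 ∷ a4 ∷ a6 ∷ x ∷ y ∷ b ∷ []) (λ a1 a2 a3 a4 a6 x y b →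
        (y :* (b :* b)) :* (y :* (b :* b)) :+ b :* (a1 :* (x :* b) :+ a3 :* b) :* (y :* (b :* b)) :-
        b :* ((x :* b) :* (x :* b) :* (x :* b) :+ b :* (a2 :* (x :* b) :* (x :* b) :+ a4 :* (x :* b) :* b :+ a6 :* b :* b)) :=
        (:- (b :* b :* b :* b)) :* ((x :* x :* x :+ a2 :* x :* x :+ a4 :* x :+ a6 :- y :* y :- (a1 :* x :+ a3) :* y) :- con (+ 0))) refl)
      (_ · h)

    root : ∀ {z k u e} → z * z + k * z ≈ u → (z * e) * (z * e) + k * (z * e) * e ≈ u * (e * e)
    root {z} {k} {u} {e} h = comb (solve (z ∷ k ∷ u ∷ e ∷ []) (λ z k u e →
        (z :* e) :* (z :* e) :+ k :* (z :* e) :* e :- u :* (e :* e) := (e :* e) :* (z :* z :+ k :* z :- u)) refl) (_ · h)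

    -- The rational root theorem for a monic quadratic. Coprimality enters through Bézout
    -- coefficients, which turns the descent on prime factors into one ring identity.
    root-unit : ∀ {n e k u r s} → n * n + k * n * e ≈ u * (e * e) → r * n + s * e ≈ 1# →
      ∃ λ q → q * e ≈ 1#
    root-unit {n} {e} {k} {u} {r} {s} h b = _ , comb (solve (n ∷ e ∷ k ∷ u ∷ r ∷ s ∷ []) (λ n e k u r s →
        (r :* r :* (u :* e :- k :* n) :+ (con (+ 2) :* r :* n :* s :+ s :* s :* e)) :* e :- con (+ 1) :=
        (:- (r :* r)) :* (n :* n :+ k :* n :* e :- u :* (e :* e)) :+ (r :* n :+ s :* e :+ con (+ 1)) :* (r :* n :+ s :* e :- con (+ 1))) refl)
      (_ · h ⊕ _ · b)

    quotient₁ : ∀ {g b y m u r s} → g * (y * (y + b * m)) ≈ b * u → r * b + s * y ≈ 1# →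
      ∃ λ q → g ≈ q * b
    quotient₁ {g} {b} {y} {m} {u} {r} {s} h e = _ , comb (solve (g ∷ b ∷ y ∷ m ∷ u ∷ r ∷ s ∷ []) (λ g b y m u r s →
        g :- (s :* s :* u :+ g :* (r :* (s :* (y :+ b :* m)) :+ (r :* b :+ s :* y) :* (r :- s :* m))) :* b :=
        (s :* s) :* (g :* (y :* (y :+ b :* m)) :- b :* u) :+ (:- g :* (r :* b :+ s :* y :+ con (+ 1))) :* (r :* b :+ s :* y :- con (+ 1))) refl)
      (_ · h ⊕ _ · e)

    quotient₂ : ∀ {g b y m a w r s} → g * (y * (y + b * m)) ≈ b * (a * a * a + g * b * w) → r * a + s * (g * b) ≈ 1# →
      ∃ λ q → b ≈ q * g
    quotient₂ {g} {b} {y} {m} {a} {w} {r} {s} h e = _ , comb (solve (g ∷ b ∷ y ∷ m ∷ a ∷ w ∷ r ∷ s ∷ []) (λ g b y m a w r s →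
        let t = s :* (g :* b)
            v = r :* a :+ t in
        b :- (r :* r :* r :* (y :* (y :+ b :* m)) :- b :* (r :* r :* r :* (b :* w)) :+ b :* b :* s :* (con (+ 3) :* r :* r :* a :* a :+ con (+ 3) :* r :* a :* t :+ t :* t)) :* g :=
        (:- (r :* r :* r)) :* (g :* (y :* (y :+ b :* m)) :- b :* (a :* a :* a :+ g :* b :* w)) :+ (:- b :* (v :* v :+ v :+ con (+ 1))) :* (v :- con (+ 1))) refl)
      (_ · h ⊕ _ · e)

    integral-curve : ∀ {a1 a2 a3 a4 a6 x y d} → x * x * x + a2 * x * x + a4 * x + a6 - y * y - (a1 * x + a3) * y ≈ 0# →
      let A = x * (d * d)
          C = y * (d * d * d) in
      C * C + a1 * A * C * d + a3 * C * (d * d * d) ≈ A * A * A + a2 * A * A * (d * d) + a4 * A * (d * d * d * d) + a6 * (d * d * d * d * d * d)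
    integral-curve {a1} {a2} {a3} {a4} {a6} {x} {y} {d} h = comb (solve (a1 ∷ a2 ∷ a3 ∷ a4 ∷ a6 ∷ x ∷ y ∷ d ∷ []) (λ a1 a2 a3 a4 a6 x y d →
        let A = x :* (d :* d)
            C = y :* (d :* d :* d) in
        C :* C :+ a1 :* A :* C :* d :+ a3 :* C :* (d :* d :* d) :- (A :* A :* A :+ a2 :* A :* A :* (d :* d) :+ a4 :* A :* (d :* d :* d :* d) :+ a6 :* (d :* d :* d :* d :* d :* d)) :=
        (:- (d :* d :* d :* d :* d :* d)) :* ((x :* x :* x :+ a2 :* x :* x :+ a4 :* x :+ a6 :- y :* y :- (a1 :* x :+ a3) :* y) :- con (+ 0))) refl)
      (_ · h)

  private
    module Shℤ = Shape ℤring
    module Shℚ = Shape ℚring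

  -- Integer identities are obtained over ℚ, where the points live, and pulled back along the
  -- injective embedding of ℤ; the reified expressions let the homomorphism act on both sides at
  -- once.
  transfer : ∀ {n} (ρ : Vec ℤ n) (f : N-ary n (Sℤ.Expr n) (Sℤ.Expr n × Sℤ.Expr n)) → let e = f $ⁿ Sℤ.vars in
    Hom.S′.⟦_⟧ ℤring ℚring (Hom.IsHom.convert ι-isHom (proj₁ e)) (Vec.map ι ρ) ≡ Hom.S′.⟦_⟧ ℤring ℚring (Hom.IsHom.convert ι-isHom (proj₂ e)) (Vec.map ι ρ) →
    Sℤ.⟦ proj₁ e ⟧ ρ ≡ Sℤ.⟦ proj₂ e ⟧ ρ
  transfer {n} ρ f h = ι-injective (trans (hom-eval (proj₁ (f $ⁿ Sℤ.vars {n})) ρ) (trans h (sym (hom-eval (proj₂ (f $ⁿ Sℤ.vars {n})) ρ))))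

  open Sℤ using (_:+_; _:*_; _:-_; :-_; _:=_; con)

  ∣1⇒abs≡1 : ∀ q e → q ℤ.* e ≡ 1ℤ → ∣ e ∣ ≡ 1
  ∣1⇒abs≡1 q e h = ℕD.∣1⇒≡1 (ℕD.divides ∣ q ∣ (trans (sym (cong ∣_∣ h)) (ℤP.abs-* q e)))

  private
    rational-root′ : ∀ z k u → z ℚ.* z ℚ.+ ι k ℚ.* z ≡ ι u → ∃ λ Y → z ≡ ι Y
    rational-root′ z@(mkℚ n d-1 c) k u h = n , trans (sym (ℚP.*-identityʳ z)) (trans (cong (λ e → z ℚ.* ι (+ e)) (sym e≡1)) (x*↧x z))
      where
      e = + suc d-1
      bz = bézout n e (Cop.recompute c)
      eq : n ℤ.* n ℤ.+ k ℤ.* n ℤ.* e ≡ u ℤ.* (e ℤ.* e)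
      eq = transfer (n ∷ k ∷ e ∷ u ∷ []) (λ n k e u → n :* n :+ k :* n :* e := u :* (e :* e))
        (subst (λ t → t ℚ.* t ℚ.+ ι k ℚ.* t ℚ.* ι e ≡ ι u ℚ.* (ι e ℚ.* ι e)) (x*↧x z) (Shℚ.root {z} {ι k} {ι u} {ι e} h))
      e≡1 : suc d-1 ≡ 1
      e≡1 = ∣1⇒abs≡1 (proj₁ ru) e (proj₂ ru)
        where ru = (Shℤ.root-unit {n} {e} {k} {u} {proj₁ bz} {proj₁ (proj₂ bz)} eq (proj₂ (proj₂ bz)))

    abstract
      rational-root : ∀ z k u → z ℚ.* z ℚ.+ ι k ℚ.* z ≡ ι u → ∃ λ Y → z ≡ ι Y
      rational-root = rational-root′

    ∣-from : ∀ {a b} → ∃ (λ q → + a ≡ q ℤ.* + b) → b ℕD.∣ a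
    ∣-from {a} {b} (q , h) = ℕD.divides ∣ q ∣ (trans (cong ∣_∣ h) (ℤP.abs-* q (+ b)))

    -- With g = gcd(b, Y), dividing the equation by g gives g Y′(Y′ + b′m) = b′(a³ + g b′w). As b′
    -- is coprime to Y′, it divides g; as g is coprime to a, it divides b′. Hence b′ = g and b = g².
    square-denominator′ : ∀ b a Y m w g b′ Y′ → 1 ℕ.≤ g → Cop.Coprime ∣ a ∣ b → Cop.Coprime b′ ∣ Y′ ∣ →
      b ≡ g ℕ.* b′ → Y ≡ + g ℤ.* Y′ →
      Y ℤ.* Y ℤ.+ + b ℤ.* m ℤ.* Y ≡ + b ℤ.* (a ℤ.* a ℤ.* a ℤ.+ + b ℤ.* w) → b ≡ g ℕ.* g
    square-denominator′ b a Y m w g b′ Y′ 1≤g cop cop′ b≡ Y≡ h = trans b≡ (cong (g ℕ.*_) (ℕD.∣-antisym b′∣g g∣b′))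
      where
      instance
        g≢0 : ℕ.NonZero g
        g≢0 = ℕ.>-nonZero 1≤g
      b+≡ : + b ≡ + g ℤ.* + b′
      b+≡ = trans (cong +_ b≡) (ℤP.pos-* g b′)
      h′ : (+ g ℤ.* Y′) ℤ.* (+ g ℤ.* Y′) ℤ.+ (+ g ℤ.* + b′) ℤ.* m ℤ.* (+ g ℤ.* Y′) ≡ (+ g ℤ.* + b′) ℤ.* (a ℤ.* a ℤ.* a ℤ.+ (+ g ℤ.* + b′) ℤ.* w)
      h′ = subst₂ (λ Y b → Y ℤ.* Y ℤ.+ b ℤ.* m ℤ.* Y ≡ b ℤ.* (a ℤ.* a ℤ.* a ℤ.+ b ℤ.* w)) Y≡ b+≡ h
      h″ : + g ℤ.* (Y′ ℤ.* (Y′ ℤ.+ + b′ ℤ.* m)) ≡ + b′ ℤ.* (a ℤ.* a ℤ.* a ℤ.+ + g ℤ.* + b′ ℤ.* w)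
      h″ = ℤP.*-cancelˡ-≡ (+ g) _ _ (trans (trans
        (Sℤ.solve (+ g ∷ Y′ ∷ + b′ ∷ m ∷ []) (λ g y b m → g :* (g :* (y :* (y :+ b :* m))) := (g :* y) :* (g :* y) :+ (g :* b) :* m :* (g :* y)) refl) h′)
        (Sℤ.solve (+ g ∷ a ∷ + b′ ∷ w ∷ []) (λ g a b w → (g :* b) :* (a :* a :* a :+ (g :* b) :* w) := g :* (b :* (a :* a :* a :+ g :* b :* w))) refl))
      bz = bézout (+ b′) Y′ cop′
      bz′ = bézout a (+ b) cop
      b′∣g : b′ ℕD.∣ g
      b′∣g = ∣-from (Shℤ.quotient₁ {+ g} {+ b′} {Y′} {m} {a ℤ.* a ℤ.* a ℤ.+ + g ℤ.* + b′ ℤ.* w} {proj₁ bz} {proj₁ (proj₂ bz)} h″ (proj₂ (proj₂ bz)))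
      g∣b′ : g ℕD.∣ b′
      g∣b′ = ∣-from (Shℤ.quotient₂ {+ g} {+ b′} {Y′} {m} {a} {w} {proj₁ bz′} {proj₁ (proj₂ bz′)} h″
        (trans (cong (λ t → proj₁ bz′ ℤ.* a ℤ.+ proj₁ (proj₂ bz′) ℤ.* t) (sym b+≡)) (proj₂ (proj₂ bz′))))

    split-gcd : ∀ b Y → 1 ℕ.≤ b → ∃₂ λ g b′ → ∃ λ Y′ → 1 ℕ.≤ g × Cop.Coprime b′ ∣ Y′ ∣ × b ≡ g ℕ.* b′ × Y ≡ + g ℤ.* Y′
    split-gcd b Y 1≤b = GCD.gcd b ∣ Y ∣ , b ℕ./ GCD.gcd b ∣ Y ∣ , ℤD._∣_.quotient gY , ℕ.>-nonZero⁻¹ (GCD.gcd b ∣ Y ∣) ,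
        subst (Cop.Coprime (b ℕ./ GCD.gcd b ∣ Y ∣)) absY′ (Cop.coprime-/gcd b ∣ Y ∣) ,
        trans (sym (ℕDM.m/n*n≡m (GCD.gcd[m,n]∣m b ∣ Y ∣))) (ℕP.*-comm (b ℕ./ GCD.gcd b ∣ Y ∣) (GCD.gcd b ∣ Y ∣)) ,
        trans (ℤD._∣_.equality gY) (ℤP.*-comm (ℤD._∣_.quotient gY) (+ GCD.gcd b ∣ Y ∣))
      where
      instance
        b≢0 : ℕ.NonZero b
        b≢0 = ℕ.>-nonZero 1≤b
        g≢0 : ℕ.NonZero (GCD.gcd b ∣ Y ∣)
        g≢0 = ℕ.≢-nonZero (λ e → ℕ.≢-nonZero⁻¹ b (GCD.gcd[m,n]≡0⇒m≡0 e))
      gY : + GCD.gcd b ∣ Y ∣ ℤD.∣ Y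
      gY = ℤD.∣ᵤ⇒∣ (GCD.gcd[m,n]∣n b ∣ Y ∣)
      absY′ : ∣ Y ∣ ℕ./ GCD.gcd b ∣ Y ∣ ≡ ∣ ℤD._∣_.quotient gY ∣
      absY′ = trans (cong (ℕ._/ GCD.gcd b ∣ Y ∣) (trans (cong ∣_∣ (ℤD._∣_.equality gY)) (ℤP.abs-* (ℤD._∣_.quotient gY) (+ GCD.gcd b ∣ Y ∣))))
        (ℕDM.m*n/n≡m ∣ ℤD._∣_.quotient gY ∣ (GCD.gcd b ∣ Y ∣))

    abstract
      square-denominator : ∀ b a Y m w → 1 ℕ.≤ b → Cop.Coprime ∣ a ∣ b →
        Y ℤ.* Y ℤ.+ + b ℤ.* m ℤ.* Y ≡ + b ℤ.* (a ℤ.* a ℤ.* a ℤ.+ + b ℤ.* w) →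
        ∃₂ λ g Y′ → b ≡ g ℕ.* g × Y ≡ + g ℤ.* Y′
      square-denominator b a Y m w 1≤b cop h = let (g , b′ , Y′ , 1≤g , cop′ , b≡ , Y≡) = split-gcd b Y 1≤b in
        g , Y′ , square-denominator′ b a Y m w g b′ Y′ 1≤g cop cop′ b≡ Y≡ h , Y≡

    root-positive : ∀ {b} g → 1 ℕ.≤ b → b ≡ g ℕ.* g → 1 ℕ.≤ g
    root-positive zero () refl
    root-positive (suc g) _ _ = ℕ.s≤s ℕ.z≤n

    coprime-ℚ : ∀ x → Cop.Coprime ∣ ↥ x ∣ (↧ₙ x)
    coprime-ℚ (mkℚ _ _ c) = Cop.recompute c

  record IntPoint (E : Curve) (x y : ℚ) : Set where
    open Curve E
    field
      A C : ℤ
      D : ℕ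
      D≥1 : 1 ℕ.≤ D
      denominator : ↧ₙ x ≡ D ℕ.* D
      x≡ : x ℚ.* ι (+ D ℤ.* + D) ≡ ι A
      y≡ : y ℚ.* ι (+ D ℤ.* + D ℤ.* + D) ≡ ι C
      unimodular : ∃₂ λ r s → r ℤ.* A ℤ.+ s ℤ.* (+ D ℤ.* + D) ≡ 1ℤ
      equation : C ℤ.* C ℤ.+ a1 ℤ.* A ℤ.* C ℤ.* + D ℤ.+ a3 ℤ.* C ℤ.* (+ D ℤ.* + D ℤ.* + D)
        ≡ A ℤ.* A ℤ.* A ℤ.+ a2 ℤ.* A ℤ.* A ℤ.* (+ D ℤ.* + D) ℤ.+ a4 ℤ.* A ℤ.* (+ D ℤ.* + D ℤ.* + D ℤ.* + D)
          ℤ.+ a6 ℤ.* (+ D ℤ.* + D ℤ.* + D ℤ.* + D ℤ.* + D ℤ.* + D)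

  -- Let b be the denominator of x. Then y b² is a root of a monic quadratic over ℤ, so it is an
  -- integer Y; `square-denominator` gives b = D² and D ∣ Y, whence y D³ = Y / D is an integer as
  -- well.
  int-point : ∀ E {x y} → Group.On (toW E) (x , y) → IntPoint E x y
  int-point E@(curve a1 a2 a3 a4 a6) {x} {y} on = record
    { A = a ; C = C ; D = D ; D≥1 = D≥1 ; denominator = b≡ ; x≡ = x≡ ; y≡ = y≡
    ; unimodular = subst (λ t → ∃₂ λ r s → r ℤ.* a ℤ.+ s ℤ.* t ≡ 1ℤ) b+≡ (bézout a (+ b) cop)
    ; equation = transfer (a1 ∷ a2 ∷ a3 ∷ a4 ∷ a6 ∷ a ∷ C ∷ + D ∷ []) (λ a1 a2 a3 a4 a6 A C d →
          C :* C :+ a1 :* A :* C :* d :+ a3 :* C :* (d :* d :* d) :=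
          A :* A :* A :+ a2 :* A :* A :* (d :* d) :+ a4 :* A :* (d :* d :* d :* d) :+ a6 :* (d :* d :* d :* d :* d :* d))
        (subst₂ (λ A C → C ℚ.* C ℚ.+ ι a1 ℚ.* A ℚ.* C ℚ.* d ℚ.+ ι a3 ℚ.* C ℚ.* (d ℚ.* d ℚ.* d) ≡
            A ℚ.* A ℚ.* A ℚ.+ ι a2 ℚ.* A ℚ.* A ℚ.* (d ℚ.* d) ℚ.+ ι a4 ℚ.* A ℚ.* (d ℚ.* d ℚ.* d ℚ.* d) ℚ.+ ι a6 ℚ.* (d ℚ.* d ℚ.* d ℚ.* d ℚ.* d ℚ.* d))
          (trans (cong (x ℚ.*_) (sym (ι-* (+ D) (+ D)))) x≡)
          (trans (cong (y ℚ.*_) (trans (cong (ℚ._* d) (sym (ι-* (+ D) (+ D)))) (sym (ι-* (+ D ℤ.* + D) (+ D))))) y≡)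
          (Shℚ.integral-curve {ι a1} {ι a2} {ι a3} {ι a4} {ι a6} {x} {y} {d} on)) }
    where
    a = ↥ x
    b = ↧ₙ x
    cop : Cop.Coprime ∣ a ∣ b
    cop = coprime-ℚ x
    1≤b : 1 ℕ.≤ b
    1≤b = ℕ.s≤s ℕ.z≤n
    m w u : ℤ
    m = a1 ℤ.* a ℤ.+ a3 ℤ.* + b
    w = a2 ℤ.* a ℤ.* a ℤ.+ a4 ℤ.* a ℤ.* + b ℤ.+ a6 ℤ.* + b ℤ.* + b
    u = + b ℤ.* (a ℤ.* a ℤ.* a ℤ.+ + b ℤ.* w)
    z : ℚ
    z = y ℚ.* (ι (+ b) ℚ.* ι (+ b))
    eqℚ : z ℚ.* z ℚ.+ ι (+ b ℤ.* m) ℚ.* z ≡ ι u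
    eqℚ = trans (cong (λ t → z ℚ.* z ℚ.+ t ℚ.* z) (hom-eval (M-expr) (a1 ∷ a2 ∷ a3 ∷ a4 ∷ a6 ∷ a ∷ + b ∷ [])))
      (trans (subst (λ t → z ℚ.* z ℚ.+ ι (+ b) ℚ.* (ι a1 ℚ.* t ℚ.+ ι a3 ℚ.* ι (+ b)) ℚ.* z ≡
          ι (+ b) ℚ.* (t ℚ.* t ℚ.* t ℚ.+ ι (+ b) ℚ.* (ι a2 ℚ.* t ℚ.* t ℚ.+ ι a4 ℚ.* t ℚ.* ι (+ b) ℚ.+ ι a6 ℚ.* ι (+ b) ℚ.* ι (+ b)))) (x*↧x x)
        (Shℚ.monic {ι a1} {ι a2} {ι a3} {ι a4} {ι a6} {x} {y} {ι (+ b)} on))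
        (sym (hom-eval U-expr (a1 ∷ a2 ∷ a3 ∷ a4 ∷ a6 ∷ a ∷ + b ∷ []))))
      where
      M-expr U-expr : Sℤ.Expr 7
      M-expr = (λ a1 a2 a3 a4 a6 a b → b :* (a1 :* a :+ a3 :* b)) $ⁿ Sℤ.vars {7}
      U-expr = (λ a1 a2 a3 a4 a6 a b → b :* (a :* a :* a :+ b :* (a2 :* a :* a :+ a4 :* a :* b :+ a6 :* b :* b))) $ⁿ Sℤ.vars {7}
    rr = rational-root z (+ b ℤ.* m) u eqℚ
    Y = proj₁ rr
    eqℤ : Y ℤ.* Y ℤ.+ + b ℤ.* m ℤ.* Y ≡ + b ℤ.* (a ℤ.* a ℤ.* a ℤ.+ + b ℤ.* w)
    eqℤ = transfer (Y ∷ + b ℤ.* m ∷ u ∷ []) (λ Y k u → Y :* Y :+ k :* Y := u)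
      (subst (λ z → z ℚ.* z ℚ.+ ι (+ b ℤ.* m) ℚ.* z ≡ ι u) (proj₂ rr) eqℚ)
    sq = square-denominator b a Y m w 1≤b cop eqℤ
    D = proj₁ sq
    C = proj₁ (proj₂ sq)
    d = ι (+ D)
    b≡ : b ≡ D ℕ.* D
    b≡ = proj₁ (proj₂ (proj₂ sq))
    b+≡ : + b ≡ + D ℤ.* + D
    b+≡ = trans (cong +_ b≡) (ℤP.pos-* D D)
    D≥1 : 1 ℕ.≤ D
    D≥1 = root-positive D 1≤b b≡
    x≡ : x ℚ.* ι (+ D ℤ.* + D) ≡ ι a
    x≡ = trans (cong (λ t → x ℚ.* ι t) (sym b+≡)) (x*↧x x)
    d≢0 : d ≢ 0ℚ
    d≢0 e = ℕP.<-irrefl (sym (ℤP.+-injective (ι-injective {+ D} {+ 0} e))) D≥1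
    y≡ : y ℚ.* ι (+ D ℤ.* + D ℤ.* + D) ≡ ι C
    y≡ = ℚ-cancel (trans (cong (λ t → d ℚ.* (y ℚ.* t)) (trans (ι-* (+ D ℤ.* + D) (+ D)) (cong (ℚ._* d) (ι-* (+ D) (+ D)))))
      (trans (Sℚ.solve (y ∷ d ∷ []) (λ y d → d Sℚ.:* (y Sℚ.:* (d Sℚ.:* d Sℚ.:* d)) Sℚ.:= y Sℚ.:* ((d Sℚ.:* d) Sℚ.:* (d Sℚ.:* d))) refl)
      (trans (cong (λ t → y ℚ.* (t ℚ.* t)) (trans (sym (ι-* (+ D) (+ D))) (cong ι (sym b+≡))))
      (trans (proj₂ rr) (trans (cong ι (proj₂ (proj₂ (proj₂ sq)))) (ι-* (+ D) C))))))
      where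
      module Sℚ = Solver ℚring
      ℚ-cancel : ∀ {s t} → d ℚ.* s ≡ d ℚ.* t → s ≡ t
      ℚ-cancel {s} {t} e = [ (λ e → ⊥-elim (d≢0 e)) , Sℚ.x-y≈0⇒x≈y ]′ (noZeroDivisors-ℚ d (s ℚ.- t)
        (trans (Sℚ.solve (d ∷ s ∷ t ∷ []) (λ d s t → d Sℚ.:* (s Sℚ.:- t) Sℚ.:= d Sℚ.:* s Sℚ.:- d Sℚ.:* t) refl) (Sℚ.x≈y⇒x-y≈0 e)))

  module _ {p : ℕ} (pp : Prime p) {q : ℚ} {n m : ℤ} (q*n≡m : q ℚ.* ℤtoℚ n ≡ ℤtoℚ m) (p∤n : ¬ (p ℕD.∣ ∣ n ∣)) where
    private
      cross : n ℤ.* ↥ q ≡ m ℤ.* ↧ q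
      cross = transfer (n ∷ ↥ q ∷ m ∷ ↧ q ∷ []) (λ n a m b → n :* a := m :* b)
        (trans (cong (ι n ℚ.*_) (sym (x*↧x q))) (trans (Sℚ.solve (q ∷ ι n ∷ ι (↧ q) ∷ []) (λ q n b → n Sℚ.:* (q Sℚ.:* b) Sℚ.:= (q Sℚ.:* n) Sℚ.:* b) refl)
          (cong (ℚ._* ι (↧ q)) q*n≡m)))
        where module Sℚ = Solver ℚring
      divides-numerator : p ℕD.∣ ∣ m ∣ ℕ.* ↧ₙ q → p ℕD.∣ ∣ ↥ q ∣
      divides-numerator h = [ (λ k → ⊥-elim (p∤n k)) , (λ k → k) ]′ (euclidsLemma ∣ n ∣ ∣ ↥ q ∣ pp
        (subst (p ℕD.∣_) (trans (sym (ℤP.abs-* m (↧ q))) (trans (cong ∣_∣ (sym cross)) (ℤP.abs-* n (↥ q)))) h))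

    fraction-PInt : PInt p q
    fraction-PInt h = ¬prime[1] (subst Prime (coprime-ℚ q (divides-numerator (ℕD.∣n⇒∣m*n ∣ m ∣ h) , h)) pp)

    fraction-PDiv : p ℕD.∣ ∣ m ∣ → PDiv p q
    fraction-PDiv h = divides-numerator (ℕD.∣m⇒∣m*n (↧ₙ q) h)

-- The integer sequences A, C, D and the relations between their terms

module Sequence where
  open import Defs
  open import Data.Integer using (+_; _+_; _*_; _-_; -_)
  open import Data.Rational as ℚ using (ℚ; 0ℚ; ↧ₙ_)
  open import Data.Vec as Vec using ([]; _∷_)
  open import Relation.Binary.Definitions using (tri<; tri≈; tri>)
  open import Relation.Binary.PropositionalEquality hiding ([_])
  open Points
  open Model

  module Invariants (E : Curve) where
    open Curve E public
    β2 β4 β6 β8 : ℤ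
    β2 = a1 * a1 + + 4 * a2
    β4 = + 2 * a4 + a1 * a3
    β6 = a3 * a3 + + 4 * a6
    β8 = a1 * a1 * a6 + + 4 * a2 * a6 - a1 * a3 * a4 + a2 * a3 * a3 - a4 * a4

  module Fℤ = Forms ℤring
  private
    module Fℚ = Forms ℚring

  -- x([n]P) = A n / (D n)², y([n]P) = C n / (D n)³; the point O corresponds to A 0 = 1, D 0 = 0.
  record EllSeq (E : Curve) : Set where
    open Invariants E
    field
      A C : ℕ → ℤ
      D : ℕ → ℕ
    B : ℕ → ℤ
    B n = + D n * + D n
    field
      A₀ : A 0 ≡ 1ℤ
      D₀ : D 0 ≡ 0
      D≥1 : ∀ n → 1 ℕ.≤ n → 1 ℕ.≤ D n
      unimodular : ∀ n → ∃₂ λ r s → r * A n + s * B n ≡ 1ℤ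
      equation : ∀ n → 1 ℕ.≤ n → let d = + D n in
        C n * C n + a1 * A n * C n * d + a3 * C n * (d * d * d)
          ≡ A n * A n * A n + a2 * A n * A n * (d * d) + a4 * A n * (d * d * d * d) + a6 * (d * d * d * d * d * d)
      -- Here m = a + b and k = a - b, the latter written without subtraction. The two index
      -- equations are arguments, so that multiples such as j * a can be supplied in the shape in
      -- which they occur.
      biquadratic : ∀ {a b m k} → a ≡ b ℕ.+ k → m ≡ a ℕ.+ b → ∃ λ c →
        Fℤ.H (A a) (B a) (A b) (B b) * Fℤ.H (A a) (B a) (A b) (B b) ≡ c * (B m * B k) ×
        Fℤ.Sₕ β2 β4 β6 (A a) (B a) (A b) (B b) ≡ c * (A m * B k + A k * B m) ×
        Fℤ.Πₕ β4 β6 β8 (A a) (B a) (A b) (B b) ≡ c * (A m * A k)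

  private
    ι = ℤtoℚ
    module Sℤ = Solver ℤring

    sumℚ : ∀ b2 b4 b6 {x b a x′ b′ a′ x₊ b₊ a₊ x₋ b₋ a₋} → x ℚ.* b ≡ a → x′ ℚ.* b′ ≡ a′ → x₊ ℚ.* b₊ ≡ a₊ → x₋ ℚ.* b₋ ≡ a₋ →
      (x ℚ.- x′) ℚ.* (x ℚ.- x′) ℚ.* (x₊ ℚ.+ x₋) ≡ Solver.fromℤ ℚring (+ 2) ℚ.* x ℚ.* x′ ℚ.* (x ℚ.+ x′) ℚ.+ b2 ℚ.* x ℚ.* x′ ℚ.+ b4 ℚ.* (x ℚ.+ x′) ℚ.+ b6 →
      Fℚ.H a b a′ b′ ℚ.* Fℚ.H a b a′ b′ ℚ.* (a₊ ℚ.* b₋ ℚ.+ a₋ ℚ.* b₊) ≡ Fℚ.Sₕ b2 b4 b6 a b a′ b′ ℚ.* (b₊ ℚ.* b₋)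
    sumℚ b2 b4 b6 {x} {b} {_} {x′} {b′} {_} {x₊} {b₊} {_} {x₋} {b₋} refl refl refl refl h =
      Fℚ.homogenize-sum {b2} {b4} {b6} {0ℚ} {x} {b} {x′} {b′} {x₊} {b₊} {x₋} {b₋} h

    prodℚ′ : ∀ b4 b6 b8 {x b a x′ b′ a′ x₊ b₊ a₊ x₋ b₋ a₋} → x ℚ.* b ≡ a → x′ ℚ.* b′ ≡ a′ → x₊ ℚ.* b₊ ≡ a₊ → x₋ ℚ.* b₋ ≡ a₋ →
      (x ℚ.- x′) ℚ.* (x ℚ.- x′) ℚ.* (x₊ ℚ.* x₋) ≡ x ℚ.* x ℚ.* x′ ℚ.* x′ ℚ.- b4 ℚ.* x ℚ.* x′ ℚ.- b6 ℚ.* (x ℚ.+ x′) ℚ.- b8 →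
      Fℚ.H a b a′ b′ ℚ.* Fℚ.H a b a′ b′ ℚ.* (a₊ ℚ.* a₋) ≡ Fℚ.Πₕ b4 b6 b8 a b a′ b′ ℚ.* (b₊ ℚ.* b₋)
    prodℚ′ b4 b6 b8 {x} {b} {_} {x′} {b′} {_} {x₊} {b₊} {_} {x₋} {b₋} refl refl refl refl h =
      Fℚ.homogenize-prod {0ℚ} {b4} {b6} {b8} {x} {b} {x′} {b′} {x₊} {b₊} {x₋} {b₋} h

    doubleℚ : ∀ b2 b4 b6 b8 {x b a x₊ b₊ a₊} → x ℚ.* b ≡ a → x₊ ℚ.* b₊ ≡ a₊ →
      (Solver.fromℤ ℚring (+ 2) ℚ.* x ℚ.* x ℚ.* (x ℚ.+ x) ℚ.+ b2 ℚ.* x ℚ.* x ℚ.+ b4 ℚ.* (x ℚ.+ x) ℚ.+ b6) ℚ.* x₊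
        ≡ x ℚ.* x ℚ.* x ℚ.* x ℚ.- b4 ℚ.* x ℚ.* x ℚ.- b6 ℚ.* (x ℚ.+ x) ℚ.- b8 →
      Fℚ.Sₕ b2 b4 b6 a b a b ℚ.* a₊ ≡ Fℚ.Πₕ b4 b6 b8 a b a b ℚ.* b₊
    doubleℚ b2 b4 b6 b8 {x} {b} {_} {x₊} {b₊} refl refl h =
      Fℚ.homogenize-double {b2} {b4} {b6} {b8} {x} {b} {0ℚ} {0ℚ} {x₊} {b₊} {0ℚ} {0ℚ} h

    third-proportion : ∀ {v₁ v₂ v₃ w₁ w₂ w₃} → w₁ ≢ 0ℤ → v₁ * w₂ ≡ v₂ * w₁ → v₁ * w₃ ≡ v₃ * w₁ → v₂ * w₃ ≡ v₃ * w₂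
    third-proportion {v₁} {v₂} {v₃} {w₁} {w₂} {w₃} w₁≢0 p q = ℤP.*-cancelˡ-≡ w₁ _ _ {{ℤ.≢-nonZero w₁≢0}}
      (trans (S.solve (v₂ ∷ w₁ ∷ w₃ ∷ []) (λ v₂ w₁ w₃ → w₁ S.:* (v₂ S.:* w₃) S.:= (v₂ S.:* w₁) S.:* w₃) refl)
      (trans (cong (_* w₃) (sym p)) (trans (S.solve (v₁ ∷ w₂ ∷ w₃ ∷ []) (λ v₁ w₂ w₃ → (v₁ S.:* w₂) S.:* w₃ S.:= (v₁ S.:* w₃) S.:* w₂) refl)
      (trans (cong (_* w₂) q) (S.solve (v₃ ∷ w₁ ∷ w₂ ∷ []) (λ v₃ w₁ w₂ → (v₃ S.:* w₁) S.:* w₂ S.:= w₁ S.:* (v₃ S.:* w₂)) refl)))))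
      where module S = Solver ℤring

    module S = Solver ℤring
    open S using (_:+_; _:*_; _:-_; :-_; _:=_; con; Expr)

    module BE {n} (a1 a2 a3 a4 a6 : Expr n) where
      e2 e4 e6 e8 : Expr n
      e2 = a1 :* a1 :+ con (+ 4) :* a2
      e4 = con (+ 2) :* a4 :+ a1 :* a3
      e6 = a3 :* a3 :+ con (+ 4) :* a6
      e8 = a1 :* a1 :* a6 :+ con (+ 4) :* a2 :* a6 :- a1 :* a3 :* a4 :+ a2 :* a3 :* a3 :- a4 :* a4

  module Integral (E : Curve) (x y : ℕ → ℚ) (pts : ∀ k → IntPoint E (x k) (y k))
    (X-sum : ∀ b k → (x (suc (b ℕ.+ k)) ℚ.- x b) ℚ.* (x (suc (b ℕ.+ k)) ℚ.- x b) ℚ.* (x (suc (suc (b ℕ.+ k) ℕ.+ b)) ℚ.+ x k) ≡ Group.S (toW E) (x (suc (b ℕ.+ k))) (x b))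
    (X-prod : ∀ b k → (x (suc (b ℕ.+ k)) ℚ.- x b) ℚ.* (x (suc (b ℕ.+ k)) ℚ.- x b) ℚ.* (x (suc (suc (b ℕ.+ k) ℕ.+ b)) ℚ.* x k) ≡ Group.Π (toW E) (x (suc (b ℕ.+ k))) (x b))
    (X-double : ∀ a → Group.S (toW E) (x a) (x a) ℚ.* x (suc (a ℕ.+ a)) ≡ Group.Π (toW E) (x a) (x a)) where

    open Invariants E
    private
      module L = Group (toW E)

    A C : ℕ → ℤ
    A zero = 1ℤ
    A (suc k) = IntPoint.A (pts k)
    C zero = 1ℤ
    C (suc k) = IntPoint.C (pts k)
    D : ℕ → ℕ
    D zero = 0
    D (suc k) = IntPoint.D (pts k)
    B : ℕ → ℤ
    B n = + D n * + D n

    D≥1 : ∀ n → 1 ℕ.≤ n → 1 ℕ.≤ D n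
    D≥1 (suc k) _ = IntPoint.D≥1 (pts k)

    unimodular : ∀ n → ∃₂ λ r s → r * A n + s * B n ≡ 1ℤ
    unimodular zero = 1ℤ , 0ℤ , refl
    unimodular (suc k) = IntPoint.unimodular (pts k)

    B≢0 : ∀ k → B (suc k) ≢ 0ℤ
    B≢0 k e = [ D≢0 , D≢0 ]′ (ℤP.i*j≡0⇒i≡0∨j≡0 (+ D (suc k)) e)
      where
      D≢0 : + D (suc k) ≢ 0ℤ
      D≢0 e = ℕP.<-irrefl (sym (ℤP.+-injective e)) (D≥1 (suc k) (ℕ.s≤s ℕ.z≤n))

    Biquadratic : (a b m k : ℕ) → Set
    Biquadratic a b m k = ∃ λ c →
      Fℤ.H (A a) (B a) (A b) (B b) * Fℤ.H (A a) (B a) (A b) (B b) ≡ c * (B m * B k) ×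
      Fℤ.Sₕ β2 β4 β6 (A a) (B a) (A b) (B b) ≡ c * (A m * B k + A k * B m) ×
      Fℤ.Πₕ β4 β6 β8 (A a) (B a) (A b) (B b) ≡ c * (A m * A k)

    proportional : ∀ a b m k → let h = Fℤ.H (A a) (B a) (A b) (B b)
                                   s = Fℤ.Sₕ β2 β4 β6 (A a) (B a) (A b) (B b)
                                   π = Fℤ.Πₕ β4 β6 β8 (A a) (B a) (A b) (B b) in
      h * h * (A m * B k + A k * B m) ≡ s * (B m * B k) → h * h * (A m * A k) ≡ π * (B m * B k) →
      s * (A m * A k) ≡ π * (A m * B k + A k * B m) → Biquadratic a b m k
    proportional a b m k p₁₂ p₁₃ p₂₃ = let (r , s , u) = unimodular m
                                           (r′ , s′ , u′) = unimodular k in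
      Fℤ.proportional {A m} {B m} {A k} {B k} {r} {s} {r′} {s′} u u′
        (Fℤ.H (A a) (B a) (A b) (B b) * Fℤ.H (A a) (B a) (A b) (B b))
        (Fℤ.Sₕ β2 β4 β6 (A a) (B a) (A b) (B b)) (Fℤ.Πₕ β4 β6 β8 (A a) (B a) (A b) (B b)) p₁₂ p₁₃ p₂₃

    zero-case : ∀ k → Biquadratic k 0 k k
    zero-case k = 1ℤ ,
      S.solve (A k ∷ B k ∷ []) (λ a b → (a :* con (+ 0) :- con (+ 1) :* b) :* (a :* con (+ 0) :- con (+ 1) :* b) := con (+ 1) :* (b :* b)) refl ,
      S.solve (β2 ∷ β4 ∷ β6 ∷ A k ∷ B k ∷ []) (λ b2 b4 b6 a b → Fℤ.Sₑ b2 b4 b6 a b (con (+ 1)) (con (+ 0)) := con (+ 1) :* (a :* b :+ a :* b)) refl ,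
      S.solve (β4 ∷ β6 ∷ β8 ∷ A k ∷ B k ∷ []) (λ b4 b6 b8 a b → Fℤ.Πₑ b4 b6 b8 a b (con (+ 1)) (con (+ 0)) := con (+ 1) :* (a :* a)) refl

    sumℤ : ∀ a b m k →
      (x a ℚ.- x b) ℚ.* (x a ℚ.- x b) ℚ.* (x m ℚ.+ x k) ≡ L.S (x a) (x b) →
      let h = Fℤ.H (A (suc a)) (B (suc a)) (A (suc b)) (B (suc b)) in
      h * h * (A (suc m) * B (suc k) + A (suc k) * B (suc m)) ≡ Fℤ.Sₕ β2 β4 β6 (A (suc a)) (B (suc a)) (A (suc b)) (B (suc b)) * (B (suc m) * B (suc k))
    sumℤ a b m k h = transfer (a1 ∷ a2 ∷ a3 ∷ a4 ∷ a6 ∷ A (suc a) ∷ B (suc a) ∷ A (suc b) ∷ B (suc b) ∷ A (suc m) ∷ B (suc m) ∷ A (suc k) ∷ B (suc k) ∷ [])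
      (λ a1 a2 a3 a4 a6 a b a′ b′ a₊ b₊ a₋ b₋ → let open BE a1 a2 a3 a4 a6
                                                    h = a :* b′ :- a′ :* b in
        h :* h :* (a₊ :* b₋ :+ a₋ :* b₊) := Fℤ.Sₑ e2 e4 e6 a b a′ b′ :* (b₊ :* b₋))
      (sumℚ L.b2 L.b4 L.b6 {x a} {ι (B (suc a))} {ι (A (suc a))} {x b} {ι (B (suc b))} {ι (A (suc b))} {x m} {ι (B (suc m))} {ι (A (suc m))} {x k} {ι (B (suc k))} {ι (A (suc k))} (IntPoint.x≡ (pts a)) (IntPoint.x≡ (pts b)) (IntPoint.x≡ (pts m)) (IntPoint.x≡ (pts k)) h)

    prodℤ : ∀ a b m k →
      (x a ℚ.- x b) ℚ.* (x a ℚ.- x b) ℚ.* (x m ℚ.* x k) ≡ L.Π (x a) (x b) →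
      let h = Fℤ.H (A (suc a)) (B (suc a)) (A (suc b)) (B (suc b)) in
      h * h * (A (suc m) * A (suc k)) ≡ Fℤ.Πₕ β4 β6 β8 (A (suc a)) (B (suc a)) (A (suc b)) (B (suc b)) * (B (suc m) * B (suc k))
    prodℤ a b m k h = transfer (a1 ∷ a2 ∷ a3 ∷ a4 ∷ a6 ∷ A (suc a) ∷ B (suc a) ∷ A (suc b) ∷ B (suc b) ∷ A (suc m) ∷ B (suc m) ∷ A (suc k) ∷ B (suc k) ∷ [])
      (λ a1 a2 a3 a4 a6 a b a′ b′ a₊ b₊ a₋ b₋ → let open BE a1 a2 a3 a4 a6
                                                    h = a :* b′ :- a′ :* b in
        h :* h :* (a₊ :* a₋) := Fℤ.Πₑ e4 e6 e8 a b a′ b′ :* (b₊ :* b₋))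
      (prodℚ′ L.b4 L.b6 L.b8 {x a} {ι (B (suc a))} {ι (A (suc a))} {x b} {ι (B (suc b))} {ι (A (suc b))} {x m} {ι (B (suc m))} {ι (A (suc m))} {x k} {ι (B (suc k))} {ι (A (suc k))} (IntPoint.x≡ (pts a)) (IntPoint.x≡ (pts b)) (IntPoint.x≡ (pts m)) (IntPoint.x≡ (pts k)) h)

    doubleℤ : ∀ a m →
      L.S (x a) (x a) ℚ.* x m ≡ L.Π (x a) (x a) →
      Fℤ.Sₕ β2 β4 β6 (A (suc a)) (B (suc a)) (A (suc a)) (B (suc a)) * A (suc m) ≡ Fℤ.Πₕ β4 β6 β8 (A (suc a)) (B (suc a)) (A (suc a)) (B (suc a)) * B (suc m)
    doubleℤ a m h = transfer (a1 ∷ a2 ∷ a3 ∷ a4 ∷ a6 ∷ A (suc a) ∷ B (suc a) ∷ A (suc m) ∷ B (suc m) ∷ [])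
      (λ a1 a2 a3 a4 a6 a b a₊ b₊ → let open BE a1 a2 a3 a4 a6 in
        Fℤ.Sₑ e2 e4 e6 a b a b :* a₊ := Fℤ.Πₑ e4 e6 e8 a b a b :* b₊)
      (doubleℚ L.b2 L.b4 L.b6 L.b8 {x a} {ι (B (suc a))} {ι (A (suc a))} {x m} {ι (B (suc m))} {ι (A (suc m))} (IntPoint.x≡ (pts a)) (IntPoint.x≡ (pts m)) h)

    -- Since [a-a]P = O has B = 0, the first entry of the target vector vanishes and the division in
    -- `third-proportion` is impossible; the remaining proportion is the duplication formula itself.
    double-case : ∀ a m →
      L.S (x a) (x a) ℚ.* x m ≡ L.Π (x a) (x a) → Biquadratic (suc a) (suc a) (suc m) 0
    double-case a m h = proportional (suc a) (suc a) (suc m) 0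
      (S.solve (A (suc a) ∷ B (suc a) ∷ A (suc m) ∷ B (suc m) ∷ s ∷ []) (λ a b a₊ b₊ s → let h = a :* b :- a :* b in
         h :* h :* (a₊ :* con (+ 0) :+ con (+ 1) :* b₊) := s :* (b₊ :* con (+ 0))) refl)
      (S.solve (A (suc a) ∷ B (suc a) ∷ A (suc m) ∷ B (suc m) ∷ π ∷ []) (λ a b a₊ b₊ p → let h = a :* b :- a :* b in
         h :* h :* (a₊ :* con (+ 1)) := p :* (b₊ :* con (+ 0))) refl)
      (trans (cong (s *_) (ℤP.*-identityʳ (A (suc m)))) (trans (doubleℤ a m h)
        (S.solve (π ∷ A (suc m) ∷ B (suc m) ∷ []) (λ p a b → p :* b := p :* (a :* con (+ 0) :+ con (+ 1) :* b)) refl)))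
      where
      s = Fℤ.Sₕ β2 β4 β6 (A (suc a)) (B (suc a)) (A (suc a)) (B (suc a))
      π = Fℤ.Πₕ β4 β6 β8 (A (suc a)) (B (suc a)) (A (suc a)) (B (suc a))

    general-case : ∀ a b m k →
      (x a ℚ.- x b) ℚ.* (x a ℚ.- x b) ℚ.* (x m ℚ.+ x k) ≡ L.S (x a) (x b) →
      (x a ℚ.- x b) ℚ.* (x a ℚ.- x b) ℚ.* (x m ℚ.* x k) ≡ L.Π (x a) (x b) → Biquadratic (suc a) (suc b) (suc m) (suc k)
    general-case a b m k hs hp = proportional (suc a) (suc b) (suc m) (suc k) (sumℤ a b m k hs) (prodℤ a b m k hp)
      (third-proportion {h * h} {s} {π} {B (suc m) * B (suc k)} {A (suc m) * B (suc k) + A (suc k) * B (suc m)} {A (suc m) * A (suc k)} (λ e → [ B≢0 m , B≢0 k ]′ (ℤP.i*j≡0⇒i≡0∨j≡0 (B (suc m)) e)) (sumℤ a b m k hs) (prodℤ a b m k hp))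
      where
      h = Fℤ.H (A (suc a)) (B (suc a)) (A (suc b)) (B (suc b))
      s = Fℤ.Sₕ β2 β4 β6 (A (suc a)) (B (suc a)) (A (suc b)) (B (suc b))
      π = Fℤ.Πₕ β4 β6 β8 (A (suc a)) (B (suc a)) (A (suc b)) (B (suc b))

    private
      biq : ∀ b k → Biquadratic (b ℕ.+ k) b (b ℕ.+ k ℕ.+ b) k
      biq zero k = subst (λ m → Biquadratic k 0 m k) (sym (ℕP.+-identityʳ k)) (zero-case k)
      biq (suc b) zero = subst₂ (λ a m → Biquadratic (suc a) (suc b) (suc m) 0) (sym (ℕP.+-identityʳ b))
        (trans (sym (ℕP.+-suc b b)) (cong (ℕ._+ suc b) (sym (ℕP.+-identityʳ b)))) (double-case b (suc (b ℕ.+ b)) (X-double b))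
      biq (suc b) (suc k) = subst₂ (λ a m → Biquadratic (suc a) (suc b) (suc m) (suc k)) (sym (ℕP.+-suc b k))
        (trans (sym (ℕP.+-suc (suc (b ℕ.+ k)) b)) (cong (ℕ._+ suc b) (sym (ℕP.+-suc b k))))
        (general-case (suc (b ℕ.+ k)) b (suc (suc (b ℕ.+ k) ℕ.+ b)) k (X-sum b k) (X-prod b k))

    ellSeq : EllSeq E
    ellSeq = record
      { A = A ; C = C ; D = D ; A₀ = refl ; D₀ = refl ; D≥1 = D≥1 ; unimodular = unimodular
      ; equation = λ { (suc k) _ → IntPoint.equation (pts k) }
      ; biquadratic = λ { {_} {b} {_} {k} refl refl → biq b k } }

  module Build (E : Curve) (x₀ y₀ : ℚ) (on₀ : F (toW E) x₀ y₀ ≡ 0ℚ)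
    (inf : ∀ n → 1 ℕ.≤ n → mul (toW E) (aff x₀ y₀) n ≢ O) where

    private
      module M = Multiples (toW E) x₀ y₀ on₀ inf

      pts : ∀ k → IntPoint E (proj₁ (M.mP k)) (proj₂ (M.mP k))
      pts k = int-point E (M.on-mP k)

      module I = Integral E (λ k → proj₁ (M.mP k)) (λ k → proj₂ (M.mP k)) pts M.X-sum M.X-prod M.X-double

    ellSeq : EllSeq E
    ellSeq = I.ellSeq

    base-x : ↧ₙ x₀ ≡ EllSeq.D ellSeq 1 ℕ.* EllSeq.D ellSeq 1 × x₀ ℚ.* ι (+ EllSeq.D ellSeq 1 * + EllSeq.D ellSeq 1) ≡ ι (EllSeq.A ellSeq 1)
    base-x = IntPoint.denominator (pts 0) , IntPoint.x≡ (pts 0)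

    base-y : y₀ ℚ.* ι (+ EllSeq.D ellSeq 1 * + EllSeq.D ellSeq 1 * + EllSeq.D ellSeq 1) ≡ ι (EllSeq.C ellSeq 1)
    base-y = IntPoint.y≡ (pts 0)

    open EDS E (aff x₀ y₀) using (Dterm)

    Dterm-D : ∀ n → 1 ℕ.≤ n → Dterm n (EllSeq.D ellSeq n)
    Dterm-D (suc k) _ = proj₁ (M.mP k) , proj₂ (M.mP k) , M.mul-mP k , IntPoint.denominator (pts k)

    private
      square-injective : ∀ m n → m ℕ.* m ≡ n ℕ.* n → m ≡ n
      square-injective m n e with ℕP.<-cmp m n
      ... | tri< m<n _ _ = ⊥-elim (ℕP.<-irrefl e (ℕP.*-mono-< m<n m<n))
      ... | tri≈ _ m≡n _ = m≡n
      ... | tri> _ _ n<m = ⊥-elim (ℕP.<-irrefl (sym e) (ℕP.*-mono-< n<m n<m))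

      aff-x : ∀ {x y x′ y′} → aff x y ≡ aff x′ y′ → x ≡ x′
      aff-x refl = refl

    Dterm-unique : ∀ {n d} → 1 ℕ.≤ n → Dterm n d → d ≡ EllSeq.D ellSeq n
    Dterm-unique {suc k} {d} _ (x , y , e , h) = square-injective d (I.D (suc k))
      (trans (sym h) (trans (cong ↧ₙ_ (aff-x (trans (sym e) (M.mul-mP k)))) (IntPoint.denominator (pts k))))

-- Quotient rings

module Quot {c ℓ : Level} (R : CommutativeRing c ℓ) (m : CommutativeRing.Carrier R) where
  open import Data.Vec using ([]; _∷_)
  open import Data.Integer using (+_)
  open CommutativeRing R
  open Solver R

  infix 4 _~_
  -- The quotient keeps the carrier and only coarsens the equality, so operations and numerals are
  -- literally those of R and integer terms can be moved between moduli unchanged.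
  _~_ : Carrier → Carrier → Set _
  x ~ y = ∃ λ q → x - y ≈ q * m

  ≈⇒~ : ∀ {x y} → x ≈ y → x ~ y
  ≈⇒~ h = 0# , trans (x≈y⇒x-y≈0 h) (sym (zeroˡ m))

  private
    ~-sym : ∀ {x y} → x ~ y → y ~ x
    ~-sym {x} {y} (q , h) = - q , comb (solve (x ∷ y ∷ q ∷ m ∷ []) (λ x y q m → (y :- x) :- (:- q) :* m := (:- con (+ 1)) :* ((x :- y) :- q :* m)) ≡.refl) (_ · h)

    ~-trans : ∀ {x y z} → x ~ y → y ~ z → x ~ z
    ~-trans {x} {y} {z} (q , h) (r , k) = q + r , comb (solve (x ∷ y ∷ z ∷ q ∷ r ∷ m ∷ []) (λ x y z q r m →
      (x :- z) :- (q :+ r) :* m := con (+ 1) :* ((x :- y) :- q :* m) :+ con (+ 1) :* ((y :- z) :- r :* m)) ≡.refl) (_ · h ⊕ _ · k)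

    ~-+ : ∀ {x y u v} → x ~ y → u ~ v → x + u ~ y + v
    ~-+ {x} {y} {u} {v} (q , h) (r , k) = q + r , comb (solve (x ∷ y ∷ u ∷ v ∷ q ∷ r ∷ m ∷ []) (λ x y u v q r m →
      ((x :+ u) :- (y :+ v)) :- (q :+ r) :* m := con (+ 1) :* ((x :- y) :- q :* m) :+ con (+ 1) :* ((u :- v) :- r :* m)) ≡.refl) (_ · h ⊕ _ · k)

    ~-* : ∀ {x y u v} → x ~ y → u ~ v → x * u ~ y * v
    ~-* {x} {y} {u} {v} (q , h) (r , k) = q * u + y * r , comb (solve (x ∷ y ∷ u ∷ v ∷ q ∷ r ∷ m ∷ []) (λ x y u v q r m →
      ((x :* u) :- (y :* v)) :- (q :* u :+ y :* r) :* m := u :* ((x :- y) :- q :* m) :+ y :* ((u :- v) :- r :* m)) ≡.refl) (_ · h ⊕ _ · k)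

    ~-neg : ∀ {x y} → x ~ y → - x ~ - y
    ~-neg {x} {y} (q , h) = - q , comb (solve (x ∷ y ∷ q ∷ m ∷ []) (λ x y q m → (:- x :- :- y) :- (:- q) :* m := (:- con (+ 1)) :* ((x :- y) :- q :* m)) ≡.refl) (_ · h)

  quotient : CommutativeRing c _
  quotient = record
    { Carrier = Carrier ; _≈_ = _~_ ; _+_ = _+_ ; _*_ = _*_ ; -_ = -_ ; 0# = 0# ; 1# = 1#
    ; isCommutativeRing = record
      { isRing = record
        { +-isAbelianGroup = record
          { isGroup = record
            { isMonoid = record
              { isSemigroup = record
                { isMagma = record
                  { isEquivalence = record { refl = ≈⇒~ refl ; sym = ~-sym ; trans = ~-trans }
                  ; ∙-cong = ~-+ }
                ; assoc = λ x y z → ≈⇒~ (+-assoc x y z) }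
              ; identity = (λ x → ≈⇒~ (+-identityˡ x)) , (λ x → ≈⇒~ (+-identityʳ x)) }
            ; inverse = (λ x → ≈⇒~ (-‿inverseˡ x)) , (λ x → ≈⇒~ (-‿inverseʳ x))
            ; ⁻¹-cong = ~-neg }
          ; comm = λ x y → ≈⇒~ (+-comm x y) }
        ; *-cong = ~-*
        ; *-assoc = λ x y z → ≈⇒~ (*-assoc x y z)
        ; *-identity = (λ x → ≈⇒~ (*-identityˡ x)) , (λ x → ≈⇒~ (*-identityʳ x))
        ; distrib = (λ x y z → ≈⇒~ (distribˡ x y z)) , (λ x y z → ≈⇒~ (distribʳ x y z)) }
      ; *-comm = λ x y → ≈⇒~ (*-comm x y) } }

  ~0⇒multiple : ∀ {x} → x ~ 0# → ∃ λ q → x ≈ q * m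
  ~0⇒multiple {x} (q , h) = q , comb (solve (x ∷ q ∷ m ∷ []) (λ x q m → x :- q :* m := con (+ 1) :* ((x :- con (+ 0)) :- q :* m)) ≡.refl) (_ · h)

  multiple⇒~0 : ∀ {x q} → x ≈ q * m → x ~ 0#
  multiple⇒~0 {x} {q} h = q , comb (solve (x ∷ q ∷ m ∷ []) (λ x q m → (x :- con (+ 0)) :- q :* m := con (+ 1) :* (x :- q :* m)) ≡.refl) (_ · h)

-- Additivity of the Frobenius

module Frob where
  open import Data.Nat using (_!; _∸_; _<_)
  open import Data.Nat.Divisibility using (_∣_; divides; ∣⇒≤; ∣1⇒≡1; m∣m*n)
  open import Data.Nat.Combinatorics using (_C_; nCn≡1; nCk≡n!/k![n-k]!; k![n∸k]!∣n!)
  open import Data.Fin as Fin using (Fin; zero; suc; toℕ; fromℕ; inject₁)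
  open ≡ using (_≡_)

  prime>1 : ∀ {p} → Prime p → 1 < p
  prime>1 pp = ℕ.nonTrivial⇒n>1 _ {{prime⇒nonTrivial pp}}

  prime∤! : ∀ {p} → Prime p → ∀ {k} → k < p → ¬ (p ∣ k !)
  prime∤! pp {zero} _ h = ℕP.<-irrefl (≡.sym (∣1⇒≡1 h)) (prime>1 pp)
  prime∤! pp {suc k} k<p h = [ (λ d → ℕP.<⇒≱ k<p (∣⇒≤ d)) , prime∤! pp (ℕP.<-trans (ℕP.n<1+n k) k<p) ]′ (euclidsLemma (suc k) (k !) pp h)

  n∣n! : ∀ n → 1 < n → n ∣ n !
  n∣n! (suc n) _ = m∣m*n (n !)

  prime∣C : ∀ {p} → Prime p → ∀ {k} → 0 < k → k < p → p ∣ p C k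
  prime∣C {p} pp {k} 0<k k<p = [ (λ d → d) , (λ d → ⊥-elim ([ prime∤! pp k<p , prime∤! pp p∸k<p ]′ (euclidsLemma (k !) ((p ∸ k) !) pp d))) ]′
    (euclidsLemma (p C k) (k ! ℕ.* (p ∸ k) !) pp (≡.subst (p ∣_) (≡.sym eq) p∣p!))
    where
    instance
      nz = k ℕP.!* (p ∸ k) !≢0
    eq : (p C k) ℕ.* (k ! ℕ.* (p ∸ k) !) ≡ p !
    eq = ≡.trans (≡.cong (ℕ._* (k ! ℕ.* (p ∸ k) !)) (nCk≡n!/k![n-k]! (ℕP.<⇒≤ k<p))) (ℕDM.m/n*n≡m (k![n∸k]!∣n! (ℕP.<⇒≤ k<p)))
    p∣p! : p ∣ p !
    p∣p! = n∣n! p (prime>1 pp)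
    p∸k<p : p ∸ k < p
    p∸k<p = ℕP.∸-monoʳ-< 0<k (ℕP.<⇒≤ k<p)

  module _ {c ℓ} (R : CommutativeRing c ℓ) where
    open CommutativeRing R hiding (zero)
    open Solver R using (fromℤ)
    open import Algebra.Properties.Semiring.Exp semiring using (_^_; ^-cong; ^-congˡ)
    open import Algebra.Properties.Semiring.Mult semiring renaming (_×_ to _⋆_)
    open import Algebra.Properties.Semiring.Mult.TCOptimised semiring using () renaming (×ᵤ≈× to ×ᵤ≈×′)
    open import Algebra.Properties.CommutativeSemiring.Binomial commutativeSemiring
    open import Algebra.Properties.Semiring.Sum semiring
    open import Data.Integer using (+_)
    open import Relation.Binary.Reasoning.Setoid setoid

    private
      sum-zero : ∀ {n} (f : Fin n → Carrier) → (∀ i → f i ≈ 0#) → sum f ≈ 0#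
      sum-zero {zero} f h = refl
      sum-zero {suc n} f h = trans (+-cong (h zero) (sum-zero (λ i → f (suc i)) (λ i → h (suc i)))) (+-identityˡ 0#)

      ×-kill : ∀ {p n} → p ⋆ 1# ≈ 0# → p ∣ n → ∀ x → n ⋆ x ≈ 0#
      ×-kill {p} {n} hp (divides q e) x = begin
        n ⋆ x                  ≈⟨ ×-congʳ n (*-identityˡ x) ⟨
        n ⋆ (1# * x)           ≈⟨ ×-assoc-* n 1# x ⟨
        (n ⋆ 1#) * x           ≈⟨ *-congʳ (trans (reflexive (≡.cong (_⋆ 1#) e)) (×1-homo-* q p)) ⟩
        ((q ⋆ 1#) * (p ⋆ 1#)) * x ≈⟨ *-congʳ (trans (*-congˡ hp) (zeroʳ _)) ⟩
        0# * x                 ≈⟨ zeroˡ x ⟩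
        0#                     ∎

    frobenius-+ : ∀ {p} → Prime p → fromℤ (+ p) ≈ 0# → ∀ x y → (x + y) ^ p ≈ x ^ p + y ^ p
    frobenius-+ {zero} pp _ = λ x y → ⊥-elim (ℕP.<⇒≱ (prime>1 pp) z≤n)
    frobenius-+ {suc zero} pp _ = λ x y → ⊥-elim (ℕP.<-irrefl ≡.refl (prime>1 pp))
    frobenius-+ {suc (suc q)} pp hp x y = begin
      (x + y) ^ p                                       ≈⟨ theorem p x y ⟩
      sum t                                             ≈⟨ +-congˡ (sum-init-last (λ i → t (suc i))) ⟩
      t zero + (sum (λ i → t (suc (inject₁ i))) + t (fromℕ p)) ≈⟨ +-cong t₀ (+-cong mid tₚ) ⟩
      y ^ p + (0# + x ^ p)                              ≈⟨ +-congˡ (+-identityˡ _) ⟩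
      y ^ p + x ^ p                                     ≈⟨ +-comm _ _ ⟩
      x ^ p + y ^ p                                     ∎
      where
      p = suc (suc q)
      hp′ : p ⋆ 1# ≈ 0#
      hp′ = trans (×ᵤ≈×′ p 1#) hp
      t : Fin (suc p) → Carrier
      t = binomialTerm x y p
      t₀ : t zero ≈ y ^ p
      t₀ = trans (+-identityʳ _) (*-identityˡ _)
      tₚ : t (fromℕ p) ≈ x ^ p
      tₚ = begin
        (p C toℕ (fromℕ p)) ⋆ (x ^ toℕ (fromℕ p) * y ^ (p ∸ toℕ (fromℕ p))) ≡⟨ ≡.cong (λ k → (p C k) ⋆ (x ^ k * y ^ (p ∸ k))) (FinP.toℕ-fromℕ p) ⟩
        (p C p) ⋆ (x ^ p * y ^ (p ∸ p)) ≡⟨ ≡.cong₂ (λ a b → a ⋆ (x ^ p * y ^ b)) (nCn≡1 p) (ℕP.n∸n≡0 p) ⟩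
        1 ⋆ (x ^ p * 1#)                ≈⟨ ×-homo-1 _ ⟩
        x ^ p * 1#                      ≈⟨ *-identityʳ _ ⟩
        x ^ p                           ∎
      mid : sum (λ i → t (suc (inject₁ i))) ≈ 0#
      mid = sum-zero (λ i → t (suc (inject₁ i))) (λ i → ×-kill hp′ (prime∣C pp (s≤s z≤n)
        (s≤s (≡.subst (_< suc q) (≡.sym (FinP.toℕ-inject₁ i)) (FinP.toℕ<n i)))) _)

-- Residues modulo p and modulo its powers

module Zp where
  open import Data.Integer using (+_; -[1+_])
  open import Data.Vec using ([]; _∷_)
  open import Relation.Binary.PropositionalEquality hiding ([_])
  open Frob
  open Model

  ZMod : ℕ → CommutativeRing _ _
  ZMod M = Quot.quotient ℤring (+ M)

  infix 4 _≡0[_]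
  _≡0[_] : ℤ → ℕ → Set
  x ≡0[ M ] = ∃ λ q → x ≡ q ℤ.* + M

  ~⇒≡0 : ∀ {M x} → Quot._~_ ℤring (+ M) x 0ℤ → x ≡0[ M ]
  ~⇒≡0 {M} = Quot.~0⇒multiple ℤring (+ M)

  ≡0⇒~ : ∀ {M x} → x ≡0[ M ] → Quot._~_ ℤring (+ M) x 0ℤ
  ≡0⇒~ {M} {x} (q , h) = Quot.multiple⇒~0 ℤring (+ M) {x} {q} h

  ∣⇒≡0 : ∀ {M x} → M ℕD.∣ ∣ x ∣ → x ≡0[ M ]
  ∣⇒≡0 {M} {x} h with ℤD.∣ᵤ⇒∣ {+ M} {x} h
  ... | ℤD.divides q e = q , e

  ≡0⇒∣ : ∀ {M x} → x ≡0[ M ] → M ℕD.∣ ∣ x ∣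
  ≡0⇒∣ {M} (q , e) = ℕD.divides ∣ q ∣ (trans (cong ∣_∣ e) (ℤP.abs-* q (+ M)))

  ≡0? : ∀ M x → Dec (x ≡0[ M ])
  ≡0? M x with M ℕD.∣? ∣ x ∣
  ... | yes h = yes (∣⇒≡0 h)
  ... | no h = no (λ k → h (≡0⇒∣ k))

  fromℤ-ZMod : ∀ M n → Solver.fromℤ (ZMod M) (+ n) ≡ + n
  fromℤ-ZMod M zero = refl
  fromℤ-ZMod M (suc zero) = refl
  fromℤ-ZMod M (suc (suc n)) = trans (cong (ℤ._+ 1ℤ) (fromℤ-ZMod M (suc n))) (cong +_ (ℕP.+-comm (suc n) 1))

  private
    module Units {c ℓ} (R : CommutativeRing c ℓ) where
      open CommutativeRing R hiding (refl)
      open Solver R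

      multiply : ∀ {r s r′ s′ x q q′} → r * x + s * q ≈ 1# → r′ * x + s′ * q′ ≈ 1# →
        (r * (r′ * x + s′ * q′) + s * q * r′) * x + (s * s′) * (q * q′) ≈ 1#
      multiply {r} {s} {r′} {s′} {x} {q} {q′} h k = comb (solve (r ∷ s ∷ r′ ∷ s′ ∷ x ∷ q ∷ q′ ∷ []) (λ r s r′ s′ x q q′ →
          (r :* (r′ :* x :+ s′ :* q′) :+ s :* q :* r′) :* x :+ (s :* s′) :* (q :* q′) :- con (+ 1) :=
          (r′ :* x :+ s′ :* q′) :* (r :* x :+ s :* q :- con (+ 1)) :+ con (+ 1) :* (r′ :* x :+ s′ :* q′ :- con (+ 1))) refl)
        (_ · h ⊕ _ · k)

      cancel : ∀ {r s x y q m} → r * x + s * m ≈ 1# → x * y ≈ q * m → y ≈ (r * q + s * y) * m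
      cancel {r} {s} {x} {y} {q} {m} h k = comb (solve (r ∷ s ∷ x ∷ y ∷ q ∷ m ∷ []) (λ r s x y q m →
        y :- (r :* q :+ s :* y) :* m := (:- y) :* (r :* x :+ s :* m :- con (+ 1)) :+ r :* (x :* y :- q :* m)) refl) (_ · h ⊕ _ · k)

      negate : ∀ {m n z q} → z ≈ q + m → z ≈ 0# → q ≈ n → m ≈ - n
      negate {m} {n} {z} {q} h k l = comb (solve (m ∷ n ∷ z ∷ q ∷ []) (λ m n z q →
        m :- :- n := (:- con (+ 1)) :* (z :- (q :+ m)) :+ con (+ 1) :* (z :- con (+ 0)) :+ (:- con (+ 1)) :* (q :- n)) refl) (_ · h ⊕ _ · k ⊕ _ · l)

  module Field (p : ℕ) (pp : Prime p) where
    open CommutativeRing (ZMod p) using (_≈_) renaming (refl to ≈-refl; sym to ≈-sym; trans to ≈-trans; +-cong to ≈-+; -‿cong to ≈-neg; *-cong to ≈-*)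
    open CommutativeRing (ZMod p) using (semiring)
    open import Algebra.Properties.Semiring.Exp semiring using (_^_; ^-congˡ)

    ≡0-prime : ∀ x y → x ℤ.* y ≡0[ p ] → x ≡0[ p ] ⊎ y ≡0[ p ]
    ≡0-prime x y h = [ (λ d → inj₁ (∣⇒≡0 d)) , (λ d → inj₂ (∣⇒≡0 d)) ]′
      (euclidsLemma ∣ x ∣ ∣ y ∣ pp (subst (p ℕD.∣_) (ℤP.abs-* x y) (≡0⇒∣ h)))

    noZeroDivisors : Solver.NoZeroDivisors (ZMod p)
    noZeroDivisors x y h = [ (λ d → inj₁ (≡0⇒~ d)) , (λ d → inj₂ (≡0⇒~ d)) ]′ (≡0-prime x y (~⇒≡0 h))

    char-p : Solver.fromℤ (ZMod p) (+ p) ≈ 0ℤ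
    char-p = subst (_≈ 0ℤ) (sym (fromℤ-ZMod p p)) (≡0⇒~ (1ℤ , sym (ℤP.*-identityˡ (+ p))))

    1≢0 : ¬ (1ℤ ≡0[ p ])
    1≢0 h = ℕP.<-irrefl (sym (ℕD.∣1⇒≡1 (≡0⇒∣ h))) (prime>1 pp)

    private
      0^p : 0ℤ ^ p ≈ 0ℤ
      0^p = go p (ℕP.<⇒≤ (prime>1 pp))
        where
        go : ∀ n → 1 ℕ.≤ n → 0ℤ ^ n ≈ 0ℤ
        go (suc n) _ = CommutativeRing.zeroˡ (ZMod p) (0ℤ ^ n)
      1^n : ∀ n → 1ℤ ^ n ≈ 1ℤ
      1^n zero = ≈-refl {1ℤ}
      1^n (suc n) = ≈-trans {1ℤ ^ suc n} {1ℤ ^ n} {1ℤ} (CommutativeRing.*-identityˡ (ZMod p) (1ℤ ^ n)) (1^n n)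

      fermat-ℕ : ∀ n → (+ n) ^ p ≈ + n
      fermat-ℕ zero = 0^p
      fermat-ℕ (suc n) = ≈-trans {(1ℤ ℤ.+ + n) ^ p} {1ℤ ^ p ℤ.+ (+ n) ^ p} {+ suc n} (frobenius-+ (ZMod p) pp char-p 1ℤ (+ n))
        (≈-+ {1ℤ ^ p} {1ℤ} {(+ n) ^ p} {+ n} (1^n p) (fermat-ℕ n))

      fermat-neg : ∀ n → (ℤ.- + n) ^ p ≈ ℤ.- + n
      fermat-neg n = Units.negate (ZMod p) {(ℤ.- + n) ^ p} {+ n} {0ℤ ^ p} {(+ n) ^ p} fr 0^p (fermat-ℕ n)
        where
        fr : 0ℤ ^ p ≈ (+ n) ^ p ℤ.+ (ℤ.- + n) ^ p
        fr = subst (λ t → t ^ p ≈ (+ n) ^ p ℤ.+ (ℤ.- + n) ^ p) (ℤP.+-inverseʳ (+ n)) (frobenius-+ (ZMod p) pp char-p (+ n) (ℤ.- + n))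

    abstract
      -- Additivity of the Frobenius gives the naturals by induction, and the negatives from 0 = n +
      -- (-n).
      fermat : ∀ x → x ^ p ≈ x
      fermat (+ n) = fermat-ℕ n
      fermat -[1+ n ] = fermat-neg (suc n)

    private
      coprime : ∀ x → ¬ (x ≡0[ p ]) → Cop.Coprime ∣ x ∣ p
      coprime x n {d} (d∣x , d∣p) = [ (λ e → e) , (λ e → ⊥-elim (n (∣⇒≡0 (subst (ℕD._∣ ∣ x ∣) e d∣x)))) ]′ (prime⇒irreducible pp d∣p)

    -- Multiplying Bézout relations for p and for p^e gives one for p^(e+1); so a unit modulo p can
    -- be cancelled modulo any power of p.
    unit-power : ∀ e x → ¬ (x ≡0[ p ]) → ∃₂ λ r s → r ℤ.* x ℤ.+ s ℤ.* + (p ℕ.^ e) ≡ 1ℤ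
    unit-power zero x n = 0ℤ , 1ℤ , refl
    unit-power (suc e) x n = let (r , s , h) = bézout x (+ p) (coprime x n)
                                 (r′ , s′ , k) = unit-power e x n in
      r ℤ.* (r′ ℤ.* x ℤ.+ s′ ℤ.* + (p ℕ.^ e)) ℤ.+ s ℤ.* + p ℤ.* r′ , s ℤ.* s′ ,
      trans (cong (λ t → (r ℤ.* (r′ ℤ.* x ℤ.+ s′ ℤ.* + (p ℕ.^ e)) ℤ.+ s ℤ.* + p ℤ.* r′) ℤ.* x ℤ.+ s ℤ.* s′ ℤ.* t) (ℤP.pos-* p (p ℕ.^ e)))
        (Units.multiply ℤring {r} {s} {r′} {s′} {x} {+ p} {+ (p ℕ.^ e)} h k)

    cancel-unit : ∀ e x y → ¬ (x ≡0[ p ]) → x ℤ.* y ≡0[ p ℕ.^ e ] → y ≡0[ p ℕ.^ e ]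
    cancel-unit e x y n (q , h) = let (r , s , k) = unit-power e x n in
      r ℤ.* q ℤ.+ s ℤ.* y , Units.cancel ℤring {r} {s} {x} {y} {q} {+ (p ℕ.^ e)} k h

    inverse : ∀ x → ¬ (x ≡0[ p ]) → ∃ λ r → r ℤ.* x ≈ 1ℤ
    inverse x n = let (r , s , h) = bézout x (+ p) (coprime x n) in r , ℤ.- s ,
      trans (cong (λ t → r ℤ.* x ℤ.- t) (sym h)) (S.solve (r ∷ x ∷ s ∷ + p ∷ []) (λ r x s p → r S.:* x S.:- (r S.:* x S.:+ s S.:* p) S.:= (S.:- s) S.:* p) refl)
      where module S = Solver ℤring

-- Identities near the point at infinity and at a singular point

module LocAlg {c ℓ : Level} (R : CommutativeRing c ℓ) where
  open import Data.Vec using ([]; _∷_)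
  open import Data.Integer using (+_)
  open CommutativeRing R
  open Solver R
  open Forms R

  private
    n# : _ → Carrier
    n# k = fromℤ (+ k)

  Δ-form : (b2 b4 b6 b8 : Carrier) → Carrier
  Δ-form b2 b4 b6 b8 = - (b2 * b2 * b8) - n# 8 * b4 * b4 * b4 - n# 27 * b6 * b6 + n# 9 * b2 * b4 * b6

  module Ex2 {n : ℕ} where
    Δₑ : (b2 b4 b6 b8 : Expr n) → Expr n
    Δₑ b2 b4 b6 b8 = :- (b2 :* b2 :* b8) :- con (+ 8) :* b4 :* b4 :* b4 :- con (+ 27) :* b6 :* b6 :+ con (+ 9) :* b2 :* b4 :* b6

    t2 : (s b2 : Expr n) → Expr n
    t2 s b2 = b2 :+ con (+ 12) :* s
    t4 : (s b2 b4 : Expr n) → Expr n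
    t4 s b2 b4 = b4 :+ s :* b2 :+ con (+ 6) :* s :* s
    t6 : (s b2 b4 b6 : Expr n) → Expr n
    t6 s b2 b4 b6 = b6 :+ con (+ 2) :* s :* b4 :+ s :* s :* b2 :+ con (+ 4) :* s :* s :* s
    t8 : (s b2 b4 b6 b8 : Expr n) → Expr n
    t8 s b2 b4 b6 b8 = b8 :+ con (+ 3) :* s :* b6 :+ con (+ 3) :* s :* s :* b4 :+ s :* s :* s :* b2 :+ con (+ 3) :* s :* s :* s :* s
  open Ex2

  -- The invariants of the equation translated by x ↦ x + s.
  b2[_] : (s b2 : Carrier) → Carrier
  b2[ s ] b2 = b2 + n# 12 * s
  b4[_] : (s b2 b4 : Carrier) → Carrier
  b4[ s ] b2 b4 = b4 + s * b2 + n# 6 * s * s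
  b6[_] : (s b2 b4 b6 : Carrier) → Carrier
  b6[ s ] b2 b4 b6 = b6 + n# 2 * s * b4 + s * s * b2 + n# 4 * s * s * s
  b8[_] : (s b2 b4 b6 b8 : Carrier) → Carrier
  b8[ s ] b2 b4 b6 b8 = b8 + n# 3 * s * b6 + n# 3 * s * s * b4 + s * s * s * b2 + n# 3 * s * s * s * s

  -- the reduced curve is singular at a point with x-coordinate s
  record Singular (s b2 b4 b6 b8 : Carrier) : Set ℓ where
    constructor singular
    field
      s4 : b4[ s ] b2 b4 ≈ 0#
      s6 : b6[ s ] b2 b4 b6 ≈ 0#
      s8 : b8[ s ] b2 b4 b6 b8 ≈ 0#

  module _ {b2 b4 b6 b8 a b a′ b′ : Carrier} where

    private
      h S Π : Carrier
      h = H a b a′ b′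
      S = Sₕ b2 b4 b6 a b a′ b′
      Π = Πₕ b4 b6 b8 a b a′ b′

    -- When h vanishes the two points have one abscissa, so up to b′² the mixed form is the diagonal
    -- one, 4x³ + b₂x² + 2b₄x + b₆ made homogeneous.
    diagonal-S : h ≈ 0# → S ≈ 0# → b′ * (b′ * Sₕ b2 b4 b6 a b a b) ≈ 0#
    diagonal-S hh hS = comb (solve (b2 ∷ b4 ∷ b6 ∷ a ∷ b ∷ a′ ∷ b′ ∷ []) (λ b2 b4 b6 a b a′ b′ →
      b′ :* (b′ :* Sₑ b2 b4 b6 a b a b) :- con (+ 0) := (b :* b) :* (Sₑ b2 b4 b6 a b a′ b′ :- con (+ 0))
        :+ (con (+ 2) :* a :* b :* (a′ :* b :+ a :* b′) :+ con (+ 2) :* a :* a :* b :* b′ :+ b2 :* a :* b :* b :* b′ :+ b4 :* b :* b :* b :* b′) :* ((a :* b′ :- a′ :* b) :- con (+ 0))) ≡.refl)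
      (_ · hS ⊕ _ · hh)

    diagonal-Π : h ≈ 0# → Π ≈ 0# → b′ * (b′ * Πₕ b4 b6 b8 a b a b) ≈ 0#
    diagonal-Π hh hΠ = comb (solve (b4 ∷ b6 ∷ b8 ∷ a ∷ b ∷ a′ ∷ b′ ∷ []) (λ b4 b6 b8 a b a′ b′ →
      b′ :* (b′ :* Πₑ b4 b6 b8 a b a b) :- con (+ 0) := (b :* b) :* (Πₑ b4 b6 b8 a b a′ b′ :- con (+ 0))
        :+ (a :* a :* (a′ :* b :+ a :* b′) :- b4 :* a :* b :* b :* b′ :- b6 :* b :* b :* b :* b′) :* ((a :* b′ :- a′ :* b) :- con (+ 0))) ≡.refl)
      (_ · hΠ ⊕ _ · hh)

    -- the discriminant is a combination of f = 4x³ + b₂x² + 2b₄x + b₆ and x⁴ - b₄x² - 2b₆x - b₈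
    discriminant : n# 4 * b8 ≈ b2 * b6 - b4 * b4 → Sₕ b2 b4 b6 a b a b ≈ 0# → Πₕ b4 b6 b8 a b a b ≈ 0# →
      b ^ 7 * Δ-form b2 b4 b6 b8 ≈ 0#
    discriminant rel hS hΠ = comb (solve (b2 ∷ b4 ∷ b6 ∷ b8 ∷ a ∷ b ∷ []) (λ b2 b4 b6 b8 a b →
      b :^ 7 :* Δₑ b2 b4 b6 b8 :- con (+ 0) :=
        (con (+ 12) :* a :* a :* a :- b2 :* a :* a :* b :- con (+ 10) :* b4 :* a :* b :* b :+ (b2 :* b4 :- con (+ 27) :* b6) :* b :* b :* b) :* (Sₑ b2 b4 b6 a b a b :- con (+ 0))
        :+ (:- (b :* (con (+ 48) :* a :* a :+ con (+ 8) :* b2 :* a :* b :+ (con (+ 32) :* b4 :- b2 :* b2) :* b :* b))) :* (Πₑ b4 b6 b8 a b a b :- con (+ 0))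
        :+ (:- (con (+ 12) :* a :* a :* b :^ 5 :+ con (+ 2) :* b2 :* a :* b :^ 6 :+ con (+ 8) :* b4 :* b :^ 7)) :* (con (+ 4) :* b8 :- (b2 :* b6 :- b4 :* b4))) ≡.refl)
      (_ · hS ⊕ _ · hΠ ⊕ _ · rel)

    -- The leading terms of the forms near O. With a and a′ units they make b / a a quadratic
    -- function of the index, which is all that is used in place of the formal group.
    vanishing-bb′ : b * b′ ≈ 0# → S ≈ n# 2 * a * a′ * (a * b′ + a′ * b) × Π ≈ a * a * a′ * a′
    vanishing-bb′ z =
      comb (solve (b2 ∷ b4 ∷ b6 ∷ a ∷ b ∷ a′ ∷ b′ ∷ []) (λ b2 b4 b6 a b a′ b′ →
        Sₑ b2 b4 b6 a b a′ b′ :- con (+ 2) :* a :* a′ :* (a :* b′ :+ a′ :* b) :=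
        (b2 :* a :* a′ :+ b4 :* (a :* b′ :+ a′ :* b) :+ b6 :* b :* b′) :* (b :* b′ :- con (+ 0))) ≡.refl) (_ · z) ,
      comb (solve (b4 ∷ b6 ∷ b8 ∷ a ∷ b ∷ a′ ∷ b′ ∷ []) (λ b4 b6 b8 a b a′ b′ →
        Πₑ b4 b6 b8 a b a′ b′ :- a :* a :* a′ :* a′ :=
        (:- (b4 :* a :* a′ :+ b6 :* (a :* b′ :+ a′ :* b) :+ b8 :* b :* b′)) :* (b :* b′ :- con (+ 0))) ≡.refl) (_ · z)

    module _ {s a₊ b₊ a₋ b₋ k : Carrier} (sing : Singular s b2 b4 b6 b8)
      (r₁ : h * h ≈ k * (b₊ * b₋)) (r₂ : S ≈ k * (a₊ * b₋ + a₋ * b₊)) (r₃ : Π ≈ k * (a₊ * a₋)) where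

      private
        u = a - s * b
        u′ = a′ - s * b′
        u₊ = a₊ - s * b₊
        u₋ = a₋ - s * b₋

      -- With the singular point moved to u = 0, where the translated b₄, b₆ and b₈ vanish, few
      -- terms of the forms survive. For τ = 0 they express an additive group, for τ ≠ 0 a
      -- multiplicative one.
      translate-S : n# 2 * u * u′ * (u * b′ + u′ * b) + b2[ s ] b2 * u * u′ * b * b′ ≈ k * (u₊ * b₋ + u₋ * b₊)
      translate-S = comb (solve (s ∷ b2 ∷ b4 ∷ b6 ∷ a ∷ b ∷ a′ ∷ b′ ∷ a₊ ∷ b₊ ∷ a₋ ∷ b₋ ∷ k ∷ []) (λ s b2 b4 b6 a b a′ b′ a₊ b₊ a₋ b₋ k →
        let u = a :- s :* b
            u′ = a′ :- s :* b′
            u₊ = a₊ :- s :* b₊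
            u₋ = a₋ :- s :* b₋
            h = a :* b′ :- a′ :* b in
        con (+ 2) :* u :* u′ :* (u :* b′ :+ u′ :* b) :+ t2 s b2 :* u :* u′ :* b :* b′ :- k :* (u₊ :* b₋ :+ u₋ :* b₊) :=
        con (+ 1) :* (Sₑ b2 b4 b6 a b a′ b′ :- k :* (a₊ :* b₋ :+ a₋ :* b₊)) :+ (:- (con (+ 2) :* s)) :* (h :* h :- k :* (b₊ :* b₋))
        :+ (:- (b :* b′ :* (u :* b′ :+ u′ :* b))) :* (t4 s b2 b4 :- con (+ 0)) :+ (:- (b :* b :* b′ :* b′)) :* (t6 s b2 b4 b6 :- con (+ 0))) ≡.refl)
        (_ · r₂ ⊕ _ · r₁ ⊕ _ · Singular.s4 sing ⊕ _ · Singular.s6 sing)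

      translate-Π : u * u * u′ * u′ ≈ k * (u₊ * u₋)
      translate-Π = comb (solve (s ∷ b2 ∷ b4 ∷ b6 ∷ b8 ∷ a ∷ b ∷ a′ ∷ b′ ∷ a₊ ∷ b₊ ∷ a₋ ∷ b₋ ∷ k ∷ []) (λ s b2 b4 b6 b8 a b a′ b′ a₊ b₊ a₋ b₋ k →
        let u = a :- s :* b
            u′ = a′ :- s :* b′
            u₊ = a₊ :- s :* b₊
            u₋ = a₋ :- s :* b₋
            h = a :* b′ :- a′ :* b in
        u :* u :* u′ :* u′ :- k :* (u₊ :* u₋) :=
        con (+ 1) :* (Πₑ b4 b6 b8 a b a′ b′ :- k :* (a₊ :* a₋)) :+ (:- s) :* (Sₑ b2 b4 b6 a b a′ b′ :- k :* (a₊ :* b₋ :+ a₋ :* b₊)) :+ (s :* s) :* (h :* h :- k :* (b₊ :* b₋))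
        :+ (u :* u′ :* b :* b′) :* (t4 s b2 b4 :- con (+ 0)) :+ (b :* b′ :* (u :* b′ :+ u′ :* b)) :* (t6 s b2 b4 b6 :- con (+ 0))
        :+ (b :* b :* b′ :* b′) :* (t8 s b2 b4 b6 b8 :- con (+ 0))) ≡.refl)
        (_ · r₃ ⊕ _ · r₂ ⊕ _ · r₁ ⊕ _ · Singular.s4 sing ⊕ _ · Singular.s6 sing ⊕ _ · Singular.s8 sing)

  -- b/v is quadratic: if it is n²ξ and (n-1)²ξ at two successive places, it is (n+1)²ξ at the next
  quadratic-step : ∀ {v b w b₁ v₊ b₊ v₋ b₋ k n} →
    n# 2 * v * w * (v * b₁ + w * b) ≈ k * (v₊ * b₋ + v₋ * b₊) → v * v * w * w ≈ k * (v₊ * v₋) →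
    w * b ≈ n * n * b₁ * v → w * b₋ ≈ (n - 1#) * (n - 1#) * b₁ * v₋ →
    (k * v₋) * (w * b₊ - (n + 1#) * (n + 1#) * b₁ * v₊) ≈ 0#
  quadratic-step {v} {b} {w} {b₁} {v₊} {b₊} {v₋} {b₋} {k} {n} hS hΠ h₀ h₋ = comb
    (solve (v ∷ b ∷ w ∷ b₁ ∷ v₊ ∷ b₊ ∷ v₋ ∷ b₋ ∷ k ∷ n ∷ []) (λ v b w b₁ v₊ b₊ v₋ b₋ k n → let 1′ = con (+ 1) in
      (k :* v₋) :* (w :* b₊ :- (n :+ 1′) :* (n :+ 1′) :* b₁ :* v₊) :- con (+ 0) :=
      (:- w) :* (con (+ 2) :* v :* w :* (v :* b₁ :+ w :* b) :- k :* (v₊ :* b₋ :+ v₋ :* b₊))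
      :+ (con (+ 2) :* v :* w :* w) :* (w :* b :- n :* n :* b₁ :* v)
      :+ (:- (k :* v₊)) :* (w :* b₋ :- (n :- 1′) :* (n :- 1′) :* b₁ :* v₋)
      :+ (b₁ :* (con (+ 2) :+ con (+ 2) :* n :* n)) :* (v :* v :* w :* w :- k :* (v₊ :* v₋))) ≡.refl)
    (_ · hS ⊕ _ · h₀ ⊕ _ · h₋ ⊕ _ · hΠ)

  -- T = 2 + τ b/v satisfies T₊ + T₋ = T T₁
  trace-step : ∀ {τ v b w b₁ v₊ b₊ v₋ b₋ k ξ ξ₁ ξ₊ ξ₋} →
    n# 2 * v * w * (v * b₁ + w * b) + τ * v * w * b * b₁ ≈ k * (v₊ * b₋ + v₋ * b₊) → v * v * w * w ≈ k * (v₊ * v₋) →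
    ξ * v ≈ b → ξ₁ * w ≈ b₁ → ξ₊ * v₊ ≈ b₊ → ξ₋ * v₋ ≈ b₋ →
    (v * v * w * w) * ((n# 2 + τ * ξ₊) - ((n# 2 + τ * ξ₁) * (n# 2 + τ * ξ) - (n# 2 + τ * ξ₋))) ≈ 0#
  trace-step {τ} {v} {b} {w} {b₁} {v₊} {b₊} {v₋} {b₋} {k} {ξ} {ξ₁} {ξ₊} {ξ₋} hS hΠ h h₁ h₊ h₋ = comb
    (solve (τ ∷ v ∷ b ∷ w ∷ b₁ ∷ v₊ ∷ b₊ ∷ v₋ ∷ b₋ ∷ k ∷ ξ ∷ ξ₁ ∷ ξ₊ ∷ ξ₋ ∷ []) (λ τ v b w b₁ v₊ b₊ v₋ b₋ k ξ ξ₁ ξ₊ ξ₋ →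
      let 2′ = con (+ 2) in
      (v :* v :* w :* w) :* ((2′ :+ τ :* ξ₊) :- ((2′ :+ τ :* ξ₁) :* (2′ :+ τ :* ξ) :- (2′ :+ τ :* ξ₋))) :- con (+ 0) :=
      (:- τ) :* (2′ :* v :* w :* (v :* b₁ :+ w :* b) :+ τ :* v :* w :* b :* b₁ :- k :* (v₊ :* b₋ :+ v₋ :* b₊))
      :+ (τ :* (ξ₊ :+ ξ₋)) :* (v :* v :* w :* w :- k :* (v₊ :* v₋))
      :+ (:- (τ :* (2′ :* v :* w :* w :+ τ :* v :* w :* b₁))) :* (ξ :* v :- b)
      :+ (:- (τ :* (2′ :* v :* v :* w :+ τ :* v :* w :* (ξ :* v)))) :* (ξ₁ :* w :- b₁)
      :+ (τ :* k :* v₋) :* (ξ₊ :* v₊ :- b₊) :+ (τ :* k :* v₊) :* (ξ₋ :* v₋ :- b₋)) ≡.refl)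
    (_ · hS ⊕ _ · hΠ ⊕ _ · h ⊕ _ · h₁ ⊕ _ · h₊ ⊕ _ · h₋)

  module _ {b2 b4 b6 b8 s : Carrier} (rel : n# 4 * b8 ≈ b2 * b6 - b4 * b4) where
    private
      B2 = b2[ s ] b2
      B4 = b4[ s ] b2 b4
      B6 = b6[ s ] b2 b4 b6
      B8 = b8[ s ] b2 b4 b6 b8

    rel-translate : n# 4 * B8 ≈ B2 * B6 - B4 * B4
    rel-translate = comb (solve (b2 ∷ b4 ∷ b6 ∷ b8 ∷ s ∷ []) (λ b2 b4 b6 b8 s →
      con (+ 4) :* t8 s b2 b4 b6 b8 :- (t2 s b2 :* t6 s b2 b4 b6 :- t4 s b2 b4 :* t4 s b2 b4) := con (+ 1) :* (con (+ 4) :* b8 :- (b2 :* b6 :- b4 :* b4))) ≡.refl) (_ · rel)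

    Δ-translate : Δ-form B2 B4 B6 B8 ≈ Δ-form b2 b4 b6 b8
    Δ-translate = comb (solve (b2 ∷ b4 ∷ b6 ∷ b8 ∷ s ∷ []) (λ b2 b4 b6 b8 s →
      Δₑ (t2 s b2) (t4 s b2 b4) (t6 s b2 b4 b6) (t8 s b2 b4 b6 b8) :- Δₑ b2 b4 b6 b8 :=
        (:- (con (+ 6) :* b2 :* s :+ con (+ 36) :* s :* s)) :* (con (+ 4) :* b8 :- (b2 :* b6 :- b4 :* b4))) ≡.refl) (_ · rel)

    c4-translate : B2 * B2 ≈ b2 * b2 - n# 24 * b4 + n# 24 * B4
    c4-translate = solve (b2 ∷ b4 ∷ s ∷ []) (λ b2 b4 s → t2 s b2 :* t2 s b2 := b2 :* b2 :- con (+ 24) :* b4 :+ con (+ 24) :* t4 s b2 b4) ≡.refl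

    module _ (dom : NoZeroDivisors) (Δ≈0 : Δ-form b2 b4 b6 b8 ≈ 0#) where

      private
        killˡ : ∀ {x y} → ¬ (x ≈ 0#) → x * y ≈ 0# → y ≈ 0#
        killˡ n h = [ (λ e → ⊥-elim (n e)) , (λ e → e) ]′ (dom _ _ h)

      -- The abscissa (18 b₆ - b₂ b₄) / c₄ of the node is valid in every characteristic. First B₄
      -- vanishes, by way of Δ; then B₂² = c₄ + 24 B₄ makes B₂ a non-zero-divisor; then B₂³ B₆
      -- vanishes, its term in B₆² being absorbed by 18 B₆ = 0, which also holds when 18 is zero.
      node : ¬ (b2 * b2 - n# 24 * b4 ≈ 0#) → (b2 * b2 - n# 24 * b4) * s ≈ n# 18 * b6 - b2 * b4 → Singular s b2 b4 b6 b8 × ¬ (B2 ≈ 0#)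
      node c4≉0 hs = singular B4≈0 B6≈0 B8≈0 , B2≉0
        where
        c4 = b2 * b2 - n# 24 * b4
        B4≈0 : B4 ≈ 0#
        B4≈0 = killˡ c4≉0 (killˡ c4≉0 (comb (solve (b2 ∷ b4 ∷ b6 ∷ b8 ∷ s ∷ []) (λ b2 b4 b6 b8 s →
          let c4 = b2 :* b2 :- con (+ 24) :* b4
              N = con (+ 18) :* b6 :- b2 :* b4 in
          c4 :* (c4 :* t4 s b2 b4) :- con (+ 0) := (b2 :* c4 :+ con (+ 6) :* (c4 :* s :+ N)) :* (c4 :* s :- N)
            :+ (:- con (+ 72)) :* (Δₑ b2 b4 b6 b8 :- con (+ 0)) :+ (:- (con (+ 18) :* b2 :* b2)) :* (con (+ 4) :* b8 :- (b2 :* b6 :- b4 :* b4))) ≡.refl)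
          (_ · hs ⊕ _ · Δ≈0 ⊕ _ · rel)))
        B2≉0 : ¬ (B2 ≈ 0#)
        B2≉0 e = c4≉0 (comb (solve (c4 ∷ B2 ∷ B4 ∷ []) (λ c4 B2 B4 → c4 :- con (+ 0) := (:- con (+ 1)) :* (B2 :* B2 :- (c4 :+ con (+ 24) :* B4)) :+ B2 :* (B2 :- con (+ 0)) :+ (:- con (+ 24)) :* (B4 :- con (+ 0))) ≡.refl)
          (_ · c4-translate ⊕ _ · e ⊕ _ · B4≈0))
        18B6≈0 : n# 18 * B6 ≈ 0#
        18B6≈0 = comb (solve (b2 ∷ b4 ∷ b6 ∷ s ∷ []) (λ b2 b4 b6 s →
          con (+ 18) :* t6 s b2 b4 b6 :- con (+ 0) := (:- con (+ 1)) :* ((b2 :* b2 :- con (+ 24) :* b4) :* s :- (con (+ 18) :* b6 :- b2 :* b4)) :+ t2 s b2 :* (t4 s b2 b4 :- con (+ 0))) ≡.refl)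
          (_ · hs ⊕ _ · B4≈0)
        Δ′≈0 : Δ-form B2 B4 B6 B8 ≈ 0#
        Δ′≈0 = trans Δ-translate Δ≈0
        B6≈0 : B6 ≈ 0#
        B6≈0 = killˡ B2≉0 (killˡ B2≉0 (killˡ B2≉0 (comb (solve (B2 ∷ B4 ∷ B6 ∷ B8 ∷ []) (λ b2 b4 b6 b8 →
          b2 :* (b2 :* (b2 :* b6)) :- con (+ 0) := (:- con (+ 4)) :* (Δₑ b2 b4 b6 b8 :- con (+ 0)) :+ (:- (b2 :* b2)) :* (con (+ 4) :* b8 :- (b2 :* b6 :- b4 :* b4))
            :+ (:- (con (+ 6) :* b6)) :* (con (+ 18) :* b6 :- con (+ 0)) :+ (b2 :* b2 :* b4 :- con (+ 32) :* b4 :* b4 :+ con (+ 36) :* b2 :* b6) :* (b4 :- con (+ 0))) ≡.refl)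
          (_ · Δ′≈0 ⊕ _ · rel-translate ⊕ _ · 18B6≈0 ⊕ _ · B4≈0))))
        B8≈0 : B8 ≈ 0#
        B8≈0 = killˡ B2≉0 (killˡ B2≉0 (comb (solve (B2 ∷ B4 ∷ B6 ∷ B8 ∷ []) (λ b2 b4 b6 b8 →
          b2 :* (b2 :* b8) :- con (+ 0) := (:- con (+ 1)) :* (Δₑ b2 b4 b6 b8 :- con (+ 0)) :+ (:- (con (+ 8) :* b4 :* b4)) :* (b4 :- con (+ 0))
             :+ (con (+ 9) :* b2 :* b4 :- con (+ 27) :* b6) :* (b6 :- con (+ 0))) ≡.refl)
          (_ · Δ′≈0 ⊕ _ · B4≈0 ⊕ _ · B6≈0)))

      -- With 6 invertible the choice s = -b₂ / 12 makes B₂ vanish. Then B₂² = c₄ + 24 B₄ removes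
      -- B₄, the discriminant removes 27 B₆², and 4 B₈ = B₂ B₆ - B₄² removes B₈.
      cusp : ¬ (n# 2 ≈ 0#) → ¬ (n# 3 ≈ 0#) → b2 * b2 - n# 24 * b4 ≈ 0# → B2 ≈ 0# → Singular s b2 b4 b6 b8
      cusp 2≉0 3≉0 c4≈0 B2≈0 = singular B4≈0 B6≈0 B8≈0
        where
        B4≈0 : B4 ≈ 0#
        B4≈0 = killˡ 2≉0 (killˡ 2≉0 (killˡ 2≉0 (killˡ 3≉0 (comb (solve ((b2 * b2 - n# 24 * b4) ∷ B2 ∷ B4 ∷ []) (λ c4 B2 B4 →
          con (+ 3) :* (con (+ 2) :* (con (+ 2) :* (con (+ 2) :* B4))) :- con (+ 0) := (:- con (+ 1)) :* (B2 :* B2 :- (c4 :+ con (+ 24) :* B4)) :+ B2 :* (B2 :- con (+ 0)) :+ (:- con (+ 1)) :* (c4 :- con (+ 0))) ≡.refl)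
          (_ · c4-translate ⊕ _ · B2≈0 ⊕ _ · c4≈0)))))
        B6≈0 : B6 ≈ 0#
        B6≈0 = [ (λ e → e) , (λ e → e) ]′ (dom _ _ (killˡ 3≉0 (killˡ 3≉0 (killˡ 3≉0 (comb (solve (B2 ∷ B4 ∷ B6 ∷ B8 ∷ []) (λ b2 b4 b6 b8 →
          con (+ 3) :* (con (+ 3) :* (con (+ 3) :* (b6 :* b6))) :- con (+ 0) := (:- con (+ 1)) :* (Δₑ b2 b4 b6 b8 :- con (+ 0)) :+ (:- (con (+ 8) :* b4 :* b4)) :* (b4 :- con (+ 0))
             :+ (con (+ 9) :* b4 :* b6 :- b2 :* b8) :* (b2 :- con (+ 0))) ≡.refl)
          (_ · trans Δ-translate Δ≈0 ⊕ _ · B4≈0 ⊕ _ · B2≈0))))))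
        B8≈0 : B8 ≈ 0#
        B8≈0 = killˡ 2≉0 (killˡ 2≉0 (comb (solve (B2 ∷ B4 ∷ B6 ∷ B8 ∷ []) (λ b2 b4 b6 b8 →
          con (+ 2) :* (con (+ 2) :* b8) :- con (+ 0) := con (+ 1) :* (con (+ 4) :* b8 :- (b2 :* b6 :- b4 :* b4)) :+ b6 :* (b2 :- con (+ 0)) :+ (:- b4) :* (b4 :- con (+ 0))) ≡.refl)
          (_ · rel-translate ⊕ _ · B2≈0 ⊕ _ · B4≈0)))

  vanishing-S : ∀ {b2 b4 b6 a b a′ b′} → b ≈ 0# → b′ ≈ 0# → Sₕ b2 b4 b6 a b a′ b′ ≈ 0#
  vanishing-S {b2} {b4} {b6} {a} {b} {a′} {b′} h h′ = comb (solve (b2 ∷ b4 ∷ b6 ∷ a ∷ b ∷ a′ ∷ b′ ∷ []) (λ b2 b4 b6 a b a′ b′ →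
    Sₑ b2 b4 b6 a b a′ b′ :- con (+ 0) :=
    (con (+ 2) :* a :* a′ :* a′ :+ b2 :* a :* a′ :* b′ :+ b4 :* b′ :* (a :* b′ :+ a′ :* b) :+ b6 :* b :* b′ :* b′) :* (b :- con (+ 0))
    :+ (con (+ 2) :* a :* a :* a′) :* (b′ :- con (+ 0))) ≡.refl) (_ · h ⊕ _ · h′)

  module _ {a1 a2 a3 a4 a6 a e d : Carrier}
    (eqn : e * e + a1 * a * e * d + a3 * e * (d * d * d) ≈ a * a * a + a2 * a * a * (d * d) + a4 * a * (d * d * d * d) + a6 * (d * d * d * d * d * d)) where

    Fyₕ Fxₕ : Carrier
    Fyₕ = n# 2 * e + a1 * a * d + a3 * (d * d * d)
    Fxₕ = a1 * e * d - n# 3 * a * a - n# 2 * a2 * a * (d * d) - a4 * (d * d * d * d)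

    private
      b2 = a1 * a1 + n# 4 * a2
      b4 = n# 2 * a4 + a1 * a3
      b6 = a3 * a3 + n# 4 * a6
      b8 = a1 * a1 * a6 + n# 4 * a2 * a6 - a1 * a3 * a4 + a2 * a3 * a3 - a4 * a4

    diagonal-Fy : Sₕ b2 b4 b6 a (d * d) a (d * d) ≈ (d * d) * (Fyₕ * Fyₕ)
    diagonal-Fy = comb (solve (a1 ∷ a2 ∷ a3 ∷ a4 ∷ a6 ∷ a ∷ e ∷ d ∷ []) (λ a1 a2 a3 a4 a6 a e d →
      let b2 = a1 :* a1 :+ con (+ 4) :* a2
          b4 = con (+ 2) :* a4 :+ a1 :* a3
          b6 = a3 :* a3 :+ con (+ 4) :* a6
          fy = con (+ 2) :* e :+ a1 :* a :* d :+ a3 :* (d :* d :* d) in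
      Sₑ b2 b4 b6 a (d :* d) a (d :* d) :- (d :* d) :* (fy :* fy) :=
      (:- (con (+ 4) :* d :* d)) :* ((e :* e :+ a1 :* a :* e :* d :+ a3 :* e :* (d :* d :* d)) :- (a :* a :* a :+ a2 :* a :* a :* (d :* d) :+ a4 :* a :* (d :* d :* d :* d) :+ a6 :* (d :* d :* d :* d :* d :* d)))) ≡.refl)
      (_ · eqn)

    -- Modulo Fy the diagonal Π is Fx², and the diagonal S is Fy² up to d². So, for d a unit of a
    -- domain, the two sides of the duplication formula vanish together exactly at a singular point.
    diagonal-Fx : Πₕ b4 b6 b8 a (d * d) a (d * d) ≈ Fxₕ * Fxₕ - a1 * Fxₕ * Fyₕ * d - (a2 * d * d + n# 2 * a) * Fyₕ * Fyₕ
    diagonal-Fx = comb (solve (a1 ∷ a2 ∷ a3 ∷ a4 ∷ a6 ∷ a ∷ e ∷ d ∷ []) (λ a1 a2 a3 a4 a6 a e d →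
      let b4 = con (+ 2) :* a4 :+ a1 :* a3
          b6 = a3 :* a3 :+ con (+ 4) :* a6
          b8 = a1 :* a1 :* a6 :+ con (+ 4) :* a2 :* a6 :- a1 :* a3 :* a4 :+ a2 :* a3 :* a3 :- a4 :* a4
          fy = con (+ 2) :* e :+ a1 :* a :* d :+ a3 :* (d :* d :* d)
          fx = a1 :* e :* d :- con (+ 3) :* a :* a :- con (+ 2) :* a2 :* a :* (d :* d) :- a4 :* (d :* d :* d :* d) in
      Πₑ b4 b6 b8 a (d :* d) a (d :* d) :- (fx :* fx :- a1 :* fx :* fy :* d :- (a2 :* d :* d :+ con (+ 2) :* a) :* fy :* fy) :=
      (a1 :* a1 :* d :* d :+ con (+ 4) :* a2 :* d :* d :+ con (+ 8) :* a) :* ((e :* e :+ a1 :* a :* e :* d :+ a3 :* e :* (d :* d :* d)) :- (a :* a :* a :+ a2 :* a :* a :* (d :* d) :+ a4 :* a :* (d :* d :* d :* d) :+ a6 :* (d :* d :* d :* d :* d :* d)))) ≡.refl)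
      (_ · eqn)

  b-relation : ∀ a1 a2 a3 a4 a6 →
    n# 4 * (a1 * a1 * a6 + n# 4 * a2 * a6 - a1 * a3 * a4 + a2 * a3 * a3 - a4 * a4) ≈
    (a1 * a1 + n# 4 * a2) * (a3 * a3 + n# 4 * a6) - (n# 2 * a4 + a1 * a3) * (n# 2 * a4 + a1 * a3)
  b-relation a1 a2 a3 a4 a6 = solve (a1 ∷ a2 ∷ a3 ∷ a4 ∷ a6 ∷ []) (λ a1 a2 a3 a4 a6 →
    con (+ 4) :* (a1 :* a1 :* a6 :+ con (+ 4) :* a2 :* a6 :- a1 :* a3 :* a4 :+ a2 :* a3 :* a3 :- a4 :* a4) :=
    (a1 :* a1 :+ con (+ 4) :* a2) :* (a3 :* a3 :+ con (+ 4) :* a6) :- (con (+ 2) :* a4 :+ a1 :* a3) :* (con (+ 2) :* a4 :+ a1 :* a3)) ≡.refl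

  -- cusps in characteristic 2 and 3, where the x-coordinate of the singular point is a square root, respectively a cube root
  module _ {b2 b4 b6 b8 : Carrier} (rel : n# 4 * b8 ≈ b2 * b6 - b4 * b4) (dom : NoZeroDivisors)
    (Δ≈0 : Δ-form b2 b4 b6 b8 ≈ 0#) (c4≈0 : b2 * b2 - n# 24 * b4 ≈ 0#) where

    private
      root : ∀ {x} → x * x ≈ 0# → x ≈ 0#
      root h = [ (λ e → e) , (λ e → e) ]′ (dom _ _ h)

    cusp₂ : n# 2 ≈ 0# → b8 * b8 ≈ b8 → Singular b8 b2 b4 b6 b8 × b2[ b8 ] b2 ≈ 0#
    cusp₂ 2≈0 sq = singular
        (comb (solve (b2 ∷ b4 ∷ b8 ∷ []) (λ b2 b4 b8 → t4 b8 b2 b4 :- con (+ 0) := con (+ 1) :* (b4 :- con (+ 0)) :+ b8 :* (b2 :- con (+ 0)) :+ (con (+ 3) :* b8 :* b8) :* (con (+ 2) :- con (+ 0))) ≡.refl) (_ · b4≈0 ⊕ _ · b2≈0 ⊕ _ · 2≈0))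
        (comb (solve (b2 ∷ b4 ∷ b6 ∷ b8 ∷ []) (λ b2 b4 b6 s → t6 s b2 b4 b6 :- con (+ 0) := con (+ 1) :* (b6 :- con (+ 0)) :+ (s :* s) :* (b2 :- con (+ 0)) :+ (s :* b4 :+ con (+ 2) :* s :* s :* s) :* (con (+ 2) :- con (+ 0))) ≡.refl) (_ · b6≈0 ⊕ _ · b2≈0 ⊕ _ · 2≈0))
        (comb (solve (b2 ∷ b4 ∷ b6 ∷ b8 ∷ []) (λ b2 b4 b6 s → t8 s b2 b4 b6 s :- con (+ 0) := (con (+ 3) :* s) :* (b6 :- con (+ 0)) :+ (con (+ 3) :* s :* s) :* (b4 :- con (+ 0)) :+ (s :* s :* s) :* (b2 :- con (+ 0))
            :+ (con (+ 3) :* (s :* s :+ s :+ con (+ 1))) :* (s :* s :- s) :+ (con (+ 2) :* s) :* (con (+ 2) :- con (+ 0))) ≡.refl) (_ · b6≈0 ⊕ _ · b4≈0 ⊕ _ · b2≈0 ⊕ _ · sq ⊕ _ · 2≈0)) ,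
        comb (solve (b2 ∷ b8 ∷ []) (λ b2 s → t2 s b2 :- con (+ 0) := con (+ 1) :* (b2 :- con (+ 0)) :+ (con (+ 6) :* s) :* (con (+ 2) :- con (+ 0))) ≡.refl) (_ · b2≈0 ⊕ _ · 2≈0)
      where
      b2≈0 : b2 ≈ 0#
      b2≈0 = root (comb (solve (b2 ∷ b4 ∷ []) (λ b2 b4 → b2 :* b2 :- con (+ 0) := con (+ 1) :* ((b2 :* b2 :- con (+ 24) :* b4) :- con (+ 0)) :+ (con (+ 12) :* b4) :* (con (+ 2) :- con (+ 0))) ≡.refl) (_ · c4≈0 ⊕ _ · 2≈0))
      b4≈0 : b4 ≈ 0#
      b4≈0 = root (comb (solve (b2 ∷ b4 ∷ b6 ∷ b8 ∷ []) (λ b2 b4 b6 b8 → b4 :* b4 :- con (+ 0) := con (+ 1) :* (con (+ 4) :* b8 :- (b2 :* b6 :- b4 :* b4)) :+ b6 :* (b2 :- con (+ 0)) :+ (:- (con (+ 2) :* b8)) :* (con (+ 2) :- con (+ 0))) ≡.refl)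
        (_ · rel ⊕ _ · b2≈0 ⊕ _ · 2≈0))
      b6≈0 : b6 ≈ 0#
      b6≈0 = root (comb (solve (b2 ∷ b4 ∷ b6 ∷ b8 ∷ []) (λ b2 b4 b6 b8 → b6 :* b6 :- con (+ 0) := con (+ 1) :* (Δₑ b2 b4 b6 b8 :- con (+ 0)) :+ (b2 :* b8 :- con (+ 9) :* b4 :* b6) :* (b2 :- con (+ 0))
          :+ (con (+ 4) :* b4 :* b4 :* b4 :+ con (+ 14) :* b6 :* b6) :* (con (+ 2) :- con (+ 0))) ≡.refl)
        (_ · Δ≈0 ⊕ _ · b2≈0 ⊕ _ · 2≈0))

    cusp₃ : n# 3 ≈ 0# → b6 * b6 * b6 ≈ b6 → Singular (- b6) b2 b4 b6 b8 × b2[ - b6 ] b2 ≈ 0#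
    cusp₃ 3≈0 cube = singular
        (comb (solve (b2 ∷ b4 ∷ b6 ∷ []) (λ b2 b4 b6 → t4 (:- b6) b2 b4 :- con (+ 0) := con (+ 1) :* (b4 :- con (+ 0)) :+ (:- b6) :* (b2 :- con (+ 0)) :+ (con (+ 2) :* b6 :* b6) :* (con (+ 3) :- con (+ 0))) ≡.refl) (_ · b4≈0 ⊕ _ · b2≈0 ⊕ _ · 3≈0))
        (comb (solve (b2 ∷ b4 ∷ b6 ∷ []) (λ b2 b4 b6 → t6 (:- b6) b2 b4 b6 :- con (+ 0) := (:- (con (+ 2) :* b6)) :* (b4 :- con (+ 0)) :+ (b6 :* b6) :* (b2 :- con (+ 0)) :+ (:- con (+ 4)) :* (b6 :* b6 :* b6 :- b6) :+ (:- b6) :* (con (+ 3) :- con (+ 0))) ≡.refl)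
          (_ · b4≈0 ⊕ _ · b2≈0 ⊕ _ · cube ⊕ _ · 3≈0))
        (comb (solve (b2 ∷ b4 ∷ b6 ∷ b8 ∷ []) (λ b2 b4 b6 b8 → let s = :- b6 in t8 s b2 b4 b6 b8 :- con (+ 0) := con (+ 1) :* (b8 :- con (+ 0)) :+ (s :* s :* s) :* (b2 :- con (+ 0))
            :+ (s :* b6 :+ s :* s :* b4 :+ s :* s :* s :* s) :* (con (+ 3) :- con (+ 0))) ≡.refl) (_ · b8≈0 ⊕ _ · b2≈0 ⊕ _ · 3≈0)) ,
        comb (solve (b2 ∷ b6 ∷ []) (λ b2 b6 → t2 (:- b6) b2 :- con (+ 0) := con (+ 1) :* (b2 :- con (+ 0)) :+ (:- (con (+ 4) :* b6)) :* (con (+ 3) :- con (+ 0))) ≡.refl) (_ · b2≈0 ⊕ _ · 3≈0)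
      where
      b2≈0 : b2 ≈ 0#
      b2≈0 = root (comb (solve (b2 ∷ b4 ∷ []) (λ b2 b4 → b2 :* b2 :- con (+ 0) := con (+ 1) :* ((b2 :* b2 :- con (+ 24) :* b4) :- con (+ 0)) :+ (con (+ 8) :* b4) :* (con (+ 3) :- con (+ 0))) ≡.refl) (_ · c4≈0 ⊕ _ · 3≈0))
      b4≈0 : b4 ≈ 0#
      b4≈0 = [ (λ e → e) , root ]′ (dom _ _ (comb (solve (b2 ∷ b4 ∷ b6 ∷ b8 ∷ []) (λ b2 b4 b6 b8 → b4 :* (b4 :* b4) :- con (+ 0) := con (+ 1) :* (Δₑ b2 b4 b6 b8 :- con (+ 0)) :+ (b2 :* b8) :* (b2 :- con (+ 0))
          :+ (con (+ 3) :* b4 :* b4 :* b4 :+ con (+ 9) :* b6 :* b6 :- con (+ 3) :* b2 :* b4 :* b6) :* (con (+ 3) :- con (+ 0))) ≡.refl)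
        (_ · Δ≈0 ⊕ _ · b2≈0 ⊕ _ · 3≈0)))
      b8≈0 : b8 ≈ 0#
      b8≈0 = comb (solve (b2 ∷ b4 ∷ b6 ∷ b8 ∷ []) (λ b2 b4 b6 b8 → b8 :- con (+ 0) := con (+ 1) :* (con (+ 4) :* b8 :- (b2 :* b6 :- b4 :* b4)) :+ b6 :* (b2 :- con (+ 0)) :+ (:- b4) :* (b4 :- con (+ 0)) :+ (:- b8) :* (con (+ 3) :- con (+ 0))) ≡.refl)
        (_ · rel ⊕ _ · b2≈0 ⊕ _ · b4≈0 ⊕ _ · 3≈0)

-- From homogeneous to affine coordinates

module Affine {c ℓ : Level} (R : CommutativeRing c ℓ) where
  open import Data.Vec using ([]; _∷_)
  open import Data.Integer using (+_)
  open CommutativeRing R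
  open Solver R
  open LocAlg R using (Singular)

  private n# = λ k → fromℤ (+ k)

  module _ {a1 a2 a3 a4 a6 x y a e d : Carrier} (ha : a ≈ x * (d * d)) (he : e ≈ y * (d * d * d)) where
    affine-F : e * e + a1 * a * e * d + a3 * e * (d * d * d) ≈ a * a * a + a2 * a * a * (d * d) + a4 * a * (d * d * d * d) + a6 * (d * d * d * d * d * d) →
      (d * d * d) * ((d * d * d) * (y * y + a1 * x * y + a3 * y - x * x * x - a2 * x * x - a4 * x - a6)) ≈ 0#
    affine-F h = comb (solve (a1 ∷ a2 ∷ a3 ∷ a4 ∷ a6 ∷ x ∷ y ∷ a ∷ e ∷ d ∷ []) (λ a1 a2 a3 a4 a6 x y a e d →
        (d :* d :* d) :* ((d :* d :* d) :* (y :* y :+ a1 :* x :* y :+ a3 :* y :- x :* x :* x :- a2 :* x :* x :- a4 :* x :- a6)) :- con (+ 0) :=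
        con (+ 1) :* ((e :* e :+ a1 :* a :* e :* d :+ a3 :* e :* (d :* d :* d)) :- (a :* a :* a :+ a2 :* a :* a :* (d :* d) :+ a4 :* a :* (d :* d :* d :* d) :+ a6 :* (d :* d :* d :* d :* d :* d)))
        :+ (:- (e :+ y :* (d :* d :* d) :+ a1 :* a :* d :+ a3 :* (d :* d :* d))) :* (e :- y :* (d :* d :* d))
        :+ (a :* a :+ a :* x :* (d :* d) :+ x :* x :* (d :* d :* d :* d) :+ a2 :* (d :* d) :* (a :+ x :* (d :* d)) :+ a4 :* (d :* d :* d :* d) :- a1 :* y :* (d :* d :* d :* d)) :* (a :- x :* (d :* d))) ≡.refl)
      (_ · h ⊕ _ · he ⊕ _ · ha)

    affine-Fy : n# 2 * e + a1 * a * d + a3 * (d * d * d) ≈ (d * d * d) * (n# 2 * y + a1 * x + a3)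
    affine-Fy = comb (solve (a1 ∷ a3 ∷ x ∷ y ∷ a ∷ e ∷ d ∷ []) (λ a1 a3 x y a e d →
        (con (+ 2) :* e :+ a1 :* a :* d :+ a3 :* (d :* d :* d)) :- (d :* d :* d) :* (con (+ 2) :* y :+ a1 :* x :+ a3) :=
        con (+ 2) :* (e :- y :* (d :* d :* d)) :+ (a1 :* d) :* (a :- x :* (d :* d))) ≡.refl)
      (_ · he ⊕ _ · ha)

    affine-Fx : a1 * e * d - n# 3 * a * a - n# 2 * a2 * a * (d * d) - a4 * (d * d * d * d) ≈ (d * d * d * d) * (a1 * y - n# 3 * x * x - n# 2 * a2 * x - a4)
    affine-Fx = comb (solve (a1 ∷ a2 ∷ a4 ∷ x ∷ y ∷ a ∷ e ∷ d ∷ []) (λ a1 a2 a4 x y a e d →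
        (a1 :* e :* d :- con (+ 3) :* a :* a :- con (+ 2) :* a2 :* a :* (d :* d) :- a4 :* (d :* d :* d :* d)) :- (d :* d :* d :* d) :* (a1 :* y :- con (+ 3) :* x :* x :- con (+ 2) :* a2 :* x :- a4) :=
        (a1 :* d) :* (e :- y :* (d :* d :* d)) :+ (:- (con (+ 3) :* (a :+ x :* (d :* d)) :+ con (+ 2) :* a2 :* (d :* d))) :* (a :- x :* (d :* d))) ≡.refl)
      (_ · he ⊕ _ · ha)

  same-abscissa : ∀ {x a d a′ d′} → a ≈ x * (d * d) → a′ ≈ x * (d′ * d′) → a * (d′ * d′) - a′ * (d * d) ≈ 0#
  same-abscissa {x} {a} {d} {a′} {d′} h h′ = comb (solve (x ∷ a ∷ d ∷ a′ ∷ d′ ∷ []) (λ x a d a′ d′ →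
      (a :* (d′ :* d′) :- a′ :* (d :* d)) :- con (+ 0) := (d′ :* d′) :* (a :- x :* (d :* d)) :+ (:- (d :* d)) :* (a′ :- x :* (d′ :* d′))) ≡.refl)
    (_ · h ⊕ _ · h′)

  from-inverse : ∀ {w d a e x y} → w * d ≈ 1# → a * (w * w) ≈ x → e * (w * w * w) ≈ y → a ≈ x * (d * d) × e ≈ y * (d * d * d)
  from-inverse {w} {d} {a} {e} {x} {y} hw hx hy =
    comb (solve (w ∷ d ∷ a ∷ x ∷ []) (λ w d a x → a :- x :* (d :* d) := (:- (a :* (w :* d :+ con (+ 1)))) :* (w :* d :- con (+ 1)) :+ (d :* d) :* (a :* (w :* w) :- x)) ≡.refl) (_ · hw ⊕ _ · hx) ,
    comb (solve (w ∷ d ∷ e ∷ y ∷ []) (λ w d e y → e :- y :* (d :* d :* d) := (:- (e :* (w :* d :* (w :* d) :+ w :* d :+ con (+ 1)))) :* (w :* d :- con (+ 1)) :+ (d :* d :* d) :* (e :* (w :* w :* w) :- y)) ≡.refl) (_ · hw ⊕ _ · hy)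

  module _ {a1 a2 a3 a4 a6 s x y : Carrier} (x≈s : x ≈ s)
    (F≈0 : y * y + a1 * x * y + a3 * y - x * x * x - a2 * x * x - a4 * x - a6 ≈ 0#)
    (sing : Singular s (a1 * a1 + n# 4 * a2) (n# 2 * a4 + a1 * a3) (a3 * a3 + n# 4 * a6) (a1 * a1 * a6 + n# 4 * a2 * a6 - a1 * a3 * a4 + a2 * a3 * a3 - a4 * a4)) where

    -- On the curve Fy² equals 4x³ + b₂x² + 2b₄x + b₆, whose value at s is the translated b₆.
    singular-Fy : (n# 2 * y + a1 * x + a3) * (n# 2 * y + a1 * x + a3) ≈ 0#
    singular-Fy = comb (solve (a1 ∷ a2 ∷ a3 ∷ a4 ∷ a6 ∷ s ∷ x ∷ y ∷ []) (λ a1 a2 a3 a4 a6 s x y →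
        let b2 = a1 :* a1 :+ con (+ 4) :* a2
            b4 = con (+ 2) :* a4 :+ a1 :* a3
            b6 = a3 :* a3 :+ con (+ 4) :* a6
            fy = con (+ 2) :* y :+ a1 :* x :+ a3 in
        fy :* fy :- con (+ 0) := con (+ 4) :* ((y :* y :+ a1 :* x :* y :+ a3 :* y :- x :* x :* x :- a2 :* x :* x :- a4 :* x :- a6) :- con (+ 0))
          :+ con (+ 1) :* ((b6 :+ con (+ 2) :* s :* b4 :+ s :* s :* b2 :+ con (+ 4) :* s :* s :* s) :- con (+ 0))
          :+ (con (+ 2) :* b4 :+ b2 :* (x :+ s) :+ con (+ 4) :* (x :* x :+ x :* s :+ s :* s)) :* (x :- s)) ≡.refl)
      (_ · F≈0 ⊕ _ · Singular.s6 sing ⊕ _ · x≈s)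

    -- Modulo Fy, the square of Fx is x⁴ - b₄x² - 2b₆x - b₈, and at x = s this is s B₆ - B₈ in the
    -- translated invariants.
    singular-Fx : n# 2 * y + a1 * x + a3 ≈ 0# → (a1 * y - n# 3 * x * x - n# 2 * a2 * x - a4) * (a1 * y - n# 3 * x * x - n# 2 * a2 * x - a4) ≈ 0#
    singular-Fx fy≈0 = comb (solve (a1 ∷ a2 ∷ a3 ∷ a4 ∷ a6 ∷ s ∷ x ∷ y ∷ []) (λ a1 a2 a3 a4 a6 s x y →
        let b2 = a1 :* a1 :+ con (+ 4) :* a2
            b4 = con (+ 2) :* a4 :+ a1 :* a3
            b6 = a3 :* a3 :+ con (+ 4) :* a6
            b8 = a1 :* a1 :* a6 :+ con (+ 4) :* a2 :* a6 :- a1 :* a3 :* a4 :+ a2 :* a3 :* a3 :- a4 :* a4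
            fy = con (+ 2) :* y :+ a1 :* x :+ a3
            fx = a1 :* y :- con (+ 3) :* x :* x :- con (+ 2) :* a2 :* x :- a4 in
        fx :* fx :- con (+ 0) := (:- (a1 :* a1 :+ con (+ 4) :* a2 :+ con (+ 8) :* x)) :* ((y :* y :+ a1 :* x :* y :+ a3 :* y :- x :* x :* x :- a2 :* x :* x :- a4 :* x :- a6) :- con (+ 0))
          :+ (a1 :* fx :+ (a2 :+ con (+ 2) :* x) :* fy) :* (fy :- con (+ 0))
          :+ x :* ((b6 :+ con (+ 2) :* s :* b4 :+ s :* s :* b2 :+ con (+ 4) :* s :* s :* s) :- con (+ 0))
          :+ (:- con (+ 1)) :* ((b8 :+ con (+ 3) :* s :* b6 :+ con (+ 3) :* s :* s :* b4 :+ s :* s :* s :* b2 :+ con (+ 3) :* s :* s :* s :* s) :- con (+ 0))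
          :+ (x :* (con (+ 2) :* b4 :+ b2 :* (x :+ s) :+ con (+ 4) :* (x :* x :+ x :* s :+ s :* s))
              :- (con (+ 3) :* b6 :+ con (+ 3) :* b4 :* (x :+ s) :+ b2 :* (x :* x :+ x :* s :+ s :* s) :+ con (+ 3) :* (x :* x :* x :+ x :* x :* s :+ x :* s :* s :+ s :* s :* s))) :* (x :- s)) ≡.refl)
      (_ · F≈0 ⊕ _ · fy≈0 ⊕ _ · Singular.s6 sing ⊕ _ · Singular.s8 sing ⊕ _ · x≈s)

-- Divisibility of the sequence by powers of one prime

module Local where
  open import Defs using (Curve)
  open import Data.Integer using (+_; _+_; _*_; _-_; -_)
  open import Data.Vec using ([]; _∷_)
  open import Relation.Binary.PropositionalEquality hiding ([_])
  open Model
  open Sequence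
  open Zp
  open Frob using (prime>1)

  module Sℤ = Solver ℤring
  open Sℤ using (_:+_; _:*_; _:-_; :-_; _:=_; con)

  ≡⇒~ : ∀ M {x y} → x ≡ y → CommutativeRing._≈_ (ZMod M) x y
  ≡⇒~ M = CommutativeRing.reflexive (ZMod M)

  ≡0-* : ∀ {M} x {y} → y ≡0[ M ] → x * y ≡0[ M ]
  ≡0-* {M} x {y} (q , h) = x * q , trans (cong (x *_) h) (sym (ℤP.*-assoc x q (+ M)))

  ≡0-*ˡ : ∀ {M} {x} y → x ≡0[ M ] → x * y ≡0[ M ]
  ≡0-*ˡ {M} {x} y h = subst (_≡0[ M ]) (ℤP.*-comm y x) (≡0-* y h)

  ≡0-+ : ∀ {M x y} → x ≡0[ M ] → y ≡0[ M ] → x + y ≡0[ M ]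
  ≡0-+ {M} (q , refl) (r , refl) = q + r , sym (ℤP.*-distribʳ-+ (+ M) q r)

  ≡0-weaken : ∀ {M N x} → M ℕD.∣ N → x ≡0[ N ] → x ≡0[ M ]
  ≡0-weaken M∣N h = ∣⇒≡0 (ℕD.∣-trans M∣N (≡0⇒∣ h))

  p∣p^ : ∀ p {e} → 1 ℕ.≤ e → p ℕD.∣ p ℕ.^ e
  p∣p^ p {suc e} _ = ℕD.m∣m*n (p ℕ.^ e)

  ≡0-mul : ∀ {M N x y} → x ≡0[ M ] → y ≡0[ N ] → x * y ≡0[ M ℕ.* N ]
  ≡0-mul {M} {N} (q , refl) (r , refl) = q * r , trans
    (Sℤ.solve (q ∷ + M ∷ r ∷ + N ∷ []) (λ q m r n → (q :* m) :* (r :* n) := (q :* r) :* (m :* n)) refl) (cong ((q * r) *_) (sym (ℤP.pos-* M N)))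

  module Prime-local (p : ℕ) (pp : Prime p) where
    open Field p pp

    instance
      p≢0 : ℕ.NonZero p
      p≢0 = prime⇒nonZero pp

    -- a quadratic equation with unit leading coefficient has p-integral roots: if (B/pᵉ)² u = t (B/pᵉ) + w then pᵉ ∣ B
    integral-root : ∀ e u B t w → ¬ (u ≡0[ p ]) →
      u * (B * B) ≡ + (p ℕ.^ e) * (t * B) + (+ (p ℕ.^ e) * + (p ℕ.^ e)) * w → B ≡0[ p ℕ.^ e ]
    integral-root zero u B t w n h = B , sym (ℤP.*-identityʳ B)
    integral-root (suc e) u B t w n h = conclude ([ (λ k → ⊥-elim (n k)) , (λ k → [ (λ x → x) , (λ x → x) ]′ (≡0-prime B B k)) ]′ (≡0-prime u (B * B) uBB))
      where
      M = + (p ℕ.^ e)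
      pM : + (p ℕ.^ suc e) ≡ + p * M
      pM = ℤP.pos-* p (p ℕ.^ e)
      h′ : u * (B * B) ≡ (+ p * M) * (t * B) + ((+ p * M) * (+ p * M)) * w
      h′ = trans h (cong (λ z → z * (t * B) + (z * z) * w) pM)
      uBB : u * (B * B) ≡0[ p ]
      uBB = M * (t * B) + M * (+ p * M) * w , trans h′ (Sℤ.solve (+ p ∷ M ∷ t * B ∷ w ∷ []) (λ p m x w → (p :* m) :* x :+ ((p :* m) :* (p :* m)) :* w := (m :* x :+ m :* (p :* m) :* w) :* p) refl)
      conclude : B ≡0[ p ] → B ≡0[ p ℕ.^ suc e ]
      conclude (q , B≡) = let (r , q≡) = integral-root e u q t w n h″ in
        r , trans B≡ (trans (cong (_* + p) q≡) (trans (Sℤ.solve (r ∷ M ∷ + p ∷ []) (λ r m p → r :* m :* p := r :* (p :* m)) refl) (cong (r *_) (sym pM))))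
        where
        h″ : u * (q * q) ≡ M * (t * q) + (M * M) * w
        h″ = ℤP.*-cancelˡ-≡ (+ p) _ _ (ℤP.*-cancelˡ-≡ (+ p) _ _ (trans
          (Sℤ.solve (+ p ∷ u ∷ q ∷ []) (λ p u q → p :* (p :* (u :* (q :* q))) := u :* ((q :* p) :* (q :* p))) refl)
          (trans (subst (λ z → u * (z * z) ≡ (+ p * M) * (t * z) + ((+ p * M) * (+ p * M)) * w) B≡ h′)
          (Sℤ.solve (+ p ∷ M ∷ t ∷ q ∷ w ∷ []) (λ p m t q w → (p :* m) :* (t :* (q :* p)) :+ ((p :* m) :* (p :* m)) :* w := p :* (p :* (m :* (t :* q) :+ (m :* m) :* w))) refl))))

    private
      square-div : ∀ k ε d → p ℕ.^ (k ℕ.+ k ℕ.+ ε) ℕD.∣ d ℕ.* d → ε ℕ.≤ 1 → p ℕ.^ (k ℕ.+ ε) ℕD.∣ d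
      square-div zero zero d h _ = ℕD.1∣ d
      square-div zero (suc zero) d h _ = subst (ℕD._∣ d) (sym (ℕP.*-identityʳ p)) ([ (λ x → x) , (λ x → x) ]′ (euclidsLemma d d pp (subst (ℕD._∣ d ℕ.* d) (ℕP.*-identityʳ p) h)))
      square-div zero (suc (suc ε)) d h (ℕ.s≤s ())
      square-div (suc k) ε d h ε≤1 = conclude ([ (λ x → x) , (λ x → x) ]′ (euclidsLemma d d pp (ℕD.∣-trans (ℕD.m∣m*n (p ℕ.^ (k ℕ.+ suc k ℕ.+ ε))) h)))
        where
        conclude : p ℕD.∣ d → p ℕ.^ (suc k ℕ.+ ε) ℕD.∣ d
        conclude (ℕD.divides q refl) = subst (p ℕ.^ (suc k ℕ.+ ε) ℕD.∣_) (ℕP.*-comm p q) (ℕD.*-monoʳ-∣ p (square-div k ε q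
          (ℕD.*-cancelˡ-∣ p (ℕD.*-cancelˡ-∣ p (subst₂ ℕD._∣_ e₁ e₂ h))) ε≤1))
          where
          e₁ : p ℕ.^ (suc k ℕ.+ suc k ℕ.+ ε) ≡ p ℕ.* (p ℕ.* p ℕ.^ (k ℕ.+ k ℕ.+ ε))
          e₁ = cong (λ n → p ℕ.* p ℕ.^ n) (cong (ℕ._+ ε) (ℕP.+-suc k k))
          e₂ : q ℕ.* p ℕ.* (q ℕ.* p) ≡ p ℕ.* (p ℕ.* (q ℕ.* q))
          e₂ = trans (ℕP.*-assoc q p (q ℕ.* p)) (trans (ℕP.*-comm q (p ℕ.* (q ℕ.* p))) (trans (ℕP.*-assoc p (q ℕ.* p) q) (cong (p ℕ.*_) (trans (cong (ℕ._* q) (ℕP.*-comm q p)) (ℕP.*-assoc p q q)))))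

    root-exact : ∀ k {d} → p ℕ.^ (k ℕ.+ k) ℕD.∣ d ℕ.* d → p ℕ.^ k ℕD.∣ d
    root-exact k {d} h = subst (λ n → p ℕ.^ n ℕD.∣ d) (ℕP.+-identityʳ k) (square-div k 0 d (subst (λ n → p ℕ.^ n ℕD.∣ d ℕ.* d) (sym (ℕP.+-identityʳ (k ℕ.+ k))) h) ℕ.z≤n)

    -- The order at p of a square is even, so one surplus factor of p in B = D² already yields a new
    -- factor in D. This is why `gain` need only win a single factor.
    root-excess : ∀ k {d} → p ℕ.^ suc (k ℕ.+ k) ℕD.∣ d ℕ.* d → p ℕ.^ suc k ℕD.∣ d
    root-excess k {d} h = subst (λ n → p ℕ.^ n ℕD.∣ d) (ℕP.+-comm k 1) (square-div k 1 d (subst (λ n → p ℕ.^ n ℕD.∣ d ℕ.* d) (sym (ℕP.+-comm (k ℕ.+ k) 1)) h) ℕP.≤-refl)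

    square-mod : ∀ k {d} → p ℕ.^ k ℕD.∣ d → p ℕ.^ (k ℕ.+ k) ℕD.∣ d ℕ.* d
    square-mod k {d} h = subst (ℕD._∣ d ℕ.* d) (sym (ℕP.^-distribˡ-+-* p k k)) (ℕD.*-pres-∣ h h)

    -- Serves twice: with V = U, the distance from a cusp, modulo p, and with V = A near infinity,
    -- modulo p^(e+1). In both cases b / v is the square of an additive parameter, hence
    -- proportional to j².
    module Quadratic (e : ℕ) (V B : ℕ → ℤ) (V-unit : ∀ j → ¬ (V j ≡0[ p ])) (B₀ : B 0 ≡ 0ℤ)
      (rel : ∀ j → ∃ λ c → ¬ (c ≡0[ p ]) ×
        CommutativeRing._≈_ (ZMod (p ℕ.^ e)) (+ 2 * V (suc j) * V 1 * (V (suc j) * B 1 + V 1 * B (suc j))) (c * (V (suc (suc j)) * B j + V j * B (suc (suc j)))) ×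
        CommutativeRing._≈_ (ZMod (p ℕ.^ e)) (V (suc j) * V (suc j) * V 1 * V 1) (c * (V (suc (suc j)) * V j))) where

      private
        M = p ℕ.^ e
        open CommutativeRing (ZMod M) using (_≈_)

      law : ∀ j → V 1 * B j ≈ + j * + j * B 1 * V j × V 1 * B (suc j) ≈ + suc j * + suc j * B 1 * V (suc j)
      law zero = ≡⇒~ M (trans (cong (V 1 *_) B₀) (ℤP.*-zeroʳ (V 1))) ,
        ≡⇒~ M (Sℤ.solve (V 1 ∷ B 1 ∷ []) (λ v b → v :* b := con (+ 1) :* con (+ 1) :* b :* v) refl)
      law (suc j) = proj₂ (law j) , next (rel j)
        where
        next : (∃ λ c → ¬ (c ≡0[ p ]) ×
          (+ 2 * V (suc j) * V 1 * (V (suc j) * B 1 + V 1 * B (suc j))) ≈ (c * (V (suc (suc j)) * B j + V j * B (suc (suc j)))) ×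
          (V (suc j) * V (suc j) * V 1 * V 1) ≈ (c * (V (suc (suc j)) * V j))) → V 1 * B (suc (suc j)) ≈ + suc (suc j) * + suc (suc j) * B 1 * V (suc (suc j))
        next (c , c≢0 , hS , hΠ) = subst (λ n → (V 1 * B (suc (suc j)) - n * n * B 1 * V (suc (suc j))) ≡0[ M ])
            (cong +_ (cong suc (ℕP.+-comm j 1)))
            (cancel-unit e (c * V j) (V 1 * B (suc (suc j)) - (+ suc j + 1ℤ) * (+ suc j + 1ℤ) * B 1 * V (suc (suc j)))
            (λ h → [ c≢0 , V-unit j ]′ (≡0-prime c (V j) h))
            (~⇒≡0 (LocAlg.quadratic-step (ZMod M) {V (suc j)} {B (suc j)} {V 1} {B 1} {V (suc (suc j))} {B (suc (suc j))} {V j} {B j} {c} {+ suc j}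
              hS hΠ (proj₂ (law j)) (proj₁ (law j)))))

  module Reduction (E : Curve) (seq : EllSeq E) (p : ℕ) (pp : Prime p) where
    open Invariants E
    open EllSeq seq
    open Field p pp
    open Prime-local p pp
    private
      module L = LocAlg (ZMod p)

    record Relation (a b m k : ℕ) (c : ℤ) : Set where
      constructor relation
      field
        r₁ : Fℤ.H (A a) (B a) (A b) (B b) * Fℤ.H (A a) (B a) (A b) (B b) ≡ c * (B m * B k)
        r₂ : Fℤ.Sₕ β2 β4 β6 (A a) (B a) (A b) (B b) ≡ c * (A m * B k + A k * B m)
        r₃ : Fℤ.Πₕ β4 β6 β8 (A a) (B a) (A b) (B b) ≡ c * (A m * A k)

    relate : ∀ {a b m k} → a ≡ b ℕ.+ k → m ≡ a ℕ.+ b → ∃ (Relation a b m k)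
    relate e f = let (c , r₁ , r₂ , r₃) = biquadratic e f in c , relation r₁ r₂ r₃

    -- every point [n]P is nonsingular modulo p
    Nonsingular : Set
    Nonsingular = ∀ {a b m k c} → a ≡ b ℕ.+ k → m ≡ a ℕ.+ b → Relation a b m k c → ¬ (c ≡0[ p ])

    not-both : ∀ n → A n ≡0[ p ] → B n ≡0[ p ] → ⊥
    not-both n hA hB = let (r , s , h) = unimodular n in
      1≢0 (subst (_≡0[ p ]) h (≡0-+ (≡0-* r hA) (≡0-* s hB)))

    ≡0-square : ∀ x → x * x ≡0[ p ] → x ≡0[ p ]
    ≡0-square x h = [ (λ k → k) , (λ k → k) ]′ (≡0-prime x x h)

    Δℤ : ℤ
    Δℤ = LocAlg.Δ-form ℤring β2 β4 β6 β8

    β-relation : + 4 * β8 ≡ β2 * β6 - β4 * β4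
    β-relation = LocAlg.b-relation ℤring a1 a2 a3 a4 a6

    private
      kill : ∀ x y → ¬ (x ≡0[ p ]) → x * y ≡0[ p ] → y ≡0[ p ]
      kill x y n h = [ (λ k → ⊥-elim (n k)) , (λ k → k) ]′ (≡0-prime x y h)

      power≢0 : ∀ n x → ¬ (x ≡0[ p ]) → ¬ (Solver._^_ (ZMod p) x n ≡0[ p ])
      power≢0 zero x h = 1≢0
      power≢0 (suc n) x h k = power≢0 n x h (kill x _ h k)

    -- If p divides c, then H, S and Π vanish modulo p. Should p divide B b, then it divides B a,
    -- and Π reduces to the unit (A a · A b)². Otherwise the abscissas agree, both diagonal forms
    -- vanish, and so does the discriminant.
    good⇒nonsingular : ¬ (Δℤ ≡0[ p ]) → Nonsingular
    good⇒nonsingular Δ≢0 {a} {b} {m} {k} {c} e f (relation r₁ r₂ r₃) c≡0 = by-cases (≡0? p (B b))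
      where
      H≡0 : Fℤ.H (A a) (B a) (A b) (B b) ≡0[ p ]
      H≡0 = ≡0-square _ (subst (_≡0[ p ]) (sym r₁) (≡0-*ˡ (B m * B k) c≡0))
      S≡0 : Fℤ.Sₕ β2 β4 β6 (A a) (B a) (A b) (B b) ≡0[ p ]
      S≡0 = subst (_≡0[ p ]) (sym r₂) (≡0-*ˡ (A m * B k + A k * B m) c≡0)
      Π≡0 : Fℤ.Πₕ β4 β6 β8 (A a) (B a) (A b) (B b) ≡0[ p ]
      Π≡0 = subst (_≡0[ p ]) (sym r₃) (≡0-*ˡ (A m * A k) c≡0)
      by-cases : Dec (B b ≡0[ p ]) → ⊥
      by-cases (yes Bb) = [ (λ h → not-both a h Ba) , (λ h → not-both b h Bb) ]′ (≡0-prime (A a) (A b) (≡0-square (A a * A b)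
          (subst (_≡0[ p ]) (Sℤ.solve (A a ∷ A b ∷ []) (λ a b → a :* a :* b :* b := (a :* b) :* (a :* b)) refl)
          (~⇒≡0 (CommutativeRing.trans (ZMod p) {A a * A a * A b * A b} {Fℤ.Πₕ β4 β6 β8 (A a) (B a) (A b) (B b)} {0ℤ}
            (CommutativeRing.sym (ZMod p) {Fℤ.Πₕ β4 β6 β8 (A a) (B a) (A b) (B b)} {A a * A a * A b * A b}
              (proj₂ (L.vanishing-bb′ {β2} {β4} {β6} {β8} {A a} {B a} {A b} {B b} (≡0⇒~ (≡0-* (B a) Bb)))))
            (≡0⇒~ Π≡0))))))
        where
        Ba : B a ≡0[ p ]
        Ba = kill (A b) (B a) (λ h → not-both b h Bb)
          (subst (_≡0[ p ]) (Sℤ.solve (A a ∷ B a ∷ A b ∷ B b ∷ []) (λ a b a′ b′ → a :* b′ :+ (:- con (+ 1)) :* (a :* b′ :- a′ :* b) := a′ :* b) refl)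
            (≡0-+ (≡0-* (A a) Bb) (≡0-* (- 1ℤ) H≡0)))
      by-cases (no Bb) = Δ≢0 (kill _ Δℤ (power≢0 7 (B a) Ba) (~⇒≡0 (L.discriminant {β2} {β4} {β6} {β8} {A a} {B a} {A a} {B a} (≡⇒~ p β-relation)
          (≡0⇒~ (kill (B b) _ Bb (kill (B b) _ Bb (~⇒≡0 (L.diagonal-S {β2} {β4} {β6} {β8} {A a} {B a} {A b} {B b} (≡0⇒~ H≡0) (≡0⇒~ S≡0))))))
          (≡0⇒~ (kill (B b) _ Bb (kill (B b) _ Bb (~⇒≡0 (L.diagonal-Π {β2} {β4} {β6} {β8} {A a} {B a} {A b} {B b} (≡0⇒~ H≡0) (≡0⇒~ Π≡0)))))))))
        where
        Ba : ¬ (B a ≡0[ p ])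
        Ba h = not-both a (kill (B b) (A a) Bb (subst (_≡0[ p ]) (Sℤ.solve (A a ∷ B a ∷ A b ∷ B b ∷ []) (λ a b a′ b′ → (a :* b′ :- a′ :* b) :+ a′ :* b := b′ :* a) refl)
          (≡0-+ H≡0 (≡0-* (A b) h)))) h

    module Bad (s : ℤ) (sing : L.Singular s β2 β4 β6 β8) where
      U : ℕ → ℤ
      U n = A n - s * B n
      τ : ℤ
      τ = L.b2[ s ] β2

      module _ {a b m k c} (r : Relation a b m k c) where
        open Relation r
        open CommutativeRing (ZMod p) using (_≈_)

        U-sum : + 2 * U a * U b * (U a * B b + U b * B a) + τ * U a * U b * B a * B b ≈ c * (U m * B k + U k * B m)
        U-sum = L.translate-S {β2} {β4} {β6} {β8} {A a} {B a} {A b} {B b} {s} {A m} {B m} {A k} {B k} {c} sing (≡⇒~ p r₁) (≡⇒~ p r₂) (≡⇒~ p r₃)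

        U-prod : U a * U a * U b * U b ≈ c * (U m * U k)
        U-prod = L.translate-Π {β2} {β4} {β6} {β8} {A a} {B a} {A b} {B b} {s} {A m} {B m} {A k} {B k} {c} sing (≡⇒~ p r₁) (≡⇒~ p r₂) (≡⇒~ p r₃)

        -- The translated product relation is U_a² U_b² = c U_m U_k, so units on the left force c
        -- and U_m to be units. Started at P, this reaches every multiple: none reduces to the
        -- singular point.
        U-units : ¬ (U a ≡0[ p ]) → ¬ (U b ≡0[ p ]) → ¬ (c ≡0[ p ]) × ¬ (U m ≡0[ p ])
        U-units ha hb = (λ h → absurd (≡0-*ˡ (U m * U k) h)) , (λ h → absurd (≡0-* c (≡0-*ˡ (U k) h)))
          where
          absurd : c * (U m * U k) ≡0[ p ] → ⊥
          absurd h = [ (λ h → [ (λ h → ha (≡0-square _ h)) , hb ]′ (≡0-prime (U a * U a) (U b) h)) , hb ]′ (≡0-prime (U a * U a * U b) (U b)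
            (~⇒≡0 (CommutativeRing.trans (ZMod p) {U a * U a * U b * U b} {c * (U m * U k)} {0ℤ} U-prod (≡0⇒~ h))))

      module _ (U₁ : ¬ (U 1 ≡0[ p ])) where

        U-unit : ∀ n → ¬ (U n ≡0[ p ])
        U-unit zero h = 1≢0 (subst (_≡0[ p ]) (trans (cong₂ (λ a d → a - s * (+ d * + d)) A₀ D₀) (cong (λ t → 1ℤ - t) (ℤP.*-zeroʳ s))) h)
        U-unit (suc zero) = U₁
        U-unit (suc (suc n)) = let (c , r) = relate {suc n} {1} {suc n ℕ.+ 1} {n} refl refl in
          subst (λ m → ¬ (U m ≡0[ p ])) (ℕP.+-comm (suc n) 1) (proj₂ (U-units r (U-unit (suc n)) U₁))

        bad⇒nonsingular : Nonsingular
        bad⇒nonsingular {a} {b} e f r = proj₁ (U-units r (U-unit a) (U-unit b))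

        -- For τ = 0 the translated relations are those of `Quadratic`, so U₁ B_p is a multiple of
        -- p².
        additive⇒p∣B : τ ≡0[ p ] → B p ≡0[ p ]
        additive⇒p∣B τ≡0 = kill (U 1) (B p) U₁ (subst (λ M → U 1 * B p ≡0[ M ]) (ℕP.*-identityʳ p)
          (~⇒≡0 {p ℕ.^ 1} {U 1 * B p} (CommutativeRing.trans (ZMod (p ℕ.^ 1)) {U 1 * B p} {+ p * + p * B 1 * U p} {0ℤ} (proj₁ (Quadratic.law 1 U B U-unit (cong (λ d → + d * + d) D₀) rel p))
            (≡0⇒~ {p ℕ.^ 1} {+ p * + p * B 1 * U p} (+ p * B 1 * U p , trans (Sℤ.solve (+ p ∷ B 1 ∷ U p ∷ []) (λ p b u → p :* p :* b :* u := p :* b :* u :* p) refl) (cong (λ n → + p * B 1 * U p * + n) (sym (ℕP.*-identityʳ p))))))))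
          where
          p¹ : ∀ {x} → x ≡0[ p ] → x ≡0[ p ℕ.^ 1 ]
          p¹ {x} = subst (x ≡0[_]) (sym (ℕP.*-identityʳ p))
          rel : ∀ j → ∃ λ c → ¬ (c ≡0[ p ]) ×
            CommutativeRing._≈_ (ZMod (p ℕ.^ 1)) (+ 2 * U (suc j) * U 1 * (U (suc j) * B 1 + U 1 * B (suc j))) (c * (U (suc (suc j)) * B j + U j * B (suc (suc j)))) ×
            CommutativeRing._≈_ (ZMod (p ℕ.^ 1)) (U (suc j) * U (suc j) * U 1 * U 1) (c * (U (suc (suc j)) * U j))
          rel j = let (c , r) = relate {suc j} {1} {suc (suc j)} {j} refl (cong suc (sym (ℕP.+-comm j 1))) in
            c , proj₁ (U-units r (U-unit (suc j)) U₁) ,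
            p¹ {+ 2 * U (suc j) * U 1 * (U (suc j) * B 1 + U 1 * B (suc j)) - c * (U (suc (suc j)) * B j + U j * B (suc (suc j)))}
              (subst (_≡0[ p ]) (Sℤ.solve (+ 2 * U (suc j) * U 1 * (U (suc j) * B 1 + U 1 * B (suc j)) ∷ τ ∷ U (suc j) * U 1 * B (suc j) * B 1 ∷ τ * U (suc j) * U 1 * B (suc j) * B 1 ∷ c * (U (suc (suc j)) * B j + U j * B (suc (suc j))) ∷ [])
                (λ x t y z w → ((x :+ z) :- w) :+ (:- con (+ 1)) :* z := x :- w) refl)
                (≡0-+ (U-sum r) (≡0-* (- 1ℤ) (≡0-*ˡ (B 1) (≡0-*ˡ (B (suc j)) (≡0-*ˡ (U 1) (≡0-*ˡ (U (suc j)) τ≡0))))))) ,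
            p¹ {U (suc j) * U (suc j) * U 1 * U 1 - c * (U (suc (suc j)) * U j)} (U-prod r)

        -- traces 2 + τ B/U along the multiples of a
        ξ : ℕ → ℤ
        ξ n = proj₁ (inverse (U n) (U-unit n)) * B n

        T : ℕ → ℕ → ℤ
        T a j = + 2 + τ * ξ (j ℕ.* a)

        ξU : ∀ n → CommutativeRing._≈_ (ZMod p) (ξ n * U n) (B n)
        ξU n = let (r , q , h) = inverse (U n) (U-unit n) in
          q * B n , trans (Sℤ.solve (r ∷ B n ∷ U n ∷ []) (λ r b u → (r :* b) :* u :- b := (r :* u :- con (+ 1)) :* b) refl)
            (trans (cong (_* B n) h) (Sℤ.solve (q ∷ + p ∷ B n ∷ []) (λ q p b → q :* p :* b := q :* b :* p) refl))

        T-step : ∀ a j → CommutativeRing._≈_ (ZMod p) (T a (suc (suc j))) (T a 1 * T a (suc j) - T a j)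
        T-step a j = kill (U b * U b * U w * U w) (T a (suc (suc j)) - (T a 1 * T a (suc j) - T a j))
            (λ h → [ (λ h → [ (λ h → U-unit b (≡0-square _ h)) , U-unit w ]′ (≡0-prime (U b * U b) (U w) h)) , U-unit w ]′ (≡0-prime (U b * U b * U w) (U w) h))
            (~⇒≡0 (L.trace-step {τ} {U b} {B b} {U w} {B w} {U m} {B m} {U k} {B k} {c} {ξ b} {ξ w} {ξ m} {ξ k}
              (U-sum r) (U-prod r) (ξU b) (ξU w) (ξU m) (ξU k)))
          where
          b = suc j ℕ.* a
          w = 1 ℕ.* a
          m = suc (suc j) ℕ.* a
          k = j ℕ.* a
          cr = relate {b} {w} {m} {k} (cong (ℕ._+ k) (sym (ℕP.+-identityʳ a))) (trans (ℕP.+-comm a b) (cong (b ℕ.+_) (sym (ℕP.+-identityʳ a))))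
          c = proj₁ cr
          r = proj₂ cr

        T₀ : ∀ a → T a 0 ≡ + 2
        T₀ a = trans (cong (λ d → + 2 + τ * (proj₁ (inverse (U 0) (U-unit 0)) * (+ d * + d))) D₀)
          (trans (cong (λ t → + 2 + τ * t) (ℤP.*-zeroʳ (proj₁ (inverse (U 0) (U-unit 0))))) (cong (λ t → + 2 + t) (ℤP.*-zeroʳ τ)))

        -- The trace at O is 2, and since τ is a unit a trace 2 means reduction to O. Equality of
        -- T_j and T_1 therefore carries p ∣ B(ja) over to B(a); it is applied with j = p.
        T-detects : ¬ (τ ≡0[ p ]) → ∀ a j → CommutativeRing._≈_ (ZMod p) (T a j) (T a 1) → B (j ℕ.* a) ≡0[ p ] → B a ≡0[ p ]
        T-detects τ≢0 a j h hj = subst (λ n → B n ≡0[ p ]) (ℕP.+-identityʳ a) B₁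
          where
          ξj : ξ (j ℕ.* a) ≡0[ p ]
          ξj = ≡0-* (proj₁ (inverse (U (j ℕ.* a)) (U-unit (j ℕ.* a)))) hj
          ξ₁ : ξ (1 ℕ.* a) ≡0[ p ]
          ξ₁ = kill τ (ξ (1 ℕ.* a)) τ≢0 (subst (_≡0[ p ]) (Sℤ.solve (τ ∷ ξ (j ℕ.* a) ∷ ξ (1 ℕ.* a) ∷ []) (λ t x y → t :* x :+ (:- con (+ 1)) :* ((con (+ 2) :+ t :* x) :- (con (+ 2) :+ t :* y)) := t :* y) refl)
            (≡0-+ (≡0-* τ ξj) (≡0-* (- 1ℤ) h)))
          B₁ : B (1 ℕ.* a) ≡0[ p ]
          B₁ = subst (_≡0[ p ]) (Sℤ.solve (ξ (1 ℕ.* a) * U (1 ℕ.* a) ∷ B (1 ℕ.* a) ∷ []) (λ x b → x :+ (:- con (+ 1)) :* (x :- b) := b) refl)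
            (≡0-+ (≡0-*ˡ (U (1 ℕ.* a)) ξ₁) (≡0-* (- 1ℤ) (ξU (1 ℕ.* a))))

    module Regular (ns : Nonsingular) where

      unit-A : ∀ n → B n ≡0[ p ] → ¬ (A n ≡0[ p ])
      unit-A n hB hA = not-both n hA hB

      module _ (e : ℕ) (1≤e : 1 ℕ.≤ e) where
        private
          M = p ℕ.^ e
          weak : ∀ {x} → x ≡0[ M ] → x ≡0[ p ]
          weak = ≡0-weaken (p∣p^ p 1≤e)

        -- The relations give A_m B_k + A_k B_m ≡ 0 modulo M and B_m B_k ≡ 0 modulo M², with A_m and
        -- A_k units. Hence B_m and B_k each satisfy a quadratic equation of the kind handled by
        -- `integral-root`, and M divides both of them.
        closed : ∀ {a b m k} → a ≡ b ℕ.+ k → m ≡ a ℕ.+ b → B a ≡0[ M ] → B b ≡0[ M ] → B m ≡0[ M ] × B k ≡0[ M ]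
        closed {a} {b} {m} {k} ea em Ba Bb = go (relate ea em)
          where
          go : ∃ (Relation a b m k) → B m ≡0[ M ] × B k ≡0[ M ]
          go (c , r@(relation r₁ r₂ r₃)) = root (B m) (B k) (A m) (A k) uAk BB sum , root (B k) (B m) (A k) (A m) uAm (subst (_≡0[ M ℕ.* M ]) (ℤP.*-comm (B m) (B k)) BB)
              (subst (_≡0[ M ]) (ℤP.+-comm (A m * B k) (A k * B m)) sum)
            where
            c≢0 = ns ea em r
            Π≢0 : ¬ (c * (A m * A k) ≡0[ p ])
            Π≢0 h = [ unit-A a (weak Ba) , unit-A b (weak Bb) ]′ (≡0-prime (A a) (A b) (≡0-square (A a * A b)
              (subst (_≡0[ p ]) (Sℤ.solve (A a ∷ A b ∷ Fℤ.Πₕ β4 β6 β8 (A a) (B a) (A b) (B b) ∷ []) (λ a b π → (:- con (+ 1)) :* (π :- a :* a :* b :* b) :+ π := (a :* b) :* (a :* b)) refl)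
                (≡0-+ (≡0-* (- 1ℤ) (proj₂ (L.vanishing-bb′ {β2} {β4} {β6} {β8} {A a} {B a} {A b} {B b} (≡0⇒~ (≡0-* (B a) (weak Bb))))))
                  (subst (_≡0[ p ]) (sym r₃) h)))))
            uAm : ¬ (A m ≡0[ p ])
            uAm h = Π≢0 (≡0-* c (≡0-*ˡ (A k) h))
            uAk : ¬ (A k ≡0[ p ])
            uAk h = Π≢0 (≡0-* c (≡0-* (A m) h))
            sum : A m * B k + A k * B m ≡0[ M ]
            sum = cancel-unit e c _ c≢0 (subst (_≡0[ M ]) r₂ (~⇒≡0 (LocAlg.vanishing-S (ZMod M) {β2} {β4} {β6} {A a} {B a} {A b} {B b} (≡0⇒~ Ba) (≡0⇒~ Bb))))
            HM : Fℤ.H (A a) (B a) (A b) (B b) ≡0[ M ]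
            HM = ≡0-+ (≡0-* (A a) Bb) (subst (_≡0[ M ]) (Sℤ.solve (A b ∷ B a ∷ []) (λ a b → (:- con (+ 1)) :* (a :* b) := :- (a :* b)) refl) (≡0-* (- 1ℤ) (≡0-* (A b) Ba)))
            BB : B m * B k ≡0[ M ℕ.* M ]
            BB = subst (B m * B k ≡0[_]) (ℕP.^-distribˡ-+-* p e e) (cancel-unit (e ℕ.+ e) c _ c≢0 (subst₂ _≡0[_] r₁ (sym (ℕP.^-distribˡ-+-* p e e)) (≡0-mul HM HM)))
            root : ∀ x y u v → ¬ (v ≡0[ p ]) → x * y ≡0[ M ℕ.* M ] → u * y + v * x ≡0[ M ] → x ≡0[ M ]
            root x y u v hv (w , hw) (t , ht) = integral-root e v x t (- (u * w)) hv (trans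
              (Sℤ.solve (x ∷ y ∷ u ∷ v ∷ []) (λ x y u v → v :* (x :* x) := (u :* y :+ v :* x) :* x :- u :* (x :* y)) refl)
              (trans (cong₂ (λ s q → s * x - u * q) ht (trans hw (cong (w *_) (ℤP.pos-* M M))))
              (Sℤ.solve (t ∷ + M ∷ x ∷ u ∷ w ∷ []) (λ t m x u w → (t :* m) :* x :- u :* (w :* (m :* m)) := m :* (t :* x) :+ (m :* m) :* (:- (u :* w))) refl)))

        multiples : ∀ a → B a ≡0[ M ] → ∀ j → B (j ℕ.* a) ≡0[ M ]
        multiples a h zero = 0ℤ , cong (λ d → + d * + d) D₀
        multiples a h (suc zero) = subst (λ n → B n ≡0[ M ]) (sym (ℕP.+-identityʳ a)) h
        multiples a h (suc (suc j)) = proj₁ (closed {suc j ℕ.* a} {a} {suc (suc j) ℕ.* a} {j ℕ.* a} refl (ℕP.+-comm a (suc j ℕ.* a)) (multiples a h (suc j)) h)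

      -- Since 2e ≥ e + 1, products of two B's vanish modulo p^(e+1) and the relations become those
      -- of `Quadratic` with V = A. At j = p the law multiplies B a by p², of which one factor is
      -- kept.
      gain : ∀ e → 1 ℕ.≤ e → ∀ a → B a ≡0[ p ℕ.^ e ] → B (p ℕ.* a) ≡0[ p ℕ.^ suc e ]
      gain e 1≤e a h = cancel-unit (suc e) (A (1 ℕ.* a)) (B (p ℕ.* a)) (unit 1)
        (subst (_≡0[ M ]) (Sℤ.solve (A (1 ℕ.* a) * B (p ℕ.* a) ∷ + p * + p * B (1 ℕ.* a) * A (p ℕ.* a) ∷ []) (λ x y → (x :- y) :+ y := x) refl)
          (≡0-+ (proj₁ (Quadratic.law (suc e) (λ j → A (j ℕ.* a)) (λ j → B (j ℕ.* a)) unit (cong (λ d → + d * + d) D₀) rel p)) small))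
        where
        M = p ℕ.^ suc e
        Bs : ∀ j → B (j ℕ.* a) ≡0[ p ℕ.^ e ]
        Bs = multiples e 1≤e a h
        unit : ∀ j → ¬ (A (j ℕ.* a) ≡0[ p ])
        unit j = unit-A (j ℕ.* a) (≡0-weaken (p∣p^ p 1≤e) (Bs j))
        small : + p * + p * B (1 ℕ.* a) * A (p ℕ.* a) ≡0[ M ]
        small = let (q , hq) = Bs 1 in + p * q * A (p ℕ.* a) , trans (cong (λ z → + p * + p * z * A (p ℕ.* a)) hq)
          (trans (Sℤ.solve (+ p ∷ q ∷ + (p ℕ.^ e) ∷ A (p ℕ.* a) ∷ []) (λ p q m a → p :* p :* (q :* m) :* a := p :* q :* a :* (p :* m)) refl)
            (cong (+ p * q * A (p ℕ.* a) *_) (sym (ℤP.pos-* p (p ℕ.^ e)))))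
        products : ∀ i j → B (i ℕ.* a) * B (j ℕ.* a) ≡0[ M ]
        products i j = ≡0-weaken (ℕD.*-monoˡ-∣ (p ℕ.^ e) (p∣p^ p 1≤e)) (≡0-mul (Bs i) (Bs j))
        rel : ∀ j → ∃ λ c → ¬ (c ≡0[ p ]) ×
          CommutativeRing._≈_ (ZMod M) (+ 2 * A (suc j ℕ.* a) * A (1 ℕ.* a) * (A (suc j ℕ.* a) * B (1 ℕ.* a) + A (1 ℕ.* a) * B (suc j ℕ.* a))) (c * (A (suc (suc j) ℕ.* a) * B (j ℕ.* a) + A (j ℕ.* a) * B (suc (suc j) ℕ.* a))) ×
          CommutativeRing._≈_ (ZMod M) (A (suc j ℕ.* a) * A (suc j ℕ.* a) * A (1 ℕ.* a) * A (1 ℕ.* a)) (c * (A (suc (suc j) ℕ.* a) * A (j ℕ.* a)))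
        rel j = c , ns eb em r , flip (Relation.r₂ r) (proj₁ v) , flip (Relation.r₃ r) (proj₂ v)
          where
          b = suc j ℕ.* a
          w = 1 ℕ.* a
          m = suc (suc j) ℕ.* a
          k = j ℕ.* a
          eb : b ≡ w ℕ.+ k
          eb = cong (ℕ._+ k) (sym (ℕP.+-identityʳ a))
          em : m ≡ b ℕ.+ w
          em = trans (ℕP.+-comm a b) (cong (b ℕ.+_) (sym (ℕP.+-identityʳ a)))
          cr = relate {b} {w} {m} {k} eb em
          c = proj₁ cr
          r = proj₂ cr
          v = LocAlg.vanishing-bb′ (ZMod M) {β2} {β4} {β6} {β8} {A b} {B b} {A w} {B w} (≡0⇒~ (products (suc j) 1))
          flip : ∀ {x y z} → x ≡ z → CommutativeRing._≈_ (ZMod M) x y → CommutativeRing._≈_ (ZMod M) y z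
          flip {x} {y} {z} refl h = CommutativeRing.sym (ZMod M) {x} {y} h

      private
        B⇒D : ∀ {M n} → B n ≡0[ M ] → M ℕD.∣ D n ℕ.* D n
        B⇒D {M} {n} h = subst (M ℕD.∣_) (ℤP.abs-* (+ D n) (+ D n)) (≡0⇒∣ h)

        D⇒B : ∀ {M n} → M ℕD.∣ D n ℕ.* D n → B n ≡0[ M ]
        D⇒B {M} {n} h = ∣⇒≡0 (subst (M ℕD.∣_) (sym (ℤP.abs-* (+ D n) (+ D n))) h)

      D-multiple : ∀ k a → p ℕ.^ k ℕD.∣ D a → ∀ j → p ℕ.^ k ℕD.∣ D (j ℕ.* a)
      D-multiple zero a _ j = ℕD.1∣ D (j ℕ.* a)
      D-multiple (suc k) a h j = root-exact (suc k) (B⇒D (multiples (suc k ℕ.+ suc k) (ℕ.s≤s ℕ.z≤n) a (D⇒B (square-mod (suc k) h)) j))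

      D-gain : ∀ k → 1 ℕ.≤ k → ∀ a → p ℕ.^ k ℕD.∣ D a → p ℕ.^ suc k ℕD.∣ D (p ℕ.* a)
      D-gain k 1≤k a h = root-excess k (B⇒D (gain (k ℕ.+ k) (ℕP.≤-trans 1≤k (ℕP.m≤m+n k k)) a (D⇒B (square-mod k h))))

    p∣D⇒B : ∀ {n} → p ℕD.∣ D n → B n ≡0[ p ]
    p∣D⇒B {n} h = ∣⇒≡0 (subst (p ℕD.∣_) (sym (ℤP.abs-* (+ D n) (+ D n))) (ℕD.∣m⇒∣m*n (D n) h))

    p∣B⇒D : ∀ {n} → B n ≡0[ p ] → p ℕD.∣ D n
    p∣B⇒D {n} h = [ (λ x → x) , (λ x → x) ]′ (euclidsLemma (D n) (D n) pp (subst (p ℕD.∣_) (ℤP.abs-* (+ D n) (+ D n)) (≡0⇒∣ h)))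

    module _ (ns : Nonsingular) where
      private
        up : ∀ {x} → x ≡0[ p ] → x ≡0[ p ℕ.^ 1 ]
        up {x} = subst (x ≡0[_]) (sym (ℕP.*-identityʳ p))
        down : ∀ {x} → x ≡0[ p ℕ.^ 1 ] → x ≡0[ p ]
        down {x} = subst (x ≡0[_]) (ℕP.*-identityʳ p)

      D-closed : ∀ {a b m k} → a ≡ b ℕ.+ k → m ≡ a ℕ.+ b → p ℕD.∣ D a → p ℕD.∣ D b → p ℕD.∣ D m × p ℕD.∣ D k
      D-closed ea em ha hb = let (x , y) = Regular.closed ns 1 ℕP.≤-refl ea em (up (p∣D⇒B ha)) (up (p∣D⇒B hb)) in p∣B⇒D (down x) , p∣B⇒D (down y)

    -- x([a]P) = x([b]P) modulo p only if [a+b]P or [a-b]P reduces to O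
    same-x⇒ : Nonsingular → ∀ {a b m k} → a ≡ b ℕ.+ k → m ≡ a ℕ.+ b → Fℤ.H (A a) (B a) (A b) (B b) ≡0[ p ] → p ℕD.∣ D m ⊎ p ℕD.∣ D k
    same-x⇒ ns {a} {b} {m} {k} ea em h = let (c , r) = relate ea em in
      [ (λ x → inj₁ (p∣B⇒D x)) , (λ x → inj₂ (p∣B⇒D x)) ]′ (≡0-prime (B m) (B k) (kill c (B m * B k) (ns ea em r) (subst (_≡0[ p ]) (Relation.r₁ r) (≡0-* (Fℤ.H (A a) (B a) (A b) (B b)) h))))

    c₄ℤ : ℤ
    c₄ℤ = β2 * β2 - + 24 * β4

    private
      zero⇒≈ : ∀ {x} → x ≡0[ p ] → CommutativeRing._≈_ (ZMod p) x 0ℤ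
      zero⇒≈ = ≡0⇒~

      small-prime : ∀ n → 1 ℕ.≤ n → n ℕ.< p → ¬ (+ n ≡0[ p ])
      small-prime (suc n) _ n<p h = ℕP.<⇒≱ n<p (ℕD.∣⇒≤ (≡0⇒∣ h))

      p≡0 : ∀ {n} → p ≡ n → CommutativeRing._≈_ (ZMod p) (+ n) 0ℤ
      p≡0 refl = ≡0⇒~ (1ℤ , sym (ℤP.*-identityˡ (+ p)))

      fermat₂ : p ≡ 2 → ∀ x → CommutativeRing._≈_ (ZMod p) (x * x) x
      fermat₂ e x = subst (λ t → CommutativeRing._≈_ (ZMod p) t x) (trans (cong (Solver._^_ (ZMod p) x) e) (cong (x *_) (ℤP.*-identityʳ x))) (fermat x)

      fermat₃ : p ≡ 3 → ∀ x → CommutativeRing._≈_ (ZMod p) (x * x * x) x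
      fermat₃ e x = subst (λ t → CommutativeRing._≈_ (ZMod p) t x) (trans (cong (Solver._^_ (ZMod p) x) e) (trans (cong (λ t → x * (x * t)) (ℤP.*-identityʳ x)) (sym (ℤP.*-assoc x x x)))) (fermat x)

    -- the reduction of the curve is singular at x = s, with a cusp or a node according to τ
    singular-point : Δℤ ≡0[ p ] → ∃ λ s → L.Singular s β2 β4 β6 β8 × (c₄ℤ ≡0[ p ] → L.b2[ s ] β2 ≡0[ p ]) × (¬ (c₄ℤ ≡0[ p ]) → ¬ (L.b2[ s ] β2 ≡0[ p ]))
    singular-point Δ≡0 = by-c₄ (≡0? p c₄ℤ)
      where
      Goal = ∃ λ s → L.Singular s β2 β4 β6 β8 × (c₄ℤ ≡0[ p ] → L.b2[ s ] β2 ≡0[ p ]) × (¬ (c₄ℤ ≡0[ p ]) → ¬ (L.b2[ s ] β2 ≡0[ p ]))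
      rel′ : CommutativeRing._≈_ (ZMod p) (+ 4 * β8) (β2 * β6 - β4 * β4)
      rel′ = ≡⇒~ p β-relation
      by-c₄ : Dec (c₄ℤ ≡0[ p ]) → Goal
      by-c₄ (no c₄≢0) = s , proj₁ n , (λ h → ⊥-elim (c₄≢0 h)) , (λ _ h → proj₂ n (≡0⇒~ h))
        where
        r = proj₁ (inverse c₄ℤ c₄≢0)
        N = + 18 * β6 - β2 * β4
        s = r * N
        hs : CommutativeRing._≈_ (ZMod p) (c₄ℤ * s) N
        hs = subst (_≡0[ p ]) (Sℤ.solve (c₄ℤ ∷ r ∷ N ∷ []) (λ c r n → n :* (r :* c :- con (+ 1)) := c :* (r :* n) :- n) refl) (≡0-* N (proj₂ (inverse c₄ℤ c₄≢0)))
        n = L.node {β2} {β4} {β6} {β8} {s} rel′ noZeroDivisors (zero⇒≈ Δ≡0) (λ h → c₄≢0 (~⇒≡0 h)) hs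
      by-c₄ (yes c₄≡0) = by-p (p ℕ.≟ 2) (p ℕ.≟ 3)
        where
        finish : ∀ {s} → L.Singular s β2 β4 β6 β8 × CommutativeRing._≈_ (ZMod p) (L.b2[ s ] β2) 0ℤ → Goal
        finish {s} (sg , τ) = s , sg , (λ _ → ~⇒≡0 τ) , (λ n → ⊥-elim (n c₄≡0))
        by-p : Dec (p ≡ 2) → Dec (p ≡ 3) → Goal
        -- In F₂ every element is its own square and in F₃ its own cube, so the roots that locate
        -- the cusp are `β8` and `- β6` themselves.
        by-p (yes e) _ = finish {β8} (L.cusp₂ {β2} {β4} {β6} {β8} rel′ noZeroDivisors (zero⇒≈ Δ≡0) (zero⇒≈ c₄≡0) (p≡0 e) (fermat₂ e β8))
        by-p (no _) (yes e) = finish { - β6 } (L.cusp₃ {β2} {β4} {β6} {β8} rel′ noZeroDivisors (zero⇒≈ Δ≡0) (zero⇒≈ c₄≡0) (p≡0 e) (fermat₃ e β6))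
        by-p (no n₂) (no n₃) = finish {s} (L.cusp {β2} {β4} {β6} {β8} {s} rel′ noZeroDivisors (zero⇒≈ Δ≡0)
            (λ h → 2≢0 (~⇒≡0 h)) (λ h → 3≢0 (~⇒≡0 h)) (zero⇒≈ c₄≡0) τ , τ)
          where
          2≤p : 2 ℕ.≤ p
          2≤p = prime>1 pp
          2<p : 2 ℕ.< p
          2<p = ℕP.≤∧≢⇒< 2≤p (λ e → n₂ (sym e))
          2≢0 = small-prime 2 (ℕ.s≤s ℕ.z≤n) 2<p
          3≢0 = small-prime 3 (ℕ.s≤s ℕ.z≤n) (ℕP.≤∧≢⇒< 2<p (λ e → n₃ (sym e)))
          12≢0 : ¬ (+ 12 ≡0[ p ])
          12≢0 h = [ (λ h → [ 2≢0 , 2≢0 ]′ (≡0-prime (+ 2) (+ 2) h)) , 3≢0 ]′ (≡0-prime (+ 4) (+ 3) h)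
          r = proj₁ (inverse (+ 12) 12≢0)
          s = r * (- β2)
          τ : CommutativeRing._≈_ (ZMod p) (L.b2[ s ] β2) 0ℤ
          τ = zero⇒≈ (subst (_≡0[ p ]) (Sℤ.solve (β2 ∷ r ∷ []) (λ b r → (:- b) :* (r :* con (+ 12) :- con (+ 1)) := b :+ con (+ 12) :* (r :* (:- b))) refl) (≡0-* (- β2) (proj₂ (inverse (+ 12) 12≢0))))

-- Polynomials in one variable

module Poly {c ℓ : Level} (K : CommutativeRing c ℓ) where
  open import Data.Integer using (+_)
  open import Data.List using (List; []; _∷_; map)
  import Data.Vec as Vec
  open ≡ using (_≡_)
  open CommutativeRing K hiding (zero)
  open Solver K
  open import Algebra.Properties.Ring ring using (-0#≈0#)

  Poly′ : Set c
  Poly′ = List Carrier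

  coeff : Poly′ → ℕ → Carrier
  coeff [] n = 0#
  coeff (a ∷ f) zero = a
  coeff (a ∷ f) (suc n) = coeff f n

  infix 4 _≋_
  -- Lists may end in zeros, so polynomials are compared through their coefficient functions.
  record _≋_ (f g : Poly′) : Set ℓ where
    constructor eq
    field at : ∀ n → coeff f n ≈ coeff g n
  open _≋_

  infixl 6 _⊞_
  infixl 7 _⊠_

  _⊞_ : Poly′ → Poly′ → Poly′
  [] ⊞ g = g
  (a ∷ f) ⊞ [] = a ∷ f
  (a ∷ f) ⊞ (b ∷ g) = (a + b) ∷ (f ⊞ g)

  neg : Poly′ → Poly′
  neg = map (λ x → - x)

  scaleP : Carrier → Poly′ → Poly′
  scaleP a = map (a *_)

  _⊠_ : Poly′ → Poly′ → Poly′
  [] ⊠ g = []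
  (a ∷ f) ⊠ g = scaleP a g ⊞ (0# ∷ (f ⊠ g))

  coeff-⊞ : ∀ f g n → coeff (f ⊞ g) n ≈ coeff f n + coeff g n
  coeff-⊞ [] g n = sym (+-identityˡ _)
  coeff-⊞ (a ∷ f) [] n = sym (+-identityʳ _)
  coeff-⊞ (a ∷ f) (b ∷ g) zero = refl
  coeff-⊞ (a ∷ f) (b ∷ g) (suc n) = coeff-⊞ f g n

  coeff-neg : ∀ f n → coeff (neg f) n ≈ - coeff f n
  coeff-neg [] n = sym -0#≈0#
  coeff-neg (a ∷ f) zero = refl
  coeff-neg (a ∷ f) (suc n) = coeff-neg f n

  coeff-scale : ∀ a f n → coeff (scaleP a f) n ≈ a * coeff f n
  coeff-scale a [] n = sym (zeroʳ a)
  coeff-scale a (b ∷ f) zero = refl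
  coeff-scale a (b ∷ f) (suc n) = coeff-scale a f n

  coeff-⊠-zero : ∀ a f g → coeff ((a ∷ f) ⊠ g) 0 ≈ a * coeff g 0
  coeff-⊠-zero a f g = trans (coeff-⊞ (scaleP a g) _ 0) (trans (+-identityʳ _) (coeff-scale a g 0))

  coeff-⊠-suc : ∀ a f g n → coeff ((a ∷ f) ⊠ g) (suc n) ≈ a * coeff g (suc n) + coeff (f ⊠ g) n
  coeff-⊠-suc a f g n = trans (coeff-⊞ (scaleP a g) _ (suc n)) (+-congʳ (coeff-scale a g (suc n)))

  private
    tail-≋ : ∀ {a b f g} → (a ∷ f) ≋ (b ∷ g) → f ≋ g
    tail-≋ h = eq (λ n → at h (suc n))

    tail-[] : ∀ {a f} → (a ∷ f) ≋ [] → f ≋ []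
    tail-[] h = eq (λ n → at h (suc n))

    ≋-sym : ∀ {f g} → f ≋ g → g ≋ f
    ≋-sym h = eq (λ n → sym (at h n))

    ≋-trans : ∀ {f g h} → f ≋ g → g ≋ h → f ≋ h
    ≋-trans h k = eq (λ n → trans (at h n) (at k n))

    ⊠-zeroˡ : ∀ f g → f ≋ [] → f ⊠ g ≋ []
    ⊠-zeroˡ [] g h = h
    ⊠-zeroˡ (a ∷ f) g h = eq λ
      { zero → trans (coeff-⊠-zero a f g) (trans (*-congʳ (at h 0)) (zeroˡ _))
      ; (suc n) → trans (coeff-⊠-suc a f g n) (trans (+-cong (trans (*-congʳ (at h 0)) (zeroˡ _)) (at (⊠-zeroˡ f g (tail-[] h)) n)) (+-identityˡ _)) }

    ⊠-cong : ∀ f f′ g g′ → f ≋ f′ → g ≋ g′ → f ⊠ g ≋ f′ ⊠ g′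
    ⊠-cong [] f′ g g′ h k = ≋-sym (⊠-zeroˡ f′ g′ (≋-sym h))
    ⊠-cong (a ∷ f) [] g g′ h k = ⊠-zeroˡ (a ∷ f) g h
    ⊠-cong (a ∷ f) (b ∷ f′) g g′ h k = eq λ
      { zero → trans (coeff-⊠-zero a f g) (trans (*-cong (at h 0) (at k 0)) (sym (coeff-⊠-zero b f′ g′)))
      ; (suc n) → trans (coeff-⊠-suc a f g n) (trans (+-cong (*-cong (at h 0) (at k (suc n))) (at (⊠-cong f f′ g g′ (tail-≋ h) k) n)) (sym (coeff-⊠-suc b f′ g′ n))) }

    ⊠-[]ʳ : ∀ f → f ⊠ [] ≋ []
    ⊠-[]ʳ [] = eq (λ _ → refl)
    ⊠-[]ʳ (a ∷ f) = eq λ { zero → refl ; (suc n) → at (⊠-[]ʳ f) n }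

    ⊠-∷ʳ : ∀ f b g n → coeff (f ⊠ (b ∷ g)) n ≈ b * coeff f n + coeff (0# ∷ (f ⊠ g)) n
    ⊠-∷ʳ [] b g zero = sym (trans (+-identityʳ _) (zeroʳ b))
    ⊠-∷ʳ [] b g (suc n) = sym (trans (+-identityʳ _) (zeroʳ b))
    ⊠-∷ʳ (a ∷ f) b g zero = trans (coeff-⊠-zero a f (b ∷ g)) (trans (*-comm a b) (sym (+-identityʳ _)))
    ⊠-∷ʳ (a ∷ f) b g (suc n) = trans (coeff-⊠-suc a f (b ∷ g) n) (trans (+-congˡ (⊠-∷ʳ f b g n))
      (trans (swap (a * coeff g n) (b * coeff f n) (coeff (0# ∷ (f ⊠ g)) n)) (+-congˡ (rest n))))
      where
      swap : ∀ x y z → x + (y + z) ≈ y + (x + z)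
      swap x y z = solve (x Vec.∷ y Vec.∷ z Vec.∷ Vec.[]) (λ x y z → x :+ (y :+ z) := y :+ (x :+ z)) ≡.refl
      rest : ∀ n → a * coeff g n + coeff (0# ∷ (f ⊠ g)) n ≈ coeff ((a ∷ f) ⊠ g) n
      rest zero = trans (+-identityʳ _) (sym (coeff-⊠-zero a f g))
      rest (suc n) = sym (coeff-⊠-suc a f g n)

    ⊠-comm : ∀ f g → f ⊠ g ≋ g ⊠ f
    ⊠-comm [] g = ≋-sym (⊠-[]ʳ g)
    ⊠-comm (a ∷ f) g = eq λ
      { zero → trans (coeff-⊠-zero a f g) (sym (trans (⊠-∷ʳ g a f 0) (+-identityʳ _)))
      ; (suc n) → trans (coeff-⊠-suc a f g n) (trans (+-congˡ (at (⊠-comm f g) n)) (sym (⊠-∷ʳ g a f (suc n)))) }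

    ⊠-distribʳ : ∀ h f g → (f ⊞ g) ⊠ h ≋ f ⊠ h ⊞ g ⊠ h
    ⊠-distribʳ h [] g = eq (λ _ → refl)
    ⊠-distribʳ h (a ∷ f) [] = eq (λ n → sym (trans (coeff-⊞ ((a ∷ f) ⊠ h) [] n) (+-identityʳ _)))
    ⊠-distribʳ h (a ∷ f) (b ∷ g) = eq λ
      { zero → trans (coeff-⊠-zero (a + b) (f ⊞ g) h) (trans (distribʳ _ _ _) (sym (trans (coeff-⊞ ((a ∷ f) ⊠ h) ((b ∷ g) ⊠ h) 0) (+-cong (coeff-⊠-zero a f h) (coeff-⊠-zero b g h)))))
      ; (suc n) → trans (coeff-⊠-suc (a + b) (f ⊞ g) h n) (trans (+-cong (distribʳ _ _ _) (trans (at (⊠-distribʳ h f g) n) (coeff-⊞ (f ⊠ h) (g ⊠ h) n)))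
          (trans (interchange (a * coeff h (suc n)) (b * coeff h (suc n)) (coeff (f ⊠ h) n) (coeff (g ⊠ h) n))
          (sym (trans (coeff-⊞ ((a ∷ f) ⊠ h) ((b ∷ g) ⊠ h) (suc n)) (+-cong (coeff-⊠-suc a f h n) (coeff-⊠-suc b g h n)))))) }
      where
      interchange : ∀ x y z w → (x + y) + (z + w) ≈ (x + z) + (y + w)
      interchange x y z w = solve (x Vec.∷ y Vec.∷ z Vec.∷ w Vec.∷ Vec.[]) (λ x y z w → (x :+ y) :+ (z :+ w) := (x :+ z) :+ (y :+ w)) ≡.refl

    ⊞-cong : ∀ {f f′ g g′} → f ≋ f′ → g ≋ g′ → f ⊞ g ≋ f′ ⊞ g′
    ⊞-cong {f} {f′} {g} {g′} h k = eq (λ n → trans (coeff-⊞ f g n) (trans (+-cong (at h n) (at k n)) (sym (coeff-⊞ f′ g′ n))))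

    scale-⊠ : ∀ a f g → scaleP a f ⊠ g ≋ scaleP a (f ⊠ g)
    scale-⊠ a [] g = eq (λ _ → refl)
    scale-⊠ a (b ∷ f) g = eq λ
      { zero → trans (coeff-⊠-zero (a * b) (scaleP a f) g) (trans (*-assoc a b _) (sym (trans (coeff-scale a ((b ∷ f) ⊠ g) 0) (*-congˡ (coeff-⊠-zero b f g)))))
      ; (suc n) → trans (coeff-⊠-suc (a * b) (scaleP a f) g n) (trans (+-cong (*-assoc a b _) (trans (at (scale-⊠ a f g) n) (coeff-scale a (f ⊠ g) n)))
          (trans (sym (distribˡ a _ _)) (sym (trans (coeff-scale a ((b ∷ f) ⊠ g) (suc n)) (*-congˡ (coeff-⊠-suc b f g n)))))) }

    shift-⊠ : ∀ f g → (0# ∷ f) ⊠ g ≋ 0# ∷ (f ⊠ g)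
    shift-⊠ f g = eq λ
      { zero → trans (coeff-⊠-zero 0# f g) (zeroˡ _)
      ; (suc n) → trans (coeff-⊠-suc 0# f g n) (trans (+-congʳ (zeroˡ _)) (+-identityˡ _)) }

    ⊠-assoc : ∀ f g h → (f ⊠ g) ⊠ h ≋ f ⊠ (g ⊠ h)
    ⊠-assoc [] g h = eq (λ _ → refl)
    ⊠-assoc (a ∷ f) g h = ≋-trans (⊠-distribʳ h (scaleP a g) (0# ∷ (f ⊠ g))) (⊞-cong (scale-⊠ a g h)
      (≋-trans (shift-⊠ (f ⊠ g) h) (eq λ { zero → refl ; (suc n) → at (⊠-assoc f g h) n })))

    one : Poly′
    one = 1# ∷ []

    ⊠-identityˡ : ∀ f → one ⊠ f ≋ f
    ⊠-identityˡ f = eq λ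
      { zero → trans (coeff-⊠-zero 1# [] f) (*-identityˡ _)
      ; (suc n) → trans (coeff-⊠-suc 1# [] f n) (trans (+-identityʳ _) (*-identityˡ _)) }

    ⊠-identityʳ : ∀ f → f ⊠ one ≋ f
    ⊠-identityʳ f = ≋-trans (⊠-comm f one) (⊠-identityˡ f)

    ⊠-distribˡ : ∀ f g h → f ⊠ (g ⊞ h) ≋ f ⊠ g ⊞ f ⊠ h
    ⊠-distribˡ f g h = ≋-trans (⊠-comm f (g ⊞ h)) (≋-trans (⊠-distribʳ f g h) (⊞-cong (⊠-comm g f) (⊠-comm h f)))

    lift₃ : ∀ f g h → (f ⊞ g) ⊞ h ≋ f ⊞ (g ⊞ h)
    lift₃ f g h = eq (λ n → trans (trans (coeff-⊞ (f ⊞ g) h n) (+-congʳ (coeff-⊞ f g n))) (trans (+-assoc _ _ _)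
      (sym (trans (coeff-⊞ f (g ⊞ h) n) (+-congˡ (coeff-⊞ g h n))))))

  polyRing : CommutativeRing c ℓ
  polyRing = record
    { Carrier = Poly′ ; _≈_ = _≋_ ; _+_ = _⊞_ ; _*_ = _⊠_ ; -_ = neg ; 0# = [] ; 1# = one
    ; isCommutativeRing = record
      { isRing = record
        { +-isAbelianGroup = record
          { isGroup = record
            { isMonoid = record
              { isSemigroup = record
                { isMagma = record
                  { isEquivalence = record { refl = eq (λ _ → refl) ; sym = ≋-sym ; trans = ≋-trans }
                  ; ∙-cong = ⊞-cong }
                ; assoc = lift₃ }
              ; identity = (λ f → eq (λ _ → refl)) , (λ f → eq (λ n → trans (coeff-⊞ f [] n) (+-identityʳ _))) }
            ; inverse = (λ f → eq (λ n → trans (coeff-⊞ (neg f) f n) (trans (+-congʳ (coeff-neg f n)) (-‿inverseˡ _))))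
                      , (λ f → eq (λ n → trans (coeff-⊞ f (neg f) n) (trans (+-congˡ (coeff-neg f n)) (-‿inverseʳ _))))
            ; ⁻¹-cong = λ {f} {g} h → eq (λ n → trans (coeff-neg f n) (trans (-‿cong (at h n)) (sym (coeff-neg g n)))) }
          ; comm = λ f g → eq (λ n → trans (coeff-⊞ f g n) (trans (+-comm _ _) (sym (coeff-⊞ g f n)))) }
        ; *-cong = λ {f} {f′} {g} {g′} → ⊠-cong f f′ g g′
        ; *-assoc = ⊠-assoc
        ; *-identity = ⊠-identityˡ , ⊠-identityʳ
        ; distrib = ⊠-distribˡ , ⊠-distribʳ }
      ; *-comm = ⊠-comm } }

  private
    module P = CommutativeRing polyRing
    module SP = Solver polyRing

  -- Degrees are bounded strictly, so that the zero polynomial satisfies `Deg< f 0` and never needs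
  -- a degree of its own.
  Deg< : Poly′ → ℕ → Set ℓ
  Deg< f n = ∀ i → n ℕ.≤ i → coeff f i ≈ 0#

  HasDeg : Poly′ → ℕ → Set ℓ
  HasDeg f n = Deg< f (suc n) × ¬ (coeff f n ≈ 0#)

  deg<-cong : ∀ {f g n} → f ≋ g → Deg< f n → Deg< g n
  deg<-cong h d i n≤i = trans (sym (at h i)) (d i n≤i)

  hasDeg-cong : ∀ {f g n} → f ≋ g → HasDeg f n → HasDeg g n
  hasDeg-cong {n = n} h (d , l) = deg<-cong h d , λ z → l (trans (at h n) z)

  deg<-mono : ∀ {f m n} → m ℕ.≤ n → Deg< f m → Deg< f n
  deg<-mono m≤n d i n≤i = d i (ℕP.≤-trans m≤n n≤i)

  deg<-⊞ : ∀ {f g n} → Deg< f n → Deg< g n → Deg< (f ⊞ g) n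
  deg<-⊞ {f} {g} d e i n≤i = trans (coeff-⊞ f g i) (trans (+-cong (d i n≤i) (e i n≤i)) (+-identityˡ _))

  deg<-neg : ∀ {f n} → Deg< f n → Deg< (neg f) n
  deg<-neg {f} d i n≤i = trans (coeff-neg f i) (trans (-‿cong (d i n≤i)) -0#≈0#)

  lead-⊠ : ∀ f g n m → Deg< f (suc n) → Deg< g (suc m) →
    Deg< (f ⊠ g) (suc (n ℕ.+ m)) × coeff (f ⊠ g) (n ℕ.+ m) ≈ coeff f n * coeff g m
  lead-⊠ [] g n m d e = (λ _ _ → refl) , sym (zeroˡ _)
  lead-⊠ (a ∷ f) g zero m d e = (λ { (suc i) (s≤s m≤i) → trans (coeff-⊠-suc a f g i) (trans (+-cong (trans (*-congˡ (e (suc i) (s≤s m≤i))) (zeroʳ a)) (f≋0 i)) (+-identityˡ _)) }) , lead m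
    where
    f≋0 : ∀ i → coeff (f ⊠ g) i ≈ 0#
    f≋0 i = at (⊠-zeroˡ f g (eq (λ n → d (suc n) (s≤s z≤n)))) i
    lead : ∀ m → coeff ((a ∷ f) ⊠ g) m ≈ a * coeff g m
    lead zero = coeff-⊠-zero a f g
    lead (suc m) = trans (coeff-⊠-suc a f g m) (trans (+-congˡ (f≋0 m)) (+-identityʳ _))
  lead-⊠ (a ∷ f) g (suc n) m d e =
    (λ { (suc i) (s≤s h) → trans (coeff-⊠-suc a f g i) (trans (+-cong (trans (*-congˡ (e (suc i) (s≤s (ℕP.≤-trans (ℕP.m≤n+m m (suc n)) (ℕP.≤-trans h ℕP.≤-refl))))) (zeroʳ a)) (proj₁ ih i h)) (+-identityˡ _)) }) ,
    trans (coeff-⊠-suc a f g (n ℕ.+ m)) (trans (+-cong (trans (*-congˡ (e (suc (n ℕ.+ m)) (s≤s (ℕP.m≤n+m m n)))) (zeroʳ a)) (proj₂ ih)) (+-identityˡ _))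
    where ih = lead-⊠ f g n m (λ i h → d (suc i) (s≤s h)) e

  module WithField (dom : NoZeroDivisors) (dec : ∀ x → Dec (x ≈ 0#)) (inv : ∀ x → ¬ (x ≈ 0#) → ∃ λ y → y * x ≈ 1#) (1≉0 : ¬ (1# ≈ 0#)) where

    hasDeg-⊠ : ∀ {f g n m} → HasDeg f n → HasDeg g m → HasDeg (f ⊠ g) (n ℕ.+ m)
    hasDeg-⊠ {f} {g} {n} {m} (d , l) (e , k) = proj₁ h , λ z → [ l , k ]′ (dom _ _ (trans (sym (proj₂ h)) z))
      where h = lead-⊠ f g n m d e

    degree : ∀ f → f ≋ [] ⊎ ∃ (HasDeg f)
    degree [] = inj₁ (eq (λ _ → refl))
    degree (a ∷ f) with degree f
    ... | inj₂ (n , d , l) = inj₂ (suc n , (λ { (suc i) (s≤s h) → d i h }) , l)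
    ... | inj₁ z with dec a
    ...   | yes a≈0 = inj₁ (eq λ { zero → a≈0 ; (suc n) → at z n })
    ...   | no a≉0 = inj₂ (0 , (λ { (suc i) _ → at z i }) , a≉0)

    hasDeg≉0 : ∀ {f n} → HasDeg f n → ¬ (f ≋ [])
    hasDeg≉0 {n = n} (_ , l) h = l (at h n)

    noZeroDivisors-P : Solver.NoZeroDivisors polyRing
    noZeroDivisors-P f g h with degree f | degree g
    ... | inj₁ z | _ = inj₁ z
    ... | inj₂ _ | inj₁ z = inj₂ z
    ... | inj₂ (n , d) | inj₂ (m , e) = ⊥-elim (hasDeg≉0 (hasDeg-⊠ {f} {g} d e) h)

    hasDeg< : ∀ {f n k} → HasDeg f n → Deg< f k → n ℕ.< k
    hasDeg< {f} {n} {k} (_ , l) d with n ℕ.<? k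
    ... | yes n<k = n<k
    ... | no n≮k = ⊥-elim (l (d n (ℕP.≮⇒≥ n≮k)))

    hasDeg-unique : ∀ {f n m} → HasDeg f n → HasDeg f m → n ≡ m
    hasDeg-unique {f} d e = ℕP.≤-antisym (ℕP.≤-pred (hasDeg< {f} d (proj₁ e))) (ℕP.≤-pred (hasDeg< {f} e (proj₁ d)))

    deg<-⊠ : ∀ {f g n m} → Deg< f n → Deg< g (suc m) → Deg< (f ⊠ g) (n ℕ.+ m)
    deg<-⊠ {f} {g} {zero} {m} d e i _ = at (⊠-zeroˡ f g (eq (λ n → d n z≤n))) i
    deg<-⊠ {f} {g} {suc n} {m} d e = proj₁ (lead-⊠ f g n m d e)

    deg<-cancel : ∀ {f g n m} → HasDeg g m → Deg< (f ⊠ g) (n ℕ.+ m) → Deg< f n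
    deg<-cancel {f} {g} {n} {m} e d with degree f
    ... | inj₁ z = λ i _ → at z i
    ... | inj₂ (k , h) = deg<-mono {f} (ℕP.+-cancelʳ-≤ m (suc k) n (hasDeg< {f ⊠ g} (hasDeg-⊠ {f} {g} h e) d)) (proj₁ h)

    module _ {g m} (gd : HasDeg g m) where
      private
        r = proj₁ (inv (coeff g m) (proj₂ gd))

      -- The tail is divided first, as in Horner's scheme; after multiplication by the variable one
      -- constant multiple of g restores the degree bound.
      divide : ∀ f → ∃₂ λ q s → f ≋ q ⊠ g ⊞ s × Deg< s m
      divide [] = [] , [] , eq (λ _ → refl) , λ _ _ → refl
      divide (a ∷ f) = let (q , s , h , d) = divide f in step q s h d
        where
        step : ∀ q s → f ≋ q ⊠ g ⊞ s → Deg< s m → ∃₂ λ q s → (a ∷ f) ≋ q ⊠ g ⊞ s × Deg< s m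
        step q s h d = q′ , s′ , P.trans e₁ (SP.solve ((0# ∷ q) Vec.∷ (k ∷ []) Vec.∷ g Vec.∷ (a ∷ s) Vec.∷ Vec.[])
            (λ q k g s → q SP.:* g SP.:+ s SP.:= (q SP.:+ k) SP.:* g SP.:+ (s SP.:- k SP.:* g)) ≡.refl) , d′
          where
          k : Carrier
          k = coeff (a ∷ s) m * r
          q′ s′ : Poly′
          q′ = (0# ∷ q) ⊞ (k ∷ [])
          s′ = (a ∷ s) ⊞ neg ((k ∷ []) ⊠ g)
          e₁ : (a ∷ f) ≋ (0# ∷ q) ⊠ g ⊞ (a ∷ s)
          e₁ = eq λ
            { zero → sym (trans (coeff-⊞ ((0# ∷ q) ⊠ g) (a ∷ s) 0) (trans (+-congʳ (at (shift-⊠ q g) 0)) (+-identityˡ a)))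
            ; (suc n) → trans (at h n) (sym (trans (coeff-⊞ ((0# ∷ q) ⊠ g) (a ∷ s) (suc n)) (trans (+-congʳ (at (shift-⊠ q g) (suc n))) (sym (coeff-⊞ (q ⊠ g) s n))))) }
          kg : ∀ n → coeff ((k ∷ []) ⊠ g) n ≈ k * coeff g n
          kg zero = coeff-⊠-zero k [] g
          kg (suc n) = trans (coeff-⊠-suc k [] g n) (+-identityʳ _)
          tail-deg : ∀ i → suc m ℕ.≤ i → coeff (a ∷ s) i ≈ 0#
          tail-deg (suc i) (s≤s h) = d i h
          at-m : k * coeff g m ≈ coeff (a ∷ s) m
          at-m = trans (*-assoc _ _ _) (trans (*-congˡ (proj₂ (inv (coeff g m) (proj₂ gd)))) (*-identityʳ _))
          d′ : Deg< s′ m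
          d′ i m≤i with m ℕ.≟ i
          ... | yes ≡.refl = trans (coeff-⊞ (a ∷ s) (neg ((k ∷ []) ⊠ g)) m) (trans (+-congˡ (trans (coeff-neg ((k ∷ []) ⊠ g) m) (-‿cong (trans (kg m) at-m)))) (-‿inverseʳ _))
          ... | no m≢i = let m<i = ℕP.≤∧≢⇒< m≤i m≢i in trans (coeff-⊞ (a ∷ s) (neg ((k ∷ []) ⊠ g)) i)
                (trans (+-cong (tail-deg i m<i) (trans (coeff-neg ((k ∷ []) ⊠ g) i) (trans (-‿cong (trans (kg i) (trans (*-congˡ (proj₁ gd i m<i)) (zeroʳ k)))) -0#≈0#))) (+-identityˡ _))

    record LowestTerms (f g : Poly′) : Set (c Agda.Primitive.⊔ ℓ) where
      field
        common f′ g′ α β : Poly′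
        f≋ : f ≋ common ⊠ f′
        g≋ : g ≋ common ⊠ g′
        coprime : α ⊠ f′ ⊞ β ⊠ g′ ≋ one

    -- Euclid's algorithm, with `n` bounding the degree of g. When g vanishes, f is the common
    -- factor and the fraction is 1 / 0.
    lowest-terms : ∀ n f g → Deg< g n → LowestTerms f g
    lowest-terms zero f g d = record { common = f ; f′ = one ; g′ = [] ; α = one ; β = []
      ; f≋ = P.sym (⊠-identityʳ f) ; g≋ = P.trans (eq (λ n → d n z≤n)) (P.sym (P.zeroʳ f))
      ; coprime = P.trans (P.+-identityʳ (one ⊠ one)) (⊠-identityˡ one) }
    lowest-terms (suc n) f g d with degree g
    ... | inj₁ z = lowest-terms-zero z
      where
      lowest-terms-zero : g ≋ [] → LowestTerms f g
      lowest-terms-zero z = record { common = f ; f′ = one ; g′ = [] ; α = one ; β = []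
        ; f≋ = P.sym (⊠-identityʳ f) ; g≋ = P.trans z (P.sym (P.zeroʳ f))
        ; coprime = P.trans (P.+-identityʳ (one ⊠ one)) (⊠-identityˡ one) }
    ... | inj₂ (m , gd) = let (q , s , h , e) = divide gd f in
        combine q s h (lowest-terms n g s (deg<-mono {s} (ℕP.≤-pred (hasDeg< {g} gd d)) e))
      where
      combine : ∀ q s → f ≋ q ⊠ g ⊞ s → LowestTerms g s → LowestTerms f g
      combine q s h L = record { common = L.common ; f′ = q ⊠ L.f′ ⊞ L.g′ ; g′ = L.f′ ; α = L.β ; β = L.α ⊞ neg (L.β ⊠ q)
        ; f≋ = P.trans h (P.trans (P.+-cong (P.*-cong (P.refl {q}) L.f≋) L.g≋) (SP.solve (q Vec.∷ L.common Vec.∷ L.f′ Vec.∷ L.g′ Vec.∷ Vec.[]) (λ q c f g → q SP.:* (c SP.:* f) SP.:+ c SP.:* g SP.:= c SP.:* (q SP.:* f SP.:+ g)) ≡.refl))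
        ; g≋ = L.f≋
        ; coprime = P.trans (SP.solve (q Vec.∷ L.α Vec.∷ L.β Vec.∷ L.f′ Vec.∷ L.g′ Vec.∷ Vec.[]) (λ q a b f g → b SP.:* (q SP.:* f SP.:+ g) SP.:+ (a SP.:+ SP.:- (b SP.:* q)) SP.:* f SP.:= a SP.:* f SP.:+ b SP.:* g) ≡.refl) L.coprime }
        where module L = LowestTerms L

    deg-bound : ∀ f → ∃ (Deg< f)
    deg-bound f with degree f
    ... | inj₁ z = 0 , λ i _ → at z i
    ... | inj₂ (n , d) = suc n , proj₁ d

  ev : Poly′ → Carrier → Carrier
  ev [] c = 0#
  ev (a ∷ f) c = a + c * ev f c

  X-_ : Carrier → Poly′
  X- c = - c ∷ 1# ∷ []

  synthetic : ∀ f c → ∃ λ q → f ≋ q ⊠ (X- c) ⊞ (ev f c ∷ [])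
  synthetic [] c = [] , eq λ { zero → refl ; (suc n) → refl }
  synthetic (a ∷ f) c = let (q , h) = synthetic f c in (0# ∷ q) ⊞ (ev f c ∷ []) , P.trans (split f) (P.trans (P.+-congˡ {a ∷ []} (P.*-cong (P.refl {0# ∷ 1# ∷ []}) h)) (finish q))
    where
    split : ∀ f → (a ∷ f) ≋ (a ∷ []) ⊞ (0# ∷ 1# ∷ []) ⊠ f
    split f = eq λ
      { zero → sym (trans (coeff-⊞ (a ∷ []) ((0# ∷ 1# ∷ []) ⊠ f) 0) (trans (+-congˡ (trans (coeff-⊠-zero 0# (1# ∷ []) f) (zeroˡ _))) (+-identityʳ a)))
      ; (suc n) → sym (trans (coeff-⊞ (a ∷ []) ((0# ∷ 1# ∷ []) ⊠ f) (suc n)) (trans (+-identityˡ _) (trans (coeff-⊠-suc 0# (1# ∷ []) f n) (trans (+-cong (zeroˡ _) (at (⊠-identityˡ f) n)) (+-identityˡ _))))) }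
    e = ev f c
    consts : (a ∷ []) ⊞ (0# ∷ 1# ∷ []) ⊠ (e ∷ []) ≋ (e ∷ []) ⊠ (X- c) ⊞ ((a + c * e) ∷ [])
    consts = eq λ
      { zero → solve (a Vec.∷ e Vec.∷ c Vec.∷ Vec.[]) (λ a e c → a :+ (con (+ 0) :* e :+ con (+ 0)) := (e :* (:- c) :+ con (+ 0)) :+ (a :+ c :* e)) ≡.refl
      ; (suc zero) → solve (a Vec.∷ e Vec.∷ c Vec.∷ Vec.[]) (λ a e c → con (+ 1) :* e :+ con (+ 0) := e :* con (+ 1)) ≡.refl
      ; (suc (suc n)) → refl }
    finish : ∀ q → (a ∷ []) ⊞ (0# ∷ 1# ∷ []) ⊠ (q ⊠ (X- c) ⊞ (e ∷ [])) ≋ ((0# ∷ q) ⊞ (e ∷ [])) ⊠ (X- c) ⊞ ((a + c * e) ∷ [])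
    finish q = P.trans (SP.solve ((a ∷ []) Vec.∷ (0# ∷ 1# ∷ []) Vec.∷ q Vec.∷ (X- c) Vec.∷ (e ∷ []) Vec.∷ Vec.[]) (λ a t q x e → a SP.:+ t SP.:* (q SP.:* x SP.:+ e) SP.:= (t SP.:* q) SP.:* x SP.:+ (a SP.:+ t SP.:* e)) ≡.refl)
      (P.trans (P.+-cong (P.*-cong tq (P.refl {X- c})) consts)
      (SP.solve ((0# ∷ q) Vec.∷ (X- c) Vec.∷ (e ∷ []) Vec.∷ ((a + c * e) ∷ []) Vec.∷ Vec.[]) (λ q x e k → q SP.:* x SP.:+ (e SP.:* x SP.:+ k) SP.:= (q SP.:+ e) SP.:* x SP.:+ k) ≡.refl))
      where
      tq : (0# ∷ 1# ∷ []) ⊠ q ≋ 0# ∷ q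
      tq = P.trans (shift-⊠ (1# ∷ []) q) (eq λ { zero → refl ; (suc n) → at (⊠-identityˡ q) n })

  ev-cong : ∀ {f g} c → f ≋ g → ev f c ≈ ev g c
  ev-cong {[]} {g} c h = sym (ev-zero g (P.sym h))
    where
    ev-zero : ∀ g → g ≋ [] → ev g c ≈ 0#
    ev-zero [] _ = refl
    ev-zero (b ∷ g) h = trans (+-cong (at h 0) (trans (*-congˡ (ev-zero g (tail-[] h))) (zeroʳ c))) (+-identityˡ _)
  ev-cong {a ∷ f} {[]} c h = trans (+-cong (at h 0) (trans (*-congˡ (ev-cong {f} {[]} c (tail-[] h))) (zeroʳ c))) (+-identityˡ _)
  ev-cong {a ∷ f} {b ∷ g} c h = +-cong (at h 0) (*-congˡ (ev-cong {f} {g} c (tail-≋ h)))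

  ev-⊞ : ∀ f g c → ev (f ⊞ g) c ≈ ev f c + ev g c
  ev-⊞ [] g c = sym (+-identityˡ _)
  ev-⊞ (a ∷ f) [] c = sym (+-identityʳ _)
  ev-⊞ (a ∷ f) (b ∷ g) c = trans (+-congˡ (*-congˡ (ev-⊞ f g c)))
    (solve (a Vec.∷ b Vec.∷ c Vec.∷ ev f c Vec.∷ ev g c Vec.∷ Vec.[]) (λ a b c f g → (a :+ b) :+ c :* (f :+ g) := (a :+ c :* f) :+ (b :+ c :* g)) ≡.refl)

  ev-scale : ∀ a f c → ev (scaleP a f) c ≈ a * ev f c
  ev-scale a [] c = sym (zeroʳ a)
  ev-scale a (b ∷ f) c = trans (+-congˡ (*-congˡ (ev-scale a f c)))
    (solve (a Vec.∷ b Vec.∷ c Vec.∷ ev f c Vec.∷ Vec.[]) (λ a b c f → a :* b :+ c :* (a :* f) := a :* (b :+ c :* f)) ≡.refl)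

  ev-⊠ : ∀ f g c → ev (f ⊠ g) c ≈ ev f c * ev g c
  ev-⊠ [] g c = sym (zeroˡ _)
  ev-⊠ (a ∷ f) g c = trans (ev-⊞ (scaleP a g) (0# ∷ (f ⊠ g)) c) (trans (+-cong (ev-scale a g c) (+-congˡ (*-congˡ (ev-⊠ f g c))))
    (solve (a Vec.∷ c Vec.∷ ev f c Vec.∷ ev g c Vec.∷ Vec.[]) (λ a c f g → a :* g :+ (con (+ 0) :+ c :* (f :* g)) := (a :+ c :* f) :* g) ≡.refl))

  ev-neg : ∀ f c → ev (neg f) c ≈ - ev f c
  ev-neg [] c = sym -0#≈0#
  ev-neg (a ∷ f) c = trans (+-congˡ (*-congˡ (ev-neg f c)))
    (solve (a Vec.∷ c Vec.∷ ev f c Vec.∷ Vec.[]) (λ a c f → :- a :+ c :* (:- f) := :- (a :+ c :* f)) ≡.refl)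

  root-factor : ∀ f c → ev f c ≈ 0# → ∃ λ q → f ≋ q ⊠ (X- c)
  root-factor f c h = let (q , e) = synthetic f c in q , P.trans e (P.trans (P.+-congˡ {q ⊠ (X- c)} (eq λ { zero → h ; (suc n) → refl })) (P.+-identityʳ (q ⊠ (X- c))))

-- Abscissas of P ± Q in Manin's argument

module Manin {c ℓ : Level} (R : CommutativeRing c ℓ) (b2 b4 b6 b8 t : CommutativeRing.Carrier R) where
  open import Data.Vec using ([]; _∷_)
  open import Data.Integer using (+_)
  open CommutativeRing R
  open Solver R
  open Forms R

  private
    n# : _ → Carrier
    n# k = fromℤ (+ k)

  h S Π : Carrier → Carrier → Carrier
  h a b = H a b t 1#
  S a b = Sₕ b2 b4 b6 a b t 1#
  Π a b = Πₕ b4 b6 b8 a b t 1#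

  -- vanishes iff x′ is one of the x-coordinates of P ± Q, where x(P) = a / b, x(Q) = t and x′ = a′ / b′
  Γ : (a′ b′ a b : Carrier) → Carrier
  Γ a′ b′ a b = h a b * h a b * (a′ * a′) - S a b * (a′ * b′) + Π a b * (b′ * b′)

  module E {n} (b2 b4 b6 b8 t : Expr n) where
    S′ Π′ h′ : Expr n → Expr n → Expr n
    S′ a b = Sₑ b2 b4 b6 a b t (con (+ 1))
    Π′ a b = Πₑ b4 b6 b8 a b t (con (+ 1))
    h′ a b = a :* con (+ 1) :- t :* b
    Γ′ : (a′ b′ a b : Expr n) → Expr n
    Γ′ a′ b′ a b = h′ a b :* h′ a b :* (a′ :* a′) :- S′ a b :* (a′ :* b′) :+ Π′ a b :* (b′ :* b′)

  -- That x′ is an abscissa of P ± Q is symmetric in the two points. This is what turns the second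
  -- root of one step into the starting pair of the next.
  Γ-sym : ∀ a′ b′ a b → Γ a′ b′ a b ≈ Γ a b a′ b′
  Γ-sym a′ b′ a b = solve (b2 ∷ b4 ∷ b6 ∷ b8 ∷ t ∷ a′ ∷ b′ ∷ a ∷ b ∷ []) (λ b2 b4 b6 b8 t a′ b′ a b → let open E b2 b4 b6 b8 t in
    Γ′ a′ b′ a b := Γ′ a b a′ b′) ≡.refl

  Γ-homogeneous : ∀ a b e w u → Γ a b (e * w) (e * u) ≈ (e * e) * Γ a b w u
  Γ-homogeneous a b e w u = solve (b2 ∷ b4 ∷ b6 ∷ b8 ∷ t ∷ a ∷ b ∷ e ∷ w ∷ u ∷ []) (λ b2 b4 b6 b8 t a b e w u → let open E b2 b4 b6 b8 t in
    Γ′ a b (e :* w) (e :* u) := (e :* e) :* Γ′ a b w u) ≡.refl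

  -- the second root w / u of the quadratic polynomial Γ(·, a / b), given the root a′ / b′ in lowest terms
  second-root : ∀ {a′ b′ a b α β} → α * a′ + β * b′ ≈ 1# → Γ a′ b′ a b ≈ 0# →
    ∃₂ λ w u → Π a b ≈ w * a′ × S a b ≈ u * a′ + w * b′ × h a b * h a b ≈ u * b′
  second-root {a′} {b′} {a} {b} {α} {β} co g =
    β * β * (s * b′ - hh * a′) + (n# 2 * α * β * b′ + α * α * a′) * π ,
    α * α * (s * a′ - π * b′) + (n# 2 * α * β * a′ + β * β * b′) * hh ,
    comb (solve (a′ ∷ b′ ∷ α ∷ β ∷ hh ∷ s ∷ π ∷ []) (λ a′ b′ α β hh s π → let v = α :* a′ :+ β :* b′ in
      π :- (β :* β :* (s :* b′ :- hh :* a′) :+ (con (+ 2) :* α :* β :* b′ :+ α :* α :* a′) :* π) :* a′ :=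
      (:- (π :* (v :+ con (+ 1)))) :* (v :- con (+ 1)) :+ (β :* β) :* ((hh :* (a′ :* a′) :- s :* (a′ :* b′) :+ π :* (b′ :* b′)) :- con (+ 0))) ≡.refl) (_ · co ⊕ _ · g) ,
    comb (solve (a′ ∷ b′ ∷ α ∷ β ∷ hh ∷ s ∷ π ∷ []) (λ a′ b′ α β hh s π → let v = α :* a′ :+ β :* b′ in
      s :- ((α :* α :* (s :* a′ :- π :* b′) :+ (con (+ 2) :* α :* β :* a′ :+ β :* β :* b′) :* hh) :* a′ :+ (β :* β :* (s :* b′ :- hh :* a′) :+ (con (+ 2) :* α :* β :* b′ :+ α :* α :* a′) :* π) :* b′) :=
      (:- (s :* (v :+ con (+ 1)))) :* (v :- con (+ 1)) :+ (:- (con (+ 2) :* α :* β)) :* ((hh :* (a′ :* a′) :- s :* (a′ :* b′) :+ π :* (b′ :* b′)) :- con (+ 0))) ≡.refl) (_ · co ⊕ _ · g) ,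
    comb (solve (a′ ∷ b′ ∷ α ∷ β ∷ hh ∷ s ∷ π ∷ []) (λ a′ b′ α β hh s π → let v = α :* a′ :+ β :* b′ in
      hh :- (α :* α :* (s :* a′ :- π :* b′) :+ (con (+ 2) :* α :* β :* a′ :+ β :* β :* b′) :* hh) :* b′ :=
      (:- (hh :* (v :+ con (+ 1)))) :* (v :- con (+ 1)) :+ (α :* α) :* ((hh :* (a′ :* a′) :- s :* (a′ :* b′) :+ π :* (b′ :* b′)) :- con (+ 0))) ≡.refl) (_ · co ⊕ _ · g)
    where
    hh = h a b * h a b
    s = S a b
    π = Π a b

  second-root-Γ : ∀ {a′ b′ a b w u} → Π a b ≈ w * a′ → S a b ≈ u * a′ + w * b′ → h a b * h a b ≈ u * b′ → Γ w u a b ≈ 0#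
  second-root-Γ {a′} {b′} {a} {b} {w} {u} hΠ hS hh = comb
    (solve (a′ ∷ b′ ∷ w ∷ u ∷ (h a b * h a b) ∷ S a b ∷ Π a b ∷ []) (λ a′ b′ w u hh s π →
      (hh :* (w :* w) :- s :* (w :* u) :+ π :* (u :* u)) :- con (+ 0) :=
      (u :* u) :* (π :- w :* a′) :+ (:- (w :* u)) :* (s :- (u :* a′ :+ w :* b′)) :+ (w :* w) :* (hh :- u :* b′)) ≡.refl)
    (_ · hΠ ⊕ _ · hS ⊕ _ · hh)

  -- For deg b < deg a the term a² t² dominates, so Π has degree 2 deg a + 2.
  Π-lead : ∀ a b → Π a b ≈ a * a * t * t + b * (- (b4 * a * t) - b6 * (a + t * b) - b8 * b)
  Π-lead a b = solve (b4 ∷ b6 ∷ b8 ∷ t ∷ a ∷ b ∷ []) (λ b4 b6 b8 t a b → Πₑ b4 b6 b8 a b t (con (+ 1)) := a :* a :* t :* t :+ b :* (:- (b4 :* a :* t) :- b6 :* (a :+ t :* b) :- b8 :* b)) ≡.refl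

  S-split : ∀ a b → S a b ≈ (n# 2 * (a * (a + t * b)) + b2 * (a * b)) * t + b * (b4 * (a + t * b) + b6 * b)
  S-split a b = solve (b2 ∷ b4 ∷ b6 ∷ t ∷ a ∷ b ∷ []) (λ b2 b4 b6 t a b → Sₑ b2 b4 b6 a b t (con (+ 1)) := (con (+ 2) :* (a :* (a :+ t :* b)) :+ b2 :* (a :* b)) :* t :+ b :* (b4 :* (a :+ t :* b) :+ b6 :* b)) ≡.refl

  f : Carrier → Carrier
  f x = n# 4 * x * x * x + b2 * x * x + n# 2 * b4 * x + b6

  module _ (rel : n# 4 * b8 ≈ b2 * b6 - b4 * b4) {x e : Carrier} (root : e * e ≈ f x * f t) where

    private
      Q : Carrier
      Q = n# 2 * (h x 1# * h x 1#)

      discriminant : (S x 1# - e) * (S x 1# + e) ≈ n# 4 * (h x 1# * h x 1#) * Π x 1#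
      discriminant = comb (solve (b2 ∷ b4 ∷ b6 ∷ b8 ∷ t ∷ x ∷ e ∷ []) (λ b2 b4 b6 b8 t x e → let open E b2 b4 b6 b8 t in let o = con (+ 1) in let f′ = λ x → con (+ 4) :* x :* x :* x :+ b2 :* x :* x :+ con (+ 2) :* b4 :* x :+ b6 in
        (S′ x o :- e) :* (S′ x o :+ e) :- con (+ 4) :* (h′ x o :* h′ x o) :* Π′ x o :=
        (:- o) :* (e :* e :- f′ x :* f′ t) :+ ((x :- t) :* (x :- t)) :* (con (+ 4) :* b8 :- (b2 :* b6 :- b4 :* b4))) ≡.refl) (_ · root ⊕ _ · rel)

    -- On y² = f(x) the abscissas of the sum and difference of points over x and t are (S ± e) / (2
    -- h²), where e is the product of the two ordinates, because S² - 4 h² Π = f(x) f(t). The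
    -- ordinates enter only through e, so no square root of f(t) has to be adjoined to F_p(t).
    first-Γ : Γ (S x 1# - e) Q x 1# ≈ 0#
    first-Γ = comb (solve (S x 1# ∷ (h x 1# * h x 1#) ∷ Π x 1# ∷ e ∷ []) (λ s hh π e → let q = con (+ 2) :* hh in
        (hh :* ((s :- e) :* (s :- e)) :- s :* ((s :- e) :* q) :+ π :* (q :* q)) :- con (+ 0) :=
        (:- hh) :* ((s :- e) :* (s :+ e) :- con (+ 4) :* hh :* π)) ≡.refl) (_ · discriminant)

    numerators : (S x 1# - e) * (S x 1# + e) ≈ n# 4 * (h x 1# * h x 1#) * Π x 1#
    numerators = discriminant

  -- Used with x = t^p: at any c in F_p, where t^p and t agree, S takes the value f(c).
  S-diagonal : ∀ x → S x 1# ≈ f t + h x 1# * (n# 2 * t * (x + n# 2 * t) + b2 * t + b4)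
  S-diagonal x = solve (b2 ∷ b4 ∷ b6 ∷ t ∷ x ∷ []) (λ b2 b4 b6 t x →
    Sₑ b2 b4 b6 x (con (+ 1)) t (con (+ 1)) := (con (+ 4) :* t :* t :* t :+ b2 :* t :* t :+ con (+ 2) :* b4 :* t :+ b6)
      :+ (x :* con (+ 1) :- t :* con (+ 1)) :* (con (+ 2) :* t :* (x :+ con (+ 2) :* t) :+ b2 :* t :+ b4)) ≡.refl

-- The identity T_p = T_1 for traces

module Dickson where
  open import Data.Integer using (+_)
  open import Data.List using ([]; _∷_)
  import Data.Vec as Vec
  open import Relation.Binary.PropositionalEquality using (_≡_; refl; sym; trans; cong; cong₂; subst)
  open Zp
  open Frob

  module FpPoly (p : ℕ) (pp : Prime p) where
    K : CommutativeRing _ _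
    K = ZMod p
    module K = CommutativeRing K
    module F = Field p pp
    open Poly K public
    module P = CommutativeRing polyRing
    module KE = SExp K.semiring
    module PE = SExp P.semiring

    private
      dec : ∀ x → Dec (x ≡0[ p ]) → Dec (x K.≈ 0ℤ)
      dec x (yes h) = yes (≡0⇒~ h)
      dec x (no n) = no (λ h → n (~⇒≡0 h))

    open Poly.WithField K F.noZeroDivisors
      (λ x → dec x (≡0? p x)) (λ x n → F.inverse x (λ h → n (≡0⇒~ h))) (λ h → F.1≢0 (~⇒≡0 h)) public

    C : ℤ → Poly′
    C a = a ∷ []

    t : Poly′
    t = 0ℤ ∷ 1ℤ ∷ []

    C-cong : ∀ {a b} → a K.≈ b → C a ≋ C b
    C-cong h = eq λ { zero → h ; (suc n) → K.refl {0ℤ} }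

    C-* : ∀ a b → C a ⊠ C b ≋ C (a ℤ.* b)
    C-* a b = eq λ { zero → coeff-⊠-zero a [] (C b) ; (suc n) → K.refl {0ℤ} }

    C-^ : ∀ a n → C a PE.^ n ≋ C (a KE.^ n)
    C-^ a zero = P.refl {P.1#}
    C-^ a (suc n) = P.trans (P.*-cong (P.refl {C a}) (C-^ a n)) (C-* a (a KE.^ n))

    φ-C : ∀ a → C a PE.^ p ≋ C a
    φ-C a = P.trans (C-^ a p) (C-cong (F.fermat a))

    private
      fromℤ-C : ∀ n → Solver.fromℤ polyRing (+ suc n) ≡ C (+ suc n)
      fromℤ-C zero = refl
      fromℤ-C (suc n) = trans (cong (_⊞ P.1#) (fromℤ-C n)) (cong (λ k → C (+ k)) (ℕP.+-comm (suc n) 1))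

      char′ : ∀ n → 1 ℕ.≤ n → + n K.≈ 0ℤ → Solver.fromℤ polyRing (+ n) ≋ []
      char′ (suc n) _ h = P.trans (P.reflexive (fromℤ-C n)) (eq λ { zero → h ; (suc n) → K.refl {0ℤ} })

    char : Solver.fromℤ polyRing (+ p) ≋ []
    char = char′ p (ℕP.<⇒≤ (prime>1 pp)) (≡0⇒~ {p} {+ p} (1ℤ , sym (ℤP.*-identityˡ (+ p))))

    deg-C : ∀ a → Deg< (C a) 1
    deg-C a (suc i) _ = K.refl {0ℤ}

    hasDeg-t : HasDeg t 1
    hasDeg-t = (λ { (suc (suc i)) _ → K.refl {0ℤ} ; (suc zero) (s≤s ()) }) , (λ h → F.1≢0 (~⇒≡0 h))

    hasDeg-one : HasDeg P.1# 0
    hasDeg-one = (λ { (suc i) _ → K.refl {0ℤ} }) , (λ h → F.1≢0 (~⇒≡0 h))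

    hasDeg-lead : ∀ {f g n} → HasDeg f n → Deg< g n → HasDeg (f ⊞ g) n
    hasDeg-lead {f} {g} {n} (d , l) e = deg<-⊞ {f} {g} d (deg<-mono {g} (ℕP.n≤1+n n) e) ,
      λ z → l (K.trans {coeff f n} {coeff (f ⊞ g) n} {0ℤ} (K.sym {coeff (f ⊞ g) n} {coeff f n} (K.trans {coeff (f ⊞ g) n} {coeff f n ℤ.+ coeff g n} {coeff f n} (coeff-⊞ f g n)
        (K.trans {coeff f n ℤ.+ coeff g n} {coeff f n ℤ.+ 0ℤ} {coeff f n} (K.+-congˡ {coeff f n} {coeff g n} {0ℤ} (e n ℕP.≤-refl)) (K.+-identityʳ (coeff f n))))) z)

    -- A nonzero multiple of μ has degree at least deg μ > 0, whereas a difference of constants has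
    -- degree 0 at most; so constants stay distinct in the quotient.
    constant-multiple : ∀ {a b k μ n} → HasDeg μ (suc n) → C a ⊞ neg (C b) ≋ k ⊠ μ → a K.≈ b
    constant-multiple {a} {b} {k} {μ} {n} dμ h = [ zero-case , (λ nd → ⊥-elim (absurd (proj₁ nd) (proj₂ nd))) ]′ (degree k)
      where
      zero-case : k ≋ [] → a K.≈ b
      zero-case z = Solver.x-y≈0⇒x≈y K {a} {b} (_≋_.at (P.trans {C a ⊞ neg (C b)} {k ⊠ μ} {[]} h (P.trans {k ⊠ μ} {[] ⊠ μ} {[]} (P.*-cong {k} {[]} {μ} {μ} z (P.refl {μ})) (P.zeroˡ μ))) 0)
      absurd : ∀ m → HasDeg k m → ⊥
      absurd m d = ℕP.<⇒≱ (hasDeg< {k ⊠ μ} {m ℕ.+ suc n} {1} (hasDeg-⊠ {k} {μ} d dμ) (deg<-cong {C a ⊞ neg (C b)} {k ⊠ μ} {1} h (deg<-⊞ {C a} {neg (C b)} (deg-C a) (deg<-neg {C b} (deg-C b)))))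
        (ℕP.≤-trans (s≤s z≤n) (ℕP.m≤n+m (suc n) m))

  private
    module Lucas {c ℓ} (R : CommutativeRing c ℓ) where
      open CommutativeRing R hiding (zero; refl; sym; trans)
      open Solver R
      open CommutativeRing R using () renaming (sym to ≈-sym; trans to ≈-trans; refl to ≈-refl)

      lucas : ∀ {q q′ s} (u : ℕ → Carrier) → q * q′ ≈ 1# → q + q′ ≈ s → u 0 ≈ fromℤ (+ 2) → u 1 ≈ s → (∀ j → u (suc (suc j)) ≈ s * u (suc j) - u j) →
        ∀ j → u j ≈ q ^ j + q′ ^ j × u (suc j) ≈ q ^ suc j + q′ ^ suc j
      lucas {q} {q′} {s} u h hs h₀ h₁ step zero = h₀ , ≈-trans h₁ (≈-trans (≈-sym hs) (solve (q Vec.∷ q′ Vec.∷ Vec.[]) (λ q q′ → q :+ q′ := q :* con (+ 1) :+ q′ :* con (+ 1)) refl))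
      lucas {q} {q′} {s} u h hs h₀ h₁ step (suc j) = let (a , b) = lucas u h hs h₀ h₁ step j in b , ≈-trans (step j) (comb
        (solve (q Vec.∷ q′ Vec.∷ s Vec.∷ q ^ j Vec.∷ q′ ^ j Vec.∷ u j Vec.∷ u (suc j) Vec.∷ Vec.[]) (λ q q′ s x y u₀ u₁ →
          (s :* u₁ :- u₀) :- (q :* (q :* x) :+ q′ :* (q′ :* y)) := (:- u₁) :* (q :+ q′ :- s) :+ (q :+ q′) :* (u₁ :- (q :* x :+ q′ :* y)) :+ (:- con (+ 1)) :* (u₀ :- (x :+ y)) :+ (x :+ y) :* (q :* q′ :- con (+ 1))) refl)
        (_ · hs ⊕ _ · b ⊕ _ · a ⊕ _ · h))

  module _ (p : ℕ) (pp : Prime p) where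
    open FpPoly p pp

    -- `μ` is q² - T_1 q + 1 and may well be reducible: of the quotient ring the argument uses the
    -- additivity of the Frobenius and the injectivity on constants.
    private module Trace (T : ℕ → ℤ) (h₀ : T 0 ≡ + 2) (step : ∀ j → T (suc (suc j)) K.≈ T 1 ℤ.* T (suc j) ℤ.- T j) where
      μ : Poly′
      μ = t ⊠ t ⊞ (neg (C (T 1) ⊠ t) ⊞ P.1#)
      t′ : Poly′
      t′ = C (T 1) ⊞ neg t
      R′ : CommutativeRing _ _
      R′ = Quot.quotient polyRing μ
      module R′ = CommutativeRing R′
      module S′ = Solver R′
      module SP = Solver polyRing
      module SK = Solver K
      sum : t ⊞ t′ ≋ C (T 1)
      sum = SP.solve (t Vec.∷ C (T 1) Vec.∷ Vec.[]) (λ t c → t SP.:+ (c SP.:+ SP.:- t) SP.:= c) refl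
      prod : t ⊠ t′ R′.≈ P.1#
      prod = neg P.1# , SP.solve (t Vec.∷ C (T 1) Vec.∷ Vec.[]) (λ t c → t SP.:* (c SP.:+ SP.:- t) SP.:- SP.con (+ 1) SP.:= (SP.:- SP.con (+ 1)) SP.:* (t SP.:* t SP.:+ (SP.:- (c SP.:* t) SP.:+ SP.con (+ 1)))) refl
      power≡ : ∀ f n → f S′.^ n ≡ f PE.^ n
      power≡ f zero = refl
      power≡ f (suc n) = cong (f ⊠_) (power≡ f n)
      lift : ∀ {f g} → f ≋ g → f R′.≈ g
      lift {f} {g} = Quot.≈⇒~ polyRing μ {f} {g}
      C-step : ∀ j → C (T (suc (suc j))) ≋ C (T 1) ⊠ C (T (suc j)) ⊞ neg (C (T j))
      C-step j = P.trans (C-cong (step j)) (P.+-cong (P.sym (C-* (T 1) (T (suc j)))) (P.refl {neg (C (T j))}))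
      powers : ∀ j → C (T j) R′.≈ t S′.^ j ⊞ t′ S′.^ j × C (T (suc j)) R′.≈ t S′.^ suc j ⊞ t′ S′.^ suc j
      powers = Lucas.lucas R′ {t} {t′} {C (T 1)} (λ j → C (T j)) prod (lift {t ⊞ t′} {C (T 1)} sum) (lift {C (T 0)} {C (+ 2)} (C-cong (K.reflexive h₀)))
        (R′.refl {C (T 1)}) (λ j → lift {C (T (suc (suc j)))} {C (T 1) ⊠ C (T (suc j)) ⊞ neg (C (T j))} (C-step j))
      deg-μ : HasDeg μ 2
      deg-μ = hasDeg-lead {t ⊠ t} {neg (C (T 1) ⊠ t) ⊞ P.1#} (hasDeg-⊠ {t} {t} hasDeg-t hasDeg-t)
        (deg<-⊞ {neg (C (T 1) ⊠ t)} {P.1#} (deg<-neg {C (T 1) ⊠ t} (deg<-⊠ {C (T 1)} {t} {1} {1} (deg-C (T 1)) (proj₁ hasDeg-t)))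
          (deg<-mono {P.1#} (s≤s z≤n) (proj₁ hasDeg-one)))
      constants : ∀ {a b} → C a R′.≈ C b → a K.≈ b
      constants {a} {b} (k , h) = constant-multiple {a} {b} {k} {μ} deg-μ h

    -- T_p = T_1^p = T_1: write T_1 = q + 1/q in F_p[q]/(q² - T_1 q + 1)
    dickson : (T : ℕ → ℤ) → T 0 ≡ + 2 → (∀ j → T (suc (suc j)) K.≈ T 1 ℤ.* T (suc j) ℤ.- T j) → T p K.≈ T 1
    dickson T h₀ step = let open Trace T h₀ step in
        K.sym {T 1} {T p} (constants {T 1} {T p} (R′.trans {C (T 1)} {(t ⊞ t′) PE.^ p} {C (T p)}
        (R′.sym {(t ⊞ t′) PE.^ p} {C (T 1)} (lift {(t ⊞ t′) PE.^ p} {C (T 1)} (P.trans (PE.^-congˡ p sum) (φ-C (T 1)))))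
        (R′.trans {(t ⊞ t′) PE.^ p} {t PE.^ p ⊞ t′ PE.^ p} {C (T p)} (lift {(t ⊞ t′) PE.^ p} {t PE.^ p ⊞ t′ PE.^ p} (frobenius-+ polyRing pp char t t′))
          (R′.sym {C (T p)} {t PE.^ p ⊞ t′ PE.^ p} (subst (C (T p) R′.≈_) (cong₂ _⊞_ (power≡ t p) (power≡ t′ p)) (proj₁ (powers p)))))))

-- Hasse's inequality

module Hasse where
  open import Data.Integer using (+_)
  open import Data.List using ([]; _∷_)
  import Data.Vec as Vec
  open import Relation.Binary.PropositionalEquality using (_≡_; _≢_; refl; sym; trans; cong; cong₂; subst)
  open Zp
  open Frob
  open Dickson using (module FpPoly)

  sumBelow : (ℕ → ℕ) → ℕ → ℕ
  sumBelow s zero = 0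
  sumBelow s (suc n) = sumBelow s n ℕ.+ s n

  module _ (p : ℕ) (pp : Prime p) (m : ℕ) (1≤m : 1 ℕ.≤ m) (p≡ : p ≡ suc (m ℕ.+ m))
    (β2 β4 β6 β8 : ℤ) (rel : + 4 ℤ.* β8 ≡ β2 ℤ.* β6 ℤ.- β4 ℤ.* β4) where

    open FpPoly p pp
    private
      PR = polyRing
      module SP = Solver PR
      module M = Manin PR (C β2) (C β4) (C β6) (C β8) t
      open SExp P.semiring using (_^_; ^-congˡ; ^-homo-*; ^-assocʳ)

      nz : ∀ k → 1 ℕ.≤ k → k ℕ.< p → ¬ (+ k K.≈ 0ℤ)
      nz (suc k) _ k<p h = ℕP.<⇒≱ k<p (ℕD.∣⇒≤ (≡0⇒∣ {p} {+ suc k} (~⇒≡0 {p} {+ suc k} h)))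

      2<p : 2 ℕ.< p
      2<p = subst (2 ℕ.<_) (sym p≡) (s≤s (ℕP.+-mono-≤ 1≤m 1≤m))

      2≉0 : ¬ (+ 2 K.≈ 0ℤ)
      2≉0 = nz 2 (s≤s z≤n) 2<p

      hasDeg-C : ∀ {a} → ¬ (a K.≈ 0ℤ) → HasDeg (C a) 0
      hasDeg-C {a} n = deg-C a , n

    -- a point of the projective line over F_p(t) in lowest terms, of height d
    record Height (d : ℕ) : Set where
      field
        a b α β : Poly′
        coprime : α ⊠ a ⊞ β ⊠ b ≋ P.1#
        deg-a : HasDeg a d
        -- Every term of the sequence has a pole at t = ∞, so its height is the degree of the
        -- numerator alone.
        deg-b : Deg< b d

    -- Two consecutive points of a progression with difference Q, the point over t, known only by
    -- their abscissas. The field `on` is what remains of the group law.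
    record Pair (d′ d : ℕ) : Set where
      field
        prev : Height d′
        this : Height d
        on : M.Γ (Height.a prev) (Height.b prev) (Height.a this) (Height.b this) ≋ []

    private
      deg-Π : ∀ {a b d} → HasDeg a d → Deg< b d → HasDeg (M.Π a b) (d ℕ.+ d ℕ.+ 1 ℕ.+ 1)
      deg-Π {a} {b} {d} da db = hasDeg-cong (P.sym (M.Π-lead a b)) (hasDeg-lead {a ⊠ a ⊠ t ⊠ t} {b ⊠ q}
          (hasDeg-⊠ {a ⊠ a ⊠ t} {t} (hasDeg-⊠ {a ⊠ a} {t} (hasDeg-⊠ {a} {a} da da) hasDeg-t) hasDeg-t)
          (deg<-mono {b ⊠ q} bound (deg<-⊠ {b} {q} {d} {suc d} db dq)))
        where
        q = neg (C β4 ⊠ a ⊠ t) ⊞ neg (C β6 ⊠ (a ⊞ t ⊠ b)) ⊞ neg (C β8 ⊠ b)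
        bound : d ℕ.+ suc d ℕ.≤ d ℕ.+ d ℕ.+ 1 ℕ.+ 1
        bound = subst (d ℕ.+ suc d ℕ.≤_) (sym (trans (ℕP.+-assoc (d ℕ.+ d) 1 1) (trans (ℕP.+-assoc d d 2) (cong (d ℕ.+_) (ℕP.+-comm d 2))))) (ℕP.+-monoʳ-≤ d (ℕP.n≤1+n (suc d)))
        tb : Deg< (t ⊠ b) (suc d)
        tb = deg<-mono {t ⊠ b} (ℕP.≤-reflexive (ℕP.+-comm d 1)) (deg<-cong (P.*-comm b t) (deg<-⊠ {b} {t} {d} {1} db (proj₁ hasDeg-t)))
        dq : Deg< q (suc (suc d))
        dq = deg<-⊞ {neg (C β4 ⊠ a ⊠ t) ⊞ neg (C β6 ⊠ (a ⊞ t ⊠ b))} {neg (C β8 ⊠ b)}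
          (deg<-⊞ {neg (C β4 ⊠ a ⊠ t)} {neg (C β6 ⊠ (a ⊞ t ⊠ b))}
            (deg<-neg {C β4 ⊠ a ⊠ t} (deg<-mono {C β4 ⊠ a ⊠ t} (ℕP.≤-reflexive (cong suc (ℕP.+-comm d 1))) (deg<-⊠ {C β4 ⊠ a} {t} {suc d} {1} (deg<-⊠ {C β4} {a} {1} {d} (deg-C β4) (proj₁ da)) (proj₁ hasDeg-t))))
            (deg<-neg {C β6 ⊠ (a ⊞ t ⊠ b)} (deg<-mono {C β6 ⊠ (a ⊞ t ⊠ b)} (ℕP.n≤1+n (suc d)) (deg<-⊠ {C β6} {a ⊞ t ⊠ b} {1} {d} (deg-C β6) (deg<-⊞ {a} {t ⊠ b} (proj₁ da) tb)))))
          (deg<-neg {C β8 ⊠ b} (deg<-mono {C β8 ⊠ b} (ℕP.n≤1+n (suc d)) (deg<-⊠ {C β8} {b} {1} {d} (deg-C β8) (deg<-mono {b} (ℕP.n≤1+n d) db))))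

      deg-S : ∀ {a b d} → HasDeg a d → Deg< b d → Deg< (M.S a b) (d ℕ.+ d ℕ.+ 1 ℕ.+ 1)
      deg-S {a} {b} {d} da db = deg<-cong (P.sym (M.S-split a b)) (deg<-⊞ {u ⊠ t} {b ⊠ v}
          (deg<-mono {u ⊠ t} (ℕP.≤-reflexive e₁) (deg<-⊠ {u} {t} {suc (d ℕ.+ d)} {1} du (proj₁ hasDeg-t)))
          (deg<-mono {b ⊠ v} e₂ (deg<-⊠ {b} {v} {d} {d} db dv)))
        where
        u = C (+ 2) ⊠ (a ⊠ (a ⊞ t ⊠ b)) ⊞ C β2 ⊠ (a ⊠ b)
        v = C β4 ⊠ (a ⊞ t ⊠ b) ⊞ C β6 ⊠ b
        e₁ : suc (d ℕ.+ d) ℕ.+ 1 ≡ d ℕ.+ d ℕ.+ 1 ℕ.+ 1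
        e₁ = cong (ℕ._+ 1) (ℕP.+-comm 1 (d ℕ.+ d))
        e₂ : d ℕ.+ d ℕ.≤ d ℕ.+ d ℕ.+ 1 ℕ.+ 1
        e₂ = ℕP.≤-trans (ℕP.m≤m+n (d ℕ.+ d) 1) (ℕP.m≤m+n (d ℕ.+ d ℕ.+ 1) 1)
        tb : Deg< (t ⊠ b) (suc d)
        tb = deg<-mono {t ⊠ b} (ℕP.≤-reflexive (ℕP.+-comm d 1)) (deg<-cong (P.*-comm b t) (deg<-⊠ {b} {t} {d} {1} db (proj₁ hasDeg-t)))
        atb : Deg< (a ⊞ t ⊠ b) (suc d)
        atb = deg<-⊞ {a} {t ⊠ b} (proj₁ da) tb
        db′ : Deg< b (suc d)
        db′ = deg<-mono {b} (ℕP.n≤1+n d) db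
        du : Deg< u (suc (d ℕ.+ d))
        du = deg<-⊞ {C (+ 2) ⊠ (a ⊠ (a ⊞ t ⊠ b))} {C β2 ⊠ (a ⊠ b)}
          (deg<-⊠ {C (+ 2)} {a ⊠ (a ⊞ t ⊠ b)} {1} {d ℕ.+ d} (deg-C (+ 2)) (deg<-⊠ {a} {a ⊞ t ⊠ b} {suc d} {d} (proj₁ da) atb))
          (deg<-⊠ {C β2} {a ⊠ b} {1} {d ℕ.+ d} (deg-C β2) (deg<-⊠ {a} {b} {suc d} {d} (proj₁ da) db′))
        dv : Deg< v (suc d)
        dv = deg<-⊞ {C β4 ⊠ (a ⊞ t ⊠ b)} {C β6 ⊠ b} (deg<-⊠ {C β4} {a ⊞ t ⊠ b} {1} {d} (deg-C β4) atb) (deg<-⊠ {C β6} {b} {1} {d} (deg-C β6) db′)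

      ≋0-cancel : ∀ {f g} → ¬ (f ≋ []) → f ⊠ g ≋ [] → g ≋ []
      ≋0-cancel {f} {g} n h = [ (λ e → ⊥-elim (n e)) , (λ e → e) ]′ (noZeroDivisors-P f g h)

      nonzero-degree : ∀ {f} → ¬ (f ≋ []) → ∃ (HasDeg f)
      nonzero-degree {f} n = [ (λ e → ⊥-elim (n e)) , (λ e → e) ]′ (degree f)

      -- Cancelling a common factor can only lower the height. This is where an equality of degrees
      -- becomes the inequality e′ ≤ e, which is harmless because heights are bounded from above.
      reduce : ∀ {d e} (q : Height d) w u → HasDeg w e → Deg< u e → M.Γ (Height.a q) (Height.b q) w u ≋ [] → ∃ λ e′ → e′ ℕ.≤ e × Pair d e′
      reduce {d} {e} q w u dw du on = go (lowest-terms (proj₁ (deg-bound u)) w u (proj₂ (deg-bound u)))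
        where
        module Q = Height q
        go : LowestTerms w u → ∃ λ e′ → e′ ℕ.≤ e × Pair d e′
        go L = e′ , subst (e′ ℕ.≤_) e≡ (ℕP.m≤n+m e′ k) , record
            { prev = q
            ; this = record { a = L.f′ ; b = L.g′ ; α = L.α ; β = L.β ; coprime = L.coprime ; deg-a = dw′
                            ; deg-b = deg<-cancel {L.g′} {L.common} {e′} {k} dk (subst (Deg< (L.g′ ⊠ L.common)) (sym (trans (ℕP.+-comm e′ k) e≡)) (deg<-cong (P.trans L.g≋ (P.*-comm L.common L.g′)) du)) }
            ; on = ≋0-cancel {L.common ⊠ L.common} cc (P.trans (P.sym (M.Γ-homogeneous Q.a Q.b L.common L.f′ L.g′)) (P.trans (Γ-cong L.f≋ L.g≋) on)) }
          where
          module L = LowestTerms L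
          w≉0 = hasDeg≉0 {w} dw
          common≉0 : ¬ (L.common ≋ [])
          common≉0 h = w≉0 (P.trans L.f≋ (P.trans (P.*-cong h (P.refl {L.f′})) (P.zeroˡ L.f′)))
          f′≉0 : ¬ (L.f′ ≋ [])
          f′≉0 h = w≉0 (P.trans L.f≋ (P.trans (P.*-cong (P.refl {L.common}) h) (P.zeroʳ L.common)))
          k = proj₁ (nonzero-degree common≉0)
          dk = proj₂ (nonzero-degree common≉0)
          e′ = proj₁ (nonzero-degree f′≉0)
          dw′ = proj₂ (nonzero-degree f′≉0)
          e≡ : k ℕ.+ e′ ≡ e
          e≡ = hasDeg-unique {w} (hasDeg-cong (P.sym L.f≋) (hasDeg-⊠ {L.common} {L.f′} dk dw′)) dw
          cc : ¬ (L.common ⊠ L.common ≋ [])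
          cc h = [ common≉0 , common≉0 ]′ (noZeroDivisors-P L.common L.common h)
          Γ-cong : ∀ {w u w′ u′} → w ≋ w′ → u ≋ u′ → M.Γ Q.a Q.b w′ u′ ≋ M.Γ Q.a Q.b w u
          Γ-cong {w} {u} {w′} {u′} hw hu = P.trans (M.Γ-sym Q.a Q.b w′ u′) (P.trans
            (P.+-cong (P.+-cong (P.*-cong (P.refl {M.h Q.a Q.b ⊠ M.h Q.a Q.b}) (P.*-cong (P.sym hw) (P.sym hw))) (P.-‿cong (P.*-cong (P.refl {M.S Q.a Q.b}) (P.*-cong (P.sym hw) (P.sym hu)))))
              (P.*-cong (P.refl {M.Π Q.a Q.b}) (P.*-cong (P.sym hu) (P.sym hu))))
            (M.Γ-sym w u Q.a Q.b))

    -- The two abscissas neighbouring the current point have product Π / h². Splitting off the known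
    -- one leaves Π = w a′, and deg Π = 2d + 2 gives deg w = 2d + 2 - d′ before reduction to lowest
    -- terms.
    next : ∀ {d′ d} → Pair d′ d → ∃ λ e → e ℕ.+ d′ ℕ.≤ d ℕ.+ d ℕ.+ 1 ℕ.+ 1 × Pair d e
    next {d′} {d} pair = let (w , u , hΠ , hS , hh) = M.second-root {V.a} {V.b} {T.a} {T.b} {V.α} {V.β} V.coprime (Pair.on pair) in go w u hΠ hS hh
      where
      module V = Height (Pair.prev pair)
      module T = Height (Pair.this pair)
      go : ∀ w u → M.Π T.a T.b ≋ w ⊠ V.a → M.S T.a T.b ≋ u ⊠ V.a ⊞ w ⊠ V.b → M.h T.a T.b ⊠ M.h T.a T.b ≋ u ⊠ V.b → ∃ λ e → e ℕ.+ d′ ℕ.≤ d ℕ.+ d ℕ.+ 1 ℕ.+ 1 × Pair d e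
      go w u hΠ hS hh = let (e′ , e′≤e , pr) = reduce (Pair.this pair) w u dw du (P.trans (M.Γ-sym T.a T.b w u) (M.second-root-Γ {V.a} {V.b} {T.a} {T.b} {w} {u} hΠ hS hh)) in
          e′ , ℕP.≤-trans (ℕP.+-monoˡ-≤ d′ e′≤e) (ℕP.≤-reflexive e≡) , pr
        where
        dΠ = deg-Π {T.a} {T.b} T.deg-a T.deg-b
        w≉0 : ¬ (w ≋ [])
        w≉0 h = hasDeg≉0 {M.Π T.a T.b} dΠ (P.trans hΠ (P.trans (P.*-cong h (P.refl {V.a})) (P.zeroˡ V.a)))
        e = proj₁ (nonzero-degree w≉0)
        dw = proj₂ (nonzero-degree w≉0)
        e≡ : e ℕ.+ d′ ≡ d ℕ.+ d ℕ.+ 1 ℕ.+ 1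
        e≡ = hasDeg-unique {M.Π T.a T.b} (hasDeg-cong (P.sym hΠ) (hasDeg-⊠ {w} {V.a} dw V.deg-a)) dΠ
        ua : u ⊠ V.a ≋ M.S T.a T.b ⊞ neg (V.b ⊠ w)
        ua = SP.comb {u ⊠ V.a} {M.S T.a T.b ⊞ neg (V.b ⊠ w)} {neg P.1# ⊠ (M.S T.a T.b ⊞ neg (u ⊠ V.a ⊞ w ⊠ V.b))}
          (SP.solve (u Vec.∷ V.a Vec.∷ M.S T.a T.b Vec.∷ V.b Vec.∷ w Vec.∷ Vec.[]) (λ u a s b w → u SP.:* a SP.:- (s SP.:+ SP.:- (b SP.:* w)) SP.:= (SP.:- SP.con (+ 1)) SP.:* (s SP.:- (u SP.:* a SP.:+ w SP.:* b))) refl)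
          (SP._·_ (neg P.1#) hS)
        du : Deg< u e
        du = deg<-cancel {u} {V.a} {e} {d′} V.deg-a (subst (Deg< (u ⊠ V.a)) (sym e≡) (deg<-cong (P.sym ua) (deg<-⊞ {M.S T.a T.b} {neg (V.b ⊠ w)} (deg-S {T.a} {T.b} T.deg-a T.deg-b)
          (deg<-neg {V.b ⊠ w} (subst (Deg< (V.b ⊠ w)) (trans (ℕP.+-comm d′ e) e≡) (deg<-⊠ {V.b} {w} {d′} {e} V.deg-b (proj₁ dw)))))))

    private
      -- The invariants are d_n + na ≤ n² + p and d_{n+1} + a ≤ d_n + 2n + 1, kept in additive form;
      -- `j` counts the remaining steps. At the end d_n is dropped, being non-negative.
      increments : ∀ n a {d₀ d₁} → Pair d₀ d₁ → d₁ ℕ.+ a ℕ.≤ d₀ ℕ.+ suc (n ℕ.+ n) → ∀ j → n ℕ.* n ℕ.+ p ℕ.≥ d₀ ℕ.+ n ℕ.* a → (n ℕ.+ j) ℕ.* a ℕ.≤ (n ℕ.+ j) ℕ.* (n ℕ.+ j) ℕ.+ p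
      increments n a {d₀} {d₁} pr inc zero bound = subst (λ k → k ℕ.* a ℕ.≤ k ℕ.* k ℕ.+ p) (sym (ℕP.+-identityʳ n)) (ℕP.≤-trans (ℕP.m≤n+m (n ℕ.* a) d₀) bound)
      increments n a {d₀} {d₁} pr inc (suc j) bound = let (e , he , pr′) = next pr in
        subst (λ k → k ℕ.* a ℕ.≤ k ℕ.* k ℕ.+ p) (sym (ℕP.+-suc n j)) (increments (suc n) a pr′ (inc′ e he) j bound′)
        where
        inc′ : ∀ e → e ℕ.+ d₀ ℕ.≤ d₁ ℕ.+ d₁ ℕ.+ 1 ℕ.+ 1 → e ℕ.+ a ℕ.≤ d₁ ℕ.+ suc (suc n ℕ.+ suc n)
        inc′ e he = ℕP.+-cancelʳ-≤ (d₀ ℕ.+ d₁) (e ℕ.+ a) (d₁ ℕ.+ suc (suc n ℕ.+ suc n)) (subst₂′ (lhs e) rhs (ℕP.+-mono-≤ he inc))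
          where
          open import Data.Nat.Solver using (module +-*-Solver)
          open +-*-Solver
          subst₂′ : ∀ {a b c d} → a ≡ c → b ≡ d → a ℕ.≤ b → c ℕ.≤ d
          subst₂′ refl refl h = h
          lhs : ∀ e → (e ℕ.+ d₀) ℕ.+ (d₁ ℕ.+ a) ≡ (e ℕ.+ a) ℕ.+ (d₀ ℕ.+ d₁)
          lhs e = solve 4 (λ e d₀ d₁ a → (e :+ d₀) :+ (d₁ :+ a) := (e :+ a) :+ (d₀ :+ d₁)) refl e d₀ d₁ a
          rhs : (d₁ ℕ.+ d₁ ℕ.+ 1 ℕ.+ 1) ℕ.+ (d₀ ℕ.+ suc (n ℕ.+ n)) ≡ (d₁ ℕ.+ suc (suc n ℕ.+ suc n)) ℕ.+ (d₀ ℕ.+ d₁)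
          rhs = solve 3 (λ d₀ d₁ n → (d₁ :+ d₁ :+ con 1 :+ con 1) :+ (d₀ :+ (con 1 :+ (n :+ n))) := (d₁ :+ (con 1 :+ ((con 1 :+ n) :+ (con 1 :+ n)))) :+ (d₀ :+ d₁)) refl d₀ d₁ n
        bound′ : d₁ ℕ.+ suc n ℕ.* a ℕ.≤ suc n ℕ.* suc n ℕ.+ p
        bound′ = subst₂′ l r (ℕP.+-mono-≤ inc bound)
          where
          open import Data.Nat.Solver using (module +-*-Solver)
          open +-*-Solver
          subst₂′ : ∀ {a b c d} → c ℕ.+ d₀ ≡ a → d ℕ.+ d₀ ≡ b → a ℕ.≤ b → c ℕ.≤ d
          subst₂′ {c = c} {d} refl refl h = ℕP.+-cancelʳ-≤ d₀ c d h
          l : (d₁ ℕ.+ suc n ℕ.* a) ℕ.+ d₀ ≡ (d₁ ℕ.+ a) ℕ.+ (d₀ ℕ.+ n ℕ.* a)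
          l = solve 4 (λ d₁ n a d₀ → (d₁ :+ (con 1 :+ n) :* a) :+ d₀ := (d₁ :+ a) :+ (d₀ :+ n :* a)) refl d₁ n a d₀
          r : (suc n ℕ.* suc n ℕ.+ p) ℕ.+ d₀ ≡ (d₀ ℕ.+ suc (n ℕ.+ n)) ℕ.+ (n ℕ.* n ℕ.+ p)
          r = solve 3 (λ n p d₀ → ((con 1 :+ n) :* (con 1 :+ n) :+ p) :+ d₀ := (d₀ :+ (con 1 :+ (n :+ n))) :+ (n :* n :+ p)) refl n p d₀

    heights-bound : ∀ a {d₁} → Pair p d₁ → d₁ ℕ.+ a ℕ.≤ p ℕ.+ 1 → ∀ n → n ℕ.* a ℕ.≤ n ℕ.* n ℕ.+ p
    heights-bound a pr h n = increments 0 a pr h n (ℕP.≤-reflexive (ℕP.+-identityʳ p))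

    private
      open CExp P.commutativeSemiring using (^-distrib-*)

      φ-+ : ∀ x y {x′ y′} → x ^ p ≋ x′ → y ^ p ≋ y′ → (x ⊞ y) ^ p ≋ x′ ⊞ y′
      φ-+ x y hx hy = P.trans (frobenius-+ PR pp char x y) (P.+-cong hx hy)

      φ-* : ∀ x y {x′ y′} → x ^ p ≋ x′ → y ^ p ≋ y′ → (x ⊠ y) ^ p ≋ x′ ⊠ y′
      φ-* x y hx hy = P.trans (^-distrib-* x y p) (P.*-cong hx hy)

      -- `τ` is the abscissa of the Frobenius image of the point over t. Since p = 2m + 1, `e` is
      -- f(t)^((p+1)/2) and e² = f(t)^(p+1) = f(t^p) f(t). So `Num` over `Q` is the abscissa of the
      -- next point of the progression.
      τ λp e Num Num₋ hh Q : Poly′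
      τ = t ^ p
      λp = M.f t
      e = λp ^ suc m
      hh = M.h τ P.1# ⊠ M.h τ P.1#
      Num = M.S τ P.1# ⊞ neg e
      Num₋ = M.S τ P.1# ⊞ e
      Q = C (+ 2) ⊠ hh

      φ-λ : λp ^ p ≋ M.f τ
      φ-λ = φ-+ (C (+ 4) ⊠ t ⊠ t ⊠ t ⊞ C β2 ⊠ t ⊠ t ⊞ C (+ 2) ⊠ C β4 ⊠ t) (C β6)
        (φ-+ (C (+ 4) ⊠ t ⊠ t ⊠ t ⊞ C β2 ⊠ t ⊠ t) (C (+ 2) ⊠ C β4 ⊠ t)
          (φ-+ (C (+ 4) ⊠ t ⊠ t ⊠ t) (C β2 ⊠ t ⊠ t)
            (φ-* (C (+ 4) ⊠ t ⊠ t) t (φ-* (C (+ 4) ⊠ t) t (φ-* (C (+ 4)) t (φ-C (+ 4)) (P.refl {τ})) (P.refl {τ})) (P.refl {τ}))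
            (φ-* (C β2 ⊠ t) t (φ-* (C β2) t (φ-C β2) (P.refl {τ})) (P.refl {τ})))
          (φ-* (C (+ 2) ⊠ C β4) t (φ-* (C (+ 2)) (C β4) (φ-C (+ 2)) (φ-C β4)) (P.refl {τ})))
        (φ-C β6)

      suc-p : suc m ℕ.+ suc m ≡ suc p
      suc-p = cong suc (trans (ℕP.+-suc m m) (sym p≡))

      e-root : e ⊠ e ≋ M.f τ ⊠ M.f t
      e-root = P.trans (P.sym (^-homo-* λp (suc m) (suc m))) (P.trans (P.reflexive (cong (λp ^_) suc-p))
        (P.trans (P.*-comm λp (λp ^ p)) (P.*-cong φ-λ (P.refl {λp}))))

      relP : C (+ 4) ⊠ C β8 ≋ C β2 ⊠ C β6 ⊞ neg (C β4 ⊠ C β4)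
      relP = eq λ { zero → K.trans {coeff (C (+ 4) ⊠ C β8) 0} {β2 ℤ.* β6 ℤ.- β4 ℤ.* β4} {coeff (C β2 ⊠ C β6 ⊞ neg (C β4 ⊠ C β4)) 0}
                      (K.trans {coeff (C (+ 4) ⊠ C β8) 0} {+ 4 ℤ.* β8} {β2 ℤ.* β6 ℤ.- β4 ℤ.* β4} (coeff-⊠-zero (+ 4) [] (C β8)) (K.reflexive rel))
                      (K.sym {coeff (C β2 ⊠ C β6 ⊞ neg (C β4 ⊠ C β4)) 0} {β2 ℤ.* β6 ℤ.- β4 ℤ.* β4}
                        (K.+-cong {coeff (C β2 ⊠ C β6) 0} {β2 ℤ.* β6} {coeff (neg (C β4 ⊠ C β4)) 0} {ℤ.- (β4 ℤ.* β4)} (coeff-⊠-zero β2 [] (C β6)) (K.-‿cong {coeff (C β4 ⊠ C β4) 0} {β4 ℤ.* β4} (coeff-⊠-zero β4 [] (C β4)))))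
                  ; (suc n) → K.refl {0ℤ} }

      on₁ : M.Γ Num Q τ P.1# ≋ []
      on₁ = M.first-Γ relP {τ} {e} e-root

      NN : Num ⊠ Num₋ ≋ C (+ 4) ⊠ hh ⊠ M.Π τ P.1#
      NN = M.numerators relP {τ} {e} e-root

      hasDeg-t^ : ∀ n → HasDeg (t ^ n) n
      hasDeg-t^ zero = hasDeg-one
      hasDeg-t^ (suc n) = hasDeg-⊠ {t} {t ^ n} hasDeg-t (hasDeg-t^ n)

      deg-λ : Deg< λp 4
      deg-λ = deg<-⊞ {C (+ 4) ⊠ t ⊠ t ⊠ t ⊞ C β2 ⊠ t ⊠ t ⊞ C (+ 2) ⊠ C β4 ⊠ t} {C β6}
        (deg<-⊞ {C (+ 4) ⊠ t ⊠ t ⊠ t ⊞ C β2 ⊠ t ⊠ t} {C (+ 2) ⊠ C β4 ⊠ t}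
          (deg<-⊞ {C (+ 4) ⊠ t ⊠ t ⊠ t} {C β2 ⊠ t ⊠ t}
            (deg<-⊠ {C (+ 4) ⊠ t ⊠ t} {t} {3} {1} (deg<-⊠ {C (+ 4) ⊠ t} {t} {2} {1} (deg<-⊠ {C (+ 4)} {t} {1} {1} (deg-C (+ 4)) dt) dt) dt)
            (deg<-mono {C β2 ⊠ t ⊠ t} (ℕP.n≤1+n 3) (deg<-⊠ {C β2 ⊠ t} {t} {2} {1} (deg<-⊠ {C β2} {t} {1} {1} (deg-C β2) dt) dt)))
          (deg<-mono {C (+ 2) ⊠ C β4 ⊠ t} {2} {4} (s≤s (s≤s z≤n)) (deg<-⊠ {C (+ 2) ⊠ C β4} {t} {1} {1} (deg<-⊠ {C (+ 2)} {C β4} {1} {0} (deg-C (+ 2)) (deg-C β4)) dt)))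
        (deg<-mono {C β6} {1} {4} (s≤s z≤n) (deg-C β6))
        where dt = proj₁ hasDeg-t

      deg-λ^ : ∀ k → Deg< (λp ^ k) (suc (k ℕ.* 3))
      deg-λ^ zero = proj₁ hasDeg-one
      deg-λ^ (suc k) = deg<-⊠ {λp} {λp ^ k} {4} {k ℕ.* 3} deg-λ (deg-λ^ k)

      deg-e : Deg< e (p ℕ.+ p ℕ.+ 1)
      deg-e = deg<-mono {e} bound (deg-λ^ (suc m))
        where
        open import Data.Nat.Solver using (module +-*-Solver)
        open +-*-Solver
        bound : suc (suc m ℕ.* 3) ℕ.≤ p ℕ.+ p ℕ.+ 1
        bound = subst (suc (suc m ℕ.* 3) ℕ.≤_) (trans (solve 1 (λ m → con 3 :+ (m :* con 3 :+ m) := (con 1 :+ (m :+ m)) :+ (con 1 :+ (m :+ m)) :+ con 1) refl m) (cong (λ q → q ℕ.+ q ℕ.+ 1) (sym p≡)))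
          (s≤s (s≤s (s≤s (subst (suc (m ℕ.* 3) ℕ.≤_) (ℕP.+-comm m (m ℕ.* 3)) (ℕP.+-monoˡ-≤ (m ℕ.* 3) 1≤m)))))

      -- The term 2 τ² t of S dominates, with degree 2p + 1 since 2 is invertible; `e` has degree at
      -- most 3(p + 1)/2, which is smaller because p ≥ 3.
      deg-Num : HasDeg Num (p ℕ.+ p ℕ.+ 1)
      deg-Num = hasDeg-cong (P.sym split) (hasDeg-lead {C (+ 2) ⊠ (τ ⊠ τ ⊠ t)} {rest}
          (hasDeg-⊠ {C (+ 2)} {τ ⊠ τ ⊠ t} (hasDeg-C 2≉0) (hasDeg-⊠ {τ ⊠ τ} {t} (hasDeg-⊠ {τ} {τ} dτ dτ) hasDeg-t))
          (deg<-⊞ {C (+ 2) ⊠ (τ ⊠ t ⊠ t) ⊞ C β2 ⊠ (τ ⊠ t) ⊞ C β4 ⊠ (τ ⊞ t) ⊞ C β6} {neg e}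
            (deg<-⊞ {C (+ 2) ⊠ (τ ⊠ t ⊠ t) ⊞ C β2 ⊠ (τ ⊠ t) ⊞ C β4 ⊠ (τ ⊞ t)} {C β6}
              (deg<-⊞ {C (+ 2) ⊠ (τ ⊠ t ⊠ t) ⊞ C β2 ⊠ (τ ⊠ t)} {C β4 ⊠ (τ ⊞ t)}
                (deg<-⊞ {C (+ 2) ⊠ (τ ⊠ t ⊠ t)} {C β2 ⊠ (τ ⊠ t)}
                  (deg<-mono {C (+ 2) ⊠ (τ ⊠ t ⊠ t)} b₁ (deg<-⊠ {C (+ 2)} {τ ⊠ t ⊠ t} {1} {p ℕ.+ 1 ℕ.+ 1} (deg-C (+ 2)) (deg<-⊠ {τ ⊠ t} {t} {suc p ℕ.+ 1} {1} dτt dt)))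
                  (deg<-mono {C β2 ⊠ (τ ⊠ t)} b₂ (deg<-⊠ {C β2} {τ ⊠ t} {1} {p ℕ.+ 1} (deg-C β2) dτt)))
                (deg<-mono {C β4 ⊠ (τ ⊞ t)} b₃ (deg<-⊠ {C β4} {τ ⊞ t} {1} {p} (deg-C β4) (deg<-⊞ {τ} {t} (proj₁ dτ) (deg<-mono {t} (ℕP.<⇒≤ (s≤s (ℕP.<⇒≤ 2<p))) dt)))))
              (deg<-mono {C β6} (ℕP.m≤n+m 1 (p ℕ.+ p)) (deg-C β6)))
            (deg<-neg {e} deg-e)))
        where
        dt = proj₁ hasDeg-t
        dτ = hasDeg-t^ p
        dτt : Deg< (τ ⊠ t) (suc p ℕ.+ 1)
        dτt = deg<-⊠ {τ} {t} {suc p} {1} (proj₁ dτ) dt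
        rest = C (+ 2) ⊠ (τ ⊠ t ⊠ t) ⊞ C β2 ⊠ (τ ⊠ t) ⊞ C β4 ⊠ (τ ⊞ t) ⊞ C β6 ⊞ neg e
        b₀ : p ℕ.+ 2 ℕ.≤ p ℕ.+ p
        b₀ = ℕP.+-monoʳ-≤ p (ℕP.<⇒≤ 2<p)
        b₁ : 1 ℕ.+ (p ℕ.+ 1 ℕ.+ 1) ℕ.≤ p ℕ.+ p ℕ.+ 1
        b₁ = subst (ℕ._≤ p ℕ.+ p ℕ.+ 1) (trans (ℕP.+-comm (p ℕ.+ 2) 1) (cong suc (sym (ℕP.+-assoc p 1 1)))) (ℕP.+-monoˡ-≤ 1 b₀)
        b₂ : 1 ℕ.+ (p ℕ.+ 1) ℕ.≤ p ℕ.+ p ℕ.+ 1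
        b₂ = ℕP.≤-trans (s≤s (ℕP.m≤m+n (p ℕ.+ 1) 1)) b₁
        b₃ : 1 ℕ.+ p ℕ.≤ p ℕ.+ p ℕ.+ 1
        b₃ = ℕP.≤-trans (s≤s (ℕP.m≤m+n p 1)) b₂
        split : Num ≋ C (+ 2) ⊠ (τ ⊠ τ ⊠ t) ⊞ rest
        split = SP.solve (C β2 Vec.∷ C β4 Vec.∷ C β6 Vec.∷ t Vec.∷ τ Vec.∷ e Vec.∷ Vec.[]) (λ b2 b4 b6 t x e →
          con (+ 2) :* x :* t :* (x :* con (+ 1) :+ t :* con (+ 1)) :+ b2 :* x :* t :* con (+ 1) :* con (+ 1) :+ b4 :* con (+ 1) :* con (+ 1) :* (x :* con (+ 1) :+ t :* con (+ 1)) :+ b6 :* con (+ 1) :* con (+ 1) :* con (+ 1) :* con (+ 1) :- e :=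
          con (+ 2) :* (x :* x :* t) :+ (con (+ 2) :* (x :* t :* t) :+ b2 :* (x :* t) :+ b4 :* (x :+ t) :+ b6 :- e)) refl
          where open SP using (_:+_; _:*_; _:-_; _:=_; con)

      deg-h : Deg< (M.h τ P.1#) (suc p)
      deg-h = deg<-⊞ {τ ⊠ P.1#} {neg (t ⊠ P.1#)} (deg<-cong (P.sym (P.*-identityʳ τ)) (proj₁ (hasDeg-t^ p)))
        (deg<-neg {t ⊠ P.1#} (deg<-cong (P.sym (P.*-identityʳ t)) (deg<-mono {t} (ℕP.<⇒≤ (s≤s (ℕP.<⇒≤ 2<p))) (proj₁ hasDeg-t))))

      deg-Q : Deg< Q (p ℕ.+ p ℕ.+ 1)
      deg-Q = deg<-mono {Q} (ℕP.≤-reflexive (ℕP.+-comm 1 (p ℕ.+ p))) (deg<-⊠ {C (+ 2)} {hh} {1} {p ℕ.+ p} (deg-C (+ 2)) (deg<-⊠ {M.h τ P.1#} {M.h τ P.1#} {suc p} {p} deg-h deg-h))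

      start : Height p
      start = record { a = τ ; b = P.1# ; α = [] ; β = P.1# ; coprime = P.trans (P.+-identityˡ (P.1# ⊠ P.1#)) (P.*-identityˡ P.1#)
        ; deg-a = hasDeg-t^ p ; deg-b = deg<-mono {P.1#} (ℕP.<⇒≤ (ℕP.<⇒≤ 2<p)) (proj₁ hasDeg-one) }

    fv : ℤ → ℤ
    fv c = + 4 ℤ.* c ℤ.* c ℤ.* c ℤ.+ β2 ℤ.* c ℤ.* c ℤ.+ + 2 ℤ.* β4 ℤ.* c ℤ.+ β6

    -- upper bounds for the number of points with x-coordinate c
    data Mult (c : ℤ) : ℕ → Set where
      none : Mult c 0
      simple : ∀ η → fv c K.≈ η ℤ.* η → Mult c 1
      double : ∀ η → fv c K.≈ η ℤ.* η → ¬ (η K.≈ 0ℤ) → Mult c 2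

    private
      infixr 2 _⟫_
      _⟫_ : ∀ {x y z : ℤ} → x K.≈ y → y K.≈ z → x K.≈ z
      _⟫_ {x} {y} {z} = K.trans {x} {y} {z}

      ev-C : ∀ a c → ev (C a) c ≡ a
      ev-C a c = trans (cong (λ z → a ℤ.+ z) (ℤP.*-zeroʳ c)) (ℤP.+-identityʳ a)

      ev-t : ∀ c → ev t c ≡ c
      ev-t c = trans (ℤP.+-identityˡ (c ℤ.* (1ℤ ℤ.+ c ℤ.* 0ℤ))) (trans (cong (λ z → c ℤ.* (1ℤ ℤ.+ z)) (ℤP.*-zeroʳ c)) (ℤP.*-identityʳ c))

      ev-*≡ : ∀ {f g x y} c → ev f c K.≈ x → ev g c K.≈ y → ev (f ⊠ g) c K.≈ x ℤ.* y
      ev-*≡ {f} {g} {x} {y} c hf hg = K.trans {ev (f ⊠ g) c} {ev f c ℤ.* ev g c} {x ℤ.* y} (ev-⊠ f g c) (K.*-cong {ev f c} {x} {ev g c} {y} hf hg)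

      ev-+≡ : ∀ {f g x y} c → ev f c K.≈ x → ev g c K.≈ y → ev (f ⊞ g) c K.≈ x ℤ.+ y
      ev-+≡ {f} {g} {x} {y} c hf hg = K.trans {ev (f ⊞ g) c} {ev f c ℤ.+ ev g c} {x ℤ.+ y} (ev-⊞ f g c) (K.+-cong {ev f c} {x} {ev g c} {y} hf hg)

      ev-neg≡ : ∀ {f x} c → ev f c K.≈ x → ev (neg f) c K.≈ ℤ.- x
      ev-neg≡ {f} {x} c hf = K.trans {ev (neg f) c} {ℤ.- ev f c} {ℤ.- x} (ev-neg f c) (K.-‿cong {ev f c} {x} hf)

      ev-C≈ : ∀ a c → ev (C a) c K.≈ a
      ev-C≈ a c = K.reflexive (ev-C a c)

      ev-t≈ : ∀ c → ev t c K.≈ c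
      ev-t≈ c = K.reflexive (ev-t c)

      ev-one : ∀ c → ev P.1# c K.≈ 1ℤ
      ev-one c = ev-C≈ 1ℤ c

      ev-^ : ∀ {f x} n c → ev f c K.≈ x → ev (f ^ n) c K.≈ x KE.^ n
      ev-^ zero c h = ev-one c
      ev-^ {f} {x} (suc n) c h = ev-*≡ {f} {f ^ n} {x} {x KE.^ n} c h (ev-^ {f} {x} n c h)

      ev-τ : ∀ c → ev τ c K.≈ c
      ev-τ c = K.trans {ev τ c} {c KE.^ p} {c} (ev-^ {t} {c} p c (ev-t≈ c)) (F.fermat c)

      ev-h : ∀ c → ev (M.h τ P.1#) c K.≈ 0ℤ
      ev-h c = K.trans {ev (M.h τ P.1#) c} {c ℤ.* 1ℤ ℤ.+ ℤ.- (c ℤ.* 1ℤ)} {0ℤ}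
        (ev-+≡ {τ ⊠ P.1#} {neg (t ⊠ P.1#)} {c ℤ.* 1ℤ} {ℤ.- (c ℤ.* 1ℤ)} c (ev-*≡ {τ} {P.1#} {c} {1ℤ} c (ev-τ c) (ev-one c)) (ev-neg≡ {t ⊠ P.1#} {c ℤ.* 1ℤ} c (ev-*≡ {t} {P.1#} {c} {1ℤ} c (ev-t≈ c) (ev-one c))))
        (K.-‿inverseʳ (c ℤ.* 1ℤ))

      ev-λ : ∀ c → ev λp c K.≈ fv c
      ev-λ c = ev-+≡ {C (+ 4) ⊠ t ⊠ t ⊠ t ⊞ C β2 ⊠ t ⊠ t ⊞ C (+ 2) ⊠ C β4 ⊠ t} {C β6} {+ 4 ℤ.* c ℤ.* c ℤ.* c ℤ.+ β2 ℤ.* c ℤ.* c ℤ.+ + 2 ℤ.* β4 ℤ.* c} {β6} c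
        (ev-+≡ {C (+ 4) ⊠ t ⊠ t ⊠ t ⊞ C β2 ⊠ t ⊠ t} {C (+ 2) ⊠ C β4 ⊠ t} {+ 4 ℤ.* c ℤ.* c ℤ.* c ℤ.+ β2 ℤ.* c ℤ.* c} {+ 2 ℤ.* β4 ℤ.* c} c
          (ev-+≡ {C (+ 4) ⊠ t ⊠ t ⊠ t} {C β2 ⊠ t ⊠ t} {+ 4 ℤ.* c ℤ.* c ℤ.* c} {β2 ℤ.* c ℤ.* c} c
            (ev-*≡ {C (+ 4) ⊠ t ⊠ t} {t} {+ 4 ℤ.* c ℤ.* c} {c} c (ev-*≡ {C (+ 4) ⊠ t} {t} {+ 4 ℤ.* c} {c} c (ev-*≡ {C (+ 4)} {t} {+ 4} {c} c (ev-C≈ (+ 4) c) (ev-t≈ c)) (ev-t≈ c)) (ev-t≈ c))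
            (ev-*≡ {C β2 ⊠ t} {t} {β2 ℤ.* c} {c} c (ev-*≡ {C β2} {t} {β2} {c} c (ev-C≈ β2 c) (ev-t≈ c)) (ev-t≈ c)))
          (ev-*≡ {C (+ 2) ⊠ C β4} {t} {+ 2 ℤ.* β4} {c} c (ev-*≡ {C (+ 2)} {C β4} {+ 2} {β4} c (ev-C≈ (+ 2) c) (ev-C≈ β4 c)) (ev-t≈ c)))
        (ev-C≈ β6 c)

      ev-S : ∀ c → ev (M.S τ P.1#) c K.≈ fv c
      ev-S c = K.trans {ev (M.S τ P.1#) c} {ev (λp ⊞ M.h τ P.1# ⊠ z) c} {fv c} (ev-cong {M.S τ P.1#} {λp ⊞ M.h τ P.1# ⊠ z} c (M.S-diagonal τ))
        (K.trans {ev (λp ⊞ M.h τ P.1# ⊠ z) c} {fv c ℤ.+ 0ℤ ℤ.* ev z c} {fv c}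
          (ev-+≡ {λp} {M.h τ P.1# ⊠ z} {fv c} {0ℤ ℤ.* ev z c} c (ev-λ c) (ev-*≡ {M.h τ P.1#} {z} {0ℤ} {ev z c} c (ev-h c) (K.refl {ev z c})))
          (K.reflexive (ℤP.+-identityʳ (fv c))))
        where z = C (+ 2) ⊠ t ⊠ (τ ⊞ C (+ 2) ⊠ t) ⊞ C β2 ⊠ t ⊞ C β4

      -- As in Euler's criterion: (η²)^((p+1)/2) = η^(p+1) = η² by Fermat.
      ev-e : ∀ c η → fv c K.≈ η ℤ.* η → ev e c K.≈ η ℤ.* η
      ev-e c η h = K.trans {ev e c} {(η ℤ.* η) KE.^ suc m} {η ℤ.* η} (ev-^ {λp} {η ℤ.* η} (suc m) c (K.trans {ev λp c} {fv c} {η ℤ.* η} (ev-λ c) h))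
        (K.trans {(η ℤ.* η) KE.^ suc m} {η KE.^ suc p} {η ℤ.* η} power (K.*-cong {η} {η} {η KE.^ p} {η} (K.refl {η}) (F.fermat η)))
        where
        power : (η ℤ.* η) KE.^ suc m K.≈ η KE.^ suc p
        power = K.trans {(η ℤ.* η) KE.^ suc m} {η KE.^ suc m ℤ.* η KE.^ suc m} {η KE.^ suc p} (CExp.^-distrib-* K.commutativeSemiring η η (suc m))
          (K.trans {η KE.^ suc m ℤ.* η KE.^ suc m} {η KE.^ (suc m ℕ.+ suc m)} {η KE.^ suc p} (K.sym {η KE.^ (suc m ℕ.+ suc m)} {η KE.^ suc m ℤ.* η KE.^ suc m} (KE.^-homo-* η (suc m) (suc m))) (K.reflexive (cong (η KE.^_) suc-p)))

      -- At c in F_p the factor h vanishes, as c^p = c, so S is f(c); if this is a square, S - e is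
      -- zero. Thus `Num` and `Q` share a root at every abscissa that carries a point.
      ev-Num : ∀ c η → fv c K.≈ η ℤ.* η → ev Num c K.≈ 0ℤ
      ev-Num c η h = K.trans {ev Num c} {η ℤ.* η ℤ.+ ℤ.- (η ℤ.* η)} {0ℤ}
        (ev-+≡ {M.S τ P.1#} {neg e} {η ℤ.* η} {ℤ.- (η ℤ.* η)} c (K.trans {ev (M.S τ P.1#) c} {fv c} {η ℤ.* η} (ev-S c) h) (ev-neg≡ {e} {η ℤ.* η} c (ev-e c η h)))
        (K.-‿inverseʳ (η ℤ.* η))

      ev-Num₋ : ∀ c η → fv c K.≈ η ℤ.* η → ¬ (η K.≈ 0ℤ) → ¬ (ev Num₋ c K.≈ 0ℤ)
      ev-Num₋ c η h n z = [ 2≉0 , (λ k → [ n , n ]′ (F.noZeroDivisors η η k)) ]′ (F.noZeroDivisors (+ 2) (η ℤ.* η)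
        (K.trans {+ 2 ℤ.* (η ℤ.* η)} {η ℤ.* η ℤ.+ η ℤ.* η} {0ℤ} (K.reflexive (two (η ℤ.* η)))
          (K.trans {η ℤ.* η ℤ.+ η ℤ.* η} {ev Num₋ c} {0ℤ} (K.sym {ev Num₋ c} {η ℤ.* η ℤ.+ η ℤ.* η} (ev-+≡ {M.S τ P.1#} {e} {η ℤ.* η} {η ℤ.* η} c (K.trans {ev (M.S τ P.1#) c} {fv c} {η ℤ.* η} (ev-S c) h) (ev-e c η h))) z)))
        where
        two : ∀ x → + 2 ℤ.* x ≡ x ℤ.+ x
        two x = trans (ℤP.*-distribʳ-+ x 1ℤ 1ℤ) (cong₂ ℤ._+_ (ℤP.*-identityˡ x) (ℤP.*-identityˡ x))

      hasDeg-X : ∀ c → HasDeg (X- c) 1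
      hasDeg-X c = (λ { (suc (suc i)) _ → K.refl {0ℤ} ; (suc zero) (s≤s ()) }) , (λ h → F.1≢0 (~⇒≡0 h))

      X≉0 : ∀ c → ¬ ((X- c) ≋ [])
      X≉0 c = hasDeg≉0 {X- c} (hasDeg-X c)

      split-root : ∀ {f g q} c → f ≋ g ⊠ q → ev f c K.≈ 0ℤ → ¬ (ev g c K.≈ 0ℤ) → ∃ λ r → q ≋ r ⊠ (X- c)
      split-root {f} {g} {q} c h z n = root-factor q c ([ (λ k → ⊥-elim (n k)) , (λ k → k) ]′ (F.noZeroDivisors (ev g c) (ev q c)
        (K.trans {ev g c ℤ.* ev q c} {ev f c} {0ℤ} (K.sym {ev f c} {ev g c ℤ.* ev q c} (K.trans {ev f c} {ev (g ⊠ q) c} {ev g c ℤ.* ev q c} (ev-cong {f} {g ⊠ q} c h) (ev-⊠ g q c))) z)))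

      cancel-X : ∀ {f g} c → f ⊠ (X- c) ≋ g ⊠ (X- c) → f ≋ g
      cancel-X {f} {g} c h = SP.x-y≈0⇒x≈y (≋0-cancel {X- c} (X≉0 c) (P.trans (SP.solve (f Vec.∷ g Vec.∷ (X- c) Vec.∷ Vec.[]) (λ f g x → x SP.:* (f SP.:- g) SP.:= f SP.:* x SP.:- g SP.:* x) refl) (SP.x≈y⇒x-y≈0 h)))

      ev-X : ∀ c → ev (X- c) c K.≈ 0ℤ
      ev-X c = K.trans {ev (X- c) c} {ℤ.- c ℤ.+ c} {0ℤ} (K.reflexive (cong (λ z → ℤ.- c ℤ.+ z) (trans (cong (λ z → c ℤ.* (1ℤ ℤ.+ z)) (ℤP.*-zeroʳ c)) (ℤP.*-identityʳ c)))) (K.-‿inverseˡ c)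

      ev-X′ : ∀ {m n} → m ℕ.< n → n ℕ.< p → ¬ (ev (X- (+ m)) (+ n) K.≈ 0ℤ)
      ev-X′ {m} {n} m<n n<p h = nz (n ℕ.∸ m) (ℕP.m<n⇒0<n∸m m<n) (ℕP.≤-<-trans (ℕP.m∸n≤m n m) n<p)
        (subst (K._≈ 0ℤ) (trans (cong (λ z → ℤ.- + m ℤ.+ z) (trans (cong (λ z → + n ℤ.* (1ℤ ℤ.+ z)) (ℤP.*-zeroʳ (+ n))) (ℤP.*-identityʳ (+ n)))) (trans (ℤP.-m+n≡n⊖m m n) (ℤP.⊖-≥ (ℕP.<⇒≤ m<n)))) h)

    -- A common factor of `Num` and `Q` collected from the abscissas below n; its degree k is the
    -- number of points counted there, and cancelling it lowers the height by k. `avoids` keeps the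
    -- later abscissas free, so the next roots can be split off from the cofactors.
    record Divisor (n k : ℕ) : Set where
      field
        g q r : Poly′
        deg-g : HasDeg g k
        g∣Num : Num ≋ g ⊠ q
        g∣Q : Q ≋ g ⊠ r
        avoids : ∀ c → n ℕ.≤ c → c ℕ.< p → ¬ (ev g (+ c) K.≈ 0ℤ)

    private
      ev-Q : ∀ c → ev Q c K.≈ 0ℤ
      ev-Q c = K.trans {ev Q c} {+ 2 ℤ.* (0ℤ ℤ.* 0ℤ)} {0ℤ} (ev-*≡ {C (+ 2)} {hh} {+ 2} {0ℤ ℤ.* 0ℤ} c (ev-C≈ (+ 2) c) (ev-*≡ {M.h τ P.1#} {M.h τ P.1#} {0ℤ} {0ℤ} c (ev-h c) (ev-h c))) (K.refl {0ℤ})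

      avoid-X : ∀ {n g} → (∀ c → n ℕ.≤ c → c ℕ.< p → ¬ (ev g (+ c) K.≈ 0ℤ)) → ∀ c → suc n ℕ.≤ c → c ℕ.< p → ¬ (ev (g ⊠ (X- (+ n))) (+ c) K.≈ 0ℤ)
      avoid-X {n} {g} av c n<c c<p h = [ av c (ℕP.<⇒≤ n<c) c<p , ev-X′ n<c c<p ]′ (F.noZeroDivisors (ev g (+ c)) (ev (X- (+ n)) (+ c))
        (K.trans {ev g (+ c) ℤ.* ev (X- (+ n)) (+ c)} {ev (g ⊠ (X- (+ n))) (+ c)} {0ℤ} (K.sym {ev (g ⊠ (X- (+ n))) (+ c)} {ev g (+ c) ℤ.* ev (X- (+ n)) (+ c)} (ev-⊠ g (X- (+ n)) (+ c))) h))

      regroup : ∀ {f g q r x} → f ≋ g ⊠ q → q ≋ r ⊠ x → f ≋ (g ⊠ x) ⊠ r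
      regroup {f} {g} {q} {r} {x} h k = P.trans h (P.trans (P.*-cong (P.refl {g}) k) (SP.solve (g Vec.∷ r Vec.∷ x Vec.∷ Vec.[]) (λ g r x → g SP.:* (r SP.:* x) SP.:= (g SP.:* x) SP.:* r) refl))

      once : ∀ {n k} → n ℕ.< p → ev Num (+ n) K.≈ 0ℤ → Divisor n k → Divisor (suc n) (k ℕ.+ 1)
      once {n} {k} n<p z d = record { g = G.g ⊠ x ; q = proj₁ s₁ ; r = proj₁ s₂ ; deg-g = hasDeg-⊠ {G.g} {x} G.deg-g (hasDeg-X (+ n))
          ; g∣Num = regroup {Num} {G.g} {G.q} {proj₁ s₁} {x} G.g∣Num (proj₂ s₁) ; g∣Q = regroup {Q} {G.g} {G.r} {proj₁ s₂} {x} G.g∣Q (proj₂ s₂) ; avoids = avoid-X {n} {G.g} G.avoids }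
        where
        module G = Divisor d
        x = X- (+ n)
        s₁ = split-root {Num} {G.g} {G.q} (+ n) G.g∣Num z (G.avoids n ℕP.≤-refl n<p)
        s₂ = split-root {Q} {G.g} {G.r} (+ n) G.g∣Q (ev-Q (+ n)) (G.avoids n ℕP.≤-refl n<p)

      -- As t - c divides h, the product `Num` · `Num₋` = 4 h² Π has a double zero at c. For η ≠ 0
      -- the value of `Num₋` at c is 2η² ≠ 0, so both zeros belong to `Num`; and `Q` = 2 h² has them
      -- too.
      twice : ∀ {n k} → n ℕ.< p → ev Num (+ n) K.≈ 0ℤ → ¬ (ev Num₋ (+ n) K.≈ 0ℤ) → Divisor n k → Divisor (suc n) (k ℕ.+ 1 ℕ.+ 1)
      twice {n} {k} n<p z nz₋ d = record { g = G.g ⊠ x ⊠ x ; q = proj₁ s₃ ; r = proj₁ s₄ ; deg-g = hasDeg-⊠ {G.g ⊠ x} {x} (hasDeg-⊠ {G.g} {x} G.deg-g (hasDeg-X (+ n))) (hasDeg-X (+ n))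
          ; g∣Num = regroup {Num} {G.g ⊠ x} {q₁} {proj₁ s₃} {x} (regroup {Num} {G.g} {G.q} {q₁} {x} G.g∣Num (proj₂ s₁)) (proj₂ s₃)
          ; g∣Q = regroup {Q} {G.g ⊠ x} {r₁} {proj₁ s₄} {x} (regroup {Q} {G.g} {G.r} {r₁} {x} G.g∣Q (proj₂ s₂)) (proj₂ s₄)
          ; avoids = λ c n<c c<p h → [ avoid-X {n} {G.g} G.avoids c n<c c<p , ev-X′ n<c c<p ]′ (F.noZeroDivisors (ev (G.g ⊠ x) (+ c)) (ev x (+ c))
              (K.trans {ev (G.g ⊠ x) (+ c) ℤ.* ev x (+ c)} {ev (G.g ⊠ x ⊠ x) (+ c)} {0ℤ} (K.sym {ev (G.g ⊠ x ⊠ x) (+ c)} {ev (G.g ⊠ x) (+ c) ℤ.* ev x (+ c)} (ev-⊠ (G.g ⊠ x) x (+ c))) h)) }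
        where
        module G = Divisor d
        x = X- (+ n)
        gn = G.avoids n ℕP.≤-refl n<p
        s₁ = split-root {Num} {G.g} {G.q} (+ n) G.g∣Num z gn
        q₁ = proj₁ s₁
        s₂ = split-root {Q} {G.g} {G.r} (+ n) G.g∣Q (ev-Q (+ n)) gn
        r₁ = proj₁ s₂
        hx = root-factor (M.h τ P.1#) (+ n) (ev-h (+ n))
        y = proj₁ hx
        hh≋ : hh ≋ (y ⊠ y ⊠ x) ⊠ x
        hh≋ = P.trans (P.*-cong (proj₂ hx) (proj₂ hx)) (SP.solve (y Vec.∷ x Vec.∷ Vec.[]) (λ y x → (y SP.:* x) SP.:* (y SP.:* x) SP.:= (y SP.:* y SP.:* x) SP.:* x) refl)
        zero-at : ∀ z → ev (z ⊠ x) (+ n) K.≈ 0ℤ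
        zero-at z = K.trans {ev (z ⊠ x) (+ n)} {ev z (+ n) ℤ.* 0ℤ} {0ℤ} (ev-*≡ {z} {x} {ev z (+ n)} {0ℤ} (+ n) (K.refl {ev z (+ n)}) (ev-X (+ n))) (K.zeroʳ (ev z (+ n)))
        e₃ : (C (+ 4) ⊠ (y ⊠ y) ⊠ M.Π τ P.1#) ⊠ x ≋ (G.g ⊠ Num₋) ⊠ q₁
        e₃ = cancel-X (+ n) (P.trans (SP.solve (C (+ 4) Vec.∷ y Vec.∷ M.Π τ P.1# Vec.∷ x Vec.∷ Vec.[]) (λ k y π x → (k SP.:* (y SP.:* y) SP.:* π) SP.:* x SP.:* x SP.:= k SP.:* ((y SP.:* y SP.:* x) SP.:* x) SP.:* π) refl)
          (P.trans (P.*-cong (P.*-cong (P.refl {C (+ 4)}) (P.sym hh≋)) (P.refl {M.Π τ P.1#})) (P.trans (P.sym NN) (P.trans (P.*-cong (P.trans G.g∣Num (P.*-cong (P.refl {G.g}) (proj₂ s₁))) (P.refl {Num₋}))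
            (SP.solve (G.g Vec.∷ q₁ Vec.∷ x Vec.∷ Num₋ Vec.∷ Vec.[]) (λ g q x n → (g SP.:* (q SP.:* x)) SP.:* n SP.:= (g SP.:* n) SP.:* q SP.:* x) refl)))))
        s₃ = split-root {(C (+ 4) ⊠ (y ⊠ y) ⊠ M.Π τ P.1#) ⊠ x} {G.g ⊠ Num₋} {q₁} (+ n) e₃ (zero-at (C (+ 4) ⊠ (y ⊠ y) ⊠ M.Π τ P.1#))
          (λ h → [ gn , nz₋ ]′ (F.noZeroDivisors (ev G.g (+ n)) (ev Num₋ (+ n)) (K.trans {ev G.g (+ n) ℤ.* ev Num₋ (+ n)} {ev (G.g ⊠ Num₋) (+ n)} {0ℤ} (K.sym {ev (G.g ⊠ Num₋) (+ n)} {ev G.g (+ n) ℤ.* ev Num₋ (+ n)} (ev-⊠ G.g Num₋ (+ n))) h)))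
        e₄ : (C (+ 2) ⊠ (y ⊠ y)) ⊠ x ≋ G.g ⊠ r₁
        e₄ = cancel-X (+ n) (P.trans (SP.solve (C (+ 2) Vec.∷ y Vec.∷ x Vec.∷ Vec.[]) (λ k y x → (k SP.:* (y SP.:* y)) SP.:* x SP.:* x SP.:= k SP.:* ((y SP.:* y SP.:* x) SP.:* x)) refl)
          (P.trans (P.*-cong (P.refl {C (+ 2)}) (P.sym hh≋)) (P.trans G.g∣Q (P.trans (P.*-cong (P.refl {G.g}) (proj₂ s₂)) (P.sym (P.*-assoc G.g r₁ x))))))
        s₄ = split-root {(C (+ 2) ⊠ (y ⊠ y)) ⊠ x} {G.g} {r₁} (+ n) e₄ (zero-at (C (+ 2) ⊠ (y ⊠ y))) gn

      divisor-step : ∀ {n k s} → n ℕ.< p → Mult (+ n) s → Divisor n k → Divisor (suc n) (k ℕ.+ s)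
      divisor-step {n} {k} n<p none d = subst (Divisor (suc n)) (sym (ℕP.+-identityʳ k)) (record { Divisor d ; avoids = λ c n<c c<p → Divisor.avoids d c (ℕP.<⇒≤ n<c) c<p })
      divisor-step {n} {k} n<p (simple η h) d = once n<p (ev-Num (+ n) η h) d
      divisor-step {n} {k} n<p (double η h ne) d = subst (Divisor (suc n)) (ℕP.+-assoc k 1 1) (twice n<p (ev-Num (+ n) η h) (ev-Num₋ (+ n) η h ne) d)

    module _ (s : ℕ → ℕ) (mult : ∀ c → c ℕ.< p → Mult (+ c) (s c)) where

      private
        divisor : ∀ n → n ℕ.≤ p → Divisor n (sumBelow s n)
        divisor zero _ = record { g = P.1# ; q = Num ; r = Q ; deg-g = hasDeg-one ; g∣Num = P.sym (P.*-identityˡ Num) ; g∣Q = P.sym (P.*-identityˡ Q)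
          ; avoids = λ c _ _ h → F.1≢0 (~⇒≡0 (K.trans {1ℤ} {ev P.1# (+ c)} {0ℤ} (K.sym {ev P.1# (+ c)} {1ℤ} (ev-one (+ c))) h)) }
        divisor (suc n) n<p = divisor-step n<p (mult n n<p) (divisor n (ℕP.<⇒≤ n<p))

        -- The degree 2p + 1 of `Num` drops by one for each counted point. With p + a points this
        -- says d₁ + a ≤ d₀ + 1, the start of the recursion with d₀ = p.
        first : ∃ λ d₁ → d₁ ℕ.+ sumBelow s p ℕ.≤ p ℕ.+ p ℕ.+ 1 × Pair p d₁
        first = let (e′ , e′≤ , pr) = reduce start G.q G.r dq dr on in e′ , ℕP.≤-trans (ℕP.+-monoˡ-≤ k e′≤) (ℕP.≤-reflexive (trans (ℕP.+-comm e₁ k) e≡)) , pr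
          where
          module G = Divisor (divisor p ℕP.≤-refl)
          k = sumBelow s p
          q≉0 : ¬ (G.q ≋ [])
          q≉0 h = hasDeg≉0 {Num} deg-Num (P.trans G.g∣Num (P.trans (P.*-cong (P.refl {G.g}) h) (P.zeroʳ G.g)))
          e₁ = proj₁ (nonzero-degree q≉0)
          dq = proj₂ (nonzero-degree q≉0)
          e≡ : k ℕ.+ e₁ ≡ p ℕ.+ p ℕ.+ 1
          e≡ = hasDeg-unique {Num} (hasDeg-cong (P.sym G.g∣Num) (hasDeg-⊠ {G.g} {G.q} G.deg-g dq)) deg-Num
          dr : Deg< G.r e₁
          dr = deg<-cancel {G.r} {G.g} {e₁} {k} G.deg-g (subst (Deg< (G.r ⊠ G.g)) (sym (trans (ℕP.+-comm e₁ k) e≡)) (deg<-cong (P.trans G.g∣Q (P.*-comm G.g G.r)) deg-Q))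
          g≉0 = hasDeg≉0 {G.g} G.deg-g
          on : M.Γ τ P.1# G.q G.r ≋ []
          on = ≋0-cancel {G.g ⊠ G.g} (λ h → [ g≉0 , g≉0 ]′ (noZeroDivisors-P G.g G.g h))
            (P.trans (P.sym (M.Γ-homogeneous τ P.1# G.g G.q G.r)) (P.trans (M.Γ-sym τ P.1# (G.g ⊠ G.q) (G.g ⊠ G.r))
              (P.trans (P.+-cong (P.+-cong (P.*-cong (P.refl {M.h τ P.1# ⊠ M.h τ P.1#}) (P.*-cong (P.sym G.g∣Num) (P.sym G.g∣Num))) (P.-‿cong (P.*-cong (P.refl {M.S τ P.1#}) (P.*-cong (P.sym G.g∣Num) (P.sym G.g∣Q)))))
                (P.*-cong (P.refl {M.Π τ P.1#}) (P.*-cong (P.sym G.g∣Q) (P.sym G.g∣Q)))) on₁)))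

      -- The bound n a ≤ n² + p is used at n = ⌊a/2⌋. For a = 2j it reads j² ≤ p. For a = 2j + 1 it
      -- reads j² + j ≤ p, where the left side is even and p is odd; so it is strict, and a² = 4(j²
      -- + j) + 1 ≤ 4p.
      hasse : ∀ a → sumBelow s p ≡ p ℕ.+ a → a ℕ.* a ℕ.≤ 4 ℕ.* p
      hasse a e = let (d₁ , h , pr) = first in
          conclude a (heights-bound a pr (ℕP.+-cancelʳ-≤ p (d₁ ℕ.+ a) (p ℕ.+ 1) (subst₂ ℕ._≤_ (l d₁) r h)))
        where
        open import Data.Nat.Solver using (module +-*-Solver)
        open +-*-Solver
        open import Relation.Binary.PropositionalEquality using (subst₂)
        l : ∀ d₁ → d₁ ℕ.+ sumBelow s p ≡ d₁ ℕ.+ a ℕ.+ p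
        l d₁ = trans (cong (d₁ ℕ.+_) e) (solve 3 (λ d p a → d :+ (p :+ a) := d :+ a :+ p) refl d₁ p a)
        r : p ℕ.+ p ℕ.+ 1 ≡ p ℕ.+ 1 ℕ.+ p
        r = solve 1 (λ p → p :+ p :+ con 1 := p :+ con 1 :+ p) refl p
        parity : ∀ a → (∃ λ j → a ≡ j ℕ.+ j) ⊎ (∃ λ j → a ≡ suc (j ℕ.+ j))
        parity zero = inj₁ (0 , refl)
        parity (suc a) = [ (λ (j , h) → inj₂ (j , cong suc h)) , (λ (j , h) → inj₁ (suc j , trans (cong suc h) (cong suc (sym (ℕP.+-suc j j))))) ]′ (parity a)
        odd≢even : ∀ i j → suc (i ℕ.+ i) ≢ j ℕ.+ j
        odd≢even i zero ()
        odd≢even zero (suc j) h = ℕP.0≢1+n (trans (ℕP.suc-injective h) (ℕP.+-suc j j))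
        odd≢even (suc i) (suc j) h = odd≢even i j (ℕP.suc-injective (ℕP.suc-injective (trans (cong suc (cong suc (sym (ℕP.+-suc i i)))) (trans h (cong suc (ℕP.+-suc j j))))))
        consecutive : ∀ j → ∃ λ i → j ℕ.* j ℕ.+ j ≡ i ℕ.+ i
        consecutive zero = 0 , refl
        consecutive (suc j) = let (i , h) = consecutive j in i ℕ.+ suc j , trans (solve 1 (λ j → (con 1 :+ j) :* (con 1 :+ j) :+ (con 1 :+ j) := (j :* j :+ j) :+ ((con 1 :+ j) :+ (con 1 :+ j))) refl j)
          (trans (cong (ℕ._+ (suc j ℕ.+ suc j)) h) (solve 2 (λ i j → (i :+ i) :+ ((con 1 :+ j) :+ (con 1 :+ j)) := (i :+ (con 1 :+ j)) :+ (i :+ (con 1 :+ j))) refl i j))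
        conclude : ∀ a → (∀ n → n ℕ.* a ℕ.≤ n ℕ.* n ℕ.+ p) → a ℕ.* a ℕ.≤ 4 ℕ.* p
        conclude a bound = [ even , odd ]′ (parity a)
          where
          even : (∃ λ j → a ≡ j ℕ.+ j) → a ℕ.* a ℕ.≤ 4 ℕ.* p
          even (j , refl) = subst (ℕ._≤ 4 ℕ.* p) (solve 1 (λ j → con 4 :* (j :* j) := (j :+ j) :* (j :+ j)) refl j)
            (ℕP.*-monoʳ-≤ 4 (ℕP.+-cancelˡ-≤ (j ℕ.* j) (j ℕ.* j) p (subst (ℕ._≤ j ℕ.* j ℕ.+ p) (ℕP.*-distribˡ-+ j j j) (bound j))))
          odd : (∃ λ j → a ≡ suc (j ℕ.+ j)) → a ℕ.* a ℕ.≤ 4 ℕ.* p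
          odd (j , refl) = ℕP.≤-trans (ℕP.≤-reflexive (solve 1 (λ j → (con 1 :+ (j :+ j)) :* (con 1 :+ (j :+ j)) := con 1 :+ con 4 :* (j :* j :+ j)) refl j))
              (ℕP.≤-trans (s≤s (ℕP.≤-trans (ℕP.n≤1+n _) (ℕP.≤-trans (ℕP.n≤1+n _) (ℕP.n≤1+n _)))) (subst (ℕ._≤ 4 ℕ.* p) (solve 1 (λ x → con 4 :* (con 1 :+ x) := con 4 :+ con 4 :* x) refl (j ℕ.* j ℕ.+ j)) (ℕP.*-monoʳ-≤ 4 strict)))
            where
            weak : j ℕ.* j ℕ.+ j ℕ.≤ p
            weak = ℕP.+-cancelˡ-≤ (j ℕ.* j) (j ℕ.* j ℕ.+ j) p (subst (ℕ._≤ j ℕ.* j ℕ.+ p) (solve 1 (λ j → j :* (con 1 :+ (j :+ j)) := j :* j :+ (j :* j :+ j)) refl j) (bound j))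
            strict : j ℕ.* j ℕ.+ j ℕ.< p
            strict = ℕP.≤∧≢⇒< weak (λ h → let (i , k) = consecutive j in odd≢even m i (trans (sym p≡) (trans (sym h) k)))

-- Counting points of the reduced curve

module Count where
  open import Defs
  open import Data.Nat.ListAction using (sum)
  open import Data.Nat.ListAction.Properties using (sum-++)
  open import Data.Integer using (+_; _+_; _*_; _-_; -_)
  open import Data.List using (List; []; _∷_; _++_; length; filter; upTo; cartesianProduct; map)
  open import Data.List.Relation.Unary.All as All using (All; []; _∷_)
  open import Data.List.Relation.Unary.AllPairs using ([]; _∷_)
  open import Data.List.Relation.Unary.Any using (here; there)
  open import Data.List.Relation.Binary.Permutation.Propositional using (_↭_; ↭-refl; ↭-trans; prep)
  open import Data.Vec using ([]; _∷_)
  open import Function using (_∘_)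
  open import Relation.Nullary.Decidable using (_×-dec_; ¬?)
  open import Relation.Binary.PropositionalEquality hiding ([_])
  open Model
  open Sequence
  open Zp
  open Local
  open Hasse using (sumBelow; Mult; none; simple; double; hasse)

  split-off : ∀ {A : Set} {xs ys : List A} → Unique xs → (∀ {z} → z ∈ xs → z ∈ ys) → ∃ λ zs → ys ↭ xs ++ zs
  split-off {xs = []} {ys} _ _ = ys , ↭-refl
  split-off {xs = x ∷ xs} {ys} (x∉ ∷ u) sub = go (MemP.∈-∃++ (sub (here refl)))
    where
    go : (∃₂ λ us vs → ys ≡ us ++ x ∷ vs) → ∃ λ zs → ys ↭ x ∷ xs ++ zs
    go (us , vs , refl) = let (zs , h) = split-off u rest in zs , ↭-trans (PermP.shift x us vs) (prep x h)
      where
      rest : ∀ {z} → z ∈ xs → z ∈ us ++ vs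
      rest {z} z∈ = [ MemP.∈-++⁺ˡ , (λ { (here e) → ⊥-elim (All.lookup x∉ z∈ (sym e)) ; (there h) → MemP.∈-++⁺ʳ us h }) ]′ (MemP.∈-++⁻ us (sub (there z∈)))

  unique-length : ∀ {A : Set} {xs ys : List A} → Unique xs → (∀ {z} → z ∈ xs → z ∈ ys) → length xs ℕ.≤ length ys
  unique-length {xs = xs} u sub = let (zs , h) = split-off u sub in
    ℕP.≤-trans (ℕP.m≤m+n (length xs) (length zs)) (ℕP.≤-reflexive (sym (trans (PermP.↭-length h) (ListP.length-++ xs))))

  private
    sum-upTo : ∀ s n → sum (map s (upTo n)) ≡ sumBelow s n
    sum-upTo s zero = refl
    sum-upTo s (suc n) = trans (cong (λ l → sum (map s l)) (sym (ListP.upTo-∷ʳ n))) (trans (cong sum (ListP.map-++ s (upTo n) (n ∷ [])))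
      (trans (sum-++ (map s (upTo n)) (s n ∷ [])) (cong₂ ℕ._+_ (sum-upTo s n) (ℕP.+-identityʳ (s n)))))

    filter-length-mono : ∀ {A : Set} {P Q : A → Set} (P? : ∀ x → Dec (P x)) (Q? : ∀ x → Dec (Q x)) → (∀ {x} → P x → Q x) → ∀ xs →
      length (filter P? xs) ℕ.≤ length (filter Q? xs)
    filter-length-mono P? Q? h [] = z≤n
    filter-length-mono P? Q? h (x ∷ xs) with P? x | Q? x
    ... | yes _ | yes _ = s≤s (filter-length-mono P? Q? h xs)
    ... | yes p | no nq = ⊥-elim (nq (h p))
    ... | no _ | yes _ = ℕP.m≤n⇒m≤1+n (filter-length-mono P? Q? h xs)
    ... | no _ | no _ = filter-length-mono P? Q? h xs

    filter-map-length : ∀ {A B : Set} {P : B → Set} (P? : ∀ x → Dec (P x)) (f : A → B) xs → length (filter P? (map f xs)) ≡ length (filter (λ x → P? (f x)) xs)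
    filter-map-length P? f [] = refl
    filter-map-length P? f (x ∷ xs) with P? (f x)
    ... | yes _ = cong suc (filter-map-length P? f xs)
    ... | no _ = filter-map-length P? f xs

    product-count : ∀ {A B : Set} {P Q : A × B → Set} (P? : ∀ x → Dec (P x)) (Q? : ∀ x → Dec (Q x)) → (∀ {x} → P x → Q x) → ∀ xs ys →
      length (filter P? (cartesianProduct xs ys)) ℕ.≤ sum (map (λ x → length (filter (λ y → Q? (x , y)) ys)) xs)
    product-count P? Q? h [] ys = z≤n
    product-count P? Q? h (x ∷ xs) ys = ℕP.≤-trans (ℕP.≤-reflexive (trans (cong length (ListP.filter-++ P? (map (x ,_) ys) (cartesianProduct xs ys))) (ListP.length-++ (filter P? (map (x ,_) ys)))))
      (ℕP.+-mono-≤ (ℕP.≤-trans (ℕP.≤-reflexive (filter-map-length P? (x ,_) ys)) (filter-length-mono (λ y → P? (x , y)) (λ y → Q? (x , y)) h ys)) (product-count P? Q? h xs ys))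

  module Points-mod (E : Curve) (p : ℕ) (pp : Prime p) where
    open Invariants E
    open Field p pp

    Fz Fxz Fyz : ℤ → ℤ → ℤ
    Fz x y = y * y + a1 * x * y + a3 * y - x * x * x - a2 * x * x - a4 * x - a6
    Fxz x y = a1 * y - + 3 * x * x - + 2 * a2 * x - a4
    Fyz x y = + 2 * y + a1 * x + a3

    private
      module S = Solver ℤring
      open S using (_:+_; _:*_; _:-_; :-_; _:=_; con; Expr)

      F-ι : ∀ x y → F (toW E) (ℤtoℚ x) (ℤtoℚ y) ≡ ℤtoℚ (Fz x y)
      F-ι x y = sym (hom-eval ((λ a1 a2 a3 a4 a6 x y → y :* y :+ a1 :* x :* y :+ a3 :* y :- x :* x :* x :- a2 :* x :* x :- a4 :* x :- a6) $ⁿ S.vars {7}) (a1 ∷ a2 ∷ a3 ∷ a4 ∷ a6 ∷ x ∷ y ∷ []))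

      Fx-ι : ∀ x y → Fx (toW E) (ℤtoℚ x) (ℤtoℚ y) ≡ ℤtoℚ (Fxz x y)
      Fx-ι x y = sym (hom-eval ((λ a1 a2 a4 x y → a1 :* y :- con (+ 3) :* x :* x :- con (+ 2) :* a2 :* x :- a4) $ⁿ S.vars {5}) (a1 ∷ a2 ∷ a4 ∷ x ∷ y ∷ []))

      Fy-ι : ∀ x y → Fy (toW E) (ℤtoℚ x) (ℤtoℚ y) ≡ ℤtoℚ (Fyz x y)
      Fy-ι x y = sym (hom-eval ((λ a1 a3 x y → con (+ 2) :* y :+ a1 :* x :+ a3) $ⁿ S.vars {4}) (a1 ∷ a3 ∷ x ∷ y ∷ []))

    PDiv⇒ : ∀ {q z} → q ≡ ℤtoℚ z → PDiv p q → z ≡0[ p ]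
    PDiv⇒ {q} {z} refl h = ∣⇒≡0 (subst (λ w → p ℕD.∣ ∣ w ∣) (numerator-ℤ z) h)

    ⇒PDiv : ∀ {q z} → q ≡ ℤtoℚ z → z ≡0[ p ] → PDiv p q
    ⇒PDiv {q} {z} refl h = subst (λ w → p ℕD.∣ ∣ w ∣) (sym (numerator-ℤ z)) (≡0⇒∣ h)

    Smooth : ℕ × ℕ → Set
    Smooth xy = Fz (+ proj₁ xy) (+ proj₂ xy) ≡0[ p ] × ¬ (Fxz (+ proj₁ xy) (+ proj₂ xy) ≡0[ p ] × Fyz (+ proj₁ xy) (+ proj₂ xy) ≡0[ p ])

    Smooth? : ∀ xy → Dec (Smooth xy)
    Smooth? (x , y) = ≡0? p (Fz (+ x) (+ y)) ×-dec ¬? (≡0? p (Fxz (+ x) (+ y)) ×-dec ≡0? p (Fyz (+ x) (+ y)))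

    smooth-points : List (ℕ × ℕ)
    smooth-points = filter Smooth? (cartesianProduct (upTo p) (upTo p))

    NsCount-smooth : NsCount E p ≡ suc (length smooth-points)
    NsCount-smooth = cong (suc ∘ length) (ListP.filter-≐ ok? Smooth?
        ((λ { {x , y} (h , n) → PDiv⇒ (F-ι (+ x) (+ y)) h , λ (k , l) → n (⇒PDiv (Fx-ι (+ x) (+ y)) k , ⇒PDiv (Fy-ι (+ x) (+ y)) l) }) ,
         (λ { {x , y} (h , n) → ⇒PDiv (F-ι (+ x) (+ y)) h , λ (k , l) → n (PDiv⇒ (Fx-ι (+ x) (+ y)) k , PDiv⇒ (Fy-ι (+ x) (+ y)) l) }))
        (cartesianProduct (upTo p) (upTo p)))
      where
      ok? : (xy : ℕ × ℕ) → Dec (PDiv p (F (toW E) (ℕtoℚ (proj₁ xy)) (ℕtoℚ (proj₂ xy))) ×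
        ¬ (PDiv p (Fx (toW E) (ℕtoℚ (proj₁ xy)) (ℕtoℚ (proj₂ xy))) × PDiv p (Fy (toW E) (ℕtoℚ (proj₁ xy)) (ℕtoℚ (proj₂ xy)))))
      ok? (x , y) = PDiv? p (F (toW E) (ℕtoℚ x) (ℕtoℚ y))
             ×-dec ¬? (PDiv? p (Fx (toW E) (ℕtoℚ x) (ℕtoℚ y)) ×-dec PDiv? p (Fy (toW E) (ℕtoℚ x) (ℕtoℚ y)))

    fibre : ℕ → List ℕ
    fibre c = filter (λ y → ≡0? p (Fz (+ c) (+ y))) (upTo p)

    count : ℕ → ℕ
    count c = length (fibre c)

    NsCount≤ : NsCount E p ℕ.≤ suc (sumBelow count p)
    NsCount≤ = subst₂ ℕ._≤_ (sym NsCount-smooth) (cong suc (sum-upTo count p))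
      (s≤s (product-count Smooth? (λ xy → ≡0? p (Fz (+ proj₁ xy) (+ proj₂ xy))) proj₁ (upTo p) (upTo p)))

    residue-unique : ∀ {x y} → x ℕ.< p → y ℕ.< p → (+ x - + y) ≡0[ p ] → x ≡ y
    residue-unique {x} {y} x<p y<p h = [ (λ x≤y → ordered x≤y y<p (subst (_≡0[ p ]) (S.solve (+ x ∷ + y ∷ []) (λ x y → (:- con (+ 1)) :* (x :- y) := y :- x) refl) (≡0-* (- 1ℤ) h))) ,
        (λ y≤x → sym (ordered y≤x x<p h)) ]′ (ℕP.≤-total x y)
      where
      ordered : ∀ {x y} → x ℕ.≤ y → y ℕ.< p → (+ y - + x) ≡0[ p ] → x ≡ y
      ordered {x} {y} x≤y y<p h with y ℕ.∸ x in e | subst (_≡0[ p ]) (trans (ℤP.m-n≡m⊖n y x) (ℤP.⊖-≥ x≤y)) h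
      ... | zero | _ = ℕP.≤-antisym x≤y (ℕP.m∸n≡0⇒m≤n e)
      ... | suc d | k = ⊥-elim (ℕP.<⇒≱ (ℕP.≤-<-trans (ℕP.≤-reflexive (sym e)) (ℕP.≤-<-trans (ℕP.m∸n≤m y x) y<p)) (ℕD.∣⇒≤ (≡0⇒∣ k)))

    private
      opposite : ∀ c y z → Fz c y ≡0[ p ] → Fz c z ≡0[ p ] → (y - z) ≡0[ p ] ⊎ (y + z + a1 * c + a3) ≡0[ p ]
      opposite c y z hy hz = ≡0-prime (y - z) (y + z + a1 * c + a3) (subst (_≡0[ p ])
        (S.solve (a1 ∷ a2 ∷ a3 ∷ a4 ∷ a6 ∷ c ∷ y ∷ z ∷ []) (λ a1 a2 a3 a4 a6 c y z →
          let f = λ y → y :* y :+ a1 :* c :* y :+ a3 :* y :- c :* c :* c :- a2 :* c :* c :- a4 :* c :- a6 in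
          f y :+ (:- con (+ 1)) :* f z := (y :- z) :* (y :+ z :+ a1 :* c :+ a3)) refl)
        (≡0-+ hy (≡0-* (- 1ℤ) hz)))

      fibre-unique : ∀ c → Unique (fibre c)
      fibre-unique c = UniqueP.filter⁺ (λ y → ≡0? p (Fz (+ c) (+ y))) (UniqueP.upTo⁺ p)

      fibre-∈ : ∀ c {y} → y ∈ fibre c → y ℕ.< p × Fz (+ c) (+ y) ≡0[ p ]
      fibre-∈ c h = let (a , b) = MemP.∈-filter⁻ (λ y → ≡0? p (Fz (+ c) (+ y))) {xs = upTo p} h in MemP.∈-upTo⁻ a , b

    data Fibre (c : ℕ) : ℕ → Set where
      empty : Fibre c 0
      one : ∀ y → Fz (+ c) (+ y) ≡0[ p ] → Fibre c 1
      two : ∀ y z → y ℕ.< p → z ℕ.< p → y ≢ z → Fz (+ c) (+ y) ≡0[ p ] → Fz (+ c) (+ z) ≡0[ p ] → Fibre c 2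

    -- Distinct ordinates over c add up to -(a1 c + a3), so a third ordinate would equal the second.
    fibre-count : ∀ c → Fibre c (count c)
    fibre-count c = go (fibre c) (fibre-unique c) (fibre-∈ c)
      where
      go : ∀ l → Unique l → (∀ {y} → y ∈ l → y ℕ.< p × Fz (+ c) (+ y) ≡0[ p ]) → Fibre c (length l)
      go [] _ _ = empty
      go (y ∷ []) _ h = one y (proj₂ (h (here refl)))
      go (y ∷ z ∷ []) ((y≢z ∷ []) ∷ _) h = two y z (proj₁ (h (here refl))) (proj₁ (h (there (here refl)))) y≢z (proj₂ (h (here refl))) (proj₂ (h (there (here refl))))
      go (y ∷ z ∷ w ∷ _) ((y≢z ∷ y≢w ∷ _) ∷ (z≢w ∷ _) ∷ _) h = ⊥-elim (z≢w (residue-unique (proj₁ hz) (proj₁ hw)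
          (subst (_≡0[ p ]) (S.solve (+ y ∷ + z ∷ + w ∷ a1 * + c ∷ a3 ∷ []) (λ y z w u v → (y :+ z :+ u :+ v) :+ (:- con (+ 1)) :* (y :+ w :+ u :+ v) := z :- w) refl)
            (≡0-+ (sum-zero z y≢z hz) (≡0-* (- 1ℤ) (sum-zero w y≢w hw))))))
        where
        hy = h (here refl)
        hz = h (there (here refl))
        hw = h (there (there (here refl)))
        sum-zero : ∀ z → y ≢ z → z ℕ.< p × Fz (+ c) (+ z) ≡0[ p ] → (+ y + + z + a1 * + c + a3) ≡0[ p ]
        sum-zero z y≢z (z<p , fz) = [ (λ k → ⊥-elim (y≢z (residue-unique (proj₁ hy) z<p k))) , (λ k → k) ]′ (opposite (+ c) (+ y) (+ z) (proj₂ hy) fz)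

    count≤2 : ∀ c → count c ℕ.≤ 2
    count≤2 c with count c | fibre-count c
    ... | _ | empty = z≤n
    ... | _ | one _ _ = s≤s z≤n
    ... | _ | two _ _ _ _ _ _ _ = ℕP.≤-refl

    count≤1 : ∀ c y₀ → Fz (+ c) y₀ ≡0[ p ] → Fyz (+ c) y₀ ≡0[ p ] → count c ℕ.≤ 1
    count≤1 c y₀ hF hFy with count c | fibre-count c
    ... | _ | empty = z≤n
    ... | _ | one _ _ = s≤s z≤n
    ... | _ | two y z y<p z<p y≢z fy fz = ⊥-elim (y≢z (residue-unique y<p z<p (subst (_≡0[ p ]) (S.solve (+ y ∷ + z ∷ y₀ ∷ []) (λ y z w → (y :- w) :+ (:- con (+ 1)) :* (z :- w) := y :- z) refl)
          (≡0-+ (only y fy) (≡0-* (- 1ℤ) (only z fz))))))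
      where
      only : ∀ y → Fz (+ c) (+ y) ≡0[ p ] → (+ y - y₀) ≡0[ p ]
      only y fy = [ (λ k → k) , (λ k → subst (_≡0[ p ]) (S.solve (+ y ∷ y₀ ∷ a1 * + c ∷ a3 ∷ []) (λ y w u v → (y :+ w :+ u :+ v) :+ (:- con (+ 1)) :* (con (+ 2) :* w :+ u :+ v) := y :- w) refl) (≡0-+ k (≡0-* (- 1ℤ) hFy))) ]′
        (opposite (+ c) (+ y) y₀ fy hF)

    sumBelow≤ : ∀ (s : ℕ → ℕ) n → (∀ c → s c ℕ.≤ 2) → sumBelow s n ℕ.≤ n ℕ.* 2
    sumBelow≤ s zero h = z≤n
    sumBelow≤ s (suc n) h = ℕP.≤-trans (ℕP.+-mono-≤ (sumBelow≤ s n h) (h n)) (ℕP.≤-reflexive (ℕP.+-comm (n ℕ.* 2) 2))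

    sumBelow< : ∀ (s : ℕ → ℕ) n → (∀ c → s c ℕ.≤ 2) → ∀ c → c ℕ.< n → s c ℕ.≤ 1 → suc (sumBelow s n) ℕ.≤ n ℕ.* 2
    sumBelow< s (suc n) h c (s≤s c≤n) k with c ℕ.≟ n
    ... | yes refl = ℕP.≤-trans (s≤s (ℕP.+-mono-≤ (sumBelow≤ s n h) k)) (ℕP.≤-reflexive (trans (cong suc (ℕP.+-comm (n ℕ.* 2) 1)) refl))
    ... | no c≢n = ℕP.≤-trans (ℕP.+-mono-≤ (sumBelow< s n h c (ℕP.≤∧≢⇒< c≤n c≢n) k) (h n)) (ℕP.≤-reflexive (ℕP.+-comm (n ℕ.* 2) 2))

    NsCount≤2p+1 : NsCount E p ℕ.≤ suc (p ℕ.* 2)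
    NsCount≤2p+1 = ℕP.≤-trans NsCount≤ (s≤s (sumBelow≤ count p count≤2))

    -- A vertical tangent leaves a single ordinate over c, one short of the two allowed. This one
    -- point makes the difference between 2p + 1 and 2p when the order of P modulo p is even.
    NsCount≤2p : ∀ c y₀ → c ℕ.< p → Fz (+ c) y₀ ≡0[ p ] → Fyz (+ c) y₀ ≡0[ p ] → NsCount E p ℕ.≤ p ℕ.* 2
    NsCount≤2p c y₀ c<p h k = ℕP.≤-trans NsCount≤ (sumBelow< count p count≤2 c c<p (count≤1 c y₀ h k))

    module _ (m : ℕ) (1≤m : 1 ℕ.≤ m) (p≡ : p ≡ suc (m ℕ.+ m)) where
      private
        rel : + 4 * β8 ≡ β2 * β6 - β4 * β4
        rel = LocAlg.b-relation ℤring a1 a2 a3 a4 a6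
        fv : ℤ → ℤ
        fv c = + 4 * c * c * c + β2 * c * c + + 2 * β4 * c + β6
        η : ℕ → ℕ → ℤ
        η c y = Fyz (+ c) (+ y)

        square : ∀ c y → Fz (+ c) (+ y) ≡0[ p ] → (fv (+ c) - η c y * η c y) ≡0[ p ]
        square c y h = subst (_≡0[ p ]) (S.solve (a1 ∷ a2 ∷ a3 ∷ a4 ∷ a6 ∷ + c ∷ + y ∷ []) (λ a1 a2 a3 a4 a6 c y →
            let b2 = a1 :* a1 :+ con (+ 4) :* a2
                b4 = con (+ 2) :* a4 :+ a1 :* a3
                b6 = a3 :* a3 :+ con (+ 4) :* a6
                e = con (+ 2) :* y :+ a1 :* c :+ a3 in
            (:- con (+ 4)) :* (y :* y :+ a1 :* c :* y :+ a3 :* y :- c :* c :* c :- a2 :* c :* c :- a4 :* c :- a6) :=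
            (con (+ 4) :* c :* c :* c :+ b2 :* c :* c :+ con (+ 2) :* b4 :* c :+ b6) :- e :* e) refl) (≡0-* (- + 4) h)

        2<p : 2 ℕ.< p
        2<p = subst (2 ℕ.<_) (sym p≡) (s≤s (ℕP.+-mono-≤ 1≤m 1≤m))

        to-mult : ∀ {c k} → Fibre c k → Mult p pp m 1≤m p≡ β2 β4 β6 β8 rel (+ c) k
        to-mult empty = none
        to-mult {c} (one y h) = simple (η c y) (square c y h)
        to-mult {c} (two y z y<p z<p y≢z hy hz) = double (η c y) (square c y hy) nonzero
          where
          nonzero : ¬ ((η c y - 0ℤ) ≡0[ p ])
          nonzero h = y≢z (residue-unique y<p z<p ([ (λ k → ⊥-elim (ℕP.<⇒≱ 2<p (ℕD.∣⇒≤ (≡0⇒∣ k)))) , (λ k → k) ]′ (≡0-prime (+ 2) (+ y - + z)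
              (subst (_≡0[ p ]) (S.solve (+ y ∷ + z ∷ a1 * + c ∷ a3 ∷ []) (λ y z u v → (con (+ 2) :* y :+ u :+ v) :+ (:- con (+ 1)) :* (con (+ 2) :* z :+ u :+ v) := con (+ 2) :* (y :- z)) refl)
                (≡0-+ h′ (≡0-* (- 1ℤ) ηz))))))
            where
            h′ : η c y ≡0[ p ]
            h′ = ~⇒≡0 h
            ηz : η c z ≡0[ p ]
            ηz = [ (λ k → k) , (λ k → k) ]′ (≡0-prime (η c z) (η c z) (subst (_≡0[ p ])
              (S.solve (fv (+ c) ∷ η c y ∷ η c z ∷ []) (λ f y z → ((f :- y :* y) :+ y :* y) :+ (:- con (+ 1)) :* (f :- z :* z) := z :* z) refl)
              (≡0-+ (≡0-+ (square c y hy) (≡0-* (η c y) h′)) (≡0-* (- 1ℤ) (square c z hz)))))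

      hasse-count : ∀ a → sumBelow count p ≡ p ℕ.+ a → a ℕ.* a ℕ.≤ 4 ℕ.* p
      hasse-count = hasse p pp m 1≤m p≡ β2 β4 β6 β8 rel count (λ c _ → to-mult (fibre-count c))

-- The rank of apparition against the number of points

module Orders where
  open import Defs
  open import Data.Integer using (+_; _+_; _*_; _-_; -_)
  open import Data.List using ([]; _∷_; length)
  open import Data.Vec using ([]; _∷_)
  open import Relation.Binary.PropositionalEquality hiding ([_])
  open Model
  open Sequence
  open Zp
  open Local
  open Count

  module Orders-mod (E : Curve) (seq : EllSeq E) (p : ℕ) (pp : Prime p) where
    open Invariants E
    open EllSeq seq
    open Field p pp
    open Points-mod E p pp
    open Reduction E seq p pp
    private
      module A′ = Affine (ZMod p)
      module L = LocAlg (ZMod p)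
      module S = Solver ℤring
      open S using (_:+_; _:*_; _:-_; :-_; _:=_; con; Expr)
      open CommutativeRing (ZMod p) using (_≈_)
      instance
        p≢0 : ℕ.NonZero p
        p≢0 = prime⇒nonZero pp

    unit-cancel : ∀ x y → ¬ (x ≡0[ p ]) → x * y ≡0[ p ] → y ≡0[ p ]
    unit-cancel x y n h = [ (λ k → ⊥-elim (n k)) , (λ k → k) ]′ (≡0-prime x y h)

    transport : ∀ x y → x ≈ y → y ≡0[ p ] → x ≡0[ p ]
    transport x y h k = subst (_≡0[ p ]) (S.solve (x ∷ y ∷ []) (λ x y → (x :- y) :+ y := x) refl) (≡0-+ h k)

    transport⁻ : ∀ x y → x ≈ y → x ≡0[ p ] → y ≡0[ p ]
    transport⁻ x y h k = subst (_≡0[ p ]) (S.solve (x ∷ y ∷ []) (λ x y → (:- con (+ 1)) :* (x :- y) :+ x := y) refl) (≡0-+ (≡0-* (- 1ℤ) h) k)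

    residue : ∀ z → ∃ λ m → m ℕ.< p × z ≈ + m
    residue z = z ℤM.%ℕ p , ℤM.n%ℕd<d z p , z ℤM./ℕ p ,
      trans (cong (_- + (z ℤM.%ℕ p)) (ℤM.a≡a%ℕn+[a/ℕn]*n z p)) (S.solve (+ (z ℤM.%ℕ p) ∷ z ℤM./ℕ p ∷ + p ∷ []) (λ m q p → (m :+ q :* p) :- m := q :* p) refl)

    record Coordinates (n : ℕ) : Set where
      field
        X Y Y⁻ : ℕ
        X<p : X ℕ.< p
        Y<p : Y ℕ.< p
        Y⁻<p : Y⁻ ℕ.< p
        A≈ : A n ≈ + X * (+ D n * + D n)
        C≈ : C n ≈ + Y * (+ D n * + D n * + D n)
        Y⁻≈ : (- + Y - a1 * + X - a3) ≈ + Y⁻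

    coordinates : ∀ n → ¬ (p ℕD.∣ D n) → Coordinates n
    coordinates n h = record { X = proj₁ x ; Y = proj₁ y ; Y⁻ = proj₁ ȳ ; X<p = proj₁ (proj₂ x) ; Y<p = proj₁ (proj₂ y) ; Y⁻<p = proj₁ (proj₂ ȳ)
      ; A≈ = proj₁ both ; C≈ = proj₂ both ; Y⁻≈ = proj₂ (proj₂ ȳ) }
      where
      iv = inverse (+ D n) (λ k → h (≡0⇒∣ k))
      w = proj₁ iv
      x = residue (A n * (w * w))
      y = residue (C n * (w * w * w))
      ȳ = residue (- + proj₁ y - a1 * + proj₁ x - a3)
      both = A′.from-inverse {w} {+ D n} {A n} {C n} {+ proj₁ x} {+ proj₁ y} (proj₂ iv) (proj₂ (proj₂ x)) (proj₂ (proj₂ y))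

    affine-on-curve : ∀ n (1≤n : 1 ℕ.≤ n) (p∤D : ¬ (p ℕD.∣ D n)) → Fz (+ Coordinates.X (coordinates n p∤D)) (+ Coordinates.Y (coordinates n p∤D)) ≡0[ p ]
    affine-on-curve n 1≤n p∤D = unit-d³ _ (unit-d³ _ (~⇒≡0 (A′.affine-F {a1} {a2} {a3} {a4} {a6} {+ X} {+ Y} {A n} {C n} {+ D n} A≈ C≈ (≡⇒~ p (equation n 1≤n)))))
      where
      open Coordinates (coordinates n p∤D)
      unit-d : ∀ {y} → + D n * y ≡0[ p ] → y ≡0[ p ]
      unit-d {y} = unit-cancel (+ D n) y (λ k → p∤D (≡0⇒∣ k))
      unit-d³ : ∀ y → + D n * + D n * + D n * y ≡0[ p ] → y ≡0[ p ]
      unit-d³ y h = unit-d {y} (unit-d {+ D n * y} (unit-d {+ D n * (+ D n * y)} (subst (_≡0[ p ]) (S.solve (+ D n ∷ y ∷ []) (λ d y → d :* d :* d :* y := d :* (d :* (d :* y))) refl) h)))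

    module _ (ns : Nonsingular) {n : ℕ} (1≤n : 1 ℕ.≤ n) (p∤D : ¬ (p ℕD.∣ D n)) where
      open Coordinates (coordinates n p∤D) public
      private
        d = + D n
        unit-d : ∀ {y} → d * y ≡0[ p ] → y ≡0[ p ]
        unit-d {y} = unit-cancel d y (λ k → p∤D (≡0⇒∣ k))
        unit-d³ : ∀ y → d * d * d * y ≡0[ p ] → y ≡0[ p ]
        unit-d³ y h = unit-d {y} (unit-d {d * y} (unit-d {d * (d * y)} (subst (_≡0[ p ]) (S.solve (d ∷ y ∷ []) (λ d y → d :* d :* d :* y := d :* (d :* (d :* y))) refl) h)))
        eqn = ≡⇒~ p (equation n 1≤n)
        fyₕ = + 2 * C n + a1 * A n * d + a3 * (d * d * d)
        fxₕ = a1 * C n * d - + 3 * A n * A n - + 2 * a2 * A n * (d * d) - a4 * (d * d * d * d)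
        fy = Fyz (+ X) (+ Y)
        fx = Fxz (+ X) (+ Y)
        cr = relate {n} {n} {n ℕ.+ n} {0} (sym (ℕP.+-identityʳ n)) refl
        c = proj₁ cr
        c≢0 = ns {n} {n} {n ℕ.+ n} {0} {c} (sym (ℕP.+-identityʳ n)) refl (proj₂ cr)
        S₂ = Fℤ.Sₕ β2 β4 β6 (A n) (B n) (A n) (B n)
        Π₂ = Fℤ.Πₕ β4 β6 β8 (A n) (B n) (A n) (B n)
        S≡ : S₂ ≡ c * B (n ℕ.+ n)
        S≡ = trans (Relation.r₂ (proj₂ cr)) (trans (cong₂ (λ a d → c * (A (n ℕ.+ n) * (+ d * + d) + a * B (n ℕ.+ n))) A₀ D₀)
          (S.solve (c ∷ A (n ℕ.+ n) ∷ B (n ℕ.+ n) ∷ []) (λ c a b → c :* (a :* con (+ 0) :+ con (+ 1) :* b) := c :* b) refl))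
        Π≡ : Π₂ ≡ c * A (n ℕ.+ n)
        Π≡ = trans (Relation.r₃ (proj₂ cr)) (cong (c *_) (trans (cong (A (n ℕ.+ n) *_) A₀) (ℤP.*-identityʳ (A (n ℕ.+ n)))))
        S≈ : S₂ ≈ (d * d) * (fyₕ * fyₕ)
        S≈ = L.diagonal-Fy {a1} {a2} {a3} {a4} {a6} {A n} {C n} {d} eqn
        Π≈ : Π₂ ≈ fxₕ * fxₕ - a1 * fxₕ * fyₕ * d - (a2 * d * d + + 2 * A n) * fyₕ * fyₕ
        Π≈ = L.diagonal-Fx {a1} {a2} {a3} {a4} {a6} {A n} {C n} {d} eqn
        fy≈ : fyₕ ≈ (d * d * d) * fy
        fy≈ = A′.affine-Fy {a1} {a2} {a3} {a4} {a6} {+ X} {+ Y} {A n} {C n} {d} A≈ C≈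
        fx≈ : fxₕ ≈ (d * d * d * d) * fx
        fx≈ = A′.affine-Fx {a1} {a2} {a3} {a4} {a6} {+ X} {+ Y} {A n} {C n} {d} A≈ C≈

      on-curve : Fz (+ X) (+ Y) ≡0[ p ]
      on-curve = affine-on-curve n 1≤n p∤D

      -- For a = b = n the relation is S = c B(2n) with c a unit, while on the diagonal S = (d Fy)².
      vertical⇒2n : fy ≡0[ p ] → p ℕD.∣ D (n ℕ.+ n)
      vertical⇒2n h = p∣B⇒D (unit-cancel c (B (n ℕ.+ n)) c≢0 (subst (_≡0[ p ]) S≡ (transport S₂ ((d * d) * (fyₕ * fyₕ)) S≈ (≡0-* (d * d) (≡0-* fyₕ (transport fyₕ (d * d * d * fy) fy≈ (≡0-* (d * d * d) h)))))))

      2n⇒vertical : p ℕD.∣ D (n ℕ.+ n) → fy ≡0[ p ]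
      2n⇒vertical h = unit-d³ fy (transport⁻ fyₕ (d * d * d * fy) fy≈ (≡0-square fyₕ (unit-d (unit-d (subst (_≡0[ p ]) (ℤP.*-assoc d d (fyₕ * fyₕ))
        (transport⁻ S₂ ((d * d) * (fyₕ * fyₕ)) S≈ (subst (_≡0[ p ]) (sym S≡) (≡0-* c (p∣D⇒B h)))))))))

      -- If both derivatives vanished, so would the diagonal S and Π, and p would divide both A and
      -- B at index 2n.
      nonsingular-point : ¬ (fx ≡0[ p ] × fy ≡0[ p ])
      nonsingular-point (hx , hy) = not-both (n ℕ.+ n) (unit-cancel c (A (n ℕ.+ n)) c≢0 (subst (_≡0[ p ]) Π≡ (transport Π₂ _ Π≈
          (subst (_≡0[ p ]) (S.solve (fxₕ ∷ fyₕ ∷ a1 ∷ d ∷ a2 ∷ A n ∷ []) (λ x y a1 d a2 a → (x :- a1 :* y :* d) :* x :+ (:- ((a2 :* d :* d :+ con (+ 2) :* a) :* y)) :* y :=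
              x :* x :- a1 :* x :* y :* d :- (a2 :* d :* d :+ con (+ 2) :* a) :* y :* y) refl)
            (≡0-+ (≡0-* (fxₕ - a1 * fyₕ * d) fxₕ≡0) (≡0-* (- ((a2 * d * d + + 2 * A n) * fyₕ)) fyₕ≡0)))))) (p∣D⇒B (vertical⇒2n hy))
        where
        fxₕ≡0 = transport fxₕ (d * d * d * d * fx) fx≈ (≡0-* (d * d * d * d) hx)
        fyₕ≡0 = transport fyₕ (d * d * d * fy) fy≈ (≡0-* (d * d * d) hy)

      smooth⁺ : Smooth (X , Y)
      smooth⁺ = on-curve , nonsingular-point

      private
        y⁻ = - + Y - a1 * + X - a3

      smooth⁻ : Smooth (X , Y⁻)
      smooth⁻ = transport⁻ (Fz (+ X) y⁻) (Fz (+ X) (+ Y⁻)) F-diff (subst (_≡0[ p ]) (S.solve (a1 ∷ a2 ∷ a3 ∷ a4 ∷ a6 ∷ + X ∷ + Y ∷ []) (λ a1 a2 a3 a4 a6 x y →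
            let f = λ y → y :* y :+ a1 :* x :* y :+ a3 :* y :- x :* x :* x :- a2 :* x :* x :- a4 :* x :- a6 in f y := f (:- y :- a1 :* x :- a3)) refl) on-curve) ,
          λ (hx , hy) → let ky = fy-zero hy in nonsingular-point (fx-zero hx ky , ky)
        where
        F-diff : Fz (+ X) y⁻ ≈ Fz (+ X) (+ Y⁻)
        F-diff = subst (_≡0[ p ]) (S.solve (a1 ∷ a2 ∷ a3 ∷ a4 ∷ a6 ∷ + X ∷ y⁻ ∷ + Y⁻ ∷ []) (λ a1 a2 a3 a4 a6 x y z →
            let f = λ y → y :* y :+ a1 :* x :* y :+ a3 :* y :- x :* x :* x :- a2 :* x :* x :- a4 :* x :- a6 in (y :- z) :* (y :+ z :+ a1 :* x :+ a3) := f y :- f z) refl) (≡0-*ˡ (y⁻ + + Y⁻ + a1 * + X + a3) Y⁻≈)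
        fy-zero : Fyz (+ X) (+ Y⁻) ≡0[ p ] → fy ≡0[ p ]
        fy-zero h = subst (_≡0[ p ]) (S.solve (a1 ∷ a3 ∷ + X ∷ + Y ∷ + Y⁻ ∷ []) (λ a1 a3 x y z →
            (:- con (+ 2)) :* (:- y :- a1 :* x :- a3 :- z) :+ (:- con (+ 1)) :* (con (+ 2) :* z :+ a1 :* x :+ a3) := con (+ 2) :* y :+ a1 :* x :+ a3) refl)
          (≡0-+ (≡0-* (- + 2) Y⁻≈) (≡0-* (- 1ℤ) h))
        fx-zero : Fxz (+ X) (+ Y⁻) ≡0[ p ] → fy ≡0[ p ] → fx ≡0[ p ]
        fx-zero h k = subst (_≡0[ p ]) (S.solve (a1 ∷ a2 ∷ a3 ∷ a4 ∷ + X ∷ + Y ∷ + Y⁻ ∷ []) (λ a1 a2 a3 a4 x y z →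
            (con (+ 1) :* (a1 :* z :- con (+ 3) :* x :* x :- con (+ 2) :* a2 :* x :- a4) :+ a1 :* (:- y :- a1 :* x :- a3 :- z)) :+ a1 :* (con (+ 2) :* y :+ a1 :* x :+ a3) :=
            a1 :* y :- con (+ 3) :* x :* x :- con (+ 2) :* a2 :* x :- a4) refl)
          (≡0-+ (≡0-+ (≡0-* 1ℤ h) (≡0-* a1 Y⁻≈)) (≡0-* a1 k))

      self-opposite⇒2n : Y ≡ Y⁻ → p ℕD.∣ D (n ℕ.+ n)
      self-opposite⇒2n e = vertical⇒2n (subst (_≡0[ p ]) (S.solve (a1 ∷ a3 ∷ + X ∷ + Y ∷ []) (λ a1 a3 x y →
        (:- con (+ 1)) :* (:- y :- a1 :* x :- a3 :- y) := con (+ 2) :* y :+ a1 :* x :+ a3) refl) (≡0-* (- 1ℤ) (subst (λ z → y⁻ ≈ + z) (sym e) Y⁻≈)))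

    module _ (ns : Nonsingular) where

      even-count : ∀ n → 1 ℕ.≤ n → ¬ (p ℕD.∣ D n) → p ℕD.∣ D (n ℕ.+ n) → NsCount E p ℕ.≤ p ℕ.* 2
      even-count n 1≤n h k = NsCount≤2p (X ns 1≤n h) (+ Y ns 1≤n h) (X<p ns 1≤n h) (on-curve ns 1≤n h) (2n⇒vertical ns 1≤n h k)

      module _ (r : ℕ) (minimal : ∀ k → 1 ℕ.≤ k → k ℕ.< r → ¬ (p ℕD.∣ D k)) where
        private
          Pos : ℕ → Set
          Pos i = 1 ℕ.≤ i × i ℕ.< r
          x̂ ŷ ŷ⁻ : ∀ {i} → Pos i → ℕ
          x̂ {i} (a , b) = X ns a (minimal i a b)
          ŷ {i} (a , b) = Y ns a (minimal i a b)
          ŷ⁻ {i} (a , b) = Y⁻ ns a (minimal i a b)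

          abscissae-< : ∀ {i j} (u : Pos i) (v : Pos j) → i ℕ.< j → i ℕ.+ j ℕ.< r → x̂ u ≢ x̂ v
          abscissae-< {i} {j} u@(a , b) v@(a′ , b′) i<j i+j<r e = [ minimal (j ℕ.+ i) (ℕP.≤-trans a′ (ℕP.m≤m+n j i)) (subst (ℕ._< r) (ℕP.+-comm i j) i+j<r) ,
              minimal (j ℕ.∸ i) (ℕP.m<n⇒0<n∸m i<j) (ℕP.≤-<-trans (ℕP.m∸n≤m j i) b′) ]′
            (same-x⇒ ns {j} {i} {j ℕ.+ i} {j ℕ.∸ i} (sym (ℕP.m+[n∸m]≡n (ℕP.<⇒≤ i<j))) refl
              (~⇒≡0 (A′.same-abscissa {+ x̂ v} {A j} {+ D j} {A i} {+ D i} (A≈ ns a′ (minimal j a′ b′))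
                (subst (λ t → A i ≈ + t * (+ D i * + D i)) e (A≈ ns a (minimal i a b))))))

          abscissae : ∀ {i j} (u : Pos i) (v : Pos j) → i ≢ j → i ℕ.+ j ℕ.< r → x̂ u ≢ x̂ v
          abscissae {i} {j} u v i≢j h e = [ (λ k → abscissae-< u v (ℕP.≤∧≢⇒< k i≢j) h e) ,
            (λ k → abscissae-< v u (ℕP.≤∧≢⇒< k (λ e → i≢j (sym e))) (subst (ℕ._< r) (ℕP.+-comm i j) h) (sym e)) ]′ (ℕP.≤-total i j)

          flip : ∀ {k} → Pos k → Pos (r ℕ.∸ k)
          flip {k} (a , b) = ℕP.m<n⇒0<n∸m b , ℕP.∸-monoʳ-< a (ℕP.<⇒≤ b)

          -- the reduction of [k]P, written as -[r-k]P when 2k > r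
          pt : ∀ {k} → Pos k → Dec (k ℕ.+ k ℕ.≤ r) → ℕ × ℕ
          pt u (yes _) = x̂ u , ŷ u
          pt u (no _) = x̂ (flip u) , ŷ⁻ (flip u)

          pt-smooth : ∀ {k} (u : Pos k) q → pt u q ∈ smooth-points
          pt-smooth {k} u@(a , b) (yes _) = MemP.∈-filter⁺ Smooth? (MemP.∈-cartesianProduct⁺ (MemP.∈-upTo⁺ (X<p ns a (minimal k a b))) (MemP.∈-upTo⁺ (Y<p ns a (minimal k a b)))) (smooth⁺ ns a (minimal k a b))
          pt-smooth {k} u (no _) = MemP.∈-filter⁺ Smooth? (MemP.∈-cartesianProduct⁺ (MemP.∈-upTo⁺ (X<p ns a (minimal _ a b))) (MemP.∈-upTo⁺ (Y⁻<p ns a (minimal _ a b)))) (smooth⁻ ns a (minimal _ a b))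
            where
            a = proj₁ (flip u)
            b = proj₂ (flip u)

          ∸-add : ∀ {k} → k ℕ.≤ r → (r ℕ.∸ k) ℕ.+ k ≡ r
          ∸-add h = ℕP.m∸n+n≡m h

          double-< : ∀ {k} → k ℕ.≤ r → r ℕ.< k ℕ.+ k → (r ℕ.∸ k) ℕ.+ (r ℕ.∸ k) ℕ.< r
          double-< {k} h l = ℕP.+-cancelʳ-< k _ _ (ℕP.<-≤-trans (ℕP.≤-<-trans (ℕP.≤-reflexive (trans (ℕP.+-assoc (r ℕ.∸ k) _ k) (trans (cong ((r ℕ.∸ k) ℕ.+_) (∸-add h)) (ℕP.+-comm (r ℕ.∸ k) r))))
            (ℕP.+-monoʳ-< r (ℕP.+-cancelʳ-< k (r ℕ.∸ k) k (ℕP.≤-<-trans (ℕP.≤-reflexive (∸-add h)) l)))) ℕP.≤-refl)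

          -- On one side of r/2, equal abscissas would put i + j or j - i, or their analogues for r
          -- - i and r - j, among the indices below r where p divides no D. On opposite sides they
          -- may agree if i + j = r; then equal ordinates would make [i]P its own opposite, so that
          -- p ∣ D(2i) with 2i < r.
          pt-injective : ∀ {i j} (u : Pos i) (v : Pos j) q q′ → i ℕ.< j → pt u q ≢ pt v q′
          pt-injective {i} {j} u v (yes a) (yes b) i<j e = abscissae u v (ℕP.<⇒≢ i<j) (ℕP.<-≤-trans (ℕP.+-monoˡ-< j i<j) b) (cong proj₁ e)
          pt-injective {i} {j} u v (no a) (yes b) i<j e = a (ℕP.≤-trans (ℕP.+-mono-≤ (ℕP.<⇒≤ i<j) (ℕP.<⇒≤ i<j)) b)
          pt-injective {i} {j} u v (no a) (no b) i<j e = abscissae (flip u) (flip v) (λ k → ℕP.<⇒≢ l (sym k))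
              (ℕP.<-trans (ℕP.+-monoʳ-< (r ℕ.∸ i) l) (double-< (ℕP.<⇒≤ (proj₂ u)) (ℕP.≰⇒> a))) (cong proj₁ e)
            where
            l : r ℕ.∸ j ℕ.< r ℕ.∸ i
            l = ℕP.∸-monoʳ-< i<j (ℕP.<⇒≤ (proj₂ v))
          pt-injective {i} {j} u v (yes a) (no b) i<j e = by (i ℕ.≟ r ℕ.∸ j)
            where
            by : Dec (i ≡ r ℕ.∸ j) → ⊥
            by (yes refl) = minimal _ (ℕP.≤-trans (proj₁ u) (ℕP.m≤m+n i i)) (double-< (ℕP.<⇒≤ (proj₂ v)) (ℕP.≰⇒> b))
              (self-opposite⇒2n ns (proj₁ u) (minimal i (proj₁ u) (proj₂ u)) (trans (cong proj₂ e) (cong ŷ⁻ {flip v} {u} (cong₂ _,_ (ℕP.≤-irrelevant _ _) (ℕP.<-irrelevant _ _)))))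
            by (no h) = abscissae u (flip v) h (subst (i ℕ.+ (r ℕ.∸ j) ℕ.<_) (trans (ℕP.+-comm j _) (∸-add (ℕP.<⇒≤ (proj₂ v)))) (ℕP.+-monoˡ-< (r ℕ.∸ j) i<j)) (cong proj₁ e)

          dec : ∀ k → Dec (k ℕ.+ k ℕ.≤ r)
          dec k = k ℕ.+ k ℕ.≤? r

          f : ∀ k → Dec (suc k ℕ.< r) → ℕ × ℕ
          f k (yes h) = pt {suc k} (s≤s z≤n , h) (dec (suc k))
          f k (no _) = 0 , 0

          g : ℕ → ℕ × ℕ
          g k = f k (suc k ℕ.<? r)

          f-injective : ∀ {i j} (q : Dec (suc i ℕ.< r)) (q′ : Dec (suc j ℕ.< r)) → i ℕ.< j → suc j ℕ.< r → f i q ≢ f j q′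
          f-injective {i} {j} (yes u) (yes v) i<j _ = pt-injective (s≤s z≤n , u) (s≤s z≤n , v) (dec (suc i)) (dec (suc j)) (s≤s i<j)
          f-injective (no n) _ i<j h _ = n (ℕP.<-trans (s≤s i<j) h)
          f-injective (yes _) (no n) _ h _ = n h

          f-smooth : ∀ {i} (q : Dec (suc i ℕ.< r)) → suc i ℕ.< r → f i q ∈ smooth-points
          f-smooth {i} (yes u) _ = pt-smooth (s≤s z≤n , u) (dec (suc i))
          f-smooth (no n) h = ⊥-elim (n h)

        bound-≤ : ∀ {i} → i ℕ.< ℕ.pred r → suc i ℕ.< r
        bound-≤ {i} h = ℕP.≤-trans (s≤s h) (ℕP.≤-reflexive (ℕP.suc-pred r {{ℕ.>-nonZero (ℕP.≤-trans (ℕP.≤-trans (s≤s z≤n) h) (ℕP.pred[n]≤n))}}))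

        -- The multiples with indices 1 to r - 1 have distinct smooth affine reductions; the point
        -- at infinity supplies the remaining one.
        rank≤NsCount : r ℕ.≤ NsCount E p
        rank≤NsCount = ℕP.≤-trans (ℕP.m≤n+m∸n r 1) (subst (suc (ℕ.pred r) ℕ.≤_) (sym NsCount-smooth) (s≤s
            (subst (ℕ._≤ length smooth-points) (ListP.length-applyUpTo g (ℕ.pred r))
              (unique-length (UniqueP.applyUpTo⁺₁ g (ℕ.pred r) (λ {i} {j} i<j j<n → f-injective (suc i ℕ.<? r) (suc j ℕ.<? r) i<j (bound-≤ j<n)))
                (λ z∈ → let (i , i<n , e) = MemP.∈-applyUpTo⁻ g z∈ in subst (_∈ smooth-points) (sym e) (f-smooth (suc i ℕ.<? r) (bound-≤ i<n)))))))

-- Nonsingular reduction from the hypothesis on P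

module Regularity where
  open import Defs
  open import Data.Integer using (+_; _+_; _*_; _-_; -_)
  open import Data.Rational as ℚ using (ℚ; ↧ₙ_)
  open import Data.Vec using ([]; _∷_)
  open import Relation.Binary.PropositionalEquality hiding ([_])
  open Model
  open Sequence
  open Zp
  open Local
  open Count
  open Orders
  open Dickson using (dickson)

  module Regularity-mod (E : Curve) (seq : EllSeq E) (x₀ y₀ : ℚ)
    (base-x : ↧ₙ x₀ ≡ EllSeq.D seq 1 ℕ.* EllSeq.D seq 1 × x₀ ℚ.* ℤtoℚ (+ EllSeq.D seq 1 * + EllSeq.D seq 1) ≡ ℤtoℚ (EllSeq.A seq 1))
    (base-y : y₀ ℚ.* ℤtoℚ (+ EllSeq.D seq 1 * + EllSeq.D seq 1 * + EllSeq.D seq 1) ≡ ℤtoℚ (EllSeq.C seq 1))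
    (p : ℕ) (pp : Prime p) where

    open Invariants E
    open EllSeq seq
    open Field p pp
    open Points-mod E p pp
    open Reduction E seq p pp
    open Orders-mod E seq p pp using (unit-cancel; transport; module Coordinates; coordinates; affine-on-curve)
    private
      module A′ = Affine (ZMod p)
      module Aℚ = Affine ℚring
      module L = LocAlg (ZMod p)
      module S = Solver ℤring
      open S using (_:+_; _:*_; _:-_; :-_; _:=_; con)
      ι = ℤtoℚ

      Δ-ι : Δ (toW E) ≡ ι Δℤ
      Δ-ι = sym (hom-eval ((λ a1 a2 a3 a4 a6 →
        let b2 = a1 :* a1 :+ con (+ 4) :* a2
            b4 = con (+ 2) :* a4 :+ a1 :* a3
            b6 = a3 :* a3 :+ con (+ 4) :* a6
            b8 = a1 :* a1 :* a6 :+ con (+ 4) :* a2 :* a6 :- a1 :* a3 :* a4 :+ a2 :* a3 :* a3 :- a4 :* a4 in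
        :- (b2 :* b2 :* b8) :- con (+ 8) :* b4 :* b4 :* b4 :- con (+ 27) :* b6 :* b6 :+ con (+ 9) :* b2 :* b4 :* b6) $ⁿ S.vars {5}) (a1 ∷ a2 ∷ a3 ∷ a4 ∷ a6 ∷ []))

      c₄-ι : c₄ (toW E) ≡ ι c₄ℤ
      c₄-ι = sym (hom-eval ((λ a1 a2 a3 a4 →
        let b2 = a1 :* a1 :+ con (+ 4) :* a2
            b4 = con (+ 2) :* a4 :+ a1 :* a3 in
        b2 :* b2 :- con (+ 24) :* b4) $ⁿ S.vars {4}) (a1 ∷ a2 ∷ a3 ∷ a4 ∷ []))

    bad⇒Δ : BadRed E p → Δℤ ≡0[ p ]
    bad⇒Δ = PDiv⇒ Δ-ι

    Δ⇒bad : Δℤ ≡0[ p ] → BadRed E p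
    Δ⇒bad = ⇒PDiv Δ-ι

    module _ (s : ℤ) (sing : L.Singular s β2 β4 β6 β8) (nsred : NsRed E p (aff x₀ y₀)) where
      private
        d = + D 1
        fyₕ fxₕ : ℤ
        fyₕ = + 2 * C 1 + a1 * A 1 * d + a3 * (d * d * d)
        fxₕ = a1 * C 1 * d - + 3 * A 1 * A 1 - + 2 * a2 * A 1 * (d * d) - a4 * (d * d * d * d)

        d²-ι : ι (d * d) ≡ ι d ℚ.* ι d
        d²-ι = hom-eval ((λ d → d :* d) $ⁿ S.vars {1}) (d ∷ [])
        d³-ι : ι (d * d * d) ≡ ι d ℚ.* ι d ℚ.* ι d
        d³-ι = hom-eval ((λ d → d :* d :* d) $ⁿ S.vars {1}) (d ∷ [])
        d⁴-ι : ι (d * d * d * d) ≡ ι d ℚ.* ι d ℚ.* ι d ℚ.* ι d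
        d⁴-ι = hom-eval ((λ d → d :* d :* d :* d) $ⁿ S.vars {1}) (d ∷ [])
        ha : ι (A 1) ≡ x₀ ℚ.* (ι d ℚ.* ι d)
        ha = trans (sym (proj₂ base-x)) (cong (x₀ ℚ.*_) d²-ι)
        hc : ι (C 1) ≡ y₀ ℚ.* (ι d ℚ.* ι d ℚ.* ι d)
        hc = trans (sym base-y) (cong (y₀ ℚ.*_) d³-ι)

        ℚ-comm : ∀ x y → x ℚ.* y ≡ y ℚ.* x
        ℚ-comm = CommutativeRing.*-comm ℚring

        Fy-ι : Fy (toW E) x₀ y₀ ℚ.* ι (d * d * d) ≡ ι fyₕ
        Fy-ι = trans (ℚ-comm (Fy (toW E) x₀ y₀) (ι (d * d * d))) (trans (cong (ℚ._* Fy (toW E) x₀ y₀) d³-ι) (trans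
          (sym (Aℚ.affine-Fy {ι a1} {ι a2} {ι a3} {ι a4} {ι a6} {x₀} {y₀} {ι (A 1)} {ι (C 1)} {ι d} ha hc))
          (sym (hom-eval ((λ a1 a3 a c d → con (+ 2) :* c :+ a1 :* a :* d :+ a3 :* (d :* d :* d)) $ⁿ S.vars {5}) (a1 ∷ a3 ∷ A 1 ∷ C 1 ∷ d ∷ [])))))

        Fx-ι : Fx (toW E) x₀ y₀ ℚ.* ι (d * d * d * d) ≡ ι fxₕ
        Fx-ι = trans (ℚ-comm (Fx (toW E) x₀ y₀) (ι (d * d * d * d))) (trans (cong (ℚ._* Fx (toW E) x₀ y₀) d⁴-ι) (trans
          (sym (Aℚ.affine-Fx {ι a1} {ι a2} {ι a3} {ι a4} {ι a6} {x₀} {y₀} {ι (A 1)} {ι (C 1)} {ι d} ha hc))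
          (sym (hom-eval ((λ a1 a2 a4 a c d → a1 :* c :* d :- con (+ 3) :* a :* a :- con (+ 2) :* a2 :* a :* (d :* d) :- a4 :* (d :* d :* d :* d)) $ⁿ S.vars {6}) (a1 ∷ a2 ∷ a4 ∷ A 1 ∷ C 1 ∷ d ∷ [])))))

        unit-* : ∀ x y → ¬ (x ≡0[ p ]) → ¬ (y ≡0[ p ]) → ¬ (x * y ≡0[ p ])
        unit-* x y hx hy h = [ hx , hy ]′ (≡0-prime x y h)

        absurd : ¬ (p ℕD.∣ D 1) → fxₕ ≡0[ p ] → fyₕ ≡0[ p ] → ⊥
        absurd p∤D hx hy = nsred
            ( (λ h → [ p∤D , p∤D ]′ (euclidsLemma (D 1) (D 1) pp (subst (p ℕD.∣_) (proj₁ base-x) h)))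
            , fraction-PInt pp {y₀} {d * d * d} {C 1} base-y (no-divisor ud³)
            , fraction-PDiv pp {Fx (toW E) x₀ y₀} {d * d * d * d} {fxₕ} Fx-ι (no-divisor (unit-* (d * d * d) d ud³ ud)) (≡0⇒∣ hx)
            , fraction-PDiv pp {Fy (toW E) x₀ y₀} {d * d * d} {fyₕ} Fy-ι (no-divisor ud³) (≡0⇒∣ hy))
          where
          no-divisor : ∀ {z} → ¬ (z ≡0[ p ]) → ¬ (p ℕD.∣ ∣ z ∣)
          no-divisor n h = n (∣⇒≡0 h)
          ud : ¬ (d ≡0[ p ])
          ud h = p∤D (≡0⇒∣ h)
          ud³ : ¬ (d * d * d ≡0[ p ])
          ud³ = unit-* (d * d) d (unit-* d d ud ud) ud

      -- if P reduced to the singular point, both partial derivatives would vanish at P modulo p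
      base-unit : ¬ (A 1 - s * B 1 ≡0[ p ])
      base-unit U≡0 = absurd p∤D (transport fxₕ (d * d * d * d * Fxz (+ X) (+ Y)) (A′.affine-Fx {a1} {a2} {a3} {a4} {a6} {+ X} {+ Y} {A 1} {C 1} {d} A≈ C≈) (≡0-* (d * d * d * d) fx≡0))
          (transport fyₕ (d * d * d * Fyz (+ X) (+ Y)) (A′.affine-Fy {a1} {a2} {a3} {a4} {a6} {+ X} {+ Y} {A 1} {C 1} {d} A≈ C≈) (≡0-* (d * d * d) fy≡0))
        where
        p∤D : ¬ (p ℕD.∣ D 1)
        p∤D h = not-both 1 (subst (_≡0[ p ]) (S.solve (A 1 ∷ s ∷ B 1 ∷ []) (λ a s b → (a :- s :* b) :+ s :* b := a) refl) (≡0-+ U≡0 (≡0-* s (p∣D⇒B h)))) (p∣D⇒B h)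
        open Coordinates (coordinates 1 p∤D)
        x≈s : (+ X - s) ≡0[ p ]
        x≈s = unit-cancel d (+ X - s) (λ h → p∤D (≡0⇒∣ h)) (unit-cancel d (d * (+ X - s)) (λ h → p∤D (≡0⇒∣ h))
          (subst (_≡0[ p ]) (S.solve (A 1 ∷ s ∷ + X ∷ d ∷ []) (λ a s x d → (a :- s :* (d :* d)) :+ (:- con (+ 1)) :* (a :- x :* (d :* d)) := d :* (d :* (x :- s))) refl) (≡0-+ U≡0 (≡0-* (- 1ℤ) A≈))))
        F≈0 : CommutativeRing._≈_ (ZMod p) (Fz (+ X) (+ Y)) 0ℤ
        F≈0 = ≡0⇒~ {p} {Fz (+ X) (+ Y)} (affine-on-curve 1 (s≤s z≤n) p∤D)
        fy≡0 : Fyz (+ X) (+ Y) ≡0[ p ]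
        fy≡0 = ≡0-square (Fyz (+ X) (+ Y)) (~⇒≡0 {p} {Fyz (+ X) (+ Y) * Fyz (+ X) (+ Y)} (A′.singular-Fy {a1} {a2} {a3} {a4} {a6} {s} {+ X} {+ Y} x≈s F≈0 sing))
        fx≡0 : Fxz (+ X) (+ Y) ≡0[ p ]
        fx≡0 = ≡0-square (Fxz (+ X) (+ Y)) (~⇒≡0 {p} {Fxz (+ X) (+ Y) * Fxz (+ X) (+ Y)} (A′.singular-Fx {a1} {a2} {a3} {a4} {a6} {s} {+ X} {+ Y} x≈s F≈0 sing (≡0⇒~ {p} {Fyz (+ X) (+ Y)} fy≡0)))

    module _ (nsred : BadRed E p → NsRed E p (aff x₀ y₀)) where

      nonsingular : Nonsingular
      nonsingular = by (≡0? p Δℤ)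
        where
        by : Dec (Δℤ ≡0[ p ]) → Nonsingular
        by (yes h) {a} {b} {m} {k} {c} = let (s , sing , _) = singular-point h in Bad.bad⇒nonsingular s sing (base-unit s sing (nsred (Δ⇒bad h))) {a} {b} {m} {k} {c}
        by (no h) = good⇒nonsingular h

      additive⇒p∣D : AdditiveRed E p → p ℕD.∣ D p
      additive⇒p∣D (bad , add) = let (s , sing , cusp , _) = singular-point (bad⇒Δ bad) in
        p∣B⇒D (Bad.additive⇒p∣B s sing (base-unit s sing (nsred bad)) (cusp (PDiv⇒ c₄-ι add)))

      -- At a node the smooth points form a torus, on which T_p = T_1 says that multiplication by p
      -- preserves traces; only the identity has trace 2, so [pk]P and [k]P reduce to O together.
      multiplicative-descent : BadRed E p → ¬ AdditiveRed E p → ∀ k → p ℕD.∣ D (p ℕ.* k) → p ℕD.∣ D k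
      multiplicative-descent bad ¬add k h = let (s , sing , _ , node) = singular-point (bad⇒Δ bad)
                                                U₁ = base-unit s sing (nsred bad) in
        p∣B⇒D (Bad.T-detects s sing U₁ (node (λ e → ¬add (bad , ⇒PDiv c₄-ι e))) k p
          (dickson p pp (Bad.T s sing U₁ k) (Bad.T₀ s sing U₁ k) (Bad.T-step s sing U₁ k)) (p∣D⇒B h))

-- Point counts as rational inequalities

module Bounds where
  open import Defs
  open import Data.Integer using (+_)
  open import Data.Rational as ℚ using (ℚ; 0ℚ; 1ℚ; _+_; _*_; _≤_; _<_)
  open import Data.Nat.Solver using (module +-*-Solver)
  open import Data.List using ([]; _∷_; map)
  open import Data.List.Relation.Unary.Any using (here; there)
  open import Data.Vec using ([]; _∷_)
  open import Relation.Binary.PropositionalEquality hiding ([_])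
  open Model
  open Count
  open Hasse using (sumBelow)
  open Frob using (prime>1)

  private
    module S = Solver ℚring
    open S using (_:+_; _:*_; _:=_; con)

  ℕtoℚ-* : ∀ m n → ℕtoℚ (m ℕ.* n) ≡ ℕtoℚ m * ℕtoℚ n
  ℕtoℚ-* m n = trans (cong ℤtoℚ (ℤP.pos-* m n)) (ι-* (+ m) (+ n))

  ℕtoℚ-+ : ∀ m n → ℕtoℚ (m ℕ.+ n) ≡ ℕtoℚ m + ℕtoℚ n
  ℕtoℚ-+ m n = ι-+ (+ m) (+ n)

  ℕtoℚ-mono-≤ : ∀ {m n} → m ℕ.≤ n → ℕtoℚ m ≤ ℕtoℚ n
  ℕtoℚ-mono-≤ {m} {n} h = ℚP.toℚᵘ-cancel-≤ (ℚᵘP.≤-respˡ-≃ (ℚᵘP.≃-sym (ιᵘ (+ m))) (ℚᵘP.≤-respʳ-≃ (ℚᵘP.≃-sym (ιᵘ (+ n)))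
    (ℚᵘ.*≤* (ℤP.*-monoʳ-≤-nonNeg (+ 1) (ℤ.+≤+ h)))))

  ℕtoℚ-pos : ∀ n → 1 ℕ.≤ n → ℚ.Positive (ℕtoℚ n)
  ℕtoℚ-pos (suc n) _ = ℚP.normalize-pos (suc n) 1

  divℕ-* : ∀ a n → 1 ℕ.≤ n → divℕ a n * ℕtoℚ n ≡ ℕtoℚ a
  divℕ-* a (suc k) _ = ℚP.toℚᵘ-injective (ℚᵘP.≃-trans (ℚP.toℚᵘ-homo-* (divℕ a (suc k)) (ℕtoℚ (suc k)))
    (ℚᵘP.≃-trans (ℚᵘP.*-cong (ℚP.toℚᵘ-fromℚᵘ (ℚᵘ.mkℚᵘ (+ a) k)) (ιᵘ (+ suc k)))
    (ℚᵘP.≃-trans (ℚᵘ.*≡* (trans (ℤP.*-identityʳ (+ a ℤ.* + suc k)) (cong (λ n → + a ℤ.* + suc n) (sym (ℕP.*-identityʳ k))))) (ℚᵘP.≃-sym (ιᵘ (+ a))))))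

  prod-divℕ : ∀ (f : ℕ → ℕ) L → (∀ q → q ∈ L → 1 ℕ.≤ q) → prodℚ (map (λ q → divℕ (f q) q) L) * ℕtoℚ (prodℕ L) ≡ ℕtoℚ (prodℕ (map f L))
  prod-divℕ f [] h = refl
  prod-divℕ f (q ∷ L) h = trans (cong (divℕ (f q) q * r *_) (ℕtoℚ-* q (prodℕ L)))
    (trans (S.solve (divℕ (f q) q ∷ r ∷ ℕtoℚ q ∷ ℕtoℚ (prodℕ L) ∷ []) (λ d r q l → d :* r :* (q :* l) := (d :* q) :* (r :* l)) refl)
    (trans (cong₂ _*_ (divℕ-* (f q) q (h q (here refl))) (prod-divℕ f L (λ q m → h q (there m)))) (sym (ℕtoℚ-* (f q) (prodℕ (map f L))))))
    where r = prodℚ (map (λ q → divℕ (f q) q) L)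

  prodℕ≥1 : ∀ L → (∀ q → q ∈ L → 1 ℕ.≤ q) → 1 ℕ.≤ prodℕ L
  prodℕ≥1 [] h = ℕP.≤-refl
  prodℕ≥1 (q ∷ L) h = ℕP.*-mono-≤ (h q (here refl)) (prodℕ≥1 L (λ q m → h q (there m)))

  quotient-bound : ∀ (f : ℕ → ℕ) L m → (∀ q → q ∈ L → 1 ℕ.≤ q) → m ℕ.* prodℕ L ℕ.≤ prodℕ (map f L) → ℕtoℚ m ≤ prodℚ (map (λ q → divℕ (f q) q) L)
  quotient-bound f L m h k = ℚP.*-cancelʳ-≤-pos (ℕtoℚ (prodℕ L)) {{ℕtoℚ-pos (prodℕ L) (prodℕ≥1 L h)}}
    (subst₂ _≤_ (ℕtoℚ-* m (prodℕ L)) (sym (prod-divℕ f L h)) (ℕtoℚ-mono-≤ k))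

  private
    mulˡ : ∀ {r p q} → 0ℚ ≤ r → p ≤ q → r * p ≤ r * q
    mulˡ {r} h = ℚP.*-monoˡ-≤-nonNeg r {{ℚ.nonNegative h}}

    mulʳ : ∀ {r p q} → 0ℚ ≤ r → p ≤ q → p * r ≤ q * r
    mulʳ {r} h = ℚP.*-monoʳ-≤-nonNeg r {{ℚ.nonNegative h}}

    0≤ℕ : ∀ n → 0ℚ ≤ ℕtoℚ n
    0≤ℕ n = ℕtoℚ-mono-≤ {0} {n} z≤n

    0≤* : ∀ {x y} → 0ℚ ≤ x → 0ℚ ≤ y → 0ℚ ≤ x * y
    0≤* {x} {y} hx hy = subst (_≤ x * y) (ℚP.*-zeroʳ x) (mulˡ hx hy)

    square-< : ∀ {x y} → 0ℚ ≤ x → x < y → x * x < y * y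
    square-< {x} {y} h l = ℚP.≤-<-trans (mulˡ h (ℚP.<⇒≤ l)) (ℚP.*-monoˡ-<-pos y {{ℚ.positive (ℚP.≤-<-trans h l)}} l)

  prodℚ-mono : ∀ (f g : ℕ → ℚ) L → (∀ q → q ∈ L → 0ℚ ≤ f q × f q ≤ g q) → 0ℚ ≤ prodℚ (map f L) × prodℚ (map f L) ≤ prodℚ (map g L)
  prodℚ-mono f g [] h = ℕtoℚ-mono-≤ {0} {1} z≤n , ℚP.≤-refl
  prodℚ-mono f g (q ∷ L) h = let (a , b) = h q (here refl)
                                 (c , d) = prodℚ-mono f g L (λ q m → h q (there m)) in
    0≤* a c , ℚP.≤-trans (mulʳ c b) (mulˡ (ℚP.≤-trans a b) d)

  divℕ-nonNeg : ∀ a n → 0ℚ ≤ divℕ a n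
  divℕ-nonNeg a zero = ℚP.≤-refl
  divℕ-nonNeg a (suc k) = ℚP.*-cancelʳ-≤-pos (ℕtoℚ (suc k)) {{ℕtoℚ-pos (suc k) (s≤s z≤n)}}
    (subst₂ _≤_ (sym (ℚP.*-zeroˡ (ℕtoℚ (suc k)))) (sym (divℕ-* a (suc k) (s≤s z≤n))) (0≤ℕ a))

  -- a² ≤ 4p and b ≥ 1/√p give a ≤ 2pb, hence p + 1 + a ≤ p(1 + b)².
  hasse-ℚ : ∀ {N p a} → 1 ℕ.≤ p → N ℕ.≤ suc p ℕ.+ a → a ℕ.* a ℕ.≤ 4 ℕ.* p → ∀ b → 0ℚ ≤ b → 1ℚ ≤ ℕtoℚ p * (b * b) →
    divℕ N p ≤ (1ℚ + b) * (1ℚ + b)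
  hasse-ℚ {N} {p} {a} 1≤p N≤ a²≤ b 0≤b 1≤pb² = ℚP.*-cancelʳ-≤-pos P {{ℕtoℚ-pos p 1≤p}} (subst (_≤ (1ℚ + b) * (1ℚ + b) * P) (sym (divℕ-* N p 1≤p))
      (ℚP.≤-trans (ℕtoℚ-mono-≤ N≤) (subst₂ _≤_ (sym N′≡) (S.solve (P ∷ b ∷ []) (λ p b → p :* (b :* b) :+ p :+ con (+ 2) :* p :* b := (con (+ 1) :+ b) :* (con (+ 1) :+ b) :* p) refl)
        (ℚP.+-mono-≤ (ℚP.+-mono-≤ 1≤pb² (ℚP.≤-refl {P})) a≤))))
    where
    P = ℕtoℚ p
    N′≡ : ℕtoℚ (suc p ℕ.+ a) ≡ 1ℚ + P + ℕtoℚ a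
    N′≡ = trans (ℕtoℚ-+ (suc p) a) (cong (_+ ℕtoℚ a) (ℕtoℚ-+ 1 p))
    0≤2pb : 0ℚ ≤ ℕtoℚ 2 * P * b
    0≤2pb = 0≤* (0≤* (0≤ℕ 2) (0≤ℕ p)) 0≤b
    a≤ : ℕtoℚ a ≤ ℕtoℚ 2 * P * b
    a≤ = ℚP.≮⇒≥ (λ l → ℚP.<-irrefl refl (ℚP.<-≤-trans (square-< 0≤2pb l)
      (ℚP.≤-trans (subst₂ _≤_ (ℕtoℚ-* a a) (trans (ℕtoℚ-* 4 p) (sym (ℚP.*-identityʳ (ℕtoℚ 4 * P)))) (ℕtoℚ-mono-≤ a²≤))
        (subst (ℕtoℚ 4 * P * 1ℚ ≤_) (S.solve (P ∷ b ∷ []) (λ p b → con (+ 4) :* p :* (p :* (b :* b)) := con (+ 2) :* p :* b :* (con (+ 2) :* p :* b)) refl)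
          (mulˡ (0≤* (0≤ℕ 4) (0≤ℕ p)) 1≤pb²)))))

  parity : ∀ n → ∃ λ m → n ≡ m ℕ.+ m ⊎ n ≡ suc (m ℕ.+ m)
  parity zero = 0 , inj₁ refl
  parity (suc n) = let (m , h) = parity n in
    [ (λ e → m , inj₂ (cong suc e)) , (λ e → suc m , inj₁ (trans (cong suc e) (cong suc (sym (ℕP.+-suc m m))))) ]′ h

  -- The excess `a` over p + 1 is truncated at 0, as an upper bound is sought. For p = 2, where the
  -- leading coefficient 2 of `Num` would vanish, the elementary 2p + 1 equals p + 1 + 2, and 2² ≤
  -- 8.
  hasse-bound : ∀ E p → Prime p → ∃ λ a → NsCount E p ℕ.≤ suc p ℕ.+ a × a ℕ.* a ℕ.≤ 4 ℕ.* p
  hasse-bound E p pp = go (proj₁ (parity p)) (proj₂ (parity p))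
    where
    open Points-mod E p pp
    Goal = ∃ λ a → NsCount E p ℕ.≤ suc p ℕ.+ a × a ℕ.* a ℕ.≤ 4 ℕ.* p
    odd : ∀ m → 1 ℕ.≤ m → p ≡ suc (m ℕ.+ m) → Goal
    odd m 1≤m e = [ (λ h → sumBelow count p ℕ.∸ p ,
        ℕP.≤-trans NsCount≤ (ℕP.≤-reflexive (cong suc (sym (ℕP.m+[n∸m]≡n h)))) ,
        hasse-count m 1≤m e (sumBelow count p ℕ.∸ p) (sym (ℕP.m+[n∸m]≡n h))) ,
      (λ h → 0 , ℕP.≤-trans NsCount≤ (ℕP.≤-trans (s≤s h) (ℕP.≤-reflexive (sym (ℕP.+-identityʳ (suc p))))) , z≤n) ]′ (ℕP.≤-total p (sumBelow count p))
    go : ∀ m → p ≡ m ℕ.+ m ⊎ p ≡ suc (m ℕ.+ m) → Goal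
    go m (inj₁ e) = 2 , ℕP.≤-trans NsCount≤2p+1 (ℕP.≤-trans (ℕP.≤-reflexive (cong (λ n → suc (n ℕ.* 2)) p≡2)) (ℕP.≤-reflexive (cong (λ n → suc n ℕ.+ 2) (sym p≡2)))) ,
        ℕP.≤-trans (ℕP.m≤m+n 4 4) (ℕP.≤-reflexive (cong (4 ℕ.*_) (sym p≡2)))
      where
      p≡2 : p ≡ 2
      p≡2 = [ (λ ()) , sym ]′ (prime⇒irreducible pp (ℕD.divides m (trans e (trans (cong (m ℕ.+_) (sym (ℕP.+-identityʳ m))) (ℕP.*-comm 2 m)))))
    go zero (inj₂ e) = ⊥-elim (ℕP.<-irrefl (sym e) (prime>1 pp))
    go (suc m) (inj₂ e) = odd (suc m) (s≤s z≤n) e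

  -- A count of 2p forces a ≥ p - 1. With p = 7 + k this gives (6 + k)² ≤ 4(7 + k), which fails
  -- already in the constant terms, 36 against 28.
  NsCount≢2p : ∀ E p → Prime p → 7 ℕ.≤ p → NsCount E p ≢ 2 ℕ.* p
  NsCount≢2p E p pp 7≤p e = let (a , N≤ , a²≤) = hasse-bound E p pp
                                k = p ℕ.∸ 7
                                p≡ = ℕP.m+[n∸m]≡n 7≤p
                                p≤ : p ℕ.≤ suc a
                                p≤ = ℕP.+-cancelˡ-≤ p p (suc a) (ℕP.≤-trans (ℕP.≤-reflexive (trans (cong (p ℕ.+_) (sym (ℕP.+-identityʳ p))) (sym e))) (ℕP.≤-trans N≤ (ℕP.≤-reflexive (sym (ℕP.+-suc p a)))))
                                6+k≤a = ℕ.s≤s⁻¹ (ℕP.≤-trans (ℕP.≤-reflexive p≡) p≤) in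
    too-big k (ℕP.≤-trans (ℕP.*-mono-≤ 6+k≤a 6+k≤a) (ℕP.≤-trans a²≤ (ℕP.≤-reflexive (cong (4 ℕ.*_) (sym p≡)))))
    where
    too-big : ∀ k → ¬ ((6 ℕ.+ k) ℕ.* (6 ℕ.+ k) ℕ.≤ 4 ℕ.* (7 ℕ.+ k))
    too-big k h = ℕP.<⇒≱ (ℕP.≤-trans (ℕP.m≤m+n (suc (28 ℕ.+ 4 ℕ.* k)) (7 ℕ.+ 8 ℕ.* k ℕ.+ k ℕ.* k)) (ℕP.≤-reflexive
      (+-*-Solver.solve 1 (λ k → N.con 29 N.:+ N.con 4 N.:* k N.:+ (N.con 7 N.:+ N.con 8 N.:* k N.:+ k N.:* k) N.:= (N.con 6 N.:+ k) N.:* (N.con 6 N.:+ k)) refl k)))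
      (ℕP.≤-trans h (ℕP.≤-reflexive (ℕP.*-distribˡ-+ 4 7 k)))
      where module N = +-*-Solver

-- Prime factors, cycles of a map, surplus factors

module Arith where
  open import Defs using (prodℕ)
  open import Data.Nat
  open import Data.Nat.Properties
  open import Data.Nat.Divisibility
  open import Data.Nat.Induction using (<-rec)
  open import Data.Nat.Primality
  open import Data.Nat.Primality.Factorisation using (factorise; PrimeFactorisation)
  open import Data.Nat.ListAction using (sum; product)
  open import Data.Nat.ListAction.Properties using (product-++; product-↭; sum-++; sum-↭; ∈⇒∣product)
  open import Data.Fin as Fin using (toℕ; fromℕ<)
  open import Data.List using (List; []; _∷_; _++_; length; map; applyUpTo)
  open import Data.List.Relation.Unary.All as All using (All; []; _∷_)
  open import Data.List.Relation.Unary.Any using (here; there)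
  open import Data.List.Relation.Unary.AllPairs using ([]; _∷_)
  open import Data.List.Relation.Unary.Linked using (Linked; [-]; _∷_)
  open import Data.List.Relation.Binary.Permutation.Propositional using (_↭_; ↭-sym)
  open import Relation.Binary.PropositionalEquality hiding ([_])
  open Frob using (prime>1)
  open Count using (split-off)

  prime-∣-prime : ∀ {p q} → Prime p → Prime q → p ∣ q → p ≡ q
  prime-∣-prime pp pq h = [ (λ e → ⊥-elim (<-irrefl (sym e) (prime>1 pp))) , (λ e → e) ]′ (prime⇒irreducible pq h)

  cancel-prime-power : ∀ {q c} → Prime q → ¬ (q ∣ c) → ∀ j u → q ^ j ∣ c * u → q ^ j ∣ u
  cancel-prime-power pq q∤c zero u h = 1∣ u
  cancel-prime-power {q} {c} pq q∤c (suc j) u h = go ([ (λ k → ⊥-elim (q∤c k)) , (λ k → k) ]′ (euclidsLemma c u pq (∣-trans (m∣m*n (q ^ j)) h)))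
    where
    instance _ = prime⇒nonZero pq
    go : q ∣ u → q ^ suc j ∣ u
    go (divides v refl) = subst (q ^ suc j ∣_) (*-comm q v) (*-monoʳ-∣ q (cancel-prime-power pq q∤c j v
      (*-cancelˡ-∣ q (subst (q ^ suc j ∣_) (trans (sym (*-assoc c v q)) (*-comm (c * v) q)) h))))

  prime-power-cancel : ∀ {q r} → Prime q → ¬ (q ∣ r) → ∀ e w → r ∣ w * q ^ e → r ∣ w
  prime-power-cancel {q} {r} pq q∤r zero w h = subst (r ∣_) (*-identityʳ w) h
  prime-power-cancel {q} {r} pq q∤r (suc e) w h = prime-power-cancel pq q∤r e w (step (w * q ^ e) (subst (r ∣_) (trans (cong (w *_) (*-comm q (q ^ e))) (sym (*-assoc w (q ^ e) q))) h))
    where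
    instance _ = prime⇒nonZero pq
    step : ∀ x → r ∣ x * q → r ∣ x
    step x (divides k e) = go ([ (λ z → z) , (λ z → ⊥-elim (q∤r z)) ]′ (euclidsLemma k r pq (divides x (sym e))))
      where
      go : q ∣ k → r ∣ x
      go (divides l refl) = divides l (*-cancelʳ-≡ x (l * r) q (trans e (trans (*-assoc l q r) (trans (cong (l *_) (*-comm q r)) (sym (*-assoc l r q))))))

  prime-divisor : ∀ n → 2 ≤ n → ∃ λ q → Prime q × q ∣ n
  prime-divisor n 2≤n = go (PrimeFactorisation.factors f) (PrimeFactorisation.isFactorisation f) (PrimeFactorisation.factorsPrime f)
    where
    f = factorise n {{>-nonZero (≤-trans (s≤s z≤n) 2≤n)}}
    go : ∀ l → n ≡ product l → All Prime l → ∃ λ q → Prime q × q ∣ n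
    go [] e _ = ⊥-elim (<-irrefl (sym e) 2≤n)
    go (q ∷ l) e (pq ∷ _) = q , pq , subst (q ∣_) (sym e) (m∣m*n (product l))

  extract : ∀ {q} → Prime q → ∀ a → 1 ≤ a → ∃₂ λ e a′ → a ≡ q ^ e * a′ × ¬ (q ∣ a′)
  extract {q} pq = <-rec _ λ a rec 1≤a → go a rec 1≤a (q ∣? a)
    where
    go : ∀ a → (∀ {b} → b < a → 1 ≤ b → ∃₂ λ e a′ → b ≡ q ^ e * a′ × ¬ (q ∣ a′)) → 1 ≤ a → Dec (q ∣ a) → ∃₂ λ e a′ → a ≡ q ^ e * a′ × ¬ (q ∣ a′)
    go a rec 1≤a (no h) = 0 , a , sym (+-identityʳ a) , h
    go a rec 1≤a (yes (divides zero refl)) = ⊥-elim (<-irrefl refl 1≤a)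
    go a rec 1≤a (yes (divides (suc b) refl)) = let (e , a′ , eq , n) = rec {suc b} (m<m*n (suc b) q (prime>1 pq)) (s≤s z≤n) in
      suc e , a′ , trans (cong (_* q) eq) (trans (*-comm (q ^ e * a′) q) (sym (*-assoc q (q ^ e) a′))) , n

  ∣-local : ∀ a b → 1 ≤ a → (∀ q → Prime q → ∀ j → q ^ j ∣ a → q ^ j ∣ b) → a ∣ b
  ∣-local = <-rec _ step
    where
    step : ∀ a → (∀ {c} → c < a → ∀ b → 1 ≤ c → (∀ q → Prime q → ∀ j → q ^ j ∣ c → q ^ j ∣ b) → c ∣ b) →
      ∀ b → 1 ≤ a → (∀ q → Prime q → ∀ j → q ^ j ∣ a → q ^ j ∣ b) → a ∣ b
    step a rec b 1≤a h = [ (λ 2≤a → large (prime-divisor a 2≤a)) , (λ a<2 → subst (_∣ b) (≤-antisym 1≤a (s≤s⁻¹ a<2)) (1∣ b)) ]′ (≤-<-connex 2 a)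
      where
      large : (∃ λ q → Prime q × q ∣ a) → a ∣ b
      large (q , pq , q∣a) = go (extract pq a 1≤a)
        where
        go : (∃₂ λ e a′ → a ≡ q ^ e * a′ × ¬ (q ∣ a′)) → a ∣ b
        go (zero , a′ , eq , n) = ⊥-elim (n (subst (q ∣_) (trans eq (+-identityʳ a′)) q∣a))
        go (suc e , zero , eq , n) = ⊥-elim (n (q ∣0))
        go (suc e , a′@(suc _) , eq , n) = glue (rec a′<a b (s≤s z≤n) (λ q′ pq′ j k → h q′ pq′ j (∣-trans k (subst (a′ ∣_) (sym eq) (n∣m*n (q ^ suc e))))))
          where
          a′<a : a′ < a
          a′<a = subst (a′ <_) (trans (*-comm a′ (q ^ suc e)) (sym eq)) (m<m*n a′ (q ^ suc e) (≤-trans (prime>1 pq) (m≤m*n q (q ^ e) {{m^n≢0 q e {{prime⇒nonZero pq}}}})))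
          glue : a′ ∣ b → a ∣ b
          glue (divides c refl) = subst (_∣ c * a′) (sym eq) (*-monoˡ-∣ a′ (cancel-prime-power pq n (suc e) c
            (subst (q ^ suc e ∣_) (*-comm c a′) (h q pq (suc e) (subst (q ^ suc e ∣_) (sym eq) (m∣m*n a′))))))

  least : ∀ {P : ℕ → Set} → (∀ n → Dec (P n)) → ∀ w → P w → ∃ λ r → P r × (∀ k → k < r → ¬ P k)
  least {P} P? w h = [ (λ n → ⊥-elim (n w ≤-refl h)) , (λ x → x) ]′ (search (suc w))
    where
    search : ∀ n → (∀ k → k < n → ¬ P k) ⊎ ∃ λ r → P r × (∀ k → k < r → ¬ P k)
    search zero = inj₁ λ _ ()
    search (suc n) = [ (λ f → decide f (P? n)) , inj₂ ]′ (search n)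
      where
      decide : (∀ k → k < n → ¬ P k) → Dec (P n) → (∀ k → k < suc n → ¬ P k) ⊎ ∃ λ r → P r × (∀ k → k < r → ¬ P k)
      decide f (yes p) = inj₂ (n , p , f)
      decide f (no np) = inj₁ λ k k<1+n → [ f k , (λ e → subst (λ k → ¬ P k) (sym e) np) ]′ (m≤n⇒m<n∨m≡n (s≤s⁻¹ k<1+n))

  ∈⇒∣prodℕ : ∀ cs {q} → q ∈ cs → q ∣ prodℕ cs
  ∈⇒∣prodℕ (c ∷ cs) (here refl) = m∣m*n (prodℕ cs)
  ∈⇒∣prodℕ (c ∷ cs) (there h) = ∣n⇒∣m*n c (∈⇒∣prodℕ cs h)

  ∣prodℕ⇒∈ : ∀ {q} → Prime q → ∀ cs → All Prime cs → q ∣ prodℕ cs → q ∈ cs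
  ∣prodℕ⇒∈ pq [] _ h = ⊥-elim (¬prime[1] (subst Prime (∣1⇒≡1 h) pq))
  ∣prodℕ⇒∈ pq (c ∷ cs) (pc ∷ ps) h = [ (λ k → here (prime-∣-prime pq pc k)) , (λ k → there (∣prodℕ⇒∈ pq cs ps k)) ]′ (euclidsLemma c (prodℕ cs) pq h)

  distinct-primes-∣ : ∀ {n} cs → All Prime cs → Unique cs → All (_∣ n) cs → prodℕ cs ∣ n
  distinct-primes-∣ {n} [] _ _ _ = 1∣ n
  distinct-primes-∣ {n} (c ∷ cs) (pc ∷ ps) (c∉ ∷ u) (c∣n ∷ ds) = go (distinct-primes-∣ cs ps u ds)
    where
    go : prodℕ cs ∣ n → c * prodℕ cs ∣ n
    go (divides k refl) = *-monoˡ-∣ (prodℕ cs) ([ (λ x → x) , (λ x → ⊥-elim (All.lookup c∉ (∣prodℕ⇒∈ pc cs ps x) refl)) ]′ (euclidsLemma k (prodℕ cs) pc c∣n))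

  prodℕ≡product : ∀ l → prodℕ l ≡ product l
  prodℕ≡product [] = refl
  prodℕ≡product (x ∷ l) = cong (x *_) (prodℕ≡product l)

  module Cycles (R : ℕ → ℕ → Set) (G : ℕ → Set) (G? : ∀ q → Dec (G q)) (bound : ℕ) (G≤ : ∀ {q} → G q → q ≤ bound)
    (next : ∀ {q} → G q → ∃ λ r → R q r × G r) where
    private
      ρ′ : ∀ q → Dec (G q) → ℕ
      ρ′ q (yes g) = proj₁ (next g)
      ρ′ q (no _) = 0

      ρ : ℕ → ℕ
      ρ q = ρ′ q (G? q)

      ρ-spec : ∀ {q} → G q → R q (ρ q) × G (ρ q)
      ρ-spec {q} g = go (G? q)
        where
        go : ∀ d → R q (ρ′ q d) × G (ρ′ q d)
        go (yes g′) = proj₂ (next g′)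
        go (no n) = ⊥-elim (n g)

      it : ℕ → ℕ → ℕ
      it zero x = x
      it (suc k) x = it k (ρ x)

      it-+ : ∀ i j x → it (i + j) x ≡ it j (it i x)
      it-+ zero j x = refl
      it-+ (suc i) j x = it-+ i j (ρ x)

      it-G : ∀ k {x} → G x → G (it k x)
      it-G zero g = g
      it-G (suc k) g = it-G k (proj₂ (ρ-spec g))

      orbit : ℕ → ℕ → List ℕ
      orbit k x = applyUpTo (λ i → it i x) k

      orbit-linked : ∀ k {x} → G x → Linked R (orbit (suc k) x ++ it (suc k) x ∷ [])
      orbit-linked zero g = proj₁ (ρ-spec g) ∷ [-]
      orbit-linked (suc k) g = proj₁ (ρ-spec g) ∷ orbit-linked k (proj₂ (ρ-spec g))

      orbit-all : ∀ k {x} → G x → All G (orbit k x)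
      orbit-all zero g = []
      orbit-all (suc k) g = g ∷ orbit-all k (proj₂ (ρ-spec g))

      Period : ℕ → ℕ → Set
      Period x k = 1 ≤ k × it k x ≡ x

      period? : ∀ x k → Dec (Period x k)
      period? x k with 1 ≤? k | it k x ≟ x
      ... | yes a | yes b = yes (a , b)
      ... | no a | _ = no λ h → a (proj₁ h)
      ... | _ | no b = no λ h → b (proj₂ h)

      -- The first `bound` + 2 iterates take at most `bound` + 1 values, so two of them coincide;
      -- the earlier one is periodic, though x itself need not be.
      periodic : ∀ {x} → G x → ∃₂ λ y k → G y × Period y k
      periodic {x} g = let (i , j , i<j , e) = FinP.pigeonhole (n<1+n (suc bound)) (λ i → fromℕ< (s≤s (G≤ (it-G (toℕ i) g)))) in
        it (toℕ i) x , toℕ j ∸ toℕ i , it-G (toℕ i) g , m<n⇒0<n∸m i<j ,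
        trans (sym (it-+ (toℕ i) (toℕ j ∸ toℕ i) x)) (trans (cong (λ n → it n x) (m+[n∸m]≡n (<⇒≤ i<j))) (sym (FinP.fromℕ<-injective (it (toℕ i) x) (it (toℕ j) x) _ _ e)))

      -- a repetition within one minimal period would give a smaller period
      orbit-unique : ∀ x k → it k x ≡ x → (∀ i → i < k → ¬ Period x i) → Unique (orbit k x)
      orbit-unique x k e min = UniqueP.applyUpTo⁺₁ (λ i → it i x) k λ {i} {j} i<j j<k eq →
        min (i + (k ∸ j)) (subst (i + (k ∸ j) <_) (m+[n∸m]≡n (<⇒≤ j<k)) (+-monoˡ-< (k ∸ j) i<j))
          (≤-trans (m<n⇒0<n∸m j<k) (m≤n+m (k ∸ j) i) ,
           trans (it-+ i (k ∸ j) x) (trans (cong (it (k ∸ j)) eq) (trans (sym (it-+ j (k ∸ j) x)) (trans (cong (λ n → it n x) (m+[n∸m]≡n (<⇒≤ j<k))) e))))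

    cycle : ∀ {x} → G x → ∃₂ λ c cs → All G (c ∷ cs) × Unique (c ∷ cs) × Linked R (c ∷ cs ++ c ∷ [])
    cycle g = let (y , k , gy , per) = periodic g
                  (l , per′ , min) = least (period? y) k per in build y l gy per′ min
      where
      build : ∀ y l → G y → Period y l → (∀ i → i < l → ¬ Period y i) → ∃₂ λ c cs → All G (c ∷ cs) × Unique (c ∷ cs) × Linked R (c ∷ cs ++ c ∷ [])
      build y (suc l) gy (_ , e) min = y , orbit l (ρ y) , orbit-all (suc l) gy , orbit-unique y (suc l) e min ,
        subst (λ z → Linked R (orbit (suc l) y ++ z ∷ [])) e (orbit-linked l gy)

  primeFactors : ℕ → List ℕ
  primeFactors zero = []
  primeFactors n@(suc _) = PrimeFactorisation.factors (factorise n)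

  primeFactors-prime : ∀ n → All Prime (primeFactors n)
  primeFactors-prime zero = []
  primeFactors-prime n@(suc _) = PrimeFactorisation.factorsPrime (factorise n)

  product-primeFactors : ∀ {n} → 1 ≤ n → product (primeFactors n) ≡ n
  product-primeFactors {n@(suc _)} _ = sym (PrimeFactorisation.isFactorisation (factorise n))

  ∈-primeFactors : ∀ {n q} → 1 ≤ n → Prime q → q ∣ n → q ∈ primeFactors n
  ∈-primeFactors {n} {q} 1≤n pq h = ∣prodℕ⇒∈ pq (primeFactors n) (primeFactors-prime n) (subst (q ∣_) (trans (sym (product-primeFactors 1≤n)) (sym (prodℕ≡product (primeFactors n)))) h)

  large-length : ∀ {n} → 2 ≤ n → 1 ≤ length (primeFactors n)
  large-length {n} 2≤n with primeFactors n | product-primeFactors {n} (≤-trans (s≤s z≤n) 2≤n)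
  ... | [] | e = ⊥-elim (<-irrefl e 2≤n)
  ... | _ ∷ _ | _ = s≤s z≤n

  composite-length : ∀ {n} → Composite n → 2 ≤ length (primeFactors n)
  composite-length {n} c with primeFactors n | primeFactors-prime n | product-primeFactors {n} (>-nonZero⁻¹ n {{composite⇒nonZero c}})
  ... | [] | _ | e = ⊥-elim (¬composite[1] (subst Composite (sym e) c))
  ... | q ∷ [] | pq ∷ _ | e = ⊥-elim (composite⇒¬prime c (subst Prime (trans (sym (*-identityʳ q)) e) pq))
  ... | _ ∷ _ ∷ _ | _ | _ = s≤s (s≤s z≤n)

  private
    product≥ : ∀ p₀ l → (∀ {q} → q ∈ l → p₀ ≤ q) → p₀ ^ length l ≤ product l
    product≥ p₀ [] h = ≤-refl
    product≥ p₀ (q ∷ l) h = *-mono-≤ (h (here refl)) (product≥ p₀ l (λ m → h (there m)))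

    sum≥ : ∀ (f : ℕ → ℕ) c l → (∀ {q} → q ∈ l → c ≤ f q) → length l * c ≤ sum (map f l)
    sum≥ f c [] h = z≤n
    sum≥ f c (q ∷ l) h = +-mono-≤ (h (here refl)) (sum≥ f c l (λ m → h (there m)))

  -- If the primes Q all occur among the prime factors of the numbers ρ q (q ∈ Q), then splitting one copy of Q off
  -- the list of all these prime factors leaves at least one factor for every composite ρ q.
  module Surplus (ρ : ℕ → ℕ) (Q T : List ℕ) (Q-unique : Unique Q) (T-unique : Unique T) (T⊆Q : ∀ {q} → q ∈ T → q ∈ Q)
    (Q-prime : ∀ {q} → q ∈ Q → Prime q) (ρ≥2 : ∀ {q} → q ∈ Q → 2 ≤ ρ q) (T-composite : ∀ {q} → q ∈ T → Composite (ρ q))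
    (covers : ∀ {q} → q ∈ Q → ∃ λ p → p ∈ Q × q ∣ ρ p) (p₀ : ℕ) (1≤p₀ : 1 ≤ p₀)
    (p₀≤ : ∀ {p q} → p ∈ Q → Prime q → q ∣ ρ p → p₀ ≤ q) where

    private
      factors : List ℕ → List ℕ
      factors [] = []
      factors (q ∷ l) = primeFactors (ρ q) ++ factors l

      product-factors : ∀ l → (∀ {q} → q ∈ l → q ∈ Q) → product (factors l) ≡ prodℕ (map ρ l)
      product-factors [] h = refl
      product-factors (q ∷ l) h = trans (product-++ (primeFactors (ρ q)) (factors l))
        (cong₂ _*_ (product-primeFactors (≤-trans (s≤s z≤n) (ρ≥2 (h (here refl))))) (product-factors l (λ m → h (there m))))

      length-factors : ∀ l → length (factors l) ≡ sum (map (λ q → length (primeFactors (ρ q))) l)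
      length-factors [] = refl
      length-factors (q ∷ l) = trans (ListP.length-++ (primeFactors (ρ q))) (cong (length (primeFactors (ρ q)) +_) (length-factors l))

      ∈-factors⁺ : ∀ l {p q} → p ∈ l → q ∈ primeFactors (ρ p) → q ∈ factors l
      ∈-factors⁺ (p ∷ l) (here refl) h = MemP.∈-++⁺ˡ h
      ∈-factors⁺ (p ∷ l) (there m) h = MemP.∈-++⁺ʳ (primeFactors (ρ p)) (∈-factors⁺ l m h)

      ∈-factors⁻ : ∀ l {q} → q ∈ factors l → ∃ λ p → p ∈ l × q ∈ primeFactors (ρ p)
      ∈-factors⁻ (p ∷ l) h = [ (λ k → p , here refl , k) , (λ k → let (p′ , m , k′) = ∈-factors⁻ l k in p′ , there m , k′) ]′ (MemP.∈-++⁻ (primeFactors (ρ p)) h)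

      Q⊆factors : ∀ {q} → q ∈ Q → q ∈ factors Q
      Q⊆factors m = let (p , p∈ , d) = covers m in ∈-factors⁺ Q p∈ (∈-primeFactors (≤-trans (s≤s z≤n) (ρ≥2 p∈)) (Q-prime m) d)

      Z T′ : List ℕ
      Z = proj₁ (split-off Q-unique Q⊆factors)
      T′ = proj₁ (split-off T-unique T⊆Q)
      factors↭ : factors Q ↭ Q ++ Z
      factors↭ = proj₂ (split-off Q-unique Q⊆factors)
      Q↭ : Q ↭ T ++ T′
      Q↭ = proj₂ (split-off T-unique T⊆Q)

      p₀≤Z : ∀ {q} → q ∈ Z → p₀ ≤ q
      p₀≤Z {q} m = let (p , p∈ , k) = ∈-factors⁻ Q (PermP.∈-resp-↭ (↭-sym factors↭) (MemP.∈-++⁺ʳ Q m)) in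
        p₀≤ p∈ (All.lookup (primeFactors-prime (ρ p)) k) (subst (q ∣_) (product-primeFactors (≤-trans (s≤s z≤n) (ρ≥2 p∈))) (∈⇒∣product k))

      len : ℕ → ℕ
      len q = length (primeFactors (ρ q))

      -- Each rank has at least one prime factor and each composite rank at least two, so there are
      -- at least |Q| + |T| factors, of which Q takes |Q|.
      t≤Z : length T ≤ length Z
      t≤Z = +-cancelˡ-≤ (length Q) (length T) (length Z) (begin
        length Q + length T                     ≡⟨ cong (_+ length T) (trans (PermP.↭-length Q↭) (ListP.length-++ T)) ⟩
        length T + length T′ + length T         ≡⟨ trans (+-assoc (length T) (length T′) (length T)) (trans (cong (length T +_) (+-comm (length T′) (length T))) (sym (+-assoc (length T) (length T) (length T′)))) ⟩
        length T + length T + length T′         ≡⟨ cong₂ _+_ (trans (cong (length T +_) (sym (+-identityʳ (length T)))) (*-comm 2 (length T))) (sym (*-identityʳ (length T′))) ⟩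
        length T * 2 + length T′ * 1            ≤⟨ +-mono-≤ (sum≥ len 2 T (λ m → composite-length (T-composite m))) (sum≥ len 1 T′ (λ m → large-length (ρ≥2 (PermP.∈-resp-↭ (↭-sym Q↭) (MemP.∈-++⁺ʳ T m))))) ⟩
        sum (map len T) + sum (map len T′)      ≡⟨ sum-++ (map len T) (map len T′) ⟨
        sum (map len T ++ map len T′)           ≡⟨ cong sum (ListP.map-++ len T T′) ⟨
        sum (map len (T ++ T′))                 ≡⟨ sum-↭ (PermP.map⁺ len Q↭) ⟨
        sum (map len Q)                         ≡⟨ length-factors Q ⟨
        length (factors Q)                      ≡⟨ trans (PermP.↭-length factors↭) (ListP.length-++ Q) ⟩
        length Q + length Z                     ∎)
        where open ≤-Reasoning

    surplus : p₀ ^ length T * prodℕ Q ≤ prodℕ (map ρ Q)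
    surplus = begin
      p₀ ^ length T * prodℕ Q  ≤⟨ *-monoˡ-≤ (prodℕ Q) (^-monoʳ-≤ p₀ {{>-nonZero 1≤p₀}} t≤Z) ⟩
      p₀ ^ length Z * prodℕ Q  ≤⟨ *-monoˡ-≤ (prodℕ Q) (product≥ p₀ Z p₀≤Z) ⟩
      product Z * prodℕ Q      ≡⟨ trans (*-comm (product Z) (prodℕ Q)) (cong (_* product Z) (prodℕ≡product Q)) ⟩
      product Q * product Z    ≡⟨ product-++ Q Z ⟨
      product (Q ++ Z)         ≡⟨ product-↭ factors↭ ⟨
      product (factors Q)      ≡⟨ product-factors Q (λ m → m) ⟩
      prodℕ (map ρ Q)          ∎
      where open ≤-Reasoning

-- Combinatorics of the map p ↦ r_p

module Arrows where
  open import Defs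
  open import Data.Nat
  open import Data.Nat.Properties
  open import Data.Nat.Divisibility
  open import Data.Nat.GCD using (gcd; gcd[m,n]∣m; gcd[m,n]∣n; gcd-greatest; gcd[m,n]≢0)
  open import Data.Nat.Coprimality using (coprime-divisor; gcd≡1⇒coprime)
  open import Data.Nat.Induction using (<-rec)
  open import Data.Nat.Primality
  open import Data.Rational as ℚ using (ℚ; 0ℚ; 1ℚ)
  open import Data.List using (List; []; _∷_; _++_; length; map; upTo)
  open import Data.List.Relation.Unary.All as All using (All; []; _∷_)
  open import Data.List.Relation.Unary.Any as Any using (here; there)
  open import Data.List.Relation.Unary.AllPairs using ([]; _∷_)
  open import Data.List.Relation.Unary.Linked using (Linked; [-]; _∷_)
  open import Data.List.Membership.Propositional using (lose; find)
  open import Relation.Nullary.Decidable using (_×-dec_)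
  open import Relation.Binary.PropositionalEquality hiding ([_])
  open Frob using (prime>1)
  open Arith
  open Bounds using (hasse-bound; hasse-ℚ; NsCount≢2p; quotient-bound; prodℚ-mono; divℕ-nonNeg)

  -- All that the combinatorics knows of the curve and the point. The condition of 2-regularity
  -- enters through `two-regular` only.
  record Divisibility (E : Curve) (P : Pt) : Set where
    open EDS E P
    field
      D : ℕ → ℕ
      DivD⇒ : ∀ {m n} → DivD m n → 1 ≤ n × m ∣ D n
      ⇒DivD : ∀ {m n} → 1 ≤ n → m ∣ D n → DivD m n
      difference : ∀ {p} → Prime p → ∀ {a b k} → a ≡ b + k → p ∣ D a → p ∣ D b → p ∣ D k
      multiple : ∀ {p} → Prime p → ∀ k a → p ^ k ∣ D a → ∀ j → p ^ k ∣ D (j * a)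
      gain : ∀ {p} → Prime p → ∀ k → 1 ≤ k → ∀ a → p ^ k ∣ D a → p ^ suc k ∣ D (p * a)
      order≤NsCount : ∀ {p} → Prime p → ∀ r → (∀ k → 1 ≤ k → k < r → ¬ (p ∣ D k)) → r ≤ NsCount E p
      even-order : ∀ {p} → Prime p → ∀ n → 1 ≤ n → ¬ (p ∣ D n) → p ∣ D (n + n) → NsCount E p ≤ p * 2
      NsCount≤ : ∀ {p} → Prime p → NsCount E p ≤ suc (p * 2)
      two-regular : IsRank 2 4 → NsCount E 2 ≡ 4 → 4 ∣ D 4
      additive : ∀ {p} → Prime p → AdditiveRed E p → p ∣ D p
      multiplicative : ∀ {p} → Prime p → BadRed E p → ¬ AdditiveRed E p → ∀ k → p ∣ D (p * k) → p ∣ D k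

  module Consequences {E : Curve} {P : Pt} (divisibility : Divisibility E P) where
    open EDS E P hiding (W)
    open Divisibility divisibility

    private
      power-one : ∀ {p n} → p ∣ n → p ^ 1 ∣ n
      power-one {p} {n} = subst (_∣ n) (sym (*-identityʳ p))
      one-power : ∀ {p n} → p ^ 1 ∣ n → p ∣ n
      one-power {p} {n} = subst (_∣ n) (*-identityʳ p)

    ∣D-multiple : ∀ {p} → Prime p → ∀ {a m} → a ∣ m → p ∣ D a → p ∣ D m
    ∣D-multiple pp {a} (divides j refl) h = one-power (multiple pp 1 a (power-one h) j)

    rank : ∀ {p w} → 1 ≤ w → p ∣ D w → ∃ (IsRank p)
    rank {p} {w} 1≤w h = let (r , (1≤r , d) , min) = least {λ n → 1 ≤ n × p ∣ D n} (λ n → 1 ≤? n ×-dec p ∣? D n) w (1≤w , h) in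
      r , 1≤r , ⇒DivD 1≤r d , λ k 1≤k k<r e → min k k<r (DivD⇒ e)

    rank-∣D : ∀ {p r} → IsRank p r → p ∣ D r
    rank-∣D (_ , d , _) = proj₂ (DivD⇒ d)

    rank-minimal : ∀ {p r} → IsRank p r → ∀ k → 1 ≤ k → k < r → ¬ (p ∣ D k)
    rank-minimal (_ , _ , min) k 1≤k k<r h = min k 1≤k k<r (⇒DivD 1≤k h)

    rank∣⇒∣D : ∀ {p r m} → Prime p → IsRank p r → r ∣ m → p ∣ D m
    rank∣⇒∣D pp isr r∣m = ∣D-multiple pp r∣m (rank-∣D isr)

    ∣D⇒rank∣ : ∀ {p r m} → Prime p → IsRank p r → p ∣ D m → r ∣ m
    ∣D⇒rank∣ {p} {r} {m} pp isr = <-rec (λ m → p ∣ D m → r ∣ m) step m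
      where
      step : ∀ m → (∀ {k} → k < m → p ∣ D k → r ∣ k) → p ∣ D m → r ∣ m
      step zero _ _ = r ∣0
      step m@(suc _) rec h = [ (λ r≤m → subst (r ∣_) (m+[n∸m]≡n r≤m) (∣m∣n⇒∣m+n ∣-refl
          (rec (∸-monoʳ-< (proj₁ isr) r≤m) (difference pp (sym (m+[n∸m]≡n r≤m)) h (rank-∣D isr))))) ,
        (λ m<r → ⊥-elim (rank-minimal isr m (s≤s z≤n) m<r h)) ]′ (≤-<-connex r m)

    gain-iterate : ∀ {q} → Prime q → ∀ e → 1 ≤ e → ∀ r → q ^ e ∣ D r → ∀ i → q ^ (e + i) ∣ D (q ^ i * r)
    gain-iterate {q} pq e 1≤e r h zero = subst₂ (λ x y → q ^ x ∣ D y) (sym (+-identityʳ e)) (sym (*-identityˡ r)) h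
    gain-iterate {q} pq e 1≤e r h (suc i) = subst₂ (λ x y → q ^ x ∣ D y) (sym (+-suc e i)) (sym (*-assoc q (q ^ i) r))
      (gain pq (e + i) (≤-trans 1≤e (m≤m+n e i)) (q ^ i * r) (gain-iterate pq e 1≤e r h i))

    private
      -- q^f is the exact power of q in r, and q^e divides D at r. For j ≤ e it is enough that r ∣
      -- w. For j = e + i, the factor w / r is divisible by q^(j-f), hence by q^i since f ≤ e, and
      -- each of these i factors raises the power in D by one. The condition f ≤ e is what fails for
      -- irregular sequences.
      powers-∣D : ∀ {q} → Prime q → ∀ e f r r′ → 1 ≤ e → f ≤ e → r ≡ q ^ f * r′ → ¬ (q ∣ r′) → q ^ e ∣ D r → ∀ j w → r ∣ w → q ^ j ∣ w → q ^ j ∣ D w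
      powers-∣D {q} pq e f r r′ 1≤e f≤e r≡ q∤r′ qe j w (divides u refl) qj = [ low , high ]′ (≤-total j e)
        where
        instance _ = prime⇒nonZero pq
        low : j ≤ e → q ^ j ∣ D (u * r)
        low j≤e = multiple pq j r (∣-trans (m≤n⇒m^n∣o^n j≤e) qe) u
          where
          m≤n⇒m^n∣o^n : ∀ {a b} → a ≤ b → q ^ a ∣ q ^ b
          m≤n⇒m^n∣o^n {a} {b} h = divides (q ^ (b ∸ a)) (trans (cong (q ^_) (sym (m∸n+n≡m h))) (^-distribˡ-+-* q (b ∸ a) a))
        high : e ≤ j → q ^ j ∣ D (u * r)
        high e≤j = subst (λ x → q ^ x ∣ D (u * r)) j≡ (go qi∣u)
          where
          i = j ∸ e
          j≡ : e + i ≡ j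
          j≡ = m+[n∸m]≡n e≤j
          qj′ : q ^ f * q ^ ((e ∸ f) + i) ∣ q ^ f * (r′ * u)
          qj′ = subst₂ _∣_ (trans (cong (q ^_) (trans (sym j≡) (trans (cong (_+ i) (sym (m+[n∸m]≡n f≤e))) (+-assoc f (e ∸ f) i)))) (^-distribˡ-+-* q f ((e ∸ f) + i)))
            (trans (cong (u *_) r≡) (trans (*-comm u (q ^ f * r′)) (*-assoc (q ^ f) r′ u))) qj
          qi∣u : q ^ i ∣ u
          qi∣u = ∣-trans (divides (q ^ (e ∸ f)) (^-distribˡ-+-* q (e ∸ f) i))
            (cancel-prime-power pq q∤r′ ((e ∸ f) + i) u (*-cancelˡ-∣ (q ^ f) {{m^n≢0 q f}} qj′))
          go : q ^ i ∣ u → q ^ (e + i) ∣ D (u * r)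
          go (divides v refl) = subst (λ x → q ^ (e + i) ∣ D x) (sym (*-assoc v (q ^ i) r)) (multiple pq (e + i) (q ^ i * r) (gain-iterate pq e 1≤e r qe i) v)

      -- q² ∣ r forces q² ≤ #E_ns(F_q) ≤ 2q + 1
      square-rank : ∀ {q r} → Prime q → IsRank q r → q * q ∣ r → q ≡ 2 × r ≡ 4
      square-rank {q} {r} pq isr (divides zero refl) = ⊥-elim (<-irrefl refl (proj₁ isr))
      square-rank {q} {r} pq isr (divides k@(suc k′) refl) = q≡2 , trans (cong₂ (λ k q → k * (q * q)) k≡1 q≡2) refl
        where
        r≤ : k * (q * q) ≤ suc (q * 2)
        r≤ = ≤-trans (order≤NsCount pq r (rank-minimal isr)) (NsCount≤ pq)
        q≤2 : q ≤ 2
        q≤2 = ≮⇒≥ (λ 3≤q → <⇒≱ (begin-strict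
          suc (q * 2)  <⟨ +-monoˡ-≤ (q * 2) (prime>1 pq) ⟩
          q + q * 2    ≡⟨ *-suc q 2 ⟨
          q * 3        ≤⟨ *-monoʳ-≤ q 3≤q ⟩
          q * q        ≤⟨ m≤n*m (q * q) k ⟩
          k * (q * q)  ∎) r≤)
          where open ≤-Reasoning
        q≡2 : q ≡ 2
        q≡2 = ≤-antisym q≤2 (prime>1 pq)
        k≡1 : k ≡ 1
        k≡1 = ≤-antisym (≮⇒≥ (λ 2≤k → <⇒≱ (s≤s (s≤s (s≤s (s≤s (s≤s (s≤s z≤n)))))) (≤-trans (*-monoˡ-≤ 4 2≤k) (subst (λ q → k * (q * q) ≤ suc (q * 2)) q≡2 r≤)))) (s≤s z≤n)

    -- The count 4 is forced. Rank 4 gives at least four points, and since the order is even, [2]P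
    -- reduces to a point with vertical tangent, which gives at most 2 · 2.
    four∣D₄ : IsRank 2 4 → 4 ∣ D 4
    four∣D₄ isr = two-regular isr (≤-antisym (even-order prime[2] 2 (s≤s z≤n) (rank-minimal isr 2 (s≤s z≤n) (s≤s (s≤s (s≤s z≤n)))) (rank-∣D isr))
      (order≤NsCount prime[2] 4 (rank-minimal isr)))

    -- The pair (e, f) passed to `powers-∣D` is (1, 0) if q ∤ r, (1, 1) if q divides r exactly once,
    -- and (2, 2) for q = 2 of rank 4, where 4 ∣ D 4 is available.
    prime-powers-∣D : ∀ {q} → Prime q → ∀ {w} → 1 ≤ w → q ∣ D w → ∀ j → q ^ j ∣ w → q ^ j ∣ D w
    prime-powers-∣D {q} pq {w} 1≤w h j qj = let (r , isr) = rank 1≤w h in by r isr (∣D⇒rank∣ pq isr h) (q ∣? r) (q * q ∣? r)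
      where
      instance _ = prime⇒nonZero pq
      by : ∀ r → IsRank q r → r ∣ w → Dec (q ∣ r) → Dec (q * q ∣ r) → q ^ j ∣ D w
      by r isr r∣w (no q∤r) _ = powers-∣D pq 1 0 r r ≤-refl z≤n (sym (+-identityʳ r)) q∤r (power-one (rank-∣D isr)) j w r∣w qj
      by r isr r∣w (yes (divides r′ r≡)) (no q²∤r) = powers-∣D pq 1 1 r r′ ≤-refl ≤-refl (trans r≡ (trans (*-comm r′ q) (cong (_* r′) (sym (*-identityʳ q)))))
        (λ k → q²∤r (subst (q * q ∣_) (sym r≡) (*-monoˡ-∣ q k))) (power-one (rank-∣D isr)) j w r∣w qj
      by r isr r∣w (yes _) (yes q²∣r) = four (square-rank pq isr q²∣r) isr r∣w qj
        where
        four : ∀ {q r} → q ≡ 2 × r ≡ 4 → IsRank q r → r ∣ w → q ^ j ∣ w → q ^ j ∣ D w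
        four (refl , refl) isr r∣w qj = powers-∣D prime[2] 2 2 4 1 (s≤s z≤n) ≤-refl refl (λ h → ¬prime[1] (subst Prime (∣1⇒≡1 h) prime[2])) (four∣D₄ isr) j w r∣w qj

    InS-intro : ∀ {w} → 1 ≤ w → (∀ q → Prime q → q ∣ w → q ∣ D w) → InS w
    InS-intro {w} 1≤w h = 1≤w , ⇒DivD 1≤w (∣-local w (D w) 1≤w λ
      { q pq zero _ → 1∣ D w
      ; q pq j@(suc j′) k → prime-powers-∣D pq 1≤w (h q pq (∣-trans (m∣m*n (q ^ j′)) k)) j k })

    InS-∣ : ∀ {w q} → InS w → q ∣ w → q ∣ D w
    InS-∣ (_ , d) h = ∣-trans h (proj₂ (DivD⇒ d))

    private
      n≢n*m : ∀ {n m} → 1 ≤ n → 2 ≤ m → n ≢ n * m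
      n≢n*m {n} {m} 1≤n 2≤m = <⇒≢ (m<m*n n m {{>-nonZero 1≤n}} 2≤m)

      ∣-factor : ∀ {n k m} → 1 ≤ n → n ∣ k → k ∣ n * m → ∃ λ c → k ≡ n * c × c ∣ m
      ∣-factor {n} {_} {m} 1≤n (divides c refl) h = c , *-comm c n , *-cancelˡ-∣ n {{>-nonZero 1≤n}} (subst (_∣ n * m) (*-comm c n) h)

    arrow-prime : ∀ {n p} → Prime p → InS n → p ∣ D n ⊎ AdditiveRed E p → Arrow n (n * p)
    arrow-prime {n} {p} pp inS@(1≤n , _) h = inS , InS-intro (*-mono-≤ 1≤n (<⇒≤ (prime>1 pp))) prime-∣ , m∣m*n p , n≢n*m 1≤n (prime>1 pp) ,
        λ k _ n∣k k∣np → let (c , k≡ , c∣p) = ∣-factor 1≤n n∣k k∣np in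
          [ (λ e → inj₁ (trans k≡ (trans (cong (n *_) e) (*-identityʳ n)))) , (λ e → inj₂ (trans k≡ (cong (n *_) e))) ]′ (prime⇒irreducible pp c∣p)
      where
      prime-∣ : ∀ q → Prime q → q ∣ n * p → q ∣ D (n * p)
      prime-∣ q pq d = [ (λ k → ∣D-multiple pq (m∣m*n p) (InS-∣ inS k)) ,
          (λ k → subst (λ q → q ∣ D (n * p)) (sym (prime-∣-prime pq pp k)) ([ (λ l → ∣D-multiple pp (m∣m*n p) l) , (λ l → ∣D-multiple pp (n∣m*n n) (additive pp l)) ]′ h)) ]′ (euclidsLemma n p pq d)

    module _ {c : ℕ} {cs : List ℕ} (cyc : GenCycle (c ∷ cs)) where
      private
        ps = proj₁ cyc
        unique = proj₁ (proj₂ cyc)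
        linked = proj₂ (proj₂ cyc)
        d = prodℕ (c ∷ cs)

        successor : ∀ {a x} xs → Linked IsRank (x ∷ xs ++ a ∷ []) → ∀ {q} → q ∈ x ∷ xs → ∃ λ r → IsRank q r × r ∈ xs ++ a ∷ []
        successor [] (h ∷ _) (here refl) = _ , h , here refl
        successor (y ∷ ys) (h ∷ _) (here refl) = y , h , here refl
        successor (y ∷ ys) (_ ∷ l) (there m) = let (r , h , k) = successor ys l m in r , h , there k

        ∈-cycle : ∀ {q} → q ∈ cs ++ c ∷ [] → q ∈ c ∷ cs
        ∈-cycle m = [ there , (λ { (here e) → here e }) ]′ (MemP.∈-++⁻ cs m)

        -- A property inherited along q ↦ r_q runs from any prime to the end of the list, returns to
        -- its head, and from there reaches every prime of the cycle.
        module Closed (Q : ℕ → Set) (step : ∀ {q r} → q ∈ c ∷ cs → IsRank q r → Q q → Q r) where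
          forward : ∀ {a x} xs → Linked IsRank (x ∷ xs ++ a ∷ []) → (∀ {q} → q ∈ x ∷ xs → q ∈ c ∷ cs) → Q x → ∀ {q} → q ∈ x ∷ xs → Q q
          forward xs l s h (here refl) = h
          forward (y ∷ ys) (r ∷ l) s h (there m) = forward ys l (λ k → s (there k)) (step (s (here refl)) r h) m
          to-end : ∀ {a x} xs → Linked IsRank (x ∷ xs ++ a ∷ []) → (∀ {q} → q ∈ x ∷ xs → q ∈ c ∷ cs) → ∀ {q} → q ∈ x ∷ xs → Q q → Q a
          to-end [] (r ∷ _) s (here refl) h = step (s (here refl)) r h
          to-end (y ∷ ys) (r ∷ l) s (here refl) h = to-end ys l (λ k → s (there k)) (here refl) (step (s (here refl)) r h)
          to-end (y ∷ ys) (_ ∷ l) s (there m) h = to-end ys l (λ k → s (there k)) m h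
          all : ∀ {q} → q ∈ c ∷ cs → Q q → ∀ {q′} → q′ ∈ c ∷ cs → Q q′
          all m h = forward cs linked (λ k → k) (to-end cs linked (λ k → k) m h)

      cycle-≥2 : 2 ≤ d
      cycle-≥2 = ≤-trans (prime>1 (All.head ps)) (m≤m*n c (prodℕ cs) {{>-nonZero (pos cs (All.tail ps))}})
        where
        pos : ∀ l → All Prime l → 1 ≤ prodℕ l
        pos [] _ = ≤-refl
        pos (q ∷ l) (pq ∷ pl) = *-mono-≤ (<⇒≤ (prime>1 pq)) (pos l pl)

      cycle-InS : ∀ {n} → InS n → InS (n * d)
      cycle-InS {n} inS@(1≤n , _) = InS-intro (*-mono-≤ 1≤n (<⇒≤ cycle-≥2)) λ q pq h →
        [ (λ k → ∣D-multiple pq (m∣m*n d) (InS-∣ inS k)) ,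
          (λ k → let (r , isr , m) = successor cs linked (∣prodℕ⇒∈ pq (c ∷ cs) ps k) in
            rank∣⇒∣D pq isr (∣n⇒∣m*n n (∈⇒∣prodℕ (c ∷ cs) (∈-cycle m)))) ]′ (euclidsLemma n d pq h)

      -- From q ∣ w and w in S follows q ∣ D w, hence r_q ∣ w, and r_q is the next prime of the
      -- cycle. So all its primes divide w, and being distinct so does their product.
      cycle-∣ : ∀ {w q} → InS w → q ∈ c ∷ cs → q ∣ w → d ∣ w
      cycle-∣ {w} inS m h = distinct-primes-∣ (c ∷ cs) ps unique (All.tabulate
        (Closed.all (_∣ w) (λ m isr k → ∣D⇒rank∣ (All.lookup ps m) isr (InS-∣ inS k)) m h))

      cycle-gcd : ∀ {n} → InS n → gcd d n ≡ 1 ⊎ gcd d n ≡ d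
      cycle-gcd {n} inS = go (≤-<-connex 2 g)
        where
        g = gcd d n
        1≤g : 1 ≤ g
        1≤g = n≢0⇒n>0 (gcd[m,n]≢0 d n (inj₂ (λ e → <-irrefl (sym e) (proj₁ inS))))
        go : 2 ≤ g ⊎ g < 2 → g ≡ 1 ⊎ g ≡ d
        go (inj₂ h) = inj₁ (≤-antisym (s≤s⁻¹ h) 1≤g)
        go (inj₁ h) = let (q , pq , q∣g) = prime-divisor g h in
          inj₂ (∣-antisym (gcd[m,n]∣m d n) (gcd-greatest ∣-refl (cycle-∣ inS (∣prodℕ⇒∈ pq (c ∷ cs) ps (∣-trans q∣g (gcd[m,n]∣m d n))) (∣-trans q∣g (gcd[m,n]∣n d n)))))

      cycle-arrow : ∀ {n} → InS n → gcd d n ≡ 1 → Arrow n (n * d)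
      cycle-arrow {n} inS@(1≤n , _) cop = inS , cycle-InS inS , m∣m*n d , n≢n*m 1≤n cycle-≥2 ,
          λ k inK n∣k k∣nd → between k inK (∣-factor 1≤n n∣k k∣nd)
        where
        between : ∀ k → InS k → (∃ λ e → k ≡ n * e × e ∣ d) → k ≡ n ⊎ k ≡ n * d
        between k inK (e , k≡ , e∣d) = go (≤-<-connex 2 e)
          where
          1≤e : 1 ≤ e
          1≤e = n≢0⇒n>0 (λ e≡0 → <-irrefl (sym (trans k≡ (trans (cong (n *_) e≡0) (*-zeroʳ n)))) (proj₁ inK))
          go : 2 ≤ e ⊎ e < 2 → k ≡ n ⊎ k ≡ n * d
          go (inj₂ h) = inj₁ (trans k≡ (trans (cong (n *_) (≤-antisym (s≤s⁻¹ h) 1≤e)) (*-identityʳ n)))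
          go (inj₁ h) = let (q , pq , q∣e) = prime-divisor e h
                            d∣k = cycle-∣ inK (∣prodℕ⇒∈ pq (c ∷ cs) ps (∣-trans q∣e e∣d)) (∣-trans q∣e (subst (e ∣_) (sym k≡) (n∣m*n n))) in
            inj₂ (trans k≡ (cong (n *_) (∣-antisym e∣d (coprime-divisor (gcd≡1⇒coprime cop) (subst (d ∣_) k≡ d∣k)))))

    -- Were p prime to r, then r ∣ np would give r ∣ n and so p ∣ D n.
    primitive-rank : ∀ {n p} → Prime p → InS n → ¬ (p ∣ D n) → p ∣ D (n * p) → ∃₂ λ r k → IsRank p r × r ≡ k * p
    primitive-rank {n} {p} pp (1≤n , _) p∤D h = let (r , isr) = rank (*-mono-≤ 1≤n (<⇒≤ (prime>1 pp))) h in go r isr (p ∣? r)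
      where
      go : ∀ r → IsRank p r → Dec (p ∣ r) → ∃₂ λ r k → IsRank p r × r ≡ k * p
      go r isr (yes (divides k e)) = r , k , isr , e
      go r isr (no p∤r) = ⊥-elim (p∤D (rank∣⇒∣D pp isr (prime-power-cancel pp p∤r 1 n (subst (r ∣_) (cong (n *_) (sym (*-identityʳ p))) (∣D⇒rank∣ pp isr h)))))

    -- The rank is kp and at most 2p + 1, so k ≤ 2 because 3p > 2p + 1. For k = 2 the order is even,
    -- hence the count is at most 2p and at least the rank 2p, which is excluded; so k = 1.
    anomalous : ∀ {n p} → Prime p → InS n → ¬ (p ∣ D n) → p ∣ D (n * p) → NsCount E p ≢ 2 * p → IsRank p p
    anomalous {n} {p} pp inS p∤D h N≢ = let (r , k , isr , r≡) = primitive-rank pp inS p∤D h in by r k isr r≡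
      where
      instance _ = prime⇒nonZero pp
      by : ∀ r k → IsRank p r → r ≡ k * p → IsRank p p
      by r zero isr r≡ = ⊥-elim (<-irrefl (sym r≡) (proj₁ isr))
      by r 1 isr r≡ = subst (IsRank p) (trans r≡ (*-identityˡ p)) isr
      by r 2 isr r≡ = ⊥-elim (N≢ (≤-antisym (≤-trans (even-order pp p (<⇒≤ (prime>1 pp)) (rank-minimal isr p (<⇒≤ (prime>1 pp)) p<r)
            (subst (λ m → p ∣ D m) (trans r≡ (cong (p +_) (+-identityʳ p))) (rank-∣D isr))) (≤-reflexive (*-comm p 2)))
          (≤-trans (≤-reflexive (sym r≡)) (order≤NsCount pp r (rank-minimal isr)))))
        where
        p<r : p < r
        p<r = subst (p <_) (trans (*-comm p 2) (sym r≡)) (m<m*n p 2 (s≤s (s≤s z≤n)))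
      by r (suc (suc (suc k))) isr r≡ = ⊥-elim (<⇒≱ (begin-strict
          suc (p * 2)       <⟨ +-monoˡ-≤ (p * 2) (prime>1 pp) ⟩
          p + p * 2         ≡⟨ trans (sym (*-suc p 2)) (*-comm p 3) ⟩
          3 * p             ≤⟨ *-monoˡ-≤ p (m≤m+n 3 k) ⟩
          (3 + k) * p       ≡⟨ r≡ ⟨
          r                 ∎) (≤-trans (order≤NsCount pp r (rank-minimal isr)) (NsCount≤ pp)))
        where open ≤-Reasoning

    IsRank-InA : ∀ {p} → Prime p → IsRank p p → GoodRed E p → InA p
    IsRank-InA {p} pp isr good = (p ∷ []) , (((pp ∷ []) , ([] ∷ []) , (isr ∷ [-])) , (good ∷ [])) , *-identityʳ p

    module Composite-arrow {n d t p₀ : ℕ} (composite : Composite d) (count : CompRankCount d t) (least-prime : LeastPrimeDiv (n * d) p₀) (arrow : Arrow n (n * d)) where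
      private
        inS = proj₁ arrow
        inS′ = proj₁ (proj₂ arrow)
        no-between = proj₂ (proj₂ (proj₂ (proj₂ arrow)))
        1≤n = proj₁ inS
        2≤d : 2 ≤ d
        2≤d = nonTrivial⇒n>1 d {{composite⇒nonTrivial composite}}
        1≤d = ≤-trans (s≤s z≤n) 2≤d
        instance _ = >-nonZero 1≤n

        Q : List ℕ
        Q = primeDivs d

        ∈Q⇒ : ∀ {q} → q ∈ Q → Prime q × q ∣ d
        ∈Q⇒ m = proj₂ (MemP.∈-filter⁻ (λ q → prime? q ×-dec q ∣? d) {xs = upTo (suc d)} m)

        ⇒∈Q : ∀ {q} → Prime q → q ∣ d → q ∈ Q
        ⇒∈Q pq h = MemP.∈-filter⁺ (λ q → prime? q ×-dec q ∣? d) (MemP.∈-upTo⁺ (s≤s (∣⇒≤ {{>-nonZero 1≤d}} h))) (pq , h)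

        -- otherwise n → np would be an intermediate arrow
        p∤Dn : ∀ {p} → Prime p → p ∣ d → ¬ (p ∣ D n)
        p∤Dn {p} pp p∣d h = let (_ , inS″ , n∣np , n≢np , _) = arrow-prime pp inS (inj₁ h) in
          [ (λ e → n≢np (sym e)) , (λ e → composite⇒¬prime composite (subst Prime (*-cancelˡ-≡ p d n e) pp)) ]′ (no-between (n * p) inS″ n∣np (*-monoʳ-∣ n p∣d))

        rank-of : ∀ {p} → p ∈ Q → ∃ (IsRank p)
        rank-of m = let (pp , p∣d) = ∈Q⇒ m in rank (*-mono-≤ 1≤n 1≤d) (InS-∣ inS′ (∣n⇒∣m*n n p∣d))

        rank∣nd : ∀ {p r} → p ∈ Q → IsRank p r → r ∣ n * d
        rank∣nd m isr = let (pp , p∣d) = ∈Q⇒ m in ∣D⇒rank∣ pp isr (InS-∣ inS′ (∣n⇒∣m*n n p∣d))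

        rank∤n : ∀ {p r} → p ∈ Q → IsRank p r → ¬ (r ∣ n)
        rank∤n m isr h = let (pp , p∣d) = ∈Q⇒ m in p∤Dn pp p∣d (rank∣⇒∣D pp isr h)

        rank≥2 : ∀ {p r} → p ∈ Q → IsRank p r → 2 ≤ r
        rank≥2 {p} {r} m isr = ≤∧≢⇒< (proj₁ isr) (λ e → rank∤n m isr (subst (_∣ n) e (1∣ n)))

        rank-unique : ∀ {p r r′} → Prime p → IsRank p r → IsRank p r′ → r ≡ r′
        rank-unique pp h h′ = ∣-antisym (∣D⇒rank∣ pp h (rank-∣D h′)) (∣D⇒rank∣ pp h′ (rank-∣D h))

      -- Each r_q divides nd but not n, since q ∤ D n; being prime it divides d. So q ↦ r_q maps the
      -- prime divisors of d to themselves and has a cycle. Its product times n lies in S between n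
      -- and nd, and differs from n, so the product is d.
      prime-ranks : (∀ {q r} → q ∈ Q → IsRank q r → ¬ Composite r) → InAgen d
      prime-ranks ¬comp = conclude (Cycles.cycle IsRank (λ q → Prime q × q ∣ d) (λ q → prime? q ×-dec q ∣? d) d (λ g → ∣⇒≤ {{>-nonZero 1≤d}} (proj₂ g)) next
          (proj₂ (prime-divisor d 2≤d)))
        where
        next : ∀ {q} → Prime q × q ∣ d → ∃ λ r → IsRank q r × (Prime r × r ∣ d)
        next {q} (pq , q∣d) = let m = ⇒∈Q pq q∣d
                                  (r , isr) = rank-of m
                                  pr = ¬composite⇒prime {{n>1⇒nonTrivial (rank≥2 m isr)}} (¬comp m isr) in
          r , isr , pr , [ (λ h → ⊥-elim (rank∤n m isr h)) , (λ h → h) ]′ (euclidsLemma n d pr (rank∣nd m isr))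
        conclude : (∃₂ λ c cs → All (λ q → Prime q × q ∣ d) (c ∷ cs) × Unique (c ∷ cs) × Linked IsRank (c ∷ cs ++ c ∷ [])) → InAgen d
        conclude (c , cs , gs , u , l) = c ∷ cs , cyc ,
            [ (λ e → ⊥-elim (n≢n*m 1≤n (cycle-≥2 cyc) (sym e))) , (λ e → *-cancelˡ-≡ (prodℕ (c ∷ cs)) d n e) ]′
              (no-between (n * prodℕ (c ∷ cs)) (cycle-InS cyc inS) (m∣m*n (prodℕ (c ∷ cs))) (*-monoʳ-∣ n (distinct-primes-∣ (c ∷ cs) (All.map proj₁ gs) u (All.map proj₂ gs))))
          where
          cyc : GenCycle (c ∷ cs)
          cyc = All.map proj₁ gs , u , l

      private
        ρ′ : ∀ q → Dec (Prime q × q ∣ d) → ℕ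
        ρ′ q (yes (pq , h)) = proj₁ (rank-of (⇒∈Q pq h))
        ρ′ q (no _) = 0

        ρ : ℕ → ℕ
        ρ q = ρ′ q (prime? q ×-dec q ∣? d)

        ρ-rank : ∀ {q} → q ∈ Q → IsRank q (ρ q)
        ρ-rank {q} m = go (prime? q ×-dec q ∣? d)
          where
          go : ∀ δ → IsRank q (ρ′ q δ)
          go (yes (pq , h)) = proj₂ (rank-of (⇒∈Q pq h))
          go (no k) = ⊥-elim (k (∈Q⇒ m))

        -- if q divides no rank r_p, removing the powers of q from d gives an intermediate element of S
        covered : ∀ {q} → q ∈ Q → ∃ λ p → p ∈ Q × q ∣ ρ p
        covered {q} m = by (Any.any? (λ p → q ∣? ρ p) Q)
          where
          pq = proj₁ (∈Q⇒ m)
          by : Dec (Any.Any (λ p → q ∣ ρ p) Q) → ∃ λ p → p ∈ Q × q ∣ ρ p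
          by (yes a) = find a
          by (no na) = ⊥-elim (split (extract pq d 1≤d))
            where
            q∤ρ : ∀ {p} → p ∈ Q → ¬ (q ∣ ρ p)
            q∤ρ p∈ h = na (lose p∈ h)
            split : (∃₂ λ e d′ → d ≡ q ^ e * d′ × ¬ (q ∣ d′)) → ⊥
            split (e , d′ , d≡ , q∤d′) = [ w≡n , w≡nd ]′ (no-between (n * d′) w∈S (m∣m*n d′) (*-monoʳ-∣ n d′∣d))
              where
              d′∣d : d′ ∣ d
              d′∣d = subst (d′ ∣_) (sym d≡) (n∣m*n (q ^ e))
              1≤d′ : 1 ≤ d′
              1≤d′ = n≢0⇒n>0 (λ { refl → q∤d′ (q ∣0) })
              nd≡ : n * d ≡ n * d′ * q ^ e
              nd≡ = trans (cong (n *_) (trans d≡ (*-comm (q ^ e) d′))) (sym (*-assoc n d′ (q ^ e)))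
              ρ∣w : ∀ {p} → p ∈ Q → ρ p ∣ n * d′
              ρ∣w {p} p∈ = prime-power-cancel pq (q∤ρ p∈) e (n * d′) (subst (ρ p ∣_) nd≡ (rank∣nd p∈ (ρ-rank p∈)))
              w∈S : InS (n * d′)
              w∈S = InS-intro (*-mono-≤ 1≤n 1≤d′) λ p pp h →
                [ (λ k → ∣D-multiple pp (m∣m*n d′) (InS-∣ inS k)) ,
                  (λ k → let p∈ = ⇒∈Q pp (∣-trans k d′∣d) in rank∣⇒∣D pp (ρ-rank p∈) (ρ∣w p∈)) ]′ (euclidsLemma n d′ pp h)
              w≡n : n * d′ ≡ n → ⊥
              w≡n eq = rank∤n m (ρ-rank m) (subst (ρ q ∣_) eq (ρ∣w m))
              w≡nd : n * d′ ≡ n * d → ⊥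
              w≡nd eq = q∤d′ (subst (q ∣_) (sym (*-cancelˡ-≡ d′ d n eq)) (proj₂ (∈Q⇒ m)))

        T : List ℕ
        T = proj₁ count
        T⇒ : ∀ {q} → q ∈ T → Prime q × q ∣ d × Σ ℕ λ r → IsRank q r × Composite r
        T⇒ {q} = proj₁ (proj₁ (proj₂ (proj₂ count)) q)

      -- The ranks divide nd, so all their prime factors are at least p₀; together with `covered`
      -- this is what `Surplus` needs. Composite ranks in the given list `T` are matched with `ρ` by
      -- uniqueness of the rank.
      ranks-product : p₀ ^ t * prodℕ Q ≤ prodℕ (map ρ Q)
      ranks-product = subst (λ t → p₀ ^ t * prodℕ Q ≤ prodℕ (map ρ Q)) (proj₂ (proj₂ (proj₂ count)))
        (Surplus.surplus ρ Q T (UniqueP.filter⁺ (λ q → prime? q ×-dec q ∣? d) (UniqueP.upTo⁺ (suc d))) (proj₁ (proj₂ count))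
          (λ m → let (pq , h , _) = T⇒ m in ⇒∈Q pq h) (λ m → proj₁ (∈Q⇒ m)) (λ m → rank≥2 m (ρ-rank m))
          (λ m → let (pq , h , r , isr , c) = T⇒ m in subst Composite (rank-unique pq isr (ρ-rank (⇒∈Q pq h))) c)
          covered p₀ (<⇒≤ (prime>1 (proj₁ least-prime)))
          (λ p∈ pq h → proj₂ (proj₂ least-prime) _ pq (∣-trans h (rank∣nd p∈ (ρ-rank p∈)))))

      prodℕ-mono : ∀ l → (∀ {q} → q ∈ l → q ∈ Q) → prodℕ (map ρ l) ≤ prodℕ (map (NsCount E) l)
      prodℕ-mono [] h = ≤-refl
      prodℕ-mono (q ∷ l) h = *-mono-≤ (order≤NsCount (proj₁ (∈Q⇒ (h (here refl)))) (ρ q) (rank-minimal (ρ-rank (h (here refl))))) (prodℕ-mono l (λ m → h (there m)))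

      lower-bound : ℕtoℚ (p₀ ^ t) ℚ.≤ prodℚ (map (λ q → divℕ (NsCount E q) q) Q)
      lower-bound = quotient-bound (NsCount E) Q (p₀ ^ t) (λ q m → <⇒≤ (prime>1 (proj₁ (∈Q⇒ m)))) (≤-trans ranks-product (prodℕ-mono Q (λ m → m)))

      upper-bound : ∀ (b : ℕ → ℚ) → (∀ q → q ∈ Q → 0ℚ ℚ.≤ b q × 1ℚ ℚ.≤ ℕtoℚ q ℚ.* (b q ℚ.* b q)) →
        prodℚ (map (λ q → divℕ (NsCount E q) q) Q) ℚ.≤ prodℚ (map (λ q → (1ℚ ℚ.+ b q) ℚ.* (1ℚ ℚ.+ b q)) Q)
      upper-bound b hb = proj₂ (prodℚ-mono (λ q → divℕ (NsCount E q) q) (λ q → (1ℚ ℚ.+ b q) ℚ.* (1ℚ ℚ.+ b q)) Q λ q m →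
        let pq = proj₁ (∈Q⇒ m)
            (a , N≤ , a²≤) = hasse-bound E q pq in
        divℕ-nonNeg (NsCount E q) q , hasse-ℚ {NsCount E q} {q} {a} (<⇒≤ (prime>1 pq)) N≤ a²≤ (b q) (proj₁ (hb q m)) (proj₂ (hb q m)))

      t≡0⇒InAgen : t ≡ 0 → InAgen d
      t≡0⇒InAgen t≡0 = prime-ranks λ {q} {r} m isr c → let (pq , h) = ∈Q⇒ m in
        empty (trans (proj₂ (proj₂ (proj₂ count))) t≡0) (proj₂ (proj₁ (proj₂ (proj₂ count)) q) (pq , h , r , isr , c))
        where
        empty : ∀ {l : List ℕ} {q} → length l ≡ 0 → q ∈ l → ⊥
        empty () (here _)
        empty () (there _)

-- The divisibility facts for a regular sequence, and the four assertions

open import Defs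
open import Data.Nat using (_≤_; _*_; _^_)
open import Data.Nat.Divisibility using (_∣_; _∣?_; n∣m*n)
open import Data.Nat.GCD using (gcd)
open import Data.Rational as ℚ using (ℚ; 0ℚ; 1ℚ; ↧ₙ_)
open import Data.Integer using (+_)
open import Data.List using (map; _∷_)
open import Data.Sum using (map₁)
open import Relation.Nullary.Decidable using (_×-dec_)
open import Relation.Binary.PropositionalEquality using (_≡_; _≢_; refl; subst)
open Sequence using (EllSeq; module Build)
open Count using (module Points-mod)
open Local using (module Reduction)
open Orders using (module Orders-mod)
open Regularity using (module Regularity-mod)
open Arrows using (Divisibility; module Consequences)
open Bounds using (NsCount≢2p)

additive? : ∀ E p → Dec (AdditiveRed E p)
additive? E p = PDiv? p (Δ (toW E)) ×-dec PDiv? p (c₄ (toW E))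

module _ (E : Curve) (x₀ y₀ : ℚ) (seq : EllSeq E) where
  open EDS E (aff x₀ y₀)
  open EllSeq seq using (D)

  divisibility : (∀ n → 1 ≤ n → Dterm n (D n)) → (∀ {n d} → 1 ≤ n → Dterm n d → d ≡ D n) →
    ↧ₙ x₀ ≡ D 1 * D 1 × x₀ ℚ.* ℤtoℚ (+ D 1 ℤ.* + D 1) ≡ ℤtoℚ (EllSeq.A seq 1) →
    y₀ ℚ.* ℤtoℚ (+ D 1 ℤ.* + D 1 ℤ.* + D 1) ≡ ℤtoℚ (EllSeq.C seq 1) →
    Regular → Divisibility E (aff x₀ y₀)
  divisibility Dterm-D Dterm-unique base-x base-y (two , nsred) = record
    { D = D
    ; DivD⇒ = λ { {m} {zero} (_ , (_ , _ , () , _) , _) ; {m} {suc n} (d , t , h) → s≤s z≤n , subst (m ∣_) (Dterm-unique (s≤s z≤n) t) h }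
    ; ⇒DivD = ⇒DivD
    ; difference = λ {p} pp e h k → proj₂ (Reduction.D-closed E seq p pp (ns pp) e refl h k)
    ; multiple = λ {p} pp → Reduction.Regular.D-multiple E seq p pp (ns pp)
    ; gain = λ {p} pp → Reduction.Regular.D-gain E seq p pp (ns pp)
    ; order≤NsCount = λ {p} pp → Orders-mod.rank≤NsCount E seq p pp (ns pp)
    ; even-order = λ {p} pp → Orders-mod.even-count E seq p pp (ns pp)
    ; NsCount≤ = λ {p} pp → Points-mod.NsCount≤2p+1 E p pp
    ; two-regular = two-regular
    ; additive = cusp
    ; multiplicative = mult
    }
    where
    ⇒DivD : ∀ {m n} → 1 ≤ n → m ∣ D n → DivD m n
    ⇒DivD {m} {n} 1≤n h = D n , Dterm-D n 1≤n , h
    red : ∀ {p} → Prime p → BadRed E p → NsRed E p (aff x₀ y₀)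
    red {p} pp = nsred p pp
    ns : ∀ {p} (pp : Prime p) → Reduction.Nonsingular E seq p pp
    ns {p} pp {a} {b} {m} {k} {c} = Regularity-mod.nonsingular E seq x₀ y₀ base-x base-y p pp (red pp) {a} {b} {m} {k} {c}
    cusp : ∀ {p} → Prime p → AdditiveRed E p → p ∣ D p
    cusp {p} pp = Regularity-mod.additive⇒p∣D E seq x₀ y₀ base-x base-y p pp (red pp)
    mult : ∀ {p} → Prime p → BadRed E p → ¬ AdditiveRed E p → ∀ k → p ∣ D (p * k) → p ∣ D k
    mult {p} pp = Regularity-mod.multiplicative-descent E seq x₀ y₀ base-x base-y p pp (red pp)
    -- If 4 ∤ D 4, the five conditions of irregularity hold. D 2 is odd because the rank is 4.
    -- Reduction at 2 is good since a cusp would give 2 ∣ D 2 directly, and a node would give it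
    -- from 2 ∣ D (2 * 2) by descent. The order of D 4 at 2 is then exactly one.
    two-regular : IsRank 2 4 → NsCount E 2 ≡ 4 → 4 ∣ D 4
    two-regular isr@(_ , (d , t , 2∣d) , min) N≡4 = by (4 ∣? D 4)
      where
      2∤D₂ : ¬ (2 ∣ D 2)
      2∤D₂ h = min 2 (s≤s z≤n) (s≤s (s≤s (s≤s z≤n))) (⇒DivD (s≤s z≤n) h)
      2∣D₄ : 2 ∣ D 4
      2∣D₄ = subst (2 ∣_) (Dterm-unique (s≤s z≤n) t) 2∣d
      good : GoodRed E 2
      good bad = by (additive? E 2)
        where
        by : Dec (AdditiveRed E 2) → ⊥
        by (yes a) = 2∤D₂ (cusp prime[2] a)
        by (no n) = 2∤D₂ (mult prime[2] bad n 2 2∣D₄)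
      by : Dec (4 ∣ D 4) → 4 ∣ D 4
      by (yes h) = h
      by (no h) = ⊥-elim (two (good , N≡4 , isr , (D 2 , Dterm-D 2 (s≤s z≤n) , 2∤D₂) , (D 4 , Dterm-D 4 (s≤s z≤n) , 2∣D₄ , h)))

theorem15 : (E : Curve) (x₀ y₀ : ℚ)
    → Δ (toW E) ≢ 0ℚ
    → F (toW E) x₀ y₀ ≡ 0ℚ
    → (∀ n → 1 ≤ n → mul (toW E) (aff x₀ y₀) n ≢ O)
    → GlobalMinimal E
    → EDS.Regular E (aff x₀ y₀)
    → let open EDS E (aff x₀ y₀) in
      -- (a)
      (∀ n p → 1 ≤ n → Prime p → InS n → (DivD p n ⊎ AdditiveRed E p)
         → Arrow n (n * p))
      -- (b)
    × (∀ n d → 1 ≤ n → 1 ≤ d → InS n → InAgen d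
         → InS (n * d) × (gcd d n ≡ 1 ⊎ gcd d n ≡ d))
    × (∀ n d → 1 ≤ n → 1 ≤ d → InS n → InAgen d → gcd d n ≡ 1
         → Arrow n (n * d))
      -- (c)
    × (∀ n p → 1 ≤ n → Prime p → InS n → ¬ DivD p n → Arrow n (n * p)
         → ((GoodRed E p → NsCount E p ≢ 2 * p → InA p)
           × (GoodRed E p → 7 ≤ p → NsCount E p ≢ 2 * p)
           × (BadRed E p → AdditiveRed E p)))
      -- (d)
    × (∀ n d t p₀ → 1 ≤ n → 1 ≤ d → Composite d
         → CompRankCount d t → LeastPrimeDiv (n * d) p₀
         → Arrow n (n * d)
         → (t ≡ 0 × InAgen d)
         ⊎ (1 ≤ t
           -- ∏_{p ∣ d} (1 + 1/√p)² ≥ ∏_{p ∣ d} #E_ns(F_p)/p, stated as: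
           -- for all rationals b_p ≥ 1/√p (i.e. b_p ≥ 0 and p b_p² ≥ 1),
           -- ∏ (1 + b_p)² ≥ ∏ #E_ns(F_p)/p
           × (∀ (b : ℕ → ℚ) → (∀ q → q ∈ primeDivs d → 0ℚ ℚ.≤ b q × 1ℚ ℚ.≤ ℕtoℚ q ℚ.* (b q ℚ.* b q))
               → prodℚ (map (λ q → divℕ (NsCount E q) q) (primeDivs d))
                 ℚ.≤ prodℚ (map (λ q → (1ℚ ℚ.+ b q) ℚ.* (1ℚ ℚ.+ b q)) (primeDivs d)))
           × ℕtoℚ (p₀ ^ t) ℚ.≤ prodℚ (map (λ q → divℕ (NsCount E q) q) (primeDivs d))))
theorem15 E x₀ y₀ _ on₀ inf _ regular =
    (λ n p _ pp inS h → arrow-prime pp inS (map₁ (λ k → proj₂ (DivD⇒ {p} {n} k)) h))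
  , (λ { n d _ _ inS (c ∷ cs , cyc , refl) → cycle-InS cyc inS , cycle-gcd cyc inS })
  , (λ { n d _ _ inS (c ∷ cs , cyc , refl) cop → cycle-arrow cyc inS cop })
  , (λ n p 1≤n pp inS ¬h arrow → part-c n p 1≤n pp inS (λ k → ¬h (⇒DivD {p} {n} 1≤n k)) arrow)
  , part-d
  where
  open Build E x₀ y₀ on₀ inf
  open EDS E (aff x₀ y₀) hiding (W; Regular)
  div : Divisibility E (aff x₀ y₀)
  div = divisibility E x₀ y₀ ellSeq Dterm-D (λ {n} {d} → Dterm-unique {n} {d}) base-x base-y regular
  open Divisibility div
  open Consequences div
  part-c : ∀ n p → 1 ≤ n → Prime p → InS n → ¬ (p ∣ D n) → Arrow n (n * p) →
    (GoodRed E p → NsCount E p ≢ 2 * p → InA p) × (GoodRed E p → 7 ≤ p → NsCount E p ≢ 2 * p) × (BadRed E p → AdditiveRed E p)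
  part-c n p 1≤n pp inS p∤D (_ , inS′ , _) =
      (λ good N≢ → IsRank-InA pp (anomalous pp inS p∤D p∣D′ N≢) good)
    , (λ _ 7≤p → NsCount≢2p E p pp 7≤p)
    , λ bad → by bad (additive? E p)
    where
    p∣D′ : p ∣ D (n * p)
    p∣D′ = InS-∣ inS′ (n∣m*n n)
    by : BadRed E p → Dec (AdditiveRed E p) → AdditiveRed E p
    by bad (yes a) = a
    by bad (no ¬a) = ⊥-elim (p∤D (multiplicative pp bad ¬a n (subst (λ m → p ∣ D m) (ℕP.*-comm n p) p∣D′)))
  part-d : ∀ n d t p₀ → 1 ≤ n → 1 ≤ d → Composite d → CompRankCount d t → LeastPrimeDiv (n * d) p₀ → Arrow n (n * d) →
    (t ≡ 0 × InAgen d) ⊎ (1 ≤ t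
      × (∀ (b : ℕ → ℚ) → (∀ q → q ∈ primeDivs d → 0ℚ ℚ.≤ b q × 1ℚ ℚ.≤ ℕtoℚ q ℚ.* (b q ℚ.* b q)) →
          prodℚ (map (λ q → divℕ (NsCount E q) q) (primeDivs d)) ℚ.≤ prodℚ (map (λ q → (1ℚ ℚ.+ b q) ℚ.* (1ℚ ℚ.+ b q)) (primeDivs d)))
      × ℕtoℚ (p₀ ^ t) ℚ.≤ prodℚ (map (λ q → divℕ (NsCount E q) q) (primeDivs d)))
  part-d n d zero p₀ _ _ comp cnt lp arrow = inj₁ (refl , Composite-arrow.t≡0⇒InAgen comp cnt lp arrow refl)
  part-d n d (suc t) p₀ _ _ comp cnt lp arrow = inj₂ (s≤s z≤n , Composite-arrow.upper-bound comp cnt lp arrow , Composite-arrow.lower-bound comp cnt lp arrow)
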